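{- Let $k,\ell$ be integers with $k\geq 3$ and $k/2\leq \ell\leq k-1$. Then there exists $n_0\in\mathbb{N}$ such that the following holds. Let $n\geq n_0$ with $n\in k\mathbb{N}$, let $V$ be a set of $n$ elements, and let $\mathcal{H}_1,\ldots,\mathcal{H}_{n/k}$ be $k$-graphs on $V$ satisfying $\delta_\ell(\mathcal{H}_i)>\delta(n,k,\ell)$ for $i=1,\ldots,n/k$. Then $\{\mathcal{H}_1,\ldots,\mathcal{H}_{n/k}\}$ admits a rainbow perfect matching, i.e. there are pairwise disjoint edges $E_1\in\mathcal{H}_1,\ldots,E_{n/k}\in\mathcal{H}_{n/k}$ with $E_1\cup\cdots\cup E_{n/k}=V$.
   Context: A $k$-graph on $V$ is a family $\mathcal{H}\subseteq\binom{V}{k}$. For $S\in\binom{V}{\ell}$, $\deg_{\mathcal{H}}(S)=|\{T: S\cup T\in\mathcal{H}\}|$, and $\delta_\ell(\mathcal{H})$ is the minimum of $\deg_{\mathcal{H}}(S)$ over all $S\in\binom{V}{\ell}$. For a partition $V=A\cup B$, $\mathcal{H}^0(A,B)$ (resp. $\mathcal{H}^1(A,B)$) is the $k$-graph on $V$ consisting of all $k$-subsets of $V$ meeting $A$ in an even (resp. odd) number of vertices. For $n=|V|\in k\mathbb{N}$, let $ext(n,k)=\{\mathcal{H}^i(A,B): i\in\{0,1\},\ A\cup B=V \text{ a partition},\ in/k \text{ and } |A| \text{ have different parity}\}$, and $\delta(n,k,\ell)=\max_{\mathcal{H}\in ext(n,k)}\delta_\ell(\mathcal{H})$. -}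

module Defs where

open import Data.Bool using (Bool; true; false; _∧_)
open import Data.Nat using (ℕ; zero; suc; _+_; _*_; _%_; _⊓_; _⊔_; _≡ᵇ_)
open import Data.List using (List; []; _∷_; map; _++_; filter; length; foldr; concatMap)
open import Data.Fin.Subset using (Subset; ∣_∣; _∩_)
open import Data.Fin.Subset.Properties using (_⊆?_)
open import Data.Vec using (_∷_; [])
open import Data.Product using (Σ; _,_; proj₁)
open import Relation.Binary.PropositionalEquality using (_≡_)
open import Relation.Nullary.Decidable using (does)
open import Data.Nat using (_≟_)

allSubsets : (n : ℕ) → List (Subset n)
allSubsets zero    = [] ∷ []
allSubsets (suc n) = map (false ∷_) (allSubsets n) ++ map (true ∷_) (allSubsets n)

subsetsOfSize : (n r : ℕ) → List (Subset n)
subsetsOfSize n r = filter (λ S → ∣ S ∣ ≟ r) (allSubsets n)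

record KGraph (n k : ℕ) : Set where
  field
    edge    : Subset n → Bool
    uniform : ∀ S → edge S ≡ true → ∣ S ∣ ≡ k
open KGraph public

edges : ∀ {n k} → KGraph n k → List (Subset n)
edges {n} {k} H = filter (λ E → edge H E Data.Bool.≟ true) (subsetsOfSize n k)
  where import Data.Bool

-- deg_H(S) = |{T : S ∪ T ∈ H}| (T disjoint from S), i.e. the number
-- of edges of H containing S.
deg : ∀ {n k} → KGraph n k → Subset n → ℕ
deg H S = length (filter (λ E → S ⊆? E) (edges H))

-- minimum / maximum of a list of naturals (empty list ↦ 0; only used
-- on non-empty lists in the theorem's range)
minList : List ℕ → ℕ
minList []       = 0
minList (x ∷ xs) = foldr _⊓_ x xs

maxList : List ℕ → ℕ
maxList = foldr _⊔_ 0

minDeg : ∀ {n k} → ℕ → KGraph n k → ℕ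
minDeg {n} ℓ H = minList (map (deg H) (subsetsOfSize n ℓ))

-- H^i(A,B) with B = V ∖ A: all k-subsets meeting A in a number of
-- vertices ≡ i (mod 2).
parityGraph : (n k i : ℕ) → Subset n → KGraph n k
parityGraph n k i A = record { edge = e ; uniform = u }
  where
  open Relation.Nullary.Decidable using (Dec; yes; no)
  e' : (S : Subset n) → Dec (∣ S ∣ ≡ k) → Bool
  e' S (yes _) = ∣ A ∩ S ∣ % 2 ≡ᵇ i
  e' S (no _)  = false
  e : Subset n → Bool
  e S = e' S (∣ S ∣ ≟ k)
  u' : ∀ S (d : Dec (∣ S ∣ ≡ k)) → e' S d ≡ true → ∣ S ∣ ≡ k
  u' S (yes q) _ = q
  u' S (no _) ()
  u : ∀ S → e S ≡ true → ∣ S ∣ ≡ k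
  u S = u' S (∣ S ∣ ≟ k)

-- ext(n,k) for n = m * k (so n/k = m): the parameters (i , A) with
-- i ∈ {0,1} and i·m, |A| of different parity.
extParams : (k m : ℕ) → List (Σ ℕ (λ _ → Subset (m * k)))
extParams k m =
  filter (λ p → ((proj₁ p * m + ∣ Σ-snd p ∣) % 2) ≟ 1)
         (concatMap (λ i → map (i ,_) (allSubsets (m * k))) (0 ∷ 1 ∷ []))
  where
  Σ-snd : Σ ℕ (λ _ → Subset (m * k)) → Subset (m * k)
  Σ-snd (_ , A) = A

δ : (k ℓ m : ℕ) → ℕ
δ k ℓ m = maxList (map (λ { (i , A) → minDeg ℓ (parityGraph (m * k) k i A) }) (extParams k m))

{-# OPTIONS --safe #-}
-- The absorption method, with tuples in place of sets: every colour contains almost half of all completions of every short list.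
-- In Ω = (colours) × V^{k-1} the links of the vertices are almost half of Ω.  By counting pairs of overlapping links, either any two
-- vertices are joined by a dense set of short chains of vertices with overlapping links, or the vertices split into two classes τ
-- inside which this holds, and then almost every colour c contains a positive proportion of each pattern of k-tuples of some
-- parity I c.  Chains through coloured blocks form gadgets; a greedy cover picks O(log n) of them which together absorb every
-- collection of K₀ blocks of the right parities.
-- Outside the gadgets, the few atypical colours and a reserve, a rainbow matching is enlarged while more than K₀ colours are free:
-- with r = k - ℓ, more than 2r parts of a suitable arrangement of r matched or unmatched blocks complete ℓ-sets of free vertices to
-- edges of free colours, so that one more edge is gained than destroyed.  The rest is cut into K₀ blocks of the right parities,
-- using reserved pairs of vertices from different classes.
-- The last parity comes out right unless each colour c has edges of a single parity J c only; this is where δ is needed exactly.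
-- If the J c do not add up to the parity of |A|, then a graph H c, or H c and H c' with J c ≠ J c', is contained in a parity graph
-- on A.  The former is in ext(n, k); in the latter case moving one vertex into or out of A gives two graphs in ext(n, k), one of
-- which has minimum degree at least as large.
module Submission where

open import Defs
open import Data.Nat using (ℕ; zero; suc; pred; _+_; _*_; _∸_; _^_; _≤_; _<_; _≤?_; _<?_; _<ᵇ_; _≤ᵇ_; _⊓_; _%_; _!; z≤n; s≤s; NonZero; >-nonZero; >-nonZero⁻¹)
  renaming (_≟_ to _≟ℕ_)
open import Data.Nat.Properties hiding (_≟_)
open import Data.Nat.DivMod using (_/_; m*n/n≡m; /-monoˡ-≤; m/n*n≤m; m≡m%n+[m/n]*n; m%n<n)
open import Data.Nat.Tactic.RingSolver using (solve-∀)
open import Data.Bool using (Bool; true; false; not; _∧_; _∨_; _xor_; if_then_else_) renaming (T to IsTrue)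
open import Data.Bool.Properties using (xor-comm; xor-assoc; xor-identityʳ; not-involutive; not-distribˡ-xor; not-distribʳ-xor; ∧-zeroʳ; ∧-identityʳ)
  renaming (_≟_ to _≟ᵇ_)
open import Data.Fin using (Fin; zero; suc)
open import Data.Fin.Properties using (toℕ<n)
open import Data.Fin.Subset using (Subset; _∈_; _⊆_; ⁅_⁆; _∪_; _∩_; ∁; ∣_∣) renaming (⊥ to ∅)
open import Data.Fin.Subset.Properties using (_⊆?_; ∪-assoc; ∪-comm; ∪-identityˡ; x∈⁅x⁆; x∈⁅y⁆⇒x≡y; x∈p∪q⁻; x∈p∪q⁺; drop-∷-⊆; ∉⊥; p⊆q⇒∣p∣≤∣q∣)
open import Data.List using (List; _ʳ++_; []; _∷_; _++_; map; length; concatMap; concat; filter; replicate; allFin)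
open import Data.List.Properties using (++-assoc; length-++; map-++; length-map; ++-identityʳ; map-∘; concat-++; length-tabulate; map-tabulate)
open import Data.List.Membership.Propositional using () renaming (_∈_ to _∈ˡ_; _∉_ to _∉ˡ_)
open import Data.List.Membership.Propositional.Properties using (∈-map⁺; ∈-map⁻; ∈-++⁺ˡ; ∈-++⁺ʳ; ∈-++⁻; ∈-allFin; ∈-∃++; ∈-filter⁺; ∈-filter⁻)
open import Data.List.Relation.Unary.Any using (here; there)
open import Data.List.Relation.Unary.All as All using (All; []; _∷_)
open import Data.List.Relation.Unary.All.Properties as AllP using ()
open import Data.List.Relation.Unary.AllPairs using ([]; _∷_)
open import Data.List.Relation.Unary.Unique.Propositional using (Unique)
open import Data.List.Relation.Unary.Unique.Propositional.Properties using (allFin⁺)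
open import Data.List.Relation.Binary.Permutation.Propositional using (_↭_; ↭-sym; ↭-trans; ↭-reflexive; prep; swap; refl; trans)
open import Data.List.Relation.Binary.Permutation.Propositional.Properties using (∈-resp-↭; All-resp-↭; map⁺; ↭-length; ++⁺ˡ; ++⁺ʳ; ++⁺; ++-comm; ++-commutativeMonoid; shift; shifts)
import Algebra.Solver.CommutativeMonoid as CMSolver
open import Data.Vec using ([]; _∷_; here; lookup; tabulate)
open import Data.Vec.Properties using (lookup-map; lookup-zipWith; []=⇒lookup; lookup⇒[]=; ≡-dec)
open import Data.Product using (Σ; ∃; _×_; _,_; proj₁; proj₂)
open import Data.Sum using (_⊎_; inj₁; inj₂; [_,_]′)
open import Data.Empty using (⊥; ⊥-elim)
open import Data.Unit using (⊤; tt)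
open import Function using (_∘_; id; _$_)
open import Relation.Nullary using (Dec; yes; no; does)
open import Relation.Binary using (DecidableEquality)
open import Relation.Binary.PropositionalEquality using (_≡_; _≢_; cong; cong₂; sym; subst; subst₂; module ≡-Reasoning) renaming (refl to refl≡; trans to trans≡)
open ≤-Reasoning

⟦_⟧ : Bool → ℕ
⟦ true ⟧ = 1
⟦ false ⟧ = 0

∑ : {A : Set} → List A → (A → ℕ) → ℕ
∑ [] f = 0
∑ (x ∷ xs) f = f x + ∑ xs f

module _ {A : Set} where

  ∑-cong : (xs : List A) {f g : A → ℕ} → (∀ x → f x ≡ g x) → ∑ xs f ≡ ∑ xs g
  ∑-cong [] e = refl≡
  ∑-cong (x ∷ xs) e = cong₂ _+_ (e x) (∑-cong xs e)

  ∑-mono-∈ : (xs : List A) {f g : A → ℕ} → (∀ x → x ∈ˡ xs → f x ≤ g x) → ∑ xs f ≤ ∑ xs g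
  ∑-mono-∈ [] e = z≤n
  ∑-mono-∈ (x ∷ xs) e = +-mono-≤ (e x (here refl≡)) (∑-mono-∈ xs (λ y p → e y (there p)))

  ∑-mono : (xs : List A) {f g : A → ℕ} → (∀ x → f x ≤ g x) → ∑ xs f ≤ ∑ xs g
  ∑-mono xs e = ∑-mono-∈ xs (λ x _ → e x)

  ∑-cong-∈ : (xs : List A) {f g : A → ℕ} → (∀ x → x ∈ˡ xs → f x ≡ g x) → ∑ xs f ≡ ∑ xs g
  ∑-cong-∈ [] e = refl≡
  ∑-cong-∈ (x ∷ xs) e = cong₂ _+_ (e x (here refl≡)) (∑-cong-∈ xs (λ y p → e y (there p)))

  ∑-add : (xs : List A) (f g : A → ℕ) → ∑ xs (λ x → f x + g x) ≡ ∑ xs f + ∑ xs g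
  ∑-add [] f g = refl≡
  ∑-add (x ∷ xs) f g = trans≡ (cong (f x + g x +_) (∑-add xs f g)) (medial (f x) (g x) (∑ xs f) (∑ xs g))
    where
    medial : ∀ a b c d → a + b + (c + d) ≡ a + c + (b + d)
    medial = solve-∀

  ∑-scale : (xs : List A) (c : ℕ) (f : A → ℕ) → ∑ xs (λ x → c * f x) ≡ c * ∑ xs f
  ∑-scale [] c f = sym (*-zeroʳ c)
  ∑-scale (x ∷ xs) c f = trans≡ (cong (c * f x +_) (∑-scale xs c f)) (sym (*-distribˡ-+ c (f x) (∑ xs f)))

  ∑-scaleʳ : (xs : List A) (f : A → ℕ) (c : ℕ) → ∑ xs (λ x → f x * c) ≡ ∑ xs f * c
  ∑-scaleʳ xs f c = trans≡ (∑-cong xs (λ x → *-comm (f x) c)) (trans≡ (∑-scale xs c f) (*-comm c _))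

  ∑-const : (xs : List A) (c : ℕ) → ∑ xs (λ _ → c) ≡ length xs * c
  ∑-const [] c = refl≡
  ∑-const (x ∷ xs) c = cong (c +_) (∑-const xs c)

  ∑-zero : (xs : List A) → ∑ xs (λ _ → 0) ≡ 0
  ∑-zero xs = trans≡ (∑-const xs 0) (*-zeroʳ (length xs))

  ∑-++ : (xs ys : List A) (f : A → ℕ) → ∑ (xs ++ ys) f ≡ ∑ xs f + ∑ ys f
  ∑-++ [] ys f = refl≡
  ∑-++ (x ∷ xs) ys f = trans≡ (cong (f x +_) (∑-++ xs ys f)) (sym (+-assoc (f x) _ _))

  ∑-↭ : {xs ys : List A} (f : A → ℕ) → xs ↭ ys → ∑ xs f ≡ ∑ ys f
  ∑-↭ f refl = refl≡
  ∑-↭ f (prep x p) = cong (f x +_) (∑-↭ f p)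
  ∑-↭ {_ ∷ _ ∷ xs} {_ ∷ _ ∷ ys} f (swap x y p) = trans≡ (cong (λ t → f x + (f y + t)) (∑-↭ f p)) (flip3 (f x) (f y) (∑ ys f))
    where
    flip3 : ∀ a b c → a + (b + c) ≡ b + (a + c)
    flip3 = solve-∀
  ∑-↭ f (trans p q) = trans≡ (∑-↭ f p) (∑-↭ f q)

  ∑-≤-length : (xs : List A) {f : A → ℕ} (c : ℕ) → (∀ x → f x ≤ c) → ∑ xs f ≤ length xs * c
  ∑-≤-length xs c e = ≤-trans (∑-mono xs e) (≤-reflexive (∑-const xs c))

  ∑-pick : (xs : List A) (f g : A → ℕ) → ∑ xs f < ∑ xs g → Σ A λ x → x ∈ˡ xs × f x < g x
  ∑-pick [] f g ()
  ∑-pick (x ∷ xs) f g lt with f x <? g x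
  ... | yes p = x , here refl≡ , p
  ... | no ¬p with ∑-pick xs f g (+-cancelˡ-< (f x) _ _ (≤-trans lt (+-monoˡ-≤ (∑ xs g) (≮⇒≥ ¬p))))
  ... | y , m , q = y , there m , q

  ∑-∈-≤ : {xs : List A} {x : A} (f : A → ℕ) → x ∈ˡ xs → f x ≤ ∑ xs f
  ∑-∈-≤ f (here refl≡) = m≤m+n _ _
  ∑-∈-≤ f (there p) = ≤-trans (∑-∈-≤ f p) (m≤n+m _ _)

  length≡∑ : (xs : List A) → length xs ≡ ∑ xs (λ _ → 1)
  length≡∑ xs = sym (trans≡ (∑-const xs 1) (*-identityʳ _))

∑-swap : {A B : Set} (xs : List A) (ys : List B) (f : A → B → ℕ) → ∑ xs (λ x → ∑ ys (f x)) ≡ ∑ ys (λ y → ∑ xs (λ x → f x y))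
∑-swap [] ys f = sym (∑-zero ys)
∑-swap (x ∷ xs) ys f = trans≡ (cong (∑ ys (f x) +_) (∑-swap xs ys f)) (sym (∑-add ys (f x) _))

∑-map : {A B : Set} (h : A → B) (xs : List A) (f : B → ℕ) → ∑ (map h xs) f ≡ ∑ xs (f ∘ h)
∑-map h [] f = refl≡
∑-map h (x ∷ xs) f = cong (f (h x) +_) (∑-map h xs f)

∑-concatMap : {A B : Set} (h : A → List B) (xs : List A) (f : B → ℕ) → ∑ (concatMap h xs) f ≡ ∑ xs (λ x → ∑ (h x) f)
∑-concatMap h [] f = refl≡
∑-concatMap h (x ∷ xs) f = trans≡ (∑-++ (h x) _ f) (cong (∑ (h x) f +_) (∑-concatMap h xs f))

∑-concat : {A : Set} (xss : List (List A)) (f : A → ℕ) → ∑ (concat xss) f ≡ ∑ xss (λ xs → ∑ xs f)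
∑-concat [] f = refl≡
∑-concat (xs ∷ xss) f = trans≡ (∑-++ xs _ f) (cong (∑ xs f +_) (∑-concat xss f))

∑-prod : {A B : Set} (xs : List A) (ys : List B) (f : A → ℕ) (g : B → ℕ) → ∑ xs (λ x → ∑ ys (λ y → f x * g y)) ≡ ∑ xs f * ∑ ys g
∑-prod xs ys f g = trans≡ (∑-cong xs (λ x → ∑-scale ys (f x) g)) (∑-scaleʳ xs f (∑ ys g))

pairs : {A B : Set} → List A → List B → List (A × B)
pairs xs ys = concatMap (λ x → map (x ,_) ys) xs

∑-pairs : {A B : Set} (xs : List A) (ys : List B) (f : A × B → ℕ) → ∑ (pairs xs ys) f ≡ ∑ xs (λ x → ∑ ys (λ y → f (x , y)))
∑-pairs xs ys f = trans≡ (∑-concatMap _ xs f) (∑-cong xs (λ x → ∑-map (x ,_) ys f))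

length-pairs : {A B : Set} (xs : List A) (ys : List B) → length (pairs xs ys) ≡ length xs * length ys
length-pairs xs ys = trans≡ (length≡∑ (pairs xs ys)) (trans≡ (∑-pairs xs ys (λ _ → 1))
  (trans≡ (∑-cong xs (λ _ → sym (length≡∑ ys))) (∑-const xs (length ys))))

∈-concatMap⁺ : {A B : Set} (h : A → List B) {xs : List A} {x : A} {y : B} → x ∈ˡ xs → y ∈ˡ h x → y ∈ˡ concatMap h xs
∈-concatMap⁺ h (here refl≡) q = ∈-++⁺ˡ q
∈-concatMap⁺ h {x ∷ xs} (there p) q = ∈-++⁺ʳ (h x) (∈-concatMap⁺ h p q)

∈-concatMap⁻ : {A B : Set} (h : A → List B) (xs : List A) {y : B} → y ∈ˡ concatMap h xs → Σ A λ x → x ∈ˡ xs × y ∈ˡ h x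
∈-concatMap⁻ h (x ∷ xs) p with ∈-++⁻ (h x) p
... | inj₁ q = x , here refl≡ , q
... | inj₂ q with ∈-concatMap⁻ h xs q
... | x' , m , r = x' , there m , r

∈-pairs⁺ : {A B : Set} {xs : List A} {ys : List B} {x : A} {y : B} → x ∈ˡ xs → y ∈ˡ ys → (x , y) ∈ˡ pairs xs ys
∈-pairs⁺ p q = ∈-concatMap⁺ _ p (∈-map⁺ _ q)

∈-pairs⁻ : {A B : Set} (xs : List A) (ys : List B) {x : A} {y : B} → (x , y) ∈ˡ pairs xs ys → x ∈ˡ xs × y ∈ˡ ys
∈-pairs⁻ xs ys p with ∈-concatMap⁻ _ xs p
... | x , m , q with ∈-map⁻ (x ,_) q
... | y , m' , refl≡ = m , m'

tuples : {A : Set} → List A → ℕ → List (List A)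
tuples xs zero = [] ∷ []
tuples xs (suc t) = concatMap (λ x → map (x ∷_) (tuples xs t)) xs

module _ {A : Set} (xs : List A) where

  ∑-tuples-suc : ∀ t (f : List A → ℕ) → ∑ (tuples xs (suc t)) f ≡ ∑ xs (λ x → ∑ (tuples xs t) (λ v → f (x ∷ v)))
  ∑-tuples-suc t f = trans≡ (∑-concatMap _ xs f) (∑-cong xs (λ x → ∑-map (x ∷_) (tuples xs t) f))

  ∑-tuples-++ : ∀ a b (f : List A → ℕ) → ∑ (tuples xs (a + b)) f ≡ ∑ (tuples xs a) (λ u → ∑ (tuples xs b) (λ v → f (u ++ v)))
  ∑-tuples-++ zero b f = sym (+-identityʳ _)
  ∑-tuples-++ (suc a) b f = trans≡ (∑-tuples-suc (a + b) f) (trans≡ (∑-cong xs (λ x → ∑-tuples-++ a b (λ v → f (x ∷ v)))) (sym (∑-tuples-suc a _)))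

  length-tuples : ∀ t → length (tuples xs t) ≡ length xs ^ t
  length-tuples zero = refl≡
  length-tuples (suc t) = trans≡ (length≡∑ (tuples xs (suc t))) (trans≡ (∑-tuples-suc t (λ _ → 1))
    (trans≡ (∑-cong xs (λ _ → trans≡ (sym (length≡∑ (tuples xs t))) (length-tuples t))) (∑-const xs (length xs ^ t))))

  ∈-tuples⁻ : ∀ t {v : List A} → v ∈ˡ tuples xs t → length v ≡ t × All (_∈ˡ xs) v
  ∈-tuples⁻ zero (here refl≡) = refl≡ , []
  ∈-tuples⁻ (suc t) p with ∈-concatMap⁻ _ xs p
  ... | x , m , q with ∈-map⁻ (x ∷_) q
  ... | v , m' , refl≡ with ∈-tuples⁻ t m'
  ... | l , a = cong suc l , m ∷ a

  ∈-tuples⁺ : {v : List A} → All (_∈ˡ xs) v → v ∈ˡ tuples xs (length v)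
  ∈-tuples⁺ [] = here refl≡
  ∈-tuples⁺ (m ∷ a) = ∈-concatMap⁺ _ m (∈-map⁺ _ (∈-tuples⁺ a))

ne : Bool → Bool → ℕ
ne a b = ⟦ a xor b ⟧

ne-triangle : ∀ a b c → ne a c ≤ ne a b + ne b c
ne-triangle false false false = z≤n
ne-triangle false false true = s≤s z≤n
ne-triangle false true false = z≤n
ne-triangle false true true = s≤s z≤n
ne-triangle true false false = s≤s z≤n
ne-triangle true false true = z≤n
ne-triangle true true false = s≤s z≤n
ne-triangle true true true = z≤n

ne-self : ∀ a → ne a a ≡ 0
ne-self false = refl≡
ne-self true = refl≡

SymFun : {A : Set} → (List A → Bool) → Set
SymFun {A} g = ∀ {u v : List A} → u ↭ v → g u ≡ g v

module _ {A : Set} (xs : List A) where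

  private
    N : ℕ
    N = length xs

  differ : ℕ → (List A → Bool) → ℕ
  differ t g = ∑ (tuples xs t) λ v → ∑ (tuples xs t) λ v' → ne (g v) (g v')

  influence : ℕ → (List A → Bool) → ℕ
  influence t g = ∑ xs λ x → ∑ xs λ y → ∑ (tuples xs t) λ w → ne (g (x ∷ w)) (g (y ∷ w))

  -- Passing from one tuple to another by replacing the entries one at a time.
  differ≤influence : ∀ t (g : List A → Bool) → SymFun g → differ (suc t) g ≤ suc t * (N ^ t * influence t g)
  differ≤influence t g inv = ≤-trans split (step t refl≡)
    where
    T = tuples xs t
    g∷ : A → List A → Bool
    g∷ y v = g (y ∷ v)
    split : differ (suc t) g ≤ N ^ t * influence t g + N * ∑ xs (λ y → differ t (g∷ y))
    split = begin
      differ (suc t) g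
        ≡⟨ ∑-tuples-suc xs t _ ⟩
      ∑ xs (λ x → ∑ T λ v → ∑ (tuples xs (suc t)) λ v' → ne (g (x ∷ v)) (g v'))
        ≡⟨ ∑-cong xs (λ x → ∑-cong T λ v → ∑-tuples-suc xs t _) ⟩
      ∑ xs (λ x → ∑ T λ v → ∑ xs λ y → ∑ T λ v' → ne (g (x ∷ v)) (g (y ∷ v')))
        ≤⟨ ∑-mono xs (λ x → ∑-mono T λ v → ∑-mono xs λ y → ∑-mono T λ v' → ne-triangle (g (x ∷ v)) (g (y ∷ v)) (g (y ∷ v'))) ⟩
      ∑ xs (λ x → ∑ T λ v → ∑ xs λ y → ∑ T λ v' → ne (g (x ∷ v)) (g (y ∷ v)) + ne (g (y ∷ v)) (g (y ∷ v')))
        ≡⟨ ∑-cong xs (λ x → ∑-cong T λ v → ∑-cong xs λ y → trans≡ (∑-add T _ _)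
             (cong (_+ ∑ T (λ v' → ne (g (y ∷ v)) (g (y ∷ v')))) (trans≡ (∑-const T _) (cong (_* ne (g (x ∷ v)) (g (y ∷ v))) (length-tuples xs t))))) ⟩
      ∑ xs (λ x → ∑ T λ v → ∑ xs λ y → N ^ t * ne (g (x ∷ v)) (g (y ∷ v)) + ∑ T (λ v' → ne (g (y ∷ v)) (g (y ∷ v'))))
        ≡⟨ ∑-cong xs (λ x → trans≡ (∑-swap T xs _) (trans≡ (∑-cong xs (λ y → trans≡ (∑-add T _ _) (cong (_+ differ t (g∷ y)) (∑-scale T (N ^ t) _))))
             (trans≡ (∑-add xs _ _) (cong (_+ ∑ xs (λ y → differ t (g∷ y))) (∑-scale xs (N ^ t) _))))) ⟩
      ∑ xs (λ x → N ^ t * ∑ xs (λ y → ∑ T λ v → ne (g (x ∷ v)) (g (y ∷ v))) + ∑ xs (λ y → differ t (g∷ y)))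
        ≡⟨ trans≡ (∑-add xs _ _) (cong₂ _+_ (∑-scale xs (N ^ t) _) (∑-const xs _)) ⟩
      N ^ t * influence t g + N * ∑ xs (λ y → differ t (g∷ y)) ∎
    step : ∀ t' → t ≡ t' → N ^ t * influence t g + N * ∑ xs (λ y → differ t (g∷ y)) ≤ suc t * (N ^ t * influence t g)
    step zero refl≡ = begin
      N ^ 0 * influence 0 g + N * ∑ xs (λ y → differ 0 (g∷ y))
        ≡⟨ cong (λ z → N ^ 0 * influence 0 g + N * z) (trans≡ (∑-cong xs (λ y → trans≡ (+-identityʳ _) (trans≡ (+-identityʳ _) (ne-self (g (y ∷ [])))))) (∑-zero xs)) ⟩
      N ^ 0 * influence 0 g + N * 0
        ≡⟨ cong (N ^ 0 * influence 0 g +_) (*-zeroʳ N) ⟩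
      1 * (N ^ 0 * influence 0 g) ∎
    step (suc t') refl≡ = +-monoʳ-≤ (N ^ t * influence t g) (begin
      N * ∑ xs (λ y → differ t (g∷ y))
        ≤⟨ *-monoʳ-≤ N (∑-mono xs (λ y → differ≤influence t' (g∷ y) (λ p → inv (prep y p)))) ⟩
      N * ∑ xs (λ y → suc t' * (N ^ t' * influence t' (g∷ y)))
        ≡⟨ cong (N *_) (trans≡ (∑-scale xs (suc t') _) (cong (suc t' *_) (∑-scale xs (N ^ t') _))) ⟩
      N * (suc t' * (N ^ t' * ∑ xs (λ y → influence t' (g∷ y))))
        ≡⟨ cong (λ z → N * (suc t' * (N ^ t' * z))) refold ⟩
      N * (suc t' * (N ^ t' * influence t g))
        ≡⟨ rearr N (suc t') (N ^ t') (influence t g) ⟩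
      suc t' * (N ^ t * influence t g) ∎)
      where
      rearr : ∀ a b c d → a * (b * (c * d)) ≡ b * (a * c * d)
      rearr = solve-∀
      refold : ∑ xs (λ y → influence t' (g∷ y)) ≡ influence (suc t') g
      refold = trans≡ (∑-swap xs xs _) (∑-cong xs (λ x → trans≡ (∑-swap xs xs _) (∑-cong xs (λ x' → sym (trans≡ (∑-tuples-suc xs t' _)
        (∑-cong xs (λ y → ∑-cong (tuples xs t') (λ w → cong₂ ne (inv (swap x y refl)) (inv (swap x' y refl))))))))))

  -- 2 S (T - S) = differ, without subtraction.
  differ-count : ∀ t (g : List A → Bool) → let S = ∑ (tuples xs t) (λ v → ⟦ g v ⟧) in
    differ t g + 2 * (S * S) ≡ 2 * (N ^ t * S)
  differ-count t g = begin-equality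
      differ t g + 2 * (S * S)
        ≡⟨ cong (λ z → differ t g + 2 * z) (sym (∑-prod T T _ _)) ⟩
      differ t g + 2 * ∑ T (λ v → ∑ T (λ v' → ⟦ g v ⟧ * ⟦ g v' ⟧))
        ≡⟨ cong (differ t g +_) (trans≡ (sym (∑-scale T 2 _)) (∑-cong T (λ v → sym (∑-scale T 2 _)))) ⟩
      differ t g + ∑ T (λ v → ∑ T (λ v' → 2 * (⟦ g v ⟧ * ⟦ g v' ⟧)))
        ≡⟨ trans≡ (sym (∑-add T _ _)) (∑-cong T (λ v → trans≡ (sym (∑-add T _ _)) (∑-cong T (λ v' → pt (g v) (g v'))))) ⟩
      ∑ T (λ v → ∑ T (λ v' → ⟦ g v ⟧ + ⟦ g v' ⟧))
        ≡⟨ ∑-cong T (λ v → trans≡ (∑-add T _ _) (cong (_+ S) (trans≡ (∑-const T _) (cong (_* ⟦ g v ⟧) (length-tuples xs t))))) ⟩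
      ∑ T (λ v → N ^ t * ⟦ g v ⟧ + S)
        ≡⟨ trans≡ (∑-add T _ _) (cong₂ _+_ (∑-scale T (N ^ t) _) (trans≡ (∑-const T _) (cong (_* S) (length-tuples xs t)))) ⟩
      N ^ t * S + N ^ t * S
        ≡⟨ cong (N ^ t * S +_) (sym (+-identityʳ _)) ⟩
      2 * (N ^ t * S) ∎
    where
    T = tuples xs t
    S = ∑ T (λ v → ⟦ g v ⟧)
    pt : ∀ a b → ne a b + 2 * (⟦ a ⟧ * ⟦ b ⟧) ≡ ⟦ a ⟧ + ⟦ b ⟧
    pt false false = refl≡
    pt false true = refl≡
    pt true false = refl≡
    pt true true = refl≡

  dist : ℕ → ℕ → ℕ
  dist a b = (a ∸ b) + (b ∸ a)

  -- What the pairs (x∷t , y∷t') and (y∷t , x∷t') contribute.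
  straight crossed : (List A → Bool) → A → A → List A → List A → ℕ
  straight g x y t t' = ⟦ g (x ∷ t) ⟧ + ⟦ g (y ∷ t') ⟧
  crossed g x y t t' = ⟦ g (y ∷ t) ⟧ + ⟦ g (x ∷ t') ⟧

  gain : ℕ → (List A → Bool) → ℕ
  gain t g = ∑ xs λ x → ∑ xs λ y → ∑ (tuples xs t) λ w → ∑ (tuples xs t) λ w' → crossed g x y w w' ∸ straight g x y w w'

  spread : ℕ → (List A → Bool) → ℕ
  spread t g = ∑ xs λ x → ∑ xs λ y → ∑ (tuples xs t) λ w → ∑ (tuples xs t) λ w' → dist (crossed g x y w w') (straight g x y w w')

  spread≡2gain : ∀ t g → spread t g ≡ 2 * gain t g
  spread≡2gain t g = begin-equality
      spread t g
        ≡⟨ ∑-cong xs (λ x → ∑-cong xs (λ y → trans≡ (∑-cong T (λ w → ∑-add T _ _)) (∑-add T _ _))) ⟩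
      ∑ xs (λ x → ∑ xs λ y → (∑ T λ w → ∑ T λ w' → crossed g x y w w' ∸ straight g x y w w') + (∑ T λ w → ∑ T λ w' → straight g x y w w' ∸ crossed g x y w w'))
        ≡⟨ trans≡ (∑-cong xs (λ x → ∑-add xs _ _)) (∑-add xs _ _) ⟩
      gain t g + ∑ xs (λ x → ∑ xs λ y → ∑ T λ w → ∑ T λ w' → straight g x y w w' ∸ crossed g x y w w')
        ≡⟨ cong (gain t g +_) (trans≡ (∑-swap xs xs _) (sym (+-identityʳ _))) ⟩
      2 * gain t g ∎
    where T = tuples xs t

  private
    triples : ℕ → List (A × A × List A)
    triples t = pairs xs (pairs xs (tuples xs t))

    ∑-triples : ∀ t f → ∑ (triples t) f ≡ ∑ xs (λ x → ∑ xs (λ y → ∑ (tuples xs t) (λ w → f (x , y , w))))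
    ∑-triples t f = trans≡ (∑-pairs xs _ f) (∑-cong xs (λ x → ∑-pairs xs _ _))

  drops : ℕ → (List A → Bool) → ℕ
  drops t g = ∑ xs λ x → ∑ xs λ y → ∑ (tuples xs t) λ w → ⟦ g (x ∷ w) ∧ not (g (y ∷ w)) ⟧

  influence≡2drops : ∀ t g → influence t g ≡ 2 * drops t g
  influence≡2drops t g = begin-equality
      influence t g
        ≡⟨ ∑-cong xs (λ x → trans≡ (∑-cong xs (λ y → trans≡ (∑-cong T (λ w → pt (g (x ∷ w)) (g (y ∷ w)))) (∑-add T _ _))) (∑-add xs _ _)) ⟩
      ∑ xs (λ x → (∑ xs λ y → ∑ T λ w → ⟦ g (x ∷ w) ∧ not (g (y ∷ w)) ⟧) + (∑ xs λ y → ∑ T λ w → ⟦ g (y ∷ w) ∧ not (g (x ∷ w)) ⟧))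
        ≡⟨ ∑-add xs _ _ ⟩
      drops t g + ∑ xs (λ x → ∑ xs λ y → ∑ T λ w → ⟦ g (y ∷ w) ∧ not (g (x ∷ w)) ⟧)
        ≡⟨ cong (drops t g +_) (trans≡ (∑-swap xs xs _) (sym (+-identityʳ _))) ⟩
      2 * drops t g ∎
    where
    T = tuples xs t
    pt : ∀ a b → ne a b ≡ ⟦ a ∧ not b ⟧ + ⟦ b ∧ not a ⟧
    pt false false = refl≡
    pt false true = refl≡
    pt true false = refl≡
    pt true true = refl≡

  -- If no exchange changes the number of good tuples, then x in a drop (x , y , t) belongs to every good
  -- tuple and y' in a drop (x' , y' , t') to none, which the tuples x ∷ y' ∷ w contradict.
  drops²≤spread : ∀ t (g : List A → Bool) → SymFun g →
    drops (suc t) g * drops (suc t) g * N ^ t ≤ 2 * (N ^ suc (suc t) * spread (suc t) g)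
  drops²≤spread t g inv = begin
      drops (suc t) g * drops (suc t) g * N ^ t
        ≡⟨ cong (λ z → z * z * N ^ t) (sym (∑-triples (suc t) q)) ⟩
      ∑ R q * ∑ R q * N ^ t
        ≡⟨ cong₂ _*_ (sym (∑-prod R R q q)) (sym (length-tuples xs t)) ⟩
      ∑ R (λ a → ∑ R λ b → q a * q b) * length W
        ≡⟨ trans≡ (sym (∑-scaleʳ R _ _)) (∑-cong R (λ a → trans≡ (sym (∑-scaleʳ R _ _)) (∑-cong R (λ b → trans≡ (*-comm _ (length W)) (sym (∑-const W _)))))) ⟩
      ∑ R (λ a → ∑ R λ b → ∑ W λ w → q a * q b)
        ≤⟨ ∑-mono R (λ a → ∑-mono R λ b → ∑-mono W λ w → pt a b w) ⟩
      ∑ R (λ a → ∑ R λ b → ∑ W λ w → d a (proj₁ (proj₂ b) ∷ w) + d b (proj₁ a ∷ w))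
        ≡⟨ trans≡ (∑-cong R (λ a → trans≡ (∑-cong R (λ b → ∑-add W _ _)) (∑-add R _ _))) (∑-add R _ _) ⟩
      ∑ R (λ a → ∑ R λ b → ∑ W λ w → d a (proj₁ (proj₂ b) ∷ w)) + ∑ R (λ a → ∑ R λ b → ∑ W λ w → d b (proj₁ a ∷ w))
        ≡⟨ cong₂ _+_ (∑-cong R fst) (trans≡ (∑-swap R R _) (∑-cong R snd)) ⟩
      ∑ R (λ a → K * ∑ (tuples xs (suc t)) (d a)) + ∑ R (λ a → K * ∑ (tuples xs (suc t)) (d a))
        ≡⟨ cong (λ z → z + z) (trans≡ (∑-scale R K _) (cong (K *_) (∑-triples (suc t) _))) ⟩
      K * spread (suc t) g + K * spread (suc t) g
        ≡⟨ cong (K * spread (suc t) g +_) (sym (+-identityʳ _)) ⟩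
      2 * (K * spread (suc t) g) ∎
    where
    R = triples (suc t)
    W = tuples xs t
    K = N ^ suc (suc t)
    q : A × A × List A → ℕ
    q (x , y , v) = ⟦ g (x ∷ v) ∧ not (g (y ∷ v)) ⟧
    d : A × A × List A → List A → ℕ
    d (x , y , v) v' = dist (crossed g x y v v') (straight g x y v v')
    bools : ∀ a₁ a₂ b₁ b₂ p q s →
      ⟦ a₁ ∧ not a₂ ⟧ * ⟦ b₁ ∧ not b₂ ⟧ ≤ dist (⟦ a₂ ⟧ + ⟦ p ⟧) (⟦ a₁ ⟧ + ⟦ q ⟧) + dist (⟦ b₂ ⟧ + ⟦ s ⟧) (⟦ b₁ ⟧ + ⟦ p ⟧)
    bools false a₂ b₁ b₂ p q s = z≤n
    bools true true b₁ b₂ p q s = z≤n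
    bools true false false b₂ p q s = z≤n
    bools true false true true p q s = z≤n
    bools true false true false false false s = s≤s z≤n
    bools true false true false false true s = s≤s z≤n
    bools true false true false true false false = s≤s z≤n
    bools true false true false true false true = s≤s z≤n
    bools true false true false true true s = s≤s z≤n
    pt : ∀ a b w → q a * q b ≤ d a (proj₁ (proj₂ b) ∷ w) + d b (proj₁ a ∷ w)
    pt (x , y , v) (x' , y' , v') w = ≤-trans
      (bools (g (x ∷ v)) (g (y ∷ v)) (g (x' ∷ v')) (g (y' ∷ v')) (g (x ∷ y' ∷ w)) (g (y ∷ y' ∷ w)) (g (x' ∷ x ∷ w)))
      (≤-reflexive (cong (λ z → d (x , y , v) (y' ∷ w) + dist (⟦ g (y' ∷ v') ⟧ + ⟦ g (x' ∷ x ∷ w) ⟧) (⟦ g (x' ∷ v') ⟧ + ⟦ z ⟧)) (inv (swap x y' refl))))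
    rearr : ∀ n p e → n * (p * e) ≡ n * p * e
    rearr = solve-∀
    T≡ : ∀ c → ∑ (tuples xs (suc t)) (λ _ → c) ≡ N ^ suc t * c
    T≡ c = trans≡ (∑-const (tuples xs (suc t)) c) (cong (_* c) (length-tuples xs (suc t)))
    fst : ∀ a → ∑ R (λ b → ∑ W λ w → d a (proj₁ (proj₂ b) ∷ w)) ≡ K * ∑ (tuples xs (suc t)) (d a)
    fst a = begin-equality
      ∑ R (λ b → ∑ W λ w → d a (proj₁ (proj₂ b) ∷ w))
        ≡⟨ ∑-triples (suc t) _ ⟩
      ∑ xs (λ x → ∑ xs λ y → ∑ (tuples xs (suc t)) λ v → ∑ W λ w → d a (y ∷ w))
        ≡⟨ trans≡ (∑-const xs _) (cong (N *_) (trans≡ (∑-cong xs (λ y → T≡ _)) (∑-scale xs (N ^ suc t) _))) ⟩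
      N * (N ^ suc t * ∑ xs (λ y → ∑ W λ w → d a (y ∷ w)))
        ≡⟨ cong (λ z → N * (N ^ suc t * z)) (sym (∑-tuples-suc xs t (d a))) ⟩
      N * (N ^ suc t * ∑ (tuples xs (suc t)) (d a))
        ≡⟨ rearr N (N ^ suc t) _ ⟩
      K * ∑ (tuples xs (suc t)) (d a) ∎
    snd : ∀ b → ∑ R (λ a → ∑ W λ w → d b (proj₁ a ∷ w)) ≡ K * ∑ (tuples xs (suc t)) (d b)
    snd b = begin-equality
      ∑ R (λ a → ∑ W λ w → d b (proj₁ a ∷ w))
        ≡⟨ ∑-triples (suc t) _ ⟩
      ∑ xs (λ x → ∑ xs λ y → ∑ (tuples xs (suc t)) λ v → ∑ W λ w → d b (x ∷ w))
        ≡⟨ ∑-cong xs (λ x → trans≡ (∑-const xs _) (cong (N *_) (T≡ _))) ⟩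
      ∑ xs (λ x → N * (N ^ suc t * ∑ W λ w → d b (x ∷ w)))
        ≡⟨ trans≡ (∑-scale xs N _) (cong (N *_) (∑-scale xs (N ^ suc t) _)) ⟩
      N * (N ^ suc t * ∑ xs (λ x → ∑ W λ w → d b (x ∷ w)))
        ≡⟨ cong (λ z → N * (N ^ suc t * z)) (sym (∑-tuples-suc xs t (d b))) ⟩
      N * (N ^ suc t * ∑ (tuples xs (suc t)) (d b))
        ≡⟨ rearr N (N ^ suc t) _ ⟩
      K * ∑ (tuples xs (suc t)) (d b) ∎

seq : ℕ → ℕ → List ℕ
seq a zero = []
seq a (suc n) = a ∷ seq (suc a) n

∈-seq⁻ : ∀ a n {i} → i ∈ˡ seq a n → a ≤ i × i < a + n
∈-seq⁻ a (suc n) (here refl≡) = ≤-refl , m<m+n a (s≤s z≤n)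
∈-seq⁻ a (suc n) (there p) with ∈-seq⁻ (suc a) n p
... | l , u = ≤-trans (n≤1+n a) l , ≤-trans u (≤-reflexive (sym (+-suc a n)))

length-seq : ∀ a n → length (seq a n) ≡ n
length-seq a zero = refl≡
length-seq a (suc n) = cong suc (length-seq (suc a) n)

seq-suc : ∀ a n → seq (suc a) n ≡ map suc (seq a n)
seq-suc a zero = refl≡
seq-suc a (suc n) = cong (suc a ∷_) (seq-suc (suc a) n)

module _ {A : Set} where

  cell : ℕ → List A → List A
  cell i [] = []
  cell zero (x ∷ xs) = x ∷ []
  cell (suc i) (x ∷ xs) = cell i xs

  rot : List A → List A
  rot [] = []
  rot (x ∷ xs) = xs ++ x ∷ []

  rots : ℕ → List A → List (List A)
  rots zero b = []
  rots (suc n) b = b ∷ rots n (rot b)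

  rot-↭ : ∀ xs → rot xs ↭ xs
  rot-↭ [] = refl
  rot-↭ (x ∷ xs) = ++-comm xs (x ∷ [])

  ∈-rots-↭ : ∀ n b {β} → β ∈ˡ rots n b → β ↭ b
  ∈-rots-↭ (suc n) b (here refl≡) = refl
  ∈-rots-↭ (suc n) b (there p) = ↭-trans (∈-rots-↭ n (rot b) p) (rot-↭ b)

  cell-rot : ∀ i xs → suc i < length xs → cell (suc i) xs ≡ cell i (rot xs)
  cell-rot i (x ∷ xs) (s≤s lt) = go i xs lt
    where
    go : ∀ i xs → i < length xs → cell i xs ≡ cell i (xs ++ x ∷ [])
    go zero (y ∷ xs) _ = refl≡
    go (suc i) (y ∷ xs) (s≤s l) = go i xs l

  map-rot-rots : ∀ n b → map rot (rots n b) ≡ rots n (rot b)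
  map-rot-rots zero b = refl≡
  map-rot-rots (suc n) b = cong (rot b ∷_) (map-rot-rots n (rot b))

  ∑-rots : ∀ i (b : List A) (ψ : List A → ℕ) → i < length b →
    ∑ (rots (length b) b) (ψ ∘ cell i) ≡ ∑ b (λ v → ψ (v ∷ []))
  ∑-rots zero b ψ lt = trans≡ (cong (λ z → ∑ (rots (length b) z) (ψ ∘ cell 0)) (sym (++-identityʳ b))) (heads b [])
    where
    heads : ∀ xs ys → ∑ (rots (length xs) (xs ++ ys)) (ψ ∘ cell 0) ≡ ∑ xs (λ v → ψ (v ∷ []))
    heads [] ys = refl≡
    heads (x ∷ xs) ys = cong (ψ (x ∷ []) +_) (trans≡ (cong (λ z → ∑ (rots (length xs) z) (ψ ∘ cell 0)) (++-assoc xs ys _)) (heads xs _))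
  ∑-rots (suc i) b ψ lt = begin-equality
    ∑ (rots (length b) b) (ψ ∘ cell (suc i))
      ≡⟨ ∑-cong-∈ (rots (length b) b) (λ β m → cong ψ (cell-rot i β (≤-trans lt (≤-reflexive (sym (↭-length (∈-rots-↭ (length b) b m))))))) ⟩
    ∑ (rots (length b) b) (λ β → ψ (cell i (rot β)))
      ≡⟨ trans≡ (sym (∑-map rot (rots (length b) b) _)) (cong (λ z → ∑ z (ψ ∘ cell i)) (map-rot-rots (length b) b)) ⟩
    ∑ (rots (length b) (rot b)) (ψ ∘ cell i)
      ≡⟨ cong (λ z → ∑ (rots z (rot b)) (ψ ∘ cell i)) (sym (↭-length (rot-↭ b))) ⟩
    ∑ (rots (length (rot b)) (rot b)) (ψ ∘ cell i)
      ≡⟨ ∑-rots i (rot b) ψ (≤-trans (n≤1+n (suc i)) (≤-trans lt (≤-reflexive (sym (↭-length (rot-↭ b)))))) ⟩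
    ∑ (rot b) (λ v → ψ (v ∷ []))
      ≡⟨ ∑-↭ _ (rot-↭ b) ⟩
    ∑ b (λ v → ψ (v ∷ [])) ∎

  row : ℕ → List (List A) → List A
  row i Y = concatMap (cell i) Y

  rows : ℕ → ℕ → List (List A) → List (List A)
  rows a n Y = map (λ i → row i Y) (seq a n)

  concat-cells : ∀ β → concat (map (λ i → cell i β) (seq 0 (length β))) ≡ β
  concat-cells [] = refl≡
  concat-cells (x ∷ β) = cong (x ∷_) (trans≡ (cong (λ z → concat (map (λ i → cell i (x ∷ β)) z)) (seq-suc 0 (length β)))
    (trans≡ (cong concat (sym (map-∘ (seq 0 (length β))))) (concat-cells β)))

  concat-rows : ∀ n Y → All (λ β → length β ≡ n) Y → concat (rows 0 n Y) ↭ concat Y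
  concat-rows n [] [] = ↭-reflexive (empty (seq 0 n))
    where
    empty : (is : List ℕ) → concat (map (λ i → row i []) is) ≡ []
    empty [] = refl≡
    empty (_ ∷ is) = empty is
  concat-rows n (β ∷ Y) (refl≡ ∷ a) = ↭-trans (zipped (seq 0 n)) (++⁺ (↭-reflexive (concat-cells β)) (concat-rows n Y a))
    where
    zipped : (is : List ℕ) → concat (map (λ i → row i (β ∷ Y)) is) ↭ concat (map (λ i → cell i β) is) ++ concat (map (λ i → row i Y) is)
    zipped [] = refl
    zipped (i ∷ is) = begin-↭
      where
      C R : List A
      C = concat (map (λ i → cell i β) is)
      R = concat (map (λ i → row i Y) is)
      begin-↭ : (cell i β ++ row i Y) ++ concat (map (λ i → row i (β ∷ Y)) is) ↭ (cell i β ++ C) ++ (row i Y ++ R)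
      begin-↭ = ↭-trans (++⁺ˡ (cell i β ++ row i Y) (zipped is)) (↭-trans (↭-reflexive (++-assoc (cell i β) (row i Y) (C ++ R)))
        (↭-trans (++⁺ˡ (cell i β) (shifts (row i Y) C)) (↭-reflexive (sym (++-assoc (cell i β) C (row i Y ++ R))))))

Config : Set → Set
Config A = (List A × List (List A)) × (List A × List (List A))

-- Two arrays of blocks, all of length suc k'; their rows are the parts, and the flag exchanges the first
-- cells of the two first rows.
module _ {A : Set} (k' : ℕ) where

  blocksOf : Config A → List (List A)
  blocksOf ((β , Z) , (β' , Z')) = (β ∷ Z) ++ (β' ∷ Z')

  parts : Bool → Config A → List (List A)
  parts s ((β , Z) , (β' , Z')) =
    (cell 0 (if s then β' else β) ++ row 0 Z) ∷ (cell 0 (if s then β else β') ++ row 0 Z') ∷ rows 1 k' (β ∷ Z) ++ rows 1 k' (β' ∷ Z')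

  parts-↭ : ∀ s c → All (λ β → length β ≡ suc k') (blocksOf c) → concat (parts s c) ↭ concat (blocksOf c)
  parts-↭ s c@((β , Z) , (β' , Z')) al = ↭-trans (uncross s) straightened
    where
    U V : List A
    U = concat (rows 1 k' (β ∷ Z))
    V = concat (rows 1 k' (β' ∷ Z'))
    c1 = cell 0 β
    c2 = cell 0 β'
    straightened : concat (parts false c) ↭ concat (blocksOf c)
    straightened = ↭-trans
      (↭-trans (++⁺ˡ (c1 ++ row 0 Z) (↭-trans (++⁺ˡ (c2 ++ row 0 Z') (↭-reflexive (sym (concat-++ (rows 1 k' (β ∷ Z)) _)))) (shifts (c2 ++ row 0 Z') U)))
        (↭-reflexive (sym (++-assoc (c1 ++ row 0 Z) U _))))
      (↭-trans (++⁺ (concat-rows (suc k') (β ∷ Z) (AllP.++⁻ˡ (β ∷ Z) al)) (concat-rows (suc k') (β' ∷ Z') (AllP.++⁻ʳ (β ∷ Z) al)))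
        (↭-reflexive (concat-++ (β ∷ Z) (β' ∷ Z'))))
    uncross : ∀ s → concat (parts s c) ↭ concat (parts false c)
    uncross false = refl
    uncross true = ↭-trans (assoc4 c2 (row 0 Z) c1 (row 0 Z') W)
      (↭-trans (↭-trans (shifts c2 (row 0 Z) {c1 ++ row 0 Z' ++ W}) (↭-trans (++⁺ˡ (row 0 Z) (shifts c2 c1)) (shifts (row 0 Z) c1)))
        (↭-sym (assoc4 c1 (row 0 Z) c2 (row 0 Z') W)))
      where
      W = concat (rows 1 k' (β ∷ Z) ++ rows 1 k' (β' ∷ Z'))
      assoc4 : ∀ (a b c d e : List A) → (a ++ b) ++ (c ++ d) ++ e ↭ a ++ b ++ c ++ d ++ e
      assoc4 a b c d e = ↭-reflexive (trans≡ (++-assoc a b _) (cong (λ z → a ++ b ++ z) (++-assoc c d e)))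

  module _ (B : List (List A)) (len : All (λ b → length b ≡ suc k') B) where

    rotated : List (List A)
    rotated = concatMap (rots (suc k')) B

    vertices : List A
    vertices = concat B

    ∑-column : ∀ i → i < suc k' → (ψ : List A → ℕ) → ∑ rotated (ψ ∘ cell i) ≡ ∑ vertices (λ v → ψ (v ∷ []))
    ∑-column i lt ψ = trans≡ (∑-concatMap (rots (suc k')) B _) (trans≡ (∑-cong-∈ B one) (sym (∑-concat B _)))
      where
      one : ∀ b → b ∈ˡ B → ∑ (rots (suc k') b) (ψ ∘ cell i) ≡ ∑ b (λ v → ψ (v ∷ []))
      one b m = subst (λ z → ∑ (rots z b) (ψ ∘ cell i) ≡ ∑ b (λ v → ψ (v ∷ []))) (All.lookup len m)
        (∑-rots i b ψ (≤-trans lt (≤-reflexive (sym (All.lookup len m)))))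

    ∑-row : ∀ i → i < suc k' → ∀ r (φ : List A → ℕ) → ∑ (tuples rotated r) (φ ∘ row i) ≡ ∑ (tuples vertices r) φ
    ∑-row i lt zero φ = refl≡
    ∑-row i lt (suc r) φ = trans≡ (∑-tuples-suc rotated r _) (trans≡ (∑-cong rotated (λ β → ∑-row i lt r (λ w → φ (cell i β ++ w))))
      (trans≡ (∑-column i lt (λ c → ∑ (tuples vertices r) (λ w → φ (c ++ w)))) (sym (∑-tuples-suc vertices r φ))))

    length-rotated : length rotated ≡ length vertices
    length-rotated = trans≡ (length≡∑ rotated) (trans≡ (∑-column 0 (s≤s z≤n) (λ _ → 1)) (sym (length≡∑ vertices)))

    arrays : ℕ → List (List A × List (List A))
    arrays r' = pairs rotated (tuples rotated r')

    configs : ℕ → List (Config A)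
    configs r' = pairs (arrays r') (arrays r')

    module _ (r' : ℕ) (g : List A → Bool) where

      private
        N = length vertices
        T = N ^ suc r'
        S = ∑ (tuples vertices (suc r')) (λ v → ⟦ g v ⟧)
        G : List A → ℕ
        G v = ⟦ g v ⟧

      length-arrays : length (arrays r') ≡ T
      length-arrays = trans≡ (length-pairs rotated _) (cong₂ _*_ length-rotated (trans≡ (length-tuples rotated r') (cong (_^ r') length-rotated)))

      length-configs : length (configs r') ≡ T * T
      length-configs = trans≡ (length-pairs (arrays r') _) (cong₂ _*_ length-arrays length-arrays)

      value : Bool → Config A → ℕ
      value s c = ∑ (parts s c) G

      improvement : Config A → ℕ
      improvement ((β , Z) , (β' , Z')) =
        (G (cell 0 β' ++ row 0 Z) + G (cell 0 β ++ row 0 Z')) ∸ (G (cell 0 β ++ row 0 Z) + G (cell 0 β' ++ row 0 Z'))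

      ∑-array-row : ∀ i → i < suc k' → ∑ (arrays r') (λ a → G (row i (proj₁ a ∷ proj₂ a))) ≡ S
      ∑-array-row i lt = trans≡ (∑-pairs rotated _ _) (trans≡ (sym (∑-tuples-suc rotated r' _)) (∑-row i lt (suc r') G))

      array-sum : ∀ is → All (_< suc k') is → ∑ (arrays r') (λ a → ∑ (map (λ i → row i (proj₁ a ∷ proj₂ a)) is) G) ≡ length is * S
      array-sum is al = begin-equality
        ∑ (arrays r') (λ a → ∑ (map (λ i → row i (proj₁ a ∷ proj₂ a)) is) G)
          ≡⟨ ∑-cong (arrays r') (λ a → ∑-map _ is G) ⟩
        ∑ (arrays r') (λ a → ∑ is (λ i → G (row i (proj₁ a ∷ proj₂ a))))
          ≡⟨ ∑-swap (arrays r') is _ ⟩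
        ∑ is (λ i → ∑ (arrays r') (λ a → G (row i (proj₁ a ∷ proj₂ a))))
          ≡⟨ ∑-cong-∈ is (λ i m → ∑-array-row i (All.lookup al m)) ⟩
        ∑ is (λ i → S)
          ≡⟨ ∑-const is S ⟩
        length is * S ∎

      ∑-value : ∑ (configs r') (value false) ≡ 2 * (suc k' * (T * S))
      ∑-value = begin-equality
        ∑ (configs r') (value false)
          ≡⟨ ∑-cong (configs r') (λ { ((β , Z) , (β' , Z')) → trans≡ (cong (λ z → G (row 0 (β ∷ Z)) + (G (row 0 (β' ∷ Z')) + z)) (∑-++ (rows 1 k' (β ∷ Z)) _ G))
               (medial (G (row 0 (β ∷ Z))) (G (row 0 (β' ∷ Z'))) (∑ (rows 1 k' (β ∷ Z)) G) (∑ (rows 1 k' (β' ∷ Z')) G)) }) ⟩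
        ∑ (configs r') (λ { (a , a') → P a + P a' })
          ≡⟨ ∑-pairs (arrays r') _ _ ⟩
        ∑ (arrays r') (λ a → ∑ (arrays r') (λ a' → P a + P a'))
          ≡⟨ ∑-cong (arrays r') (λ a → trans≡ (∑-add (arrays r') _ _) (cong₂ _+_ (trans≡ (∑-const (arrays r') _) (cong (_* P a) length-arrays)) P-sum)) ⟩
        ∑ (arrays r') (λ a → T * P a + suc k' * S)
          ≡⟨ trans≡ (∑-add (arrays r') _ _) (cong₂ _+_ (trans≡ (∑-scale (arrays r') T P) (cong (T *_) P-sum)) (trans≡ (∑-const (arrays r') _) (cong (_* (suc k' * S)) length-arrays))) ⟩
        T * (suc k' * S) + T * (suc k' * S)
          ≡⟨ final T (suc k') S ⟩
        2 * (suc k' * (T * S)) ∎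
        where
        P : List A × List (List A) → ℕ
        P (β , Z) = ∑ (map (λ i → row i (β ∷ Z)) (seq 0 (suc k'))) G
        P-sum : ∑ (arrays r') P ≡ suc k' * S
        P-sum = trans≡ (array-sum (seq 0 (suc k')) (All.tabulate (λ m → proj₂ (∈-seq⁻ 0 (suc k') m)))) (cong (_* S) (length-seq 0 (suc k')))
        medial : ∀ a b c d → a + (b + (c + d)) ≡ (a + c) + (b + d)
        medial = solve-∀
        final : ∀ a b c → a * (b * c) + a * (b * c) ≡ 2 * (b * (a * c))
        final = solve-∀

      ∑-improvement : ∑ (configs r') improvement ≡ gain vertices r' g
      ∑-improvement = begin-equality
        ∑ (configs r') improvement
          ≡⟨ trans≡ (∑-pairs (arrays r') _ _) (trans≡ (∑-pairs rotated _ _) (∑-cong rotated (λ β → ∑-cong R' (λ Z → ∑-pairs rotated _ _)))) ⟩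
        ∑ rotated (λ β → ∑ R' λ Z → ∑ rotated λ β' → ∑ R' λ Z' → imp (cell 0 β) (cell 0 β') (row 0 Z) (row 0 Z'))
          ≡⟨ ∑-cong rotated (λ β → ∑-cong R' λ Z → ∑-cong rotated λ β' → ∑-row 0 (s≤s z≤n) r' _) ⟩
        ∑ rotated (λ β → ∑ R' λ Z → ∑ rotated λ β' → ∑ V' λ w' → imp (cell 0 β) (cell 0 β') (row 0 Z) w')
          ≡⟨ ∑-cong rotated (λ β → ∑-row 0 (s≤s z≤n) r' (λ w → ∑ rotated λ β' → ∑ V' λ w' → imp (cell 0 β) (cell 0 β') w w')) ⟩
        ∑ rotated (λ β → ∑ V' λ w → ∑ rotated λ β' → ∑ V' λ w' → imp (cell 0 β) (cell 0 β') w w')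
          ≡⟨ ∑-cong rotated (λ β → trans≡ (∑-cong V' λ w → ∑-column 0 (s≤s z≤n) (λ c → ∑ V' λ w' → imp (cell 0 β) c w w')) (∑-swap V' vertices _)) ⟩
        ∑ rotated (λ β → ∑ vertices λ y → ∑ V' λ w → ∑ V' λ w' → imp (cell 0 β) (y ∷ []) w w')
          ≡⟨ ∑-column 0 (s≤s z≤n) (λ c → ∑ vertices λ y → ∑ V' λ w → ∑ V' λ w' → imp c (y ∷ []) w w') ⟩
        gain vertices r' g ∎
        where
        R' = tuples rotated r'
        V' = tuples vertices r'
        imp : List A → List A → List A → List A → ℕ
        imp c c' w w' = (G (c' ++ w) + G (c ++ w')) ∸ (G (c ++ w) + G (c' ++ w'))

      value-improved : ∀ c → value false c + improvement c ≡ value false c ⊎ value false c + improvement c ≡ value true c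
      value-improved ((β , Z) , (β' , Z')) = go (G (cell 0 β ++ row 0 Z)) (G (cell 0 β' ++ row 0 Z')) (G (cell 0 β' ++ row 0 Z)) (G (cell 0 β ++ row 0 Z')) _
        where
        assoc : ∀ a b c → a + (b + c) ≡ (a + b) + c
        assoc = solve-∀
        go : ∀ a b a' b' z → (a + (b + z)) + ((a' + b') ∸ (a + b)) ≡ a + (b + z) ⊎ (a + (b + z)) + ((a' + b') ∸ (a + b)) ≡ a' + (b' + z)
        go a b a' b' z with ≤-total (a' + b') (a + b)
        ... | inj₁ le = inj₁ (trans≡ (cong (a + (b + z) +_) (m≤n⇒m∸n≡0 le)) (+-identityʳ _))
        ... | inj₂ ge = inj₂ (trans≡ (cong (_+ d) (assoc a b z)) (trans≡ (exch (a + b) z d)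
            (trans≡ (cong (_+ z) (m+[n∸m]≡n ge)) (sym (assoc a' b' z)))))
          where
          d = (a' + b') ∸ (a + b)
          exch : ∀ p z d → p + z + d ≡ (p + d) + z
          exch = solve-∀

      length-parts : ∀ s (c : Config A) → length (parts s c) ≡ suc (suc (k' + k'))
      length-parts s ((β , Z) , (β' , Z')) = cong (2 +_) (trans≡ (length-++ (rows 1 k' (β ∷ Z)) {rows 1 k' (β' ∷ Z')})
        (cong₂ _+_ (trans≡ (length-map _ (seq 1 k')) (length-seq 1 k')) (trans≡ (length-map _ (seq 1 k')) (length-seq 1 k'))))

      value-≤ : ∀ s c → value s c ≤ 2 * suc k'
      value-≤ s c = ≤-trans (∑-≤-length (parts s c) 1 (λ v → ⟦⟧≤1 (g v))) (≤-reflexive (trans≡ (*-identityʳ _) (trans≡ (length-parts s c) (dbl k'))))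
        where
        ⟦⟧≤1 : ∀ b → ⟦ b ⟧ ≤ 1
        ⟦⟧≤1 true = ≤-refl
        ⟦⟧≤1 false = z≤n
        dbl : ∀ a → suc (suc (a + a)) ≡ 2 * suc a
        dbl = solve-∀

-- 2 S (T - S) ≥ 3 T² / 8 when T/4 ≤ S ≤ 3T/4.
differ-large : ∀ {D S T} → D + 2 * (S * S) ≡ 2 * (T * S) → T ≤ 4 * S → 4 * S ≤ 3 * T → 3 * (T * T) ≤ 8 * D
differ-large {D} {S} {T} eq lo hi with m≤n⇒∃[o]m+o≡n lo | m≤n⇒∃[o]m+o≡n hi
... | p , T+p≡ | q , S+q≡ = +-cancelʳ-≤ (2 * (T * p)) _ _ (begin
    3 * (T * T) + 2 * (T * p)
      ≡⟨ fact ⟩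
    8 * D + p * p
      ≤⟨ +-monoʳ-≤ (8 * D) (*-monoˡ-≤ p p≤2T) ⟩
    8 * D + 2 * T * p
      ≡⟨ cong (8 * D +_) (*-assoc 2 T p) ⟩
    8 * D + 2 * (T * p) ∎)
  where
  p≤2T : p ≤ 2 * T
  p≤2T = +-cancelˡ-≤ T _ _ (≤-trans (≤-reflexive T+p≡) hi)
  e1 : ∀ D S → 8 * (D + 2 * (S * S)) ≡ 8 * D + (4 * S) * (4 * S)
  e1 = solve-∀
  e2 : ∀ T S → 8 * (2 * (T * S)) ≡ 4 * (T * (4 * S))
  e2 = solve-∀
  e3 : ∀ D T p → 8 * D + (T + p) * (T + p) ≡ (8 * D + p * p) + (T * T + 2 * (T * p))
  e3 = solve-∀
  e4 : ∀ T p → 4 * (T * (T + p)) ≡ (3 * (T * T) + 2 * (T * p)) + (T * T + 2 * (T * p))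
  e4 = solve-∀
  fact : 3 * (T * T) + 2 * (T * p) ≡ 8 * D + p * p
  fact = +-cancelʳ-≡ (T * T + 2 * (T * p)) _ _ (trans≡ (sym (e4 T p)) (trans≡ (cong (λ z → 4 * (T * z)) T+p≡)
    (trans≡ (sym (e2 T S)) (trans≡ (cong (8 *_) (sym eq)) (trans≡ (e1 D S) (trans≡ (cong (λ z → 8 * D + z * z) (sym T+p≡)) (e3 D T p)))))))

module _ {A : Set} (xs : List A) (t : ℕ) (g : List A → Bool) (inv : SymFun g) where

  private
    N r T S : ℕ
    N = length xs
    r = suc (suc t)
    T = N ^ r
    S = ∑ (tuples xs r) (λ v → ⟦ g v ⟧)

  gain-large : T ≤ 4 * S → 4 * S ≤ 3 * T → T * T ≤ 114 * (r * r) * gain xs (suc t) g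
  gain-large lo hi with N in N≡
  ... | zero = z≤n
  ... | suc n' = *-cancelˡ-≤ 9 (begin
      9 * (N' ^ r * N' ^ r)
        ≤⟨ *-cancelʳ-≤ _ _ (N' * N' * N' ^ t) {{m*n≢0 (N' * N') (N' ^ t) {{_}} {{m^n≢0 N' t}}}} main ⟩
      1024 * (r * r) * G
        ≤⟨ *-monoˡ-≤ G (*-monoˡ-≤ (r * r) (≤ᵇ⇒≤ 1024 1026 tt)) ⟩
      1026 * (r * r) * G
        ≡⟨ e0 (r * r) G ⟩
      9 * (114 * (r * r) * G) ∎)
    where
    N' G Q D P : ℕ
    N' = suc n'
    G = gain xs (suc t) g
    Q = drops xs (suc t) g
    D = differ xs r g
    P = N' ^ suc t
    instance
      nzP : NonZero P
      nzP = m^n≢0 N' (suc t)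
    e0 : ∀ a b → 1026 * a * b ≡ 9 * (114 * a * b)
    e0 = solve-∀
    D≤ : D ≤ r * (P * (2 * Q))
    D≤ = ≤-trans (differ≤influence xs (suc t) g inv) (≤-reflexive (cong₂ (λ a b → r * (a ^ suc t * b)) N≡ (influence≡2drops xs (suc t) g)))
    Q-large : 3 * (N' * (N' * P)) ≤ 16 * (r * Q)
    Q-large = *-cancelˡ-≤ P (begin
      P * (3 * (N' * (N' * P)))
        ≡⟨ a1 P N' ⟩
      3 * (N' ^ r * N' ^ r)
        ≤⟨ differ-large {D} {S} {N' ^ r} (trans≡ (differ-count xs r g) (cong (λ z → 2 * (z ^ r * S)) N≡)) lo hi ⟩
      8 * D
        ≤⟨ *-monoʳ-≤ 8 D≤ ⟩
      8 * (r * (P * (2 * Q)))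
        ≡⟨ a2 r P Q ⟩
      P * (16 * (r * Q)) ∎)
      where
      a1 : ∀ P n → P * (3 * (n * (n * P))) ≡ 3 * (n * P * (n * P))
      a1 = solve-∀
      a2 : ∀ r P Q → 8 * (r * (P * (2 * Q))) ≡ P * (16 * (r * Q))
      a2 = solve-∀
    main : 9 * (N' ^ r * N' ^ r) * (N' * N' * N' ^ t) ≤ 1024 * (r * r) * G * (N' * N' * N' ^ t)
    main = begin
      9 * (N' ^ r * N' ^ r) * (N' * N' * N' ^ t)
        ≡⟨ b1 N' (N' ^ t) ⟩
      3 * (N' * (N' * P)) * (3 * (N' * (N' * P))) * N' ^ t
        ≤⟨ *-monoˡ-≤ (N' ^ t) (*-mono-≤ Q-large Q-large) ⟩
      16 * (r * Q) * (16 * (r * Q)) * N' ^ t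
        ≡⟨ b2 r Q (N' ^ t) ⟩
      256 * (r * r) * (Q * Q * N' ^ t)
        ≤⟨ *-monoʳ-≤ (256 * (r * r)) (≤-trans (≤-reflexive (cong (λ z → Q * Q * z ^ t) (sym N≡))) (≤-trans (drops²≤spread xs t g inv)
             (≤-reflexive (cong₂ (λ a b → 2 * (a ^ r * b)) N≡ (spread≡2gain xs (suc t) g))))) ⟩
      256 * (r * r) * (2 * (N' ^ r * (2 * G)))
        ≡⟨ b3 (r * r) N' (N' ^ t) G ⟩
      1024 * (r * r) * G * (N' * N' * N' ^ t) ∎
      where
      b1 : ∀ n p → 9 * (n * (n * p) * (n * (n * p))) * (n * n * p) ≡ 3 * (n * (n * (n * p))) * (3 * (n * (n * (n * p)))) * p
      b1 = solve-∀
      b2 : ∀ r q p → 16 * (r * q) * (16 * (r * q)) * p ≡ 256 * (r * r) * (q * q * p)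
      b2 = solve-∀
      b3 : ∀ r n p g → 256 * r * (2 * (n * (n * p) * (2 * g))) ≡ 1024 * r * g * (n * n * p)
      b3 = solve-∀

quarter : ∀ e S T → 2 ≤ e → e * T ≤ e * (2 * S) + T → T ≤ 4 * S
quarter (suc e) S T 2≤e h = *-cancelˡ-≤ (suc e) (+-cancelʳ-≤ (suc e * T) _ _ (begin
    suc e * T + suc e * T
      ≤⟨ +-mono-≤ h h ⟩
    (suc e * (2 * S) + T) + (suc e * (2 * S) + T)
      ≡⟨ a1 (suc e) S T ⟩
    suc e * (4 * S) + 2 * T
      ≤⟨ +-monoʳ-≤ (suc e * (4 * S)) (*-monoˡ-≤ T 2≤e) ⟩
    suc e * (4 * S) + suc e * T ∎))
  where
  a1 : ∀ e S T → (e * (2 * S) + T) + (e * (2 * S) + T) ≡ e * (4 * S) + 2 * T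
  a1 = solve-∀

excessConst : ℕ → ℕ
excessConst r = 114 * (r * r)

-- Half of all tuples being good gives, on average, k good parts out of 2k, which beats 2r at once when 2r < k;
-- when 2r = k the exchange of two first cells provides the excess.
excess : ∀ k r e {G T S X} → 1 ≤ r → 2 * (excessConst r * k) ≤ e → e * T ≤ e * (2 * S) + T →
  2 * (k * (T * S)) + G ≤ 2 * r * (T * T) + 2 * k * X → (2 * r < k) ⊎ (2 * r ≡ k × (T ≤ 4 * S → 4 * S ≤ 3 * T → T * T ≤ excessConst r * G)) →
  T * T ≤ 4 * (k * excessConst r) * X
excess k r@(suc r₀) e {G} {T} {S} {X} 1≤r big dens sum cases = go cases
  where
  c : ℕ
  c = excessConst r
  instance
    nzc : NonZero c
    nzc = _
  scaled : e * (k * (T * T)) ≤ e * (2 * (k * (T * S))) + k * (T * T)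
  scaled = begin
    e * (k * (T * T))
      ≡⟨ a1 e k T ⟩
    k * T * (e * T)
      ≤⟨ *-monoʳ-≤ (k * T) dens ⟩
    k * T * (e * (2 * S) + T)
      ≡⟨ a2 e k T S ⟩
    e * (2 * (k * (T * S))) + k * (T * T) ∎
    where
    a1 : ∀ e k T → e * (k * (T * T)) ≡ k * T * (e * T)
    a1 = solve-∀
    a2 : ∀ e k T S → k * T * (e * (2 * S) + T) ≡ e * (2 * (k * (T * S))) + k * (T * T)
    a2 = solve-∀
  finish : 0 < e → ∀ M → e * (T * T) ≤ M + 2 * (k * (e * X)) * c → 2 * M ≤ e * (T * T) → T * T ≤ 4 * (k * c) * X
  finish (s≤s {n = e'} _) M h1 h2 = *-cancelˡ-≤ e (+-cancelʳ-≤ (e * (T * T)) _ _ (begin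
    e * (T * T) + e * (T * T)
      ≤⟨ +-mono-≤ h1 h1 ⟩
    (M + 2 * (k * (e * X)) * c) + (M + 2 * (k * (e * X)) * c)
      ≡⟨ a1 M k e X c ⟩
    e * (4 * (k * c) * X) + 2 * M
      ≤⟨ +-monoʳ-≤ (e * (4 * (k * c) * X)) h2 ⟩
    e * (4 * (k * c) * X) + e * (T * T) ∎))
    where
    a1 : ∀ M k e X c → (M + 2 * (k * (e * X)) * c) + (M + 2 * (k * (e * X)) * c) ≡ e * (4 * (k * c) * X) + 2 * M
    a1 = solve-∀
  0<e : 0 < k → 0 < e
  0<e 0<k = ≤-trans (≤-trans 0<k (≤-trans (m≤n*m k c) (m≤m+n (c * k) _))) big
  2ck : 2 * (c * k * (T * T)) ≤ e * (T * T)
  2ck = ≤-trans (≤-reflexive (sym (*-assoc 2 (c * k) (T * T)))) (*-monoˡ-≤ (T * T) big)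
  go : (2 * r < k) ⊎ (2 * r ≡ k × (T ≤ 4 * S → 4 * S ≤ 3 * T → T * T ≤ c * G)) → T * T ≤ 4 * (k * c) * X
  go (inj₁ lt) = finish (0<e (≤-trans (s≤s z≤n) lt)) (k * (T * T)) (+-cancelʳ-≤ (e * (2 * r * (T * T))) _ _ (begin
      e * (T * T) + e * (2 * r * (T * T))
        ≡⟨ a1 e (2 * r) (T * T) ⟩
      e * (suc (2 * r) * (T * T))
        ≤⟨ *-monoʳ-≤ e (*-monoˡ-≤ (T * T) lt) ⟩
      e * (k * (T * T))
        ≤⟨ scaled ⟩
      e * (2 * (k * (T * S))) + k * (T * T)
        ≤⟨ +-monoˡ-≤ (k * (T * T)) (*-monoʳ-≤ e (≤-trans (m≤m+n _ G) sum)) ⟩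
      e * (2 * r * (T * T) + 2 * k * X) + k * (T * T)
        ≤⟨ m≤m+n _ _ ⟩
      e * (2 * r * (T * T) + 2 * k * X) + k * (T * T) + 2 * (k * (e * X)) * (pred c)
        ≡⟨ a2 e (2 * r * (T * T)) k X (T * T) (pred c) ⟩
      k * (T * T) + 2 * (k * (e * X)) * suc (pred c) + e * (2 * r * (T * T)) ∎))
      (≤-trans (*-monoʳ-≤ 2 (*-monoˡ-≤ (T * T) (m≤n*m k c))) 2ck)
    where
    a1 : ∀ e r t → e * t + e * (r * t) ≡ e * ((1 + r) * t)
    a1 = solve-∀
    a2 : ∀ e r k X t c → e * (r + 2 * k * X) + k * t + 2 * (k * (e * X)) * c ≡ k * t + 2 * (k * (e * X)) * (1 + c) + e * r
    a2 = solve-∀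
  go (inj₂ (refl≡ , gl)) with 4 * S ≤? 3 * T
  ... | yes hi = finish (0<e (s≤s z≤n)) (c * k * (T * T)) (begin
      e * (T * T)
        ≤⟨ *-monoʳ-≤ e (gl (quarter e S T (≤-trans (*-monoʳ-≤ 2 {1} {c * k} (s≤s z≤n)) big) dens) hi) ⟩
      e * (c * G)
        ≡⟨ a3 e c G ⟩
      c * (e * G)
        ≤⟨ *-monoʳ-≤ c eG ⟩
      c * (k * (T * T) + e * (2 * k * X))
        ≡⟨ a4 c k (T * T) e X ⟩
      c * k * (T * T) + 2 * (k * (e * X)) * c ∎) 2ck
    where
    a3 : ∀ e c G → e * (c * G) ≡ c * (e * G)
    a3 = solve-∀
    a4 : ∀ c k t e X → c * (k * t + e * (2 * k * X)) ≡ c * k * t + 2 * (k * (e * X)) * c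
    a4 = solve-∀
    eG : e * G ≤ k * (T * T) + e * (2 * k * X)
    eG = +-cancelʳ-≤ (e * (k * (T * T)) + e * (2 * (k * (T * S)))) _ _ (begin
      e * G + (e * (k * (T * T)) + e * (2 * (k * (T * S))))
        ≡⟨ a5 e G (k * (T * T)) (2 * (k * (T * S))) ⟩
      e * (k * (T * T)) + e * (2 * (k * (T * S)) + G)
        ≤⟨ +-mono-≤ scaled (*-monoʳ-≤ e sum) ⟩
      (e * (2 * (k * (T * S))) + k * (T * T)) + e * (k * (T * T) + 2 * k * X)
        ≡⟨ a6 e (2 * (k * (T * S))) (k * (T * T)) (2 * k * X) ⟩
      k * (T * T) + e * (2 * k * X) + (e * (k * (T * T)) + e * (2 * (k * (T * S)))) ∎)
      where
      a5 : ∀ e g a b → e * g + (e * a + e * b) ≡ e * a + e * (b + g)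
      a5 = solve-∀
      a6 : ∀ e a b x → (e * a + b) + e * (b + x) ≡ b + e * x + (e * b + e * a)
      a6 = solve-∀
  ... | no ¬hi = ≤-trans (*-cancelˡ-≤ (2 * k) (+-cancelʳ-≤ (4 * (k * (T * T))) _ _ (begin
      2 * k * (T * T) + 4 * (k * (T * T))
        ≡⟨ a7 k T ⟩
      2 * (k * (T * (3 * T)))
        ≤⟨ *-monoʳ-≤ 2 (*-monoʳ-≤ k (*-monoʳ-≤ T (<⇒≤ (≰⇒> ¬hi)))) ⟩
      2 * (k * (T * (4 * S)))
        ≡⟨ a8 k T S ⟩
      4 * (2 * (k * (T * S)))
        ≤⟨ *-monoʳ-≤ 4 (≤-trans (m≤m+n _ G) sum) ⟩
      4 * (k * (T * T) + 2 * k * X)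
        ≡⟨ a9 k (T * T) X ⟩
      2 * k * (4 * X) + 4 * (k * (T * T)) ∎))) (*-monoˡ-≤ X (*-monoʳ-≤ 4 {1} {k * c} (s≤s z≤n)))
    where
    a7 : ∀ k T → 2 * k * (T * T) + 4 * (k * (T * T)) ≡ 2 * (k * (T * (3 * T)))
    a7 = solve-∀
    a8 : ∀ k T S → 2 * (k * (T * (4 * S))) ≡ 4 * (2 * (k * (T * S)))
    a8 = solve-∀
    a9 : ∀ k t X → 4 * (k * t + 2 * k * X) ≡ 2 * k * (4 * X) + 4 * (k * t)
    a9 = solve-∀

concatMap⁺ : {A B : Set} (f : A → List B) {xs ys : List A} → xs ↭ ys → concatMap f xs ↭ concatMap f ys
concatMap⁺ f refl = refl
concatMap⁺ f (prep x p) = ++⁺ˡ (f x) (concatMap⁺ f p)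
concatMap⁺ f (swap x y p) = ↭-trans (shifts (f x) (f y)) (++⁺ˡ (f y) (++⁺ˡ (f x) (concatMap⁺ f p)))
concatMap⁺ f (trans p q) = trans (concatMap⁺ f p) (concatMap⁺ f q)

concatMap-++ : {A B : Set} (f : A → List B) (xs ys : List A) → concatMap f (xs ++ ys) ≡ concatMap f xs ++ concatMap f ys
concatMap-++ f [] ys = refl≡
concatMap-++ f (x ∷ xs) ys = trans≡ (cong (f x ++_) (concatMap-++ f xs ys)) (sym (++-assoc (f x) _ _))

length-concatMap : {A B : Set} (f : A → List B) (s : ℕ) (xs : List A) → All (λ x → length (f x) ≡ s) xs → length (concatMap f xs) ≡ length xs * s
length-concatMap f s [] [] = refl≡
length-concatMap f s (x ∷ xs) (e ∷ a) = trans≡ (length-++ (f x)) (cong₂ _+_ e (length-concatMap f s xs a))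

module _ {A : Set} where

  ∉⇒All≢ : {x : A} (xs : List A) → x ∉ˡ xs → All (x ≢_) xs
  ∉⇒All≢ [] _ = []
  ∉⇒All≢ (y ∷ xs) n = (λ e → n (here e)) ∷ ∉⇒All≢ xs (n ∘ there)

  Unique-resp-↭ : {xs ys : List A} → xs ↭ ys → Unique xs → Unique ys
  Unique-resp-↭ refl u = u
  Unique-resp-↭ (prep x p) (a ∷ u) = All-resp-↭ p a ∷ Unique-resp-↭ p u
  Unique-resp-↭ (swap x y p) ((n ∷ a) ∷ (b ∷ u)) = ((n ∘ sym) ∷ All-resp-↭ p b) ∷ (All-resp-↭ p a ∷ Unique-resp-↭ p u)
  Unique-resp-↭ (trans p q) u = Unique-resp-↭ q (Unique-resp-↭ p u)

  Unique-++⁻ : (xs : List A) {ys : List A} → Unique (xs ++ ys) → Unique xs × Unique ys × (∀ {x} → x ∈ˡ xs → x ∉ˡ ys)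
  Unique-++⁻ [] u = [] , u , λ ()
  Unique-++⁻ (x ∷ xs) (a ∷ u) with Unique-++⁻ xs u
  ... | p , q , d = AllP.++⁻ˡ xs a ∷ p , q , λ { (here refl≡) m → All.lookup (AllP.++⁻ʳ xs a) m refl≡ ; (there m) m' → d m m' }

  Unique-++⁺ : {xs ys : List A} → Unique xs → Unique ys → (∀ {x} → x ∈ˡ xs → x ∉ˡ ys) → Unique (xs ++ ys)
  Unique-++⁺ [] v d = v
  Unique-++⁺ {xs = x ∷ xs} (a ∷ u) v d = AllP.++⁺ a (∉⇒All≢ _ (d (here refl≡))) ∷ Unique-++⁺ u v (d ∘ there)

  extract : (xs ys : List A) → Unique xs → All (_∈ˡ ys) xs → Σ (List A) λ zs → ys ↭ xs ++ zs
  extract [] ys _ _ = ys , refl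
  extract (x ∷ xs) ys (a ∷ u) (m ∷ al) with ∈-∃++ m
  ... | p , q , refl≡ with extract xs (p ++ q) u (All.tabulate λ {y} y∈ → strip y y∈)
    where
    strip : ∀ y → y ∈ˡ xs → y ∈ˡ p ++ q
    strip y y∈ with ∈-++⁻ p (All.lookup al y∈)
    ... | inj₁ i = ∈-++⁺ˡ i
    ... | inj₂ (here e) = ⊥-elim (All.lookup a y∈ (sym e))
    ... | inj₂ (there i) = ∈-++⁺ʳ p i
  ... | zs , e = zs , ↭-trans (shift x p q) (prep x e)

  split-at : (j : ℕ) (xs : List A) → j ≤ length xs → Σ (List A) λ us → Σ (List A) λ vs → xs ≡ us ++ vs × length us ≡ j
  split-at zero xs _ = [] , xs , refl≡ , refl≡
  split-at (suc j) (x ∷ xs) (s≤s l) with split-at j xs l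
  ... | us , vs , e , f = x ∷ us , vs , cong (x ∷_) e , cong suc f

  -- Blocks of length k (given as suc k'), with less than one block left over.
  chunk : (k' j : ℕ) (xs : List A) → length xs ≤ j → Σ (List (List A)) λ F → Σ (List A) λ zs →
    xs ≡ concat F ++ zs × All (λ b → length b ≡ suc k') F × length zs ≤ k'
  chunk k' j xs le with suc k' ≤? length xs
  ... | no ¬p = [] , xs , refl≡ , [] , ≤-pred (≰⇒> ¬p)
  chunk k' zero xs le | yes p = ⊥-elim (<⇒≱ (s≤s z≤n) (≤-trans p le))
  chunk k' (suc j) xs le | yes p with split-at (suc k') xs p
  ... | us , vs , refl≡ , l with chunk k' j vs (≤-pred (begin
          suc (length vs) ≤⟨ +-monoˡ-≤ (length vs) {1} {length us} (≤-trans (s≤s z≤n) (≤-reflexive (sym l))) ⟩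
          length us + length vs ≡⟨ sym (length-++ us) ⟩
          length (us ++ vs) ≤⟨ le ⟩
          suc j ∎))
  ... | F , zs , e , al , sm = us ∷ F , zs , trans≡ (cong (us ++_) e) (sym (++-assoc us (concat F) zs)) , l ∷ al , sm

Unique-concatMap⁻ : {A B : Set} (f : B → List A) (bs : List B) → All (λ b → 0 < length (f b)) bs → Unique (concatMap f bs) → Unique bs
Unique-concatMap⁻ f [] _ _ = []
Unique-concatMap⁻ f (b ∷ bs) (p ∷ ps) u with Unique-++⁻ (f b) u
... | _ , v , d = ∉⇒All≢ bs fresh' ∷ Unique-concatMap⁻ f bs ps v
  where
  first : (xs : List _) → 0 < length xs → Σ _ (_∈ˡ xs)
  first (x ∷ xs) _ = x , here refl≡
  fresh' : b ∉ˡ bs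
  fresh' m with first (f b) p
  ... | x , x∈ = d x∈ (∈-concatMap⁺ f m x∈)

bool-≤1 : ∀ b → ⟦ b ⟧ ≤ 1
bool-≤1 true = ≤-refl
bool-≤1 false = z≤n

∧-true : ∀ {a b} → a ∧ b ≡ true → a ≡ true × b ≡ true
∧-true {true} {true} _ = refl≡ , refl≡

not-true : ∀ {a} → not a ≡ true → a ≡ false
not-true {false} _ = refl≡

not-∧ : ∀ a b → ⟦ not (a ∧ b) ⟧ ≤ ⟦ not a ⟧ + ⟦ not b ⟧
not-∧ true b = ≤-refl
not-∧ false b = s≤s z≤n

module Fresh {A : Set} (_≟_ : DecidableEquality A) where

  mem : A → List A → Bool
  mem x [] = false
  mem x (y ∷ ys) = does (x ≟ y) ∨ mem x ys

  mem⇒∈ : ∀ {x} ys → mem x ys ≡ true → x ∈ˡ ys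
  mem⇒∈ {x} (y ∷ ys) e with x ≟ y
  ... | yes p = here p
  ... | no _ = there (mem⇒∈ ys e)

  ∈⇒mem : ∀ {x ys} → x ∈ˡ ys → mem x ys ≡ true
  ∈⇒mem {x} {y ∷ ys} m with x ≟ y | m
  ... | yes _ | _ = refl≡
  ... | no n | here e = ⊥-elim (n e)
  ... | no _ | there m' = ∈⇒mem m'

  fresh : List A → List A → Bool
  fresh F [] = true
  fresh F (x ∷ xs) = not (mem x F) ∧ fresh (x ∷ F) xs

  fresh-++ : ∀ F xs ys → fresh F (xs ++ ys) ≡ fresh F xs ∧ fresh (xs ʳ++ F) ys
  fresh-++ F [] ys = refl≡
  fresh-++ F (x ∷ xs) ys with not (mem x F)
  ... | true = fresh-++ (x ∷ F) xs ys
  ... | false = refl≡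

  fresh-disjoint : ∀ F xs → fresh F xs ≡ true → ∀ {x} → x ∈ˡ xs → x ∉ˡ F
  fresh-disjoint F (x ∷ xs) e (here refl≡) m with ∧-true {not (mem x F)} e
  ... | p , _ with trans≡ (sym (not-true p)) (∈⇒mem m)
  ... | ()
  fresh-disjoint F (x ∷ xs) e (there i) m = fresh-disjoint (x ∷ F) xs (proj₂ (∧-true {not (mem x F)} e)) i (there m)

  fresh-unique : ∀ F xs → fresh F xs ≡ true → Unique xs
  fresh-unique F [] e = []
  fresh-unique F (x ∷ xs) e with ∧-true {not (mem x F)} e
  ... | _ , q = ∉⇒All≢ xs (λ m → fresh-disjoint (x ∷ F) xs q m (here refl≡)) ∷ fresh-unique (x ∷ F) xs q

  stale : List A → List A → ℕ
  stale F xs = ⟦ not (fresh F xs) ⟧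

  stale-≤-∑ : ∀ F xs → Unique xs → stale F xs ≤ ∑ xs (λ v → ⟦ mem v F ⟧)
  stale-≤-∑ F [] _ = z≤n
  stale-≤-∑ F (x ∷ xs) (a ∷ u) with mem x F
  ... | true = s≤s z≤n
  ... | false = ≤-trans (stale-≤-∑ (x ∷ F) xs u) (≤-reflexive (∑-cong-∈ xs other))
    where
    other : ∀ v → v ∈ˡ xs → ⟦ mem v (x ∷ F) ⟧ ≡ ⟦ mem v F ⟧
    other v m with v ≟ x
    ... | yes e = ⊥-elim (All.lookup a m (sym e))
    ... | no _ = refl≡

  ∑-mem : ∀ xs F → Unique xs → ∑ xs (λ v → ⟦ mem v F ⟧) ≤ length F
  ∑-mem xs [] u = ≤-reflexive (∑-zero xs)
  ∑-mem xs (y ∷ F) u = begin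
    ∑ xs (λ v → ⟦ does (v ≟ y) ∨ mem v F ⟧)
      ≤⟨ ∑-mono xs (λ v → or (does (v ≟ y)) (mem v F)) ⟩
    ∑ xs (λ v → ⟦ does (v ≟ y) ⟧ + ⟦ mem v F ⟧)
      ≡⟨ ∑-add xs _ _ ⟩
    ∑ xs (λ v → ⟦ does (v ≟ y) ⟧) + ∑ xs (λ v → ⟦ mem v F ⟧)
      ≤⟨ +-mono-≤ (one xs u) (∑-mem xs F u) ⟩
    suc (length F) ∎
    where
    or : ∀ a b → ⟦ a ∨ b ⟧ ≤ ⟦ a ⟧ + ⟦ b ⟧
    or true b = s≤s z≤n
    or false b = ≤-refl
    none : ∀ xs → y ∉ˡ xs → ∑ xs (λ v → ⟦ does (v ≟ y) ⟧) ≡ 0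
    none [] _ = refl≡
    none (x ∷ xs) n with x ≟ y
    ... | yes e = ⊥-elim (n (here (sym e)))
    ... | no _ = none xs (n ∘ there)
    one : ∀ xs → Unique xs → ∑ xs (λ v → ⟦ does (v ≟ y) ⟧) ≤ 1
    one [] _ = z≤n
    one (x ∷ xs) (a ∷ u) with x ≟ y
    ... | yes refl≡ = ≤-reflexive (cong suc (none xs (λ m → All.lookup a m refl≡)))
    ... | no _ = one xs u

  length-ʳ++ : ∀ (xs F : List A) → length (xs ʳ++ F) ≡ length xs + length F
  length-ʳ++ [] F = refl≡
  length-ʳ++ (x ∷ xs) F = trans≡ (length-ʳ++ xs (x ∷ F)) (+-suc (length xs) (length F))

  stale-tuples : {E : Set} (es : List E) (vs : E → List A) (s p q Z : ℕ) → (∀ {e} → e ∈ˡ es → length (vs e) ≤ s) →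
    (∀ F → length F ≤ Z → ∑ es (λ e → stale F (vs e)) * q ≤ p * length es) →
    ∀ t F → length F + t * s ≤ Z → ∑ (tuples es t) (λ θ → stale F (concatMap vs θ)) * q ≤ t * (p * length es ^ t)
  stale-tuples es vs s p q Z len bound zero F _ = z≤n
  stale-tuples es vs s p q Z len bound (suc t) F le = begin
    ∑ (tuples es (suc t)) (λ θ → stale F (concatMap vs θ)) * q
      ≡⟨ cong (_* q) (∑-tuples-suc es t _) ⟩
    ∑ es (λ e → ∑ T λ θ → stale F (vs e ++ concatMap vs θ)) * q
      ≤⟨ *-monoˡ-≤ q (∑-mono es λ e → ∑-mono T λ θ → ≤-trans (≤-reflexive (cong (λ z → ⟦ not z ⟧) (fresh-++ F (vs e) (concatMap vs θ)))) (not-∧ (fresh F (vs e)) _)) ⟩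
    ∑ es (λ e → ∑ T λ θ → stale F (vs e) + stale (vs e ʳ++ F) (concatMap vs θ)) * q
      ≡⟨ cong (_* q) (trans≡ (∑-cong es (λ e → trans≡ (∑-add T _ _) (cong (_+ rec e) (trans≡ (∑-const T _) (cong (_* stale F (vs e)) (length-tuples es t))))))
           (trans≡ (∑-add es _ _) (cong (_+ ∑ es rec) (∑-scale es (n ^ t) _)))) ⟩
    (n ^ t * first + ∑ es rec) * q
      ≡⟨ trans≡ (*-distribʳ-+ q (n ^ t * first) (∑ es rec)) (cong₂ _+_ (*-assoc (n ^ t) first q) (sym (∑-scaleʳ es rec q))) ⟩
    n ^ t * (first * q) + ∑ es (λ e → rec e * q)
      ≤⟨ +-mono-≤ (*-monoʳ-≤ (n ^ t) (bound F (≤-trans (m≤m+n _ _) le))) (∑-mono-∈ es (λ e m → stale-tuples es vs s p q Z len bound t (vs e ʳ++ F) (begin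
           length (vs e ʳ++ F) + t * s ≡⟨ cong (_+ t * s) (length-ʳ++ (vs e) F) ⟩
           length (vs e) + length F + t * s ≤⟨ +-monoˡ-≤ (t * s) (+-monoˡ-≤ (length F) (len m)) ⟩
           s + length F + t * s ≡⟨ perm s (length F) (t * s) ⟩
           length F + (s + t * s) ≤⟨ le ⟩
           Z ∎))) ⟩
    n ^ t * (p * n) + ∑ es (λ e → t * (p * n ^ t))
      ≡⟨ cong (n ^ t * (p * n) +_) (∑-const es _) ⟩
    n ^ t * (p * n) + n * (t * (p * n ^ t))
      ≡⟨ final n (n ^ t) p t ⟩
    suc t * (p * n ^ suc t) ∎
    where
    n = length es
    T = tuples es t
    first = ∑ es (λ e → stale F (vs e))
    rec : _ → ℕ
    rec e = ∑ T (λ θ → stale (vs e ʳ++ F) (concatMap vs θ))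
    perm : ∀ a b c → a + b + c ≡ b + (a + c)
    perm = solve-∀
    final : ∀ n p b t → p * (b * n) + n * (t * (b * p)) ≡ (1 + t) * (b * (n * p))
    final = solve-∀

  concatMap-singleton : (v : List A) → concatMap (_∷ []) v ≡ v
  concatMap-singleton [] = refl≡
  concatMap-singleton (x ∷ v) = cong (x ∷_) (concatMap-singleton v)

  stale-vertex-tuples : ∀ xs → Unique xs → ∀ t F Z → length F + t ≤ Z → ∑ (tuples xs t) (stale F) * length xs ≤ t * (Z * length xs ^ t)
  stale-vertex-tuples xs u t F Z le = ≤-trans (≤-reflexive (cong (_* length xs) (∑-cong (tuples xs t) (λ v → cong (stale F) (sym (concatMap-singleton v))))))
    (stale-tuples xs (_∷ []) 1 Z (length xs) Z (λ _ → ≤-refl) (λ F' l → *-monoˡ-≤ (length xs) $ ≤-trans (∑-mono xs (λ v → single v F')) (≤-trans (∑-mem xs F' u) l)) t F (≤-trans (≤-reflexive (cong (length F +_) (*-identityʳ t))) le))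
    where
    single : ∀ v F → stale F (v ∷ []) ≤ ⟦ mem v F ⟧
    single v F with mem v F
    ... | true = ≤-refl
    ... | false = z≤n

  fresh-complete : ∀ F xs → Unique xs → (∀ {x} → x ∈ˡ xs → x ∉ˡ F) → fresh F xs ≡ true
  fresh-complete F [] u d = refl≡
  fresh-complete F (x ∷ xs) (a ∷ u) d with mem x F in eq
  ... | true = ⊥-elim (d (here refl≡) (mem⇒∈ F eq))
  ... | false = fresh-complete (x ∷ F) xs u (λ { m (here e) → All.lookup a m (sym e) ; m (there i) → d (there m) i })

T-true : ∀ {b} → IsTrue b → b ≡ true
T-true {true} _ = refl≡

true-T : ∀ {b} → b ≡ true → IsTrue b
true-T refl≡ = tt

<ᵇ-true : ∀ {a b} → (a <ᵇ b) ≡ true → a < b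
<ᵇ-true {a} {b} e = <ᵇ⇒< a b (true-T e)

<ᵇ-cases : ∀ a b → (a <ᵇ b) ≡ true ⊎ ((a <ᵇ b) ≡ false × b ≤ a)
<ᵇ-cases a b with a <ᵇ b in e
... | true = inj₁ refl≡
... | false = inj₂ (refl≡ , ≮⇒≥ λ lt → absurd (trans≡ (sym e) (T-true (<⇒<ᵇ lt))))
  where
  absurd : false ≢ true
  absurd ()

module _ {A : Set} (k' r' : ℕ) (B : List (List A)) (len : All (λ b → length b ≡ suc k') B) where

  private
    k r : ℕ
    k = suc k'
    r = suc r'

  goodFlag : (List A → Bool) → Bool → Config A → Bool
  goodFlag g s c = 2 * r <ᵇ value k' B len r' g s c

  goodCount : (List A → Bool) → Config A → ℕ
  goodCount g c = ⟦ goodFlag g false c ⟧ + ⟦ goodFlag g true c ⟧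

  many-good : (g : List A → Bool) → SymFun g → ∀ e → 2 * (excessConst r * k) ≤ e → (2 * r < k) ⊎ (2 * r ≡ k × 2 ≤ r) →
    let T′ = length (concat B) ^ r in
    e * T′ ≤ e * (2 * ∑ (tuples (concat B) r) (λ v → ⟦ g v ⟧)) + T′ →
    T′ * T′ ≤ 4 * (k * excessConst r) * ∑ (configs k' B len r') (goodCount g)
  many-good g inv e big cases dens = excess k r e {gain (concat B) r' g} {T} {S} {X} (s≤s z≤n) big dens total (cases' cases)
    where
    T = length (concat B) ^ r
    S = ∑ (tuples (concat B) r) (λ v → ⟦ g v ⟧)
    Y = configs k' B len r'
    X = ∑ Y (goodCount g)
    val : Bool → Config A → ℕ
    val = value k' B len r' g
    cases' : (2 * r < k) ⊎ (2 * r ≡ k × 2 ≤ r) → (2 * r < k) ⊎ (2 * r ≡ k × (T ≤ 4 * S → 4 * S ≤ 3 * T → T * T ≤ excessConst r * gain (concat B) r' g))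
    cases' (inj₁ lt) = inj₁ lt
    cases' (inj₂ (eq , 2≤r)) = inj₂ (eq , tight r' refl≡ 2≤r)
      where
      tight : ∀ t → r' ≡ t → 2 ≤ suc t → T ≤ 4 * S → 4 * S ≤ 3 * T → T * T ≤ excessConst r * gain (concat B) r' g
      tight (suc t) refl≡ _ = gain-large (concat B) t g inv
      tight zero refl≡ (s≤s ())
    bounded : ∀ c v s → v ≡ val s c → v ≤ 2 * r + 2 * k * ⟦ goodFlag g s c ⟧
    bounded c v s refl≡ with <ᵇ-cases (2 * r) (val s c)
    ... | inj₁ e₁ = ≤-trans (value-≤ k' B len r' g s c) (≤-trans (≤-reflexive (sym (trans≡ (cong (λ b → 2 * k * ⟦ b ⟧) e₁) (*-identityʳ (2 * k))))) (m≤n+m _ (2 * r)))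
    ... | inj₂ (_ , le) = ≤-trans le (m≤m+n _ _)
    pt : ∀ c → val false c + improvement k' B len r' g c ≤ 2 * r + 2 * k * goodCount g c
    pt c with value-improved k' B len r' g c
    ... | inj₁ e₁ = ≤-trans (bounded c _ false e₁) (+-monoʳ-≤ (2 * r) (*-monoʳ-≤ (2 * k) (m≤m+n _ _)))
    ... | inj₂ e₂ = ≤-trans (bounded c _ true e₂) (+-monoʳ-≤ (2 * r) (*-monoʳ-≤ (2 * k) (m≤n+m _ ⟦ goodFlag g false c ⟧)))
    total : 2 * (k * (T * S)) + gain (concat B) r' g ≤ 2 * r * (T * T) + 2 * k * X
    total = begin
      2 * (k * (T * S)) + gain (concat B) r' g
        ≡⟨ sym (cong₂ _+_ (∑-value k' B len r' g) (∑-improvement k' B len r' g)) ⟩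
      ∑ Y (val false) + ∑ Y (improvement k' B len r' g)
        ≡⟨ sym (∑-add Y _ _) ⟩
      ∑ Y (λ c → val false c + improvement k' B len r' g c)
        ≤⟨ ∑-mono Y pt ⟩
      ∑ Y (λ c → 2 * r + 2 * k * goodCount g c)
        ≡⟨ trans≡ (∑-add Y _ _) (cong₂ _+_ (trans≡ (∑-const Y _) (trans≡ (cong (_* (2 * r)) (length-configs k' B len r' g)) (*-comm (T * T) _))) (∑-scale Y (2 * k) _)) ⟩
      2 * r * (T * T) + 2 * k * X ∎

∑-tuples-sub : {A : Set} (V X Y : List A) → V ↭ X ++ Y → (f : List A → ℕ) → (∀ v → f v ≤ 1) → ∀ t →
  length V * ∑ (tuples V t) f ≤ length V * ∑ (tuples X t) f + t * (length Y * length V ^ t)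
∑-tuples-sub V X Y p f le zero = m≤m+n _ _
∑-tuples-sub V X Y p f le (suc t) = begin
  n * ∑ (tuples V (suc t)) f
    ≡⟨ cong (n *_) (trans≡ (∑-tuples-suc V t f) (trans≡ (∑-↭ F p) (∑-++ X Y F))) ⟩
  n * (∑ X F + ∑ Y F)
    ≡⟨ trans≡ (*-distribˡ-+ n (∑ X F) (∑ Y F)) (cong (_+ n * ∑ Y F) (sym (∑-scale X n F))) ⟩
  ∑ X (λ x → n * F x) + n * ∑ Y F
    ≤⟨ +-mono-≤ (∑-mono X (λ x → ∑-tuples-sub V X Y p (λ v → f (x ∷ v)) (λ v → le (x ∷ v)) t)) (*-monoʳ-≤ n (∑-≤-length Y (n ^ t) F≤)) ⟩
  ∑ X (λ x → n * ∑ (tuples X t) (λ v → f (x ∷ v)) + t * (length Y * n ^ t)) + n * (length Y * n ^ t)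
    ≡⟨ cong (_+ n * (length Y * n ^ t)) (trans≡ (∑-add X _ _) (cong₂ _+_ (trans≡ (∑-scale X n _) (cong (n *_) (sym (∑-tuples-suc X t f)))) (∑-const X _))) ⟩
  n * ∑ (tuples X (suc t)) f + length X * (t * (length Y * n ^ t)) + n * (length Y * n ^ t)
    ≤⟨ +-monoˡ-≤ (n * (length Y * n ^ t)) (+-monoʳ-≤ (n * ∑ (tuples X (suc t)) f) (*-monoˡ-≤ (t * (length Y * n ^ t)) X≤n)) ⟩
  n * ∑ (tuples X (suc t)) f + n * (t * (length Y * n ^ t)) + n * (length Y * n ^ t)
    ≡⟨ final (n * ∑ (tuples X (suc t)) f) n t (length Y) (n ^ t) ⟩
  n * ∑ (tuples X (suc t)) f + suc t * (length Y * n ^ suc t) ∎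
  where
  n = length V
  F : _ → ℕ
  F x = ∑ (tuples V t) (λ v → f (x ∷ v))
  F≤ : ∀ x → F x ≤ n ^ t
  F≤ x = ≤-trans (∑-≤-length (tuples V t) 1 (λ v → le (x ∷ v))) (≤-reflexive (trans≡ (*-identityʳ _) (length-tuples V t)))
  X≤n : length X ≤ n
  X≤n = ≤-trans (m≤m+n _ (length Y)) (≤-reflexive (trans≡ (sym (length-++ X)) (sym (↭-length p))))
  final : ∀ s n t y q → s + n * (t * (y * q)) + n * (y * q) ≡ s + (1 + t) * (y * (n * q))
  final = solve-∀

density-transfer : {A : Set} (V X Y : List A) → V ↭ X ++ Y → (f : List A → ℕ) → (∀ v → f v ≤ 1) → ∀ r E →
  1 ≤ E → 1 ≤ length V → 4 * r * E * length Y ≤ length V →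
  2 * E * length V ^ r ≤ 2 * E * (2 * ∑ (tuples V r) f) + length V ^ r →
  E * length X ^ r ≤ E * (2 * ∑ (tuples X r) f) + length X ^ r
density-transfer V X Y p f le r E 1≤E 1≤n small dens with m≤n⇒∃[o]m+o≡n (^-monoˡ-≤ r X≤n)
  where
  X≤n : length X ≤ length V
  X≤n = ≤-trans (m≤m+n _ (length Y)) (≤-reflexive (trans≡ (sym (length-++ X)) (sym (↭-length p))))
... | q , T+q≡ = +-cancelʳ-≤ q _ _ (begin
    E * T + q
      ≤⟨ +-monoʳ-≤ (E * T) (≤-trans (≤-reflexive (sym (*-identityˡ q))) (*-monoˡ-≤ q 1≤E)) ⟩
    E * T + E * q
      ≡⟨ trans≡ (sym (*-distribˡ-+ E T q)) (cong (E *_) T+q≡) ⟩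
    E * P
      ≤⟨ *-cancelˡ-≤ (2 * n) {{m*n≢0 2 n {{_}} {{>-nonZero 1≤n}}}} main ⟩
    E * (2 * SX) + P
      ≡⟨ trans≡ (cong (E * (2 * SX) +_) (sym T+q≡)) (sym (+-assoc (E * (2 * SX)) T q)) ⟩
    E * (2 * SX) + T + q ∎)
  where
  n = length V
  T = length X ^ r
  P = n ^ r
  SV = ∑ (tuples V r) f
  SX = ∑ (tuples X r) f
  a1 : ∀ n E P → 2 * n * (E * P) ≡ n * (2 * E * P)
  a1 = solve-∀
  a2 : ∀ n E S P → n * (2 * E * (2 * S) + P) ≡ 4 * E * (n * S) + n * P
  a2 = solve-∀
  a3 : ∀ n E S r y P → 4 * E * (n * S + r * (y * P)) + n * P ≡ 4 * E * (n * S) + n * P + 4 * r * E * y * P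
  a3 = solve-∀
  a4 : ∀ n E S P → 4 * E * (n * S) + n * P + n * P ≡ 2 * n * (E * (2 * S) + P)
  a4 = solve-∀
  main : 2 * n * (E * P) ≤ 2 * n * (E * (2 * SX) + P)
  main = begin
    2 * n * (E * P)
      ≡⟨ a1 n E P ⟩
    n * (2 * E * P)
      ≤⟨ *-monoʳ-≤ n dens ⟩
    n * (2 * E * (2 * SV) + P)
      ≡⟨ a2 n E SV P ⟩
    4 * E * (n * SV) + n * P
      ≤⟨ +-monoˡ-≤ (n * P) (*-monoʳ-≤ (4 * E) (∑-tuples-sub V X Y p f le r)) ⟩
    4 * E * (n * SX + r * (length Y * P)) + n * P
      ≡⟨ a3 n E SX r (length Y) P ⟩
    4 * E * (n * SX) + n * P + 4 * r * E * length Y * P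
      ≤⟨ +-monoʳ-≤ (4 * E * (n * SX) + n * P) (*-monoˡ-≤ P small) ⟩
    4 * E * (n * SX) + n * P + n * P
      ≡⟨ a4 n E SX P ⟩
    2 * n * (E * (2 * SX) + P) ∎

select : {X : Set} (p : X → Bool) (xs : List X) → Σ (List X) λ ys → Σ (List X) λ zs →
  xs ↭ ys ++ zs × All (λ x → p x ≡ true) ys × length ys ≡ ∑ xs (λ x → ⟦ p x ⟧)
select p [] = [] , [] , refl , [] , refl≡
select p (x ∷ xs) with select p xs | p x in eq
... | ys , zs , e , al , l | true = x ∷ ys , zs , prep x e , eq ∷ al , cong suc l
... | ys , zs , e , al , l | false = ys , x ∷ zs , ↭-trans (prep x e) (↭-sym (shift x ys zs)) , al , l

unselected : {X : Set} (p : X → Bool) {xs ys zs : List X} → xs ↭ ys ++ zs → All (λ x → p x ≡ true) ys → length ys ≡ ∑ xs (λ x → ⟦ p x ⟧) → ∀ {x} → x ∈ˡ zs → p x ≡ false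
unselected p {xs} {ys} {zs} perm al l {x} m = go (p x) refl≡
  where
  φ : _ → ℕ
  φ y = ⟦ p y ⟧
  go : ∀ b → p x ≡ b → p x ≡ false
  go false e = e
  go true e = ⊥-elim (<-irrefl refl≡ (begin-strict
    ∑ xs φ ≡⟨ sym l ⟩
    length ys ≡⟨ trans≡ (length≡∑ ys) (∑-cong-∈ ys (λ y i → cong ⟦_⟧ (sym (All.lookup al i)))) ⟩
    ∑ ys φ <⟨ m<m+n (∑ ys φ) (≤-trans (≤-reflexive (cong ⟦_⟧ (sym e))) (∑-∈-≤ φ m)) ⟩
    ∑ ys φ + ∑ zs φ ≡⟨ trans≡ (sym (∑-++ ys zs φ)) (sym (∑-↭ φ perm)) ⟩
    ∑ xs φ ∎))

∑-positive : {X : Set} (p : X → Bool) (xs : List X) → 0 < ∑ xs (λ x → ⟦ p x ⟧) → Σ X λ x → p x ≡ true × (Σ (List X) λ zs → xs ↭ x ∷ zs)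
∑-positive p xs lt with select p xs
... | [] , zs , e , al , l = ⊥-elim (<-irrefl l lt)
... | y ∷ ys , zs , e , (q ∷ _) , l = y , q , ys ++ zs , e

assign : {Q P : Set} (ok : Q → P → Bool) (qs : List Q) (ps : List P) → All (λ q → length qs ≤ ∑ ps (λ p → ⟦ ok q p ⟧)) qs →
  Σ (List (Q × P)) λ as → Σ (List P) λ rest → map proj₁ as ≡ qs × All (λ a → ok (proj₁ a) (proj₂ a) ≡ true) as × ps ↭ map proj₂ as ++ rest
assign ok [] ps _ = [] , ps , refl≡ , [] , refl
assign ok (q ∷ qs) ps (b ∷ bs) with ∑-positive (ok q) ps (≤-trans (s≤s z≤n) b)
... | p , e , zs , perm with assign ok qs zs (All.map (λ {q'} l → ≤-pred (≤-trans l (≤-trans (≤-reflexive (∑-↭ _ perm)) (+-monoˡ-≤ (∑ zs (λ x → ⟦ ok q' x ⟧)) (bool-≤1 (ok q' p)))))) bs)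
... | as , rest , e₁ , al , e₂ = (q , p) ∷ as , rest , cong (q ∷_) e₁ , e ∷ al , ↭-trans perm (prep p e₂)

deal : {A C : Set} (ℓ : ℕ) (ds : List C) (U : List A) → length ds * ℓ ≤ length U →
  Σ (List (C × List A)) λ PL → Σ (List A) λ U₂ → map proj₁ PL ≡ ds × U ≡ concatMap proj₂ PL ++ U₂ × All (λ p → length (proj₂ p) ≡ ℓ) PL
deal ℓ [] U _ = [] , U , refl≡ , refl≡ , []
deal ℓ (d ∷ ds) U le with split-at ℓ U (≤-trans (m≤m+n ℓ _) le)
... | L , U' , refl≡ , l with deal ℓ ds U' (+-cancelˡ-≤ ℓ _ _ (≤-trans le (≤-reflexive (trans≡ (length-++ L) (cong (_+ length U') l)))))
... | PL , U₂ , e₁ , e₂ , al = (d , L) ∷ PL , U₂ , cong (d ∷_) e₁ , trans≡ (cong (L ++_) e₂) (sym (++-assoc L _ U₂)) , l ∷ al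

module _ {A : Set} (k' r' : ℕ) where

  private
    k r : ℕ
    k = suc k'
    r = suc r'

  cell-length : ∀ i (β : List A) → i < length β → length (cell i β) ≡ 1
  cell-length zero (x ∷ β) _ = refl≡
  cell-length (suc i) (x ∷ β) (s≤s l) = cell-length i β l

  row-length : ∀ i Y → i < k → All (λ β → length β ≡ k) Y → length (row i Y) ≡ length Y
  row-length i [] lt [] = refl≡
  row-length i (β ∷ Y) lt (e ∷ al) = trans≡ (length-++ (cell i β)) (cong₂ _+_ (cell-length i β (≤-trans lt (≤-reflexive (sym e)))) (row-length i Y lt al))

  parts-length : ∀ s c → All (λ β → length β ≡ k) (blocksOf k' c) → length (proj₂ (proj₁ c)) ≡ r' → length (proj₂ (proj₂ c)) ≡ r' →
    All (λ p → length p ≡ r) (parts k' s c)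
  parts-length s ((β , Z) , (β' , Z')) al l l' =
    first s lβ lβ' lZ l ∷ second s lβ lβ' lZ' l' ∷ AllP.++⁺ (rest (β ∷ Z) (lβ ∷ lZ) (cong suc l)) (rest (β' ∷ Z') (lβ' ∷ lZ') (cong suc l'))
    where
    lβ = All.lookup al (here refl≡)
    lβ' = All.lookup al (∈-++⁺ʳ (β ∷ Z) (here refl≡))
    lZ = All.tabulate (λ m → All.lookup al (there (∈-++⁺ˡ m)))
    lZ' = All.tabulate (λ m → All.lookup al (∈-++⁺ʳ (β ∷ Z) (there m)))
    first : ∀ s {β β' : List A} {Z} → length β ≡ k → length β' ≡ k → All (λ β → length β ≡ k) Z → length Z ≡ r' → length (cell 0 (if s then β' else β) ++ row 0 Z) ≡ r
    first true {β} {β'} {Z} a b c d = trans≡ (row-length 0 (β' ∷ Z) (s≤s z≤n) (b ∷ c)) (cong suc d)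
    first false {β} {β'} {Z} a b c d = trans≡ (row-length 0 (β ∷ Z) (s≤s z≤n) (a ∷ c)) (cong suc d)
    second : ∀ s {β β' : List A} {Z} → length β ≡ k → length β' ≡ k → All (λ β → length β ≡ k) Z → length Z ≡ r' → length (cell 0 (if s then β else β') ++ row 0 Z) ≡ r
    second true {β} {β'} {Z} a b c d = trans≡ (row-length 0 (β ∷ Z) (s≤s z≤n) (a ∷ c)) (cong suc d)
    second false {β} {β'} {Z} a b c d = trans≡ (row-length 0 (β' ∷ Z) (s≤s z≤n) (b ∷ c)) (cong suc d)
    rest : ∀ Y → All (λ β → length β ≡ k) Y → length Y ≡ r → All (λ p → length p ≡ r) (rows 1 k' Y)
    rest Y al l = AllP.map⁺ (All.tabulate (λ {i} m → trans≡ (row-length i Y (proj₂ (∈-seq⁻ 1 k' m)) al) l))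

module ConfigChoice {A P : Set} (_≟_ : DecidableEquality A) (k' r' : ℕ)
  (B : List (List A)) (len : All (λ b → length b ≡ suc k') B) (X-unique : Unique (concat B))
  (κ d₀ : ℕ) (d₀≡ : suc (8 * suc r' * κ) ≡ d₀) (N-large : 16 * (κ * (suc r' * suc r' * (suc k' * suc k'))) ≤ length (concat B)) (N>0 : 0 < length (concat B))
  (PL : List P) (|PL| : length PL ≡ d₀) (g : P → List A → Bool)
  (good-enough : ∀ p → p ∈ˡ PL → length (concat B) ^ suc r' * length (concat B) ^ suc r' ≤ κ * ∑ (configs k' B len r') (goodCount k' r' B len (g p))) where

  open Fresh _≟_
  private
      k r : ℕ
      k = suc k'
      r = suc r'
      X : List A
      X = concat B
      N T : ℕ
      N = length X
      T = N ^ r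
      Ω : List (Config A)
      Ω = configs k' B len r'
      instance
        nzN : NonZero N
        nzN = >-nonZero N>0
        nzT : NonZero T
        nzT = m^n≢0 N r
      cfgStale : Config A → ℕ
      cfgStale c = stale [] (concat (blocksOf k' c))
      R : List (List A)
      R = rotated k' B len
      R-origin : ∀ {β} → β ∈ˡ R → Σ (List A) λ b → b ∈ˡ B × β ↭ b
      R-origin m with ∈-concatMap⁻ (rots k) B m
      ... | b , b∈ , β∈ = b , b∈ , ∈-rots-↭ k b β∈
      R-len : ∀ {β} → β ∈ˡ R → length β ≡ k
      R-len m with R-origin m
      ... | b , b∈ , p = trans≡ (↭-length p) (All.lookup len b∈)
      R-unique : ∀ {β} → β ∈ˡ R → Unique β
      R-unique m with R-origin m
      ... | b , b∈ , p with ∈-∃++ b∈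
      ... | us , ws , q = Unique-resp-↭ (↭-sym p) (proj₁ (Unique-++⁻ b (proj₁ (proj₂ (Unique-++⁻ (concat us)
        (subst Unique (trans≡ (cong concat q) (sym (concat-++ us (b ∷ ws)))) X-unique))))))
      R-stale : ∀ Z F → length F ≤ Z → ∑ R (λ β → stale F β) ≤ k * Z
      R-stale Z F le = begin
        ∑ R (stale F)
          ≤⟨ ∑-mono-∈ R (λ β m → stale-≤-∑ F β (R-unique m)) ⟩
        ∑ R (λ β → ∑ β φ)
          ≡⟨ trans≡ (∑-concatMap (rots k) B _) (∑-cong B (λ b → trans≡ (∑-cong-∈ (rots k b) (λ β m → ∑-↭ φ (∈-rots-↭ k b m))) (trans≡ (∑-const (rots k b) _) (cong (_* ∑ b φ) (length-rots k b))))) ⟩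
        ∑ B (λ b → k * ∑ b φ)
          ≡⟨ trans≡ (∑-scale B k _) (cong (k *_) (sym (∑-concat B φ))) ⟩
        k * ∑ X φ
          ≤⟨ *-monoʳ-≤ k (≤-trans (∑-mem X F X-unique) le) ⟩
        k * Z ∎
        where
        φ : A → ℕ
        φ v = ⟦ mem v F ⟧
        length-rots : ∀ j (b : List A) → length (rots j b) ≡ j
        length-rots zero b = refl≡
        length-rots (suc j) b = cong suc (length-rots j (rot b))
      stale-few : 4 * κ * ∑ Ω cfgStale ≤ T * T
      stale-few = *-cancelʳ-≤ _ _ N (begin
        4 * κ * ∑ Ω cfgStale * N
          ≡⟨ *-assoc (4 * κ) _ N ⟩
        4 * κ * (∑ Ω cfgStale * N)
          ≡⟨ cong (λ s → 4 * κ * (s * N)) reindex ⟩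
        4 * κ * (∑ (tuples R (r + r)) (λ θ → stale [] (concatMap id θ)) * N)
          ≡⟨ cong (λ s → 4 * κ * (∑ (tuples R (r + r)) (λ θ → stale [] (concatMap id θ)) * s)) (sym (length-rotated k' B len)) ⟩
        4 * κ * (∑ (tuples R (r + r)) (λ θ → stale [] (concatMap id θ)) * length R)
          ≤⟨ *-monoʳ-≤ (4 * κ) (stale-tuples R id k (k * ((r + r) * k)) (length R) ((r + r) * k) (λ m → ≤-reflexive (R-len m)) (λ F le → *-monoˡ-≤ (length R) (R-stale ((r + r) * k) F le)) (r + r) [] ≤-refl) ⟩
        4 * κ * ((r + r) * (k * ((r + r) * k) * length R ^ (r + r)))
          ≡⟨ cong (λ s → 4 * κ * ((r + r) * (k * ((r + r) * k) * s))) (trans≡ (cong (_^ (r + r)) (length-rotated k' B len)) (^-distribˡ-+-* N r r)) ⟩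
        4 * κ * ((r + r) * (k * ((r + r) * k) * (T * T)))
          ≡⟨ a1 κ r k T ⟩
        16 * (κ * (r * r * (k * k))) * (T * T)
          ≤⟨ *-monoˡ-≤ (T * T) N-large ⟩
        N * (T * T)
          ≡⟨ *-comm N (T * T) ⟩
        T * T * N ∎)
        where
        a1 : ∀ κ r k T → 4 * κ * ((r + r) * (k * ((r + r) * k) * (T * T))) ≡ 16 * (κ * (r * r * (k * k))) * (T * T)
        a1 = solve-∀
        reindex : ∑ Ω cfgStale ≡ ∑ (tuples R (r + r)) (λ θ → stale [] (concatMap id θ))
        reindex = begin-equality
          ∑ Ω cfgStale
            ≡⟨ ∑-pairs (arrays k' B len r') (arrays k' B len r') _ ⟩
          ∑ (arrays k' B len r') (λ a → ∑ (arrays k' B len r') (λ a' → cfgStale (a , a')))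
            ≡⟨ trans≡ (∑-cong (arrays k' B len r') (λ a → trans≡ (∑-pairs R _ _) (sym (∑-tuples-suc R r' (λ v → f ((proj₁ a ∷ proj₂ a) ++ v))))))
                 (trans≡ (∑-pairs R _ _) (sym (∑-tuples-suc R r' (λ u → ∑ (tuples R r) (λ v → f (u ++ v)))))) ⟩
          ∑ (tuples R r) (λ u → ∑ (tuples R r) (λ v → f (u ++ v)))
            ≡⟨ sym (∑-tuples-++ R r r f) ⟩
          ∑ (tuples R (r + r)) f
            ≡⟨ ∑-cong (tuples R (r + r)) (λ θ → cong (λ y → stale [] (concat y)) (sym (map-id′ θ))) ⟩
          ∑ (tuples R (r + r)) (λ θ → stale [] (concatMap id θ)) ∎
          where
          f : List (List A) → ℕ
          f θ = stale [] (concat θ)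
          map-id′ : (θ : List (List A)) → map id θ ≡ θ
          map-id′ [] = refl≡
          map-id′ (x ∷ θ) = cong (x ∷_) (map-id′ θ)
      lhs rhs : Config A → ℕ
      lhs c = 4 * r + 2 * d₀ * cfgStale c
      rhs c = ∑ PL (λ p → goodCount k' r' B len (g p) c)
      averaged : ∑ Ω lhs < ∑ Ω rhs
      averaged = *-cancelˡ-< (2 * κ) _ _ (begin-strict
        2 * κ * ∑ Ω lhs
          ≡⟨ cong (2 * κ *_) (trans≡ (∑-add Ω _ _) (cong₂ _+_ (trans≡ (∑-const Ω _) (cong (_* (4 * r)) (length-configs k' B len r' (λ _ → true)))) (∑-scale Ω (2 * d₀) _))) ⟩
        2 * κ * (T * T * (4 * r) + 2 * d₀ * ∑ Ω cfgStale)
          ≡⟨ a1 κ T r d₀ (∑ Ω cfgStale) ⟩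
        8 * r * κ * (T * T) + d₀ * (4 * κ * ∑ Ω cfgStale)
          ≤⟨ +-monoʳ-≤ (8 * r * κ * (T * T)) (*-monoʳ-≤ d₀ stale-few) ⟩
        8 * r * κ * (T * T) + d₀ * (T * T)
          <⟨ +-monoˡ-< (d₀ * (T * T)) (*-monoˡ-< (T * T) {{m*n≢0 T T}} (≤-reflexive d₀≡)) ⟩
        d₀ * (T * T) + d₀ * (T * T)
          ≡⟨ cong (λ s → s * (T * T) + s * (T * T)) (sym |PL|) ⟩
        length PL * (T * T) + length PL * (T * T)
          ≡⟨ sym (cong₂ _+_ (∑-const PL (T * T)) (∑-const PL (T * T))) ⟩
        ∑ PL (λ _ → T * T) + ∑ PL (λ _ → T * T)
          ≤⟨ +-mono-≤ (∑-mono-∈ PL good-enough) (∑-mono-∈ PL good-enough) ⟩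
        ∑ PL (λ p → κ * ∑ Ω (goodCount k' r' B len (g p))) + ∑ PL (λ p → κ * ∑ Ω (goodCount k' r' B len (g p)))
          ≡⟨ cong (λ s → s + s) (trans≡ (∑-scale PL κ _) (cong (κ *_) (∑-swap PL Ω _))) ⟩
        κ * ∑ Ω rhs + κ * ∑ Ω rhs
          ≡⟨ a2 κ (∑ Ω rhs) ⟩
        2 * κ * ∑ Ω rhs ∎)
        where
        a1 : ∀ κ T r d s → 2 * κ * (T * T * (4 * r) + 2 * d * s) ≡ 8 * r * κ * (T * T) + d * (4 * κ * s)
        a1 = solve-∀
        a2 : ∀ κ s → κ * s + κ * s ≡ 2 * κ * s
        a2 = solve-∀
      gd : Config A → Bool → ℕ
      gd c s = ∑ PL (λ p → ⟦ goodFlag k' r' B len (g p) s c ⟧)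
      c-fresh : ∀ c → lhs c < rhs c → fresh [] (concat (blocksOf k' c)) ≡ true
      c-fresh c lt = decide (fresh [] (concat (blocksOf k' c))) refl≡
        where
        rhs≤ : rhs c ≤ 4 * r + 2 * d₀ * 1
        rhs≤ = begin
          rhs c ≤⟨ ∑-≤-length PL 2 (λ p → +-mono-≤ (bool-≤1 (goodFlag k' r' B len (g p) false c)) (bool-≤1 (goodFlag k' r' B len (g p) true c))) ⟩
          length PL * 2 ≡⟨ trans≡ (cong (_* 2) |PL|) (trans≡ (*-comm d₀ 2) (sym (*-identityʳ (2 * d₀)))) ⟩
          2 * d₀ * 1 ≤⟨ m≤n+m _ (4 * r) ⟩
          4 * r + 2 * d₀ * 1 ∎
        decide : ∀ b → fresh [] (concat (blocksOf k' c)) ≡ b → fresh [] (concat (blocksOf k' c)) ≡ true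
        decide true e = e
        decide false e = ⊥-elim (<⇒≱ lt (≤-trans rhs≤ (≤-reflexive (cong (λ b → 4 * r + 2 * d₀ * ⟦ not b ⟧) (sym e)))))
      flag : ∀ c → lhs c < rhs c → Σ Bool λ s → 2 * r < gd c s
      flag c lt = decide (2 * r <? gd c false) (2 * r <? gd c true)
        where
        a1 : ∀ r → 2 * r + 2 * r ≡ 4 * r
        a1 = solve-∀
        decide : Dec (2 * r < gd c false) → Dec (2 * r < gd c true) → Σ Bool λ s → 2 * r < gd c s
        decide (yes p) _ = false , p
        decide (no _) (yes p) = true , p
        decide (no ¬p) (no ¬q) = ⊥-elim (<⇒≱ lt (begin
          rhs c ≡⟨ ∑-add PL _ _ ⟩
          gd c false + gd c true ≤⟨ +-mono-≤ (≮⇒≥ ¬p) (≮⇒≥ ¬q) ⟩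
          2 * r + 2 * r ≡⟨ a1 r ⟩
          4 * r ≤⟨ m≤m+n (4 * r) (2 * d₀ * cfgStale c) ⟩
          lhs c ∎))

  config-choice : Σ (Config A) λ c → c ∈ˡ Ω × fresh [] (concat (blocksOf k' c)) ≡ true × (Σ Bool λ s → 2 * r < gd c s)
  config-choice = pack (∑-pick Ω lhs rhs averaged)
    where
    pack : (Σ (Config A) λ c → c ∈ˡ Ω × lhs c < rhs c) → Σ (Config A) λ c → c ∈ˡ Ω × fresh [] (concat (blocksOf k' c)) ≡ true × (Σ Bool λ s → 2 * r < gd c s)
    pack (c , c∈ , lt) = c , c∈ , c-fresh c lt , flag c lt

module _ {A : Set} where

  private
    module PA = CMSolver (++-commutativeMonoid {A = A})

  shuffle₄ : ∀ (a b c d : List A) → a ++ (b ++ (c ++ d)) ↭ (a ++ c) ++ (b ++ d)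
  shuffle₄ = PA.solve 4 (λ a b c d → a PA.⊕ (b PA.⊕ (c PA.⊕ d)) PA.⊜ (a PA.⊕ c) PA.⊕ (b PA.⊕ d)) refl

  interchange : ∀ (a b c d : List A) → (a ++ b) ++ (c ++ d) ↭ (a ++ c) ++ (b ++ d)
  interchange = PA.solve 4 (λ a b c d → (a PA.⊕ b) PA.⊕ (c PA.⊕ d) PA.⊜ (a PA.⊕ c) PA.⊕ (b PA.⊕ d)) refl

  shuffle₅ : ∀ (a b c d e : List A) → (a ++ b) ++ ((c ++ d) ++ e) ↭ (c ++ b) ++ ((a ++ d) ++ e)
  shuffle₅ = PA.solve 5 (λ a b c d e → (a PA.⊕ b) PA.⊕ ((c PA.⊕ d) PA.⊕ e) PA.⊜ (c PA.⊕ b) PA.⊕ ((a PA.⊕ d) PA.⊕ e)) refl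

  shuffle₇ : ∀ (q t r o f p z : List A) → ((q ++ t) ++ r) ++ ((o ++ f) ++ (p ++ z)) ↭ ((t ++ o) ++ (r ++ f)) ++ ((q ++ p) ++ z)
  shuffle₇ = PA.solve 7 (λ q t r o f p z → ((q PA.⊕ t) PA.⊕ r) PA.⊕ ((o PA.⊕ f) PA.⊕ (p PA.⊕ z)) PA.⊜ ((t PA.⊕ o) PA.⊕ (r PA.⊕ f)) PA.⊕ ((q PA.⊕ p) PA.⊕ z)) refl

  concat-↭ : {P Q R : List (List A)} → P ↭ Q ++ R → concat P ↭ concat Q ++ concat R
  concat-↭ {P} {Q} {R} p = ↭-trans (↭-reflexive (concat≡ P)) (↭-trans (concatMap⁺ id p) (↭-reflexive (trans≡ (sym (concat≡ (Q ++ R))) (sym (concat-++ Q R)))))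
    where
    concat≡ : (θ : List (List A)) → concat θ ≡ concatMap id θ
    concat≡ [] = refl≡
    concat≡ (x ∷ θ) = cong (x ++_) (concat≡ θ)

-- The list entries: matched edges, and chunks of unmatched vertices.
module _ {A C : Set} where

  Entry : Set
  Entry = (C × List A) ⊎ List A

  private
    Block : Set
    Block = C × List A

  vs : Entry → List A
  vs (inj₁ b) = proj₂ b
  vs (inj₂ f) = f

  real : Entry → List Block
  real (inj₁ b) = b ∷ []
  real (inj₂ f) = []

  fake : Entry → List A
  fake (inj₁ b) = []
  fake (inj₂ f) = f

  split-entries : ∀ Z → concatMap vs Z ↭ concatMap proj₂ (concatMap real Z) ++ concatMap fake Z
  split-entries [] = refl
  split-entries (inj₁ b ∷ Z) = ↭-trans (++⁺ˡ (proj₂ b) (split-entries Z)) (↭-reflexive (sym (++-assoc (proj₂ b) _ _)))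
  split-entries (inj₂ f ∷ Z) = ↭-trans (++⁺ˡ f (split-entries Z)) (shifts f (concatMap proj₂ (concatMap real Z)))

  real-inj₁ : ∀ M → concatMap real (map inj₁ M) ≡ M
  real-inj₁ [] = refl≡
  real-inj₁ (b ∷ M) = cong (b ∷_) (real-inj₁ M)

  real-inj₂ : ∀ F → concatMap real (map inj₂ F) ≡ []
  real-inj₂ [] = refl≡
  real-inj₂ (f ∷ F) = real-inj₂ F

  vs-inj₁ : ∀ M → concatMap vs (map inj₁ M) ≡ concatMap proj₂ M
  vs-inj₁ [] = refl≡
  vs-inj₁ (b ∷ M) = cong (proj₂ b ++_) (vs-inj₁ M)

  vs-inj₂ : ∀ F → concatMap vs (map inj₂ F) ≡ concat F
  vs-inj₂ [] = refl≡
  vs-inj₂ (f ∷ F) = cong (f ++_) (vs-inj₂ F)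

  real-≤ : ∀ Z → length (concatMap real Z) ≤ length Z
  real-≤ [] = z≤n
  real-≤ (inj₁ b ∷ Z) = s≤s (real-≤ Z)
  real-≤ (inj₂ f ∷ Z) = ≤-trans (real-≤ Z) (n≤1+n _)

  origins : (es : List Entry) (bl : List (List A)) → All (λ β → Σ Entry λ e → e ∈ˡ es × β ↭ vs e) bl →
    Σ (List Entry) λ bs → All (_∈ˡ es) bs × concat bl ↭ concatMap vs bs × length bs ≡ length bl
  origins es [] [] = [] , [] , refl , refl≡
  origins es (β ∷ bl) ((e , m , p) ∷ al) with origins es bl al
  ... | bs , al' , q , l = e ∷ bs , m ∷ al' , ++⁺ p q , cong suc l

-- State of the augmentation: a rainbow matching M with unmatched vertices U and unused colours D.
record State {A C : Set} (k : ℕ) (h : C → List A → Bool) (V' : List A) (C' : List C) : Set where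
  field
    M : List (C × List A)
    U : List A
    D : List C
    vert : concatMap proj₂ M ++ U ↭ V'
    col : map proj₁ M ++ D ↭ C'
    sound : ∀ {b} → b ∈ˡ M → h (proj₁ b) (proj₂ b) ≡ true × length (proj₂ b) ≡ k

module Augment {A C : Set} (k : ℕ) (h : C → List A → Bool) (V' : List A) (C' : List C) (st : State k h V' C')
  (PL : List (C × List A)) (D₂ : List C) (F : List (List A)) (z : List A)
  (D≡ : State.D st ≡ map proj₁ PL ++ D₂) (V'↭ : V' ↭ concatMap vs (map inj₁ (State.M st) ++ map inj₂ F) ++ (concatMap proj₂ PL ++ z))
  (bl P : List (List A)) (bs rest : List Entry) (PL₂ : List (C × List A)) (as : List ((C × List A) × List A)) (others : List (List A))
  (bl↭bs : concat bl ↭ concatMap vs bs) (P↭bl : concat P ↭ concat bl) (as-len : ∀ {a} → a ∈ˡ as → length (proj₂ (proj₁ a) ++ proj₂ a) ≡ k)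
  (es↭ : map inj₁ (State.M st) ++ map inj₂ F ↭ bs ++ rest)
  (|as| : length as ≡ suc (length (concatMap real bs))) (PL↭ : PL ↭ map proj₁ as ++ PL₂)
  (as-good : ∀ {a} → a ∈ˡ as → h (proj₁ (proj₁ a)) (proj₂ (proj₁ a) ++ proj₂ a) ≡ true) (parts↭ : P ↭ map proj₂ as ++ others) where

     open State st
     private
      es : List Entry
      es = map inj₁ M ++ map inj₂ F
      LL : List A
      LL = concatMap proj₂ PL
      Block : Set
      Block = C × List A
      RB RR : List Block
      RB = concatMap real bs
      RR = concatMap real rest
      glue : (C × List A) × List A → Block
      glue ((d , L) , t) = d , L ++ t
      newE : List Block
      newE = map glue as
      glue-verts : ∀ as → concatMap proj₂ (map glue as) ↭ concatMap proj₂ (map proj₁ as) ++ concat (map proj₂ as)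
      glue-verts [] = refl
      glue-verts (((d , L) , t) ∷ as) = ↭-trans (++⁺ˡ (L ++ t) (glue-verts as))
        (interchange L t (concatMap proj₂ (map proj₁ as)) (concat (map proj₂ as)))
      glue-cols : ∀ as → map proj₁ (map glue as) ≡ map proj₁ (map proj₁ as)
      glue-cols [] = refl≡
      glue-cols (a ∷ as) = cong (proj₁ (proj₁ a) ∷_) (glue-cols as)
      M' : List Block
      M' = newE ++ RR
      OV FR P₂ : List A
      OV = concat others
      FR = concatMap fake rest
      P₂ = concatMap proj₂ PL₂
      U' : List A
      U' = (OV ++ FR) ++ (P₂ ++ z)
      D' : List C
      D' = (map proj₁ RB ++ map proj₁ PL₂) ++ D₂
      LL↭ : LL ↭ concatMap proj₂ (map proj₁ as) ++ P₂
      LL↭ = ↭-trans (concatMap⁺ proj₂ PL↭) (↭-reflexive (concatMap-++ proj₂ (map proj₁ as) PL₂))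
      X↭ : concatMap vs es ↭ (concat (map proj₂ as) ++ OV) ++ (concatMap proj₂ RR ++ FR)
      X↭ = ↭-trans (concatMap⁺ vs es↭) (↭-trans (↭-reflexive (concatMap-++ vs bs rest))
        (++⁺ (↭-trans (↭-sym bl↭bs) (↭-trans (↭-sym P↭bl) (concat-↭ {Q = map proj₂ as} {R = others} parts↭))) (split-entries rest)))
      vert' : concatMap proj₂ M' ++ U' ↭ V'
      vert' = ↭-trans (++⁺ʳ U' (↭-trans (↭-reflexive (concatMap-++ proj₂ newE RR)) (++⁺ʳ (concatMap proj₂ RR) (glue-verts as))))
        (↭-trans (shuffle₇ (concatMap proj₂ (map proj₁ as)) (concat (map proj₂ as)) (concatMap proj₂ RR) OV FR P₂ z)
          (↭-trans (++⁺ (↭-sym X↭) (++⁺ʳ z (↭-sym LL↭))) (↭-sym V'↭)))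
      es-real : concatMap real es ≡ M
      es-real = trans≡ (concatMap-++ real (map inj₁ M) (map inj₂ F)) (trans≡ (cong₂ _++_ (real-inj₁ M) (real-inj₂ F)) (++-identityʳ M))
      M↭ : M ↭ RB ++ RR
      M↭ = ↭-trans (↭-reflexive (sym es-real)) (↭-trans (concatMap⁺ real es↭) (↭-reflexive (concatMap-++ real bs rest)))
      col' : map proj₁ M' ++ D' ↭ C'
      col' = ↭-trans (++⁺ʳ D' (↭-reflexive (trans≡ (map-++ proj₁ newE RR) (cong (_++ map proj₁ RR) (glue-cols as)))))
        (↭-trans (shuffle₅ (map proj₁ (map proj₁ as)) (map proj₁ RR) (map proj₁ RB) (map proj₁ PL₂) D₂)
          (↭-trans (++⁺ (↭-sym (↭-trans (map⁺ proj₁ M↭) (↭-reflexive (map-++ proj₁ RB RR))))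
              (++⁺ʳ D₂ (↭-sym (↭-trans (map⁺ proj₁ PL↭) (↭-reflexive (map-++ proj₁ (map proj₁ as) PL₂))))))
            (↭-trans (++⁺ˡ (map proj₁ M) (↭-reflexive (sym D≡))) col)))
      sound' : ∀ {b} → b ∈ˡ M' → h (proj₁ b) (proj₂ b) ≡ true × length (proj₂ b) ≡ k
      sound' m with ∈-++⁻ newE m
      ... | inj₂ p = sound (∈-resp-↭ (↭-sym M↭) (∈-++⁺ʳ RB p))
      ... | inj₁ p with ∈-map⁻ glue p
      ... | a , a∈ , refl≡ = as-good a∈ , as-len a∈

     augmented : Σ (State k h V' C') λ st' → suc (length (State.D st')) ≡ length D
     augmented = record { M = M' ; U = U' ; D = D' ; vert = vert' ; col = col' ; sound = sound' } , +-cancelˡ-≡ (length M) _ _ (begin-equality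
       length M + suc (length D')
         ≡⟨ cong (_+ suc (length D')) (trans≡ (↭-length M↭) (length-++ RB)) ⟩
       length RB + length RR + suc (length D')
         ≡⟨ a1 (length RB) (length RR) (length D') ⟩
       suc (length RB) + length RR + length D'
         ≡⟨ cong (λ y → y + length RR + length D') (trans≡ (sym |as|) (sym (length-map glue as))) ⟩
       length newE + length RR + length D'
         ≡⟨ cong (_+ length D') (trans≡ (sym (length-++ newE)) (sym (length-map proj₁ M'))) ⟩
       length (map proj₁ M') + length D'
         ≡⟨ trans≡ (sym (length-++ (map proj₁ M'))) (trans≡ (↭-length col') (trans≡ (sym (↭-length col)) (length-++ (map proj₁ M)))) ⟩
       length (map proj₁ M) + length D
         ≡⟨ cong (_+ length D) (length-map proj₁ M) ⟩
       length M + length D ∎)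
       where
       a1 : ∀ a b d → a + b + (1 + d) ≡ (1 + a) + b + d
       a1 = solve-∀

record NearPerfectData (A C : Set) : Set where
  constructor near-perfect-data
  field
    _≟_ : DecidableEquality A
    k' r' ℓ : ℕ
    ℓ+r : ℓ + suc r' ≡ suc k'
    cases : (2 * suc r' < suc k') ⊎ (2 * suc r' ≡ suc k' × 2 ≤ suc r')
    h : C → List A → Bool
    h-sym : ∀ c → SymFun (h c)
    V V' W : List A
    C' : List C
    uniq : Unique V
    V↭ : V ↭ V' ++ W
    κ E d₀ : ℕ
    κ≡ : 4 * (suc k' * excessConst (suc r')) ≡ κ
    E≡ : 2 * (excessConst (suc r') * suc k') ≡ E
    d₀≡ : suc (8 * suc r' * κ) ≡ d₀
    κ≥1 : 1 ≤ κ
    E≥1 : 1 ≤ E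
    degree : ∀ {c} → c ∈ˡ C' → ∀ L → Unique L → length L ≡ ℓ → 2 * E * length V ^ suc r' ≤ 2 * E * (2 * ∑ (tuples V (suc r')) (λ t → ⟦ h c (L ++ t) ⟧)) + length V ^ suc r'
    small₁ : 4 * suc r' * E * (k' + d₀ * ℓ + length W) ≤ length V
    small₂ : 16 * (κ * (suc r' * suc r' * (suc k' * suc k'))) + (k' + d₀ * ℓ + length W) ≤ length V

module NearPerfect {A C : Set} (data′ : NearPerfectData A C) where

  open NearPerfectData data′

  open Fresh _≟_

  private
    k r n : ℕ
    k = suc k'
    r = suc r'
    n = length V
    St : Set
    St = State k h V' C'

  module Dealt (st : St) (PL : List (C × List A)) (D₂ : List C) (F : List (List A)) (z : List A)
    (D≡ : State.D st ≡ map proj₁ PL ++ D₂) (U≡ : State.U st ≡ concatMap proj₂ PL ++ (concat F ++ z))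
    (PL-ℓ : All (λ p → length (proj₂ p) ≡ ℓ) PL) (|PL| : length PL ≡ d₀) (F-len : All (λ b → length b ≡ suc k') F) (|z| : length z ≤ k') where

    open State st
    private
      LL : List A
      LL = concatMap proj₂ PL
      es : List Entry
      es = map inj₁ M ++ map inj₂ F
      B : List (List A)
      B = map vs es
      es-len : ∀ {e} → e ∈ˡ es → length (vs e) ≡ k
      es-len m with ∈-++⁻ (map inj₁ M) m
      ... | inj₁ p with ∈-map⁻ inj₁ p
      ... | b , b∈ , refl≡ = proj₂ (sound b∈)
      es-len m | inj₂ p with ∈-map⁻ inj₂ p
      ... | f , f∈ , refl≡ = All.lookup F-len f∈
      len : All (λ b → length b ≡ k) B
      len = AllP.map⁺ (All.tabulate es-len)
      X Y : List A
      X = concat B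
      Y = (LL ++ z) ++ W
      N T : ℕ
      N = length X
      T = N ^ r
      X≡ : X ≡ concatMap proj₂ M ++ concat F
      X≡ = trans≡ (concatMap-++ vs (map inj₁ M) (map inj₂ F)) (cong₂ _++_ (vs-inj₁ M) (vs-inj₂ F))
      V'↭ : V' ↭ X ++ (LL ++ z)
      V'↭ = ↭-trans (↭-sym vert) (↭-trans (↭-reflexive (cong (concatMap proj₂ M ++_) U≡))
        (↭-trans (shuffle₄ (concatMap proj₂ M) LL (concat F) z) (↭-reflexive (cong (_++ LL ++ z) (sym X≡)))))
      V↭XY : V ↭ X ++ Y
      V↭XY = ↭-trans V↭ (↭-trans (++⁺ʳ W V'↭) (↭-reflexive (++-assoc X (LL ++ z) W)))
      |Y| : length Y ≤ k' + d₀ * ℓ + length W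
      |Y| = begin
        length Y ≡⟨ trans≡ (length-++ (LL ++ z)) (cong (_+ length W) (length-++ LL)) ⟩
        length LL + length z + length W ≡⟨ cong (λ y → y + length z + length W) (trans≡ (length-concatMap proj₂ ℓ PL PL-ℓ) (cong (_* ℓ) |PL|)) ⟩
        d₀ * ℓ + length z + length W ≤⟨ +-monoˡ-≤ (length W) (≤-trans (+-monoʳ-≤ (d₀ * ℓ) |z|) (≤-reflexive (+-comm (d₀ * ℓ) k'))) ⟩
        k' + d₀ * ℓ + length W ∎
      n≡ : n ≡ N + length Y
      n≡ = trans≡ (↭-length V↭XY) (length-++ X)
      N-large : 16 * (κ * (r * r * (k * k))) ≤ N
      N-large = +-cancelʳ-≤ (k' + d₀ * ℓ + length W) _ _ (≤-trans small₂ (≤-trans (≤-reflexive n≡) (+-monoʳ-≤ N |Y|)))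
      N>0 : 0 < N
      N>0 = ≤-trans (≤-trans κ≥1 (≤-trans (m≤m*n κ (r * r * (k * k))) (m≤n*m (κ * (r * r * (k * k))) 16))) N-large
      X-unique : Unique X
      X-unique = proj₁ (Unique-++⁻ X (Unique-resp-↭ V↭XY uniq))
      ds⊆C' : ∀ {c} → c ∈ˡ map proj₁ PL → c ∈ˡ C'
      ds⊆C' m = ∈-resp-↭ col (∈-++⁺ʳ (map proj₁ M) (subst (_ ∈ˡ_) (sym D≡) (∈-++⁺ˡ m)))
      PL-unique : ∀ {p} → p ∈ˡ PL → Unique (proj₂ p)
      PL-unique {p} m with ∈-∃++ m
      ... | us , ws , e = proj₁ (Unique-++⁻ (proj₂ p) (proj₁ (proj₂ (Unique-++⁻ (concatMap proj₂ us)
        (subst Unique (trans≡ (cong (concatMap proj₂) e) (concatMap-++ proj₂ us (p ∷ ws))) LL-unique)))))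
        where
        LL-unique : Unique LL
        LL-unique = proj₁ (Unique-++⁻ LL (proj₁ (Unique-++⁻ (LL ++ z) (proj₁ (proj₂ (Unique-++⁻ X (Unique-resp-↭ V↭XY uniq)))))))
      g : C × List A → List A → Bool
      g (d , L) t = h d (L ++ t)
      g-sym : ∀ p → SymFun (g p)
      g-sym (d , L) q = h-sym d (++⁺ˡ L q)
      Ω : List (Config A)
      Ω = configs k' B len r'
      good-enough : ∀ p → p ∈ˡ PL → T * T ≤ κ * ∑ Ω (goodCount k' r' B len (g p))
      good-enough p m = subst (λ y → T * T ≤ y * ∑ Ω (goodCount k' r' B len (g p))) κ≡ $ many-good k' r' B len (g p) (g-sym p) E (≤-reflexive E≡) cases
        (density-transfer V X Y V↭XY (λ t → ⟦ g p t ⟧) (λ t → bool-≤1 (g p t)) r E E≥1 (≤-trans N>0 (≤-trans (m≤m+n N (length Y)) (≤-reflexive (sym n≡))))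
          (≤-trans (*-monoʳ-≤ (4 * r * E) |Y|) small₁)
          (degree (ds⊆C' (∈-map⁺ proj₁ m)) (proj₂ p) (PL-unique m) (All.lookup PL-ℓ m)))
      R : List (List A)
      R = rotated k' B len
      R-origin : ∀ {β} → β ∈ˡ R → Σ Entry λ e → e ∈ˡ es × β ↭ vs e
      R-origin m with ∈-concatMap⁻ (rots k) B m
      ... | b , b∈ , β∈ with ∈-map⁻ vs b∈
      ... | e , e∈ , refl≡ = e , e∈ , ∈-rots-↭ k (vs e) β∈
      R-len : ∀ {β} → β ∈ˡ R → length β ≡ k
      R-len m with R-origin m
      ... | e , e∈ , p = trans≡ (↭-length p) (es-len e∈)
      arr∈ : ∀ {a} → a ∈ˡ arrays k' B len r' → proj₁ a ∈ˡ R × length (proj₂ a) ≡ r' × All (_∈ˡ R) (proj₂ a)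
      arr∈ {β , Z} m with ∈-pairs⁻ R (tuples R r') m
      ... | p , q = p , ∈-tuples⁻ R r' q
      Result : Set
      Result = Σ St λ st' → suc (length (State.D st')) ≡ length D
      module Chosen (c : Config A) (c-fresh : fresh [] (concat (blocksOf k' c)) ≡ true) (s : Bool) (s-good : 2 * r < ∑ PL (λ p → ⟦ goodFlag k' r' B len (g p) s c ⟧))
        (a∈ : proj₁ (proj₁ c) ∈ˡ R × length (proj₂ (proj₁ c)) ≡ r' × All (_∈ˡ R) (proj₂ (proj₁ c)))
        (a∈' : proj₁ (proj₂ c) ∈ˡ R × length (proj₂ (proj₂ c)) ≡ r' × All (_∈ˡ R) (proj₂ (proj₂ c))) where
        bl : List (List A)
        bl = blocksOf k' c
        bl∈ : All (_∈ˡ R) bl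
        bl∈ = AllP.++⁺ (proj₁ a∈ ∷ proj₂ (proj₂ a∈)) (proj₁ a∈' ∷ proj₂ (proj₂ a∈'))
        |bl| : length bl ≡ r + r
        |bl| = trans≡ (length-++ (proj₁ (proj₁ c) ∷ proj₂ (proj₁ c))) (cong₂ (λ a b → suc a + suc b) (proj₁ (proj₂ a∈)) (proj₁ (proj₂ a∈')))
        bl-len : All (λ β → length β ≡ k) bl
        bl-len = All.map R-len bl∈
        P : List (List A)
        P = parts k' s c
        gp : C × List A → Bool
        gp p = goodFlag k' r' B len (g p) s c
        go₃ : (bs rest : List Entry) → concat bl ↭ concatMap vs bs → es ↭ bs ++ rest → (Q zs : List (C × List A)) → PL ↭ Q ++ zs → length Q ≡ suc (length (concatMap real bs)) →
          (Σ (List ((C × List A) × List A)) λ as → Σ (List (List A)) λ others → map proj₁ as ≡ Q × All (λ a → g (proj₁ a) (proj₂ a) ≡ true) as × P ↭ map proj₂ as ++ others) → Result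
        go₃ bs rest bl↭bs es↭ Q zs PL↭ |Q| (as , others , refl≡ , as-good , parts↭) =
          Augment.augmented k h V' C' st PL D₂ F z D≡ V'↭ bl P bs rest zs as others bl↭bs (parts-↭ k' s c bl-len) as-len es↭ (trans≡ (sym (length-map proj₁ as)) |Q|) PL↭ (All.lookup as-good) parts↭
          where
          as-len : ∀ {a} → a ∈ˡ as → length (proj₂ (proj₁ a) ++ proj₂ a) ≡ k
          as-len {(d , L) , t} m = trans≡ (length-++ L) (trans≡ (cong₂ _+_ (All.lookup PL-ℓ (∈-resp-↭ (↭-sym PL↭) (∈-++⁺ˡ (∈-map⁺ proj₁ m))))
            (All.lookup (parts-length k' r' s c bl-len (proj₁ (proj₂ a∈)) (proj₁ (proj₂ a∈'))) (∈-resp-↭ (↭-sym parts↭) (∈-++⁺ˡ (∈-map⁺ proj₂ m))))) ℓ+r)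
        go₂ : (bs rest : List Entry) → concat bl ↭ concatMap vs bs → length bs ≡ length bl → es ↭ bs ++ rest →
          (Σ (List (C × List A)) λ ys → Σ (List (C × List A)) λ zs → PL ↭ ys ++ zs × All (λ p → gp p ≡ true) ys × length ys ≡ ∑ PL (λ p → ⟦ gp p ⟧)) → Result
        go₂ bs rest bl↭bs |bs| es↭ (ys , zs , PL↭ , ys-good , |ys|) = go (split-at q ys (≤-trans q≤ (≤-trans s-good (≤-reflexive (sym |ys|)))))
          where
          q : ℕ
          q = suc (length (concatMap real bs))
          q≤ : q ≤ suc (2 * r)
          q≤ = s≤s (≤-trans (real-≤ bs) (≤-reflexive (trans≡ (trans≡ |bs| |bl|) (cong (r +_) (sym (+-identityʳ r))))))
          go : (Σ (List (C × List A)) λ us → Σ (List (C × List A)) λ ws → ys ≡ us ++ ws × length us ≡ q) → Result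
          go (Q , Q' , ys≡ , |Q|) = go₃ bs rest bl↭bs es↭ Q (Q' ++ zs) (↭-trans PL↭ (↭-reflexive (trans≡ (cong (_++ zs) ys≡) (++-assoc Q Q' zs)))) |Q|
            (assign g Q P (All.tabulate λ {p} m → ≤-trans (≤-reflexive |Q|) (≤-trans q≤ (<ᵇ-true {2 * r} (All.lookup ys-good (subst (p ∈ˡ_) (sym ys≡) (∈-++⁺ˡ m)))))))
        go₁ : (Σ (List Entry) λ bs → All (_∈ˡ es) bs × concat bl ↭ concatMap vs bs × length bs ≡ length bl) → Result
        go₁ (bs , bs∈ , bl↭bs , |bs|) = go₂ bs (proj₁ ex) bl↭bs |bs| (proj₂ ex) (select gp PL)
          where
          ex : Σ (List Entry) λ rest → es ↭ bs ++ rest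
          ex = extract bs es (Unique-concatMap⁻ vs bs (All.map (λ m → ≤-trans (s≤s z≤n) (≤-reflexive (sym (es-len m)))) bs∈)
            (Unique-resp-↭ bl↭bs (fresh-unique [] (concat bl) c-fresh))) bs∈
        result : Result
        result = go₁ (origins es bl (All.map R-origin bl∈))

    next : Σ St λ st' → suc (length (State.D st')) ≡ length D
    next = pack (ConfigChoice.config-choice _≟_ k' r' B len X-unique κ d₀ d₀≡ N-large N>0 PL |PL| g good-enough)
      where
      pack : (Σ (Config A) λ c → c ∈ˡ Ω × fresh [] (concat (blocksOf k' c)) ≡ true × (Σ Bool λ s → 2 * r < ∑ PL (λ p → ⟦ goodFlag k' r' B len (g p) s c ⟧))) → Result
      pack (c , c∈ , c-fresh , s , s-good) = Chosen.result c c-fresh s s-good (arr∈ (proj₁ both)) (arr∈ (proj₂ both))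
        where
        both = ∈-pairs⁻ (arrays k' B len r') (arrays k' B len r') c∈

  step : (st : St) → d₀ ≤ length (State.D st) → d₀ * ℓ ≤ length (State.U st) → Σ St λ st' → suc (length (State.D st')) ≡ length (State.D st)
  step st d₀≤ d₀ℓ≤ with split-at d₀ (State.D st) d₀≤
  ... | ds , D₂ , D≡ , |ds| with deal ℓ ds (State.U st) (≤-trans (≤-reflexive (cong (_* ℓ) |ds|)) d₀ℓ≤)
  ... | PL , U₂ , refl≡ , U≡ , PL-ℓ with chunk k' (length U₂) U₂ ≤-refl
  ... | F , z , refl≡ , F-len , |z| = Dealt.next st PL D₂ F z D≡ U≡ PL-ℓ (trans≡ (sym (length-map proj₁ PL)) |ds|) F-len |z|

  -- With ρ vertices missing from V', so that |V'| + ρ ≥ k |C'|.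
  module _ (K₀ ρ : ℕ) (V'-large : k * length C' ≤ length V' + ρ) (d₀≤K₀ : d₀ ≤ K₀) (room : d₀ * ℓ + ρ ≤ k * K₀) where

    private
      unmatched : (st : St) → k * length (State.D st) ≤ length (State.U st) + ρ
      unmatched st = +-cancelˡ-≤ (k * length M) _ _ (begin
        k * length M + k * length D
          ≡⟨ sym (*-distribˡ-+ k (length M) (length D)) ⟩
        k * (length M + length D)
          ≡⟨ cong (k *_) (trans≡ (cong (_+ length D) (sym (length-map proj₁ M))) (trans≡ (sym (length-++ (map proj₁ M))) (↭-length col))) ⟩
        k * length C'
          ≤⟨ V'-large ⟩
        length V' + ρ
          ≡⟨ cong (_+ ρ) (trans≡ (sym (↭-length vert)) (trans≡ (length-++ (concatMap proj₂ M))
               (cong (_+ length U) (trans≡ (length-concatMap proj₂ k M (All.tabulate (λ m → proj₂ (sound m)))) (*-comm (length M) k))))) ⟩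
        k * length M + length U + ρ
          ≡⟨ +-assoc (k * length M) (length U) ρ ⟩
        k * length M + (length U + ρ) ∎)
        where open State st

      iterate : ∀ j (st : St) → length (State.D st) ≡ j + K₀ → Σ St λ st' → length (State.D st') ≡ K₀
      iterate zero st e = st , e
      iterate (suc j) st e = continue (step st (≤-trans d₀≤K₀ K₀≤) (+-cancelʳ-≤ ρ _ _ (≤-trans room (≤-trans (*-monoʳ-≤ k K₀≤) (unmatched st)))))
        where
        K₀≤ : K₀ ≤ length (State.D st)
        K₀≤ = ≤-trans (m≤n+m K₀ (suc j)) (≤-reflexive (sym e))
        continue : (Σ St λ st' → suc (length (State.D st')) ≡ length (State.D st)) → Σ St λ st' → length (State.D st') ≡ K₀
        continue (st' , e') = iterate j st' (suc-injective (trans≡ e' e))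

    near-perfect : K₀ ≤ length C' → Σ St λ st → length (State.D st) ≡ K₀
    near-perfect le = iterate (length C' ∸ K₀) (record { M = [] ; U = V' ; D = C' ; vert = refl ; col = refl ; sound = λ () }) (sym (m∸n+n≡m le))

∑-pick-≤ : {A : Set} (xs : List A) (f g : A → ℕ) → 0 < length xs → ∑ xs f ≤ ∑ xs g → Σ A λ x → x ∈ˡ xs × f x ≤ g x
∑-pick-≤ xs f g pos le = pack (∑-pick xs f (suc ∘ g) (begin-strict
    ∑ xs f <⟨ s≤s le ⟩
    1 + ∑ xs g ≤⟨ +-monoˡ-≤ (∑ xs g) pos ⟩
    length xs + ∑ xs g ≡⟨ cong (_+ ∑ xs g) (length≡∑ xs) ⟩
    ∑ xs (λ _ → 1) + ∑ xs g ≡⟨ sym (∑-add xs _ _) ⟩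
    ∑ xs (suc ∘ g) ∎))
  where
  pack : (Σ _ λ x → x ∈ˡ xs × f x < suc (g x)) → Σ _ λ x → x ∈ˡ xs × f x ≤ g x
  pack (x , m , lt) = x , m , ≤-pred lt

module Cover {𝒳 𝒴 : Set} (Y : List 𝒴) (R : 𝒳 → 𝒴 → Bool) (bad : List 𝒴 → 𝒴 → Bool) where

  Valid : List 𝒴 → List 𝒴 → Set
  Valid P₀ [] = ⊤
  Valid P₀ (y ∷ P) = bad P₀ y ≡ false × y ∈ˡ Y × Valid (y ∷ P₀) P

  Covering : ℕ → List 𝒴 → List 𝒳 → Set
  Covering T P₀ X = Σ (List 𝒴) λ P → Valid P₀ P × length P ≤ T ×
    (∀ x → x ∈ˡ X → Σ 𝒴 λ y → y ∈ˡ P × R x y ≡ true) × (∀ y → y ∈ˡ P → Σ 𝒳 λ x → x ∈ˡ X × R x y ≡ true)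

  -- A greedily chosen y covers at least the proportion 1 / (Q + 1) of the elements not yet covered.
  cover : ∀ Q T (X : List 𝒳) (P₀ : List 𝒴) → All (_∈ˡ Y) P₀ → 0 < length Y →
    (∀ x → x ∈ˡ X → 2 * length Y ≤ suc Q * ∑ Y (λ y → ⟦ R x y ⟧)) →
    (∀ P → All (_∈ˡ Y) P → length P < T + length P₀ → suc Q * ∑ Y (λ y → ⟦ bad P y ⟧) ≤ length Y) →
    length X * Q ^ T < suc Q ^ T → Covering T P₀ X
  cover Q T [] P₀ _ _ _ _ _ = [] , tt , z≤n , (λ _ ()) , λ _ ()
  cover Q zero (x ∷ X) P₀ _ _ _ _ (s≤s ())
  cover Q (suc T) X@(_ ∷ _) P₀ P₀∈ pos hit few fin = choose (∑-pick-≤ Y f g pos (begin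
      ∑ Y f
        ≡⟨ trans≡ (∑-add Y _ _) (cong₂ _+_ (∑-const Y (length X)) (∑-scale Y (suc Q * length X) _)) ⟩
      length Y * length X + suc Q * length X * ∑ Y (λ y → ⟦ bad P₀ y ⟧)
        ≡⟨ a1 (length Y) (length X) (suc Q) (∑ Y (λ y → ⟦ bad P₀ y ⟧)) ⟩
      length X * (length Y + suc Q * ∑ Y (λ y → ⟦ bad P₀ y ⟧))
        ≤⟨ *-monoʳ-≤ (length X) (+-monoʳ-≤ (length Y) (≤-trans (few P₀ P₀∈ (s≤s (m≤n+m (length P₀) T))) (≤-reflexive (sym (+-identityʳ _))))) ⟩
      length X * (2 * length Y)
        ≡⟨ sym (∑-const X _) ⟩
      ∑ X (λ _ → 2 * length Y)
        ≤⟨ ∑-mono-∈ X hit ⟩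
      ∑ X (λ x → suc Q * ∑ Y (λ y → ⟦ R x y ⟧))
        ≡⟨ trans≡ (∑-scale X (suc Q) _) (trans≡ (cong (suc Q *_) (∑-swap X Y _)) (sym (∑-scale Y (suc Q) _))) ⟩
      ∑ Y g ∎))
    where
    f g : 𝒴 → ℕ
    f y = length X + suc Q * length X * ⟦ bad P₀ y ⟧
    g y = suc Q * ∑ X (λ x → ⟦ R x y ⟧)
    a1 : ∀ y x q b → y * x + q * x * b ≡ x * (y + q * b)
    a1 = solve-∀
    not-bad : ∀ y b → length X + suc Q * length X * ⟦ b ⟧ ≤ g y → b ≡ false
    not-bad y false le = refl≡
    not-bad y true le = ⊥-elim (n≮0 (+-cancelʳ-≤ (suc Q * length X * 1) (length X) 0 (≤-trans le
      (≤-trans (*-monoʳ-≤ (suc Q) (∑-≤-length X 1 (λ x → bool-≤1 (R x y)))) (≤-reflexive (sym (*-assoc (suc Q) (length X) 1)))))))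
    choose : (Σ 𝒴 λ y → y ∈ˡ Y × f y ≤ g y) → Covering (suc T) P₀ X
    choose (y , y∈ , le) = extend (select (λ x → not (R x y)) X)
      where
      nb : bad P₀ y ≡ false
      nb = not-bad y (bad P₀ y) le
      extend : (Σ (List 𝒳) λ X' → Σ (List 𝒳) λ zs → X ↭ X' ++ zs × All (λ x → not (R x y) ≡ true) X' × length X' ≡ ∑ X (λ x → ⟦ not (R x y) ⟧)) →
        Covering (suc T) P₀ X
      extend (X' , zs , X↭ , all-X' , |X'|) = pack (cover Q T X' (y ∷ P₀) (y∈ ∷ P₀∈) pos (λ x m → hit x (sub m))
          (λ P P∈ lt → few P P∈ (≤-trans lt (≤-reflexive (+-suc T (length P₀))))) (*-cancelˡ-< (suc Q) _ _ (begin-strict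
            suc Q * (length X' * Q ^ T)
              ≡⟨ sym (*-assoc (suc Q) (length X') (Q ^ T)) ⟩
            suc Q * length X' * Q ^ T
              ≤⟨ *-monoˡ-≤ (Q ^ T) shrunk ⟩
            Q * length X * Q ^ T
              ≡⟨ a2 Q (length X) (Q ^ T) ⟩
            length X * Q ^ suc T
              <⟨ fin ⟩
            suc Q * suc Q ^ T ∎)))
        where
        sub : ∀ {x} → x ∈ˡ X' → x ∈ˡ X
        sub m = ∈-resp-↭ (↭-sym X↭) (∈-++⁺ˡ m)
        a2 : ∀ q x p → q * x * p ≡ x * (q * p)
        a2 = solve-∀
        hits = ∑ X (λ x → ⟦ R x y ⟧)
        complement : length X' + hits ≡ length X
        complement = trans≡ (cong (_+ hits) |X'|) (trans≡ (sym (∑-add X (λ x → ⟦ not (R x y) ⟧) (λ x → ⟦ R x y ⟧))) (trans≡ (∑-cong X (λ x → one (R x y))) (sym (length≡∑ X))))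
          where
          one : ∀ b → ⟦ not b ⟧ + ⟦ b ⟧ ≡ 1
          one true = refl≡
          one false = refl≡
        shrunk : suc Q * length X' ≤ Q * length X
        shrunk = +-cancelʳ-≤ (suc Q * hits) _ _ (begin
          suc Q * length X' + suc Q * hits
            ≡⟨ trans≡ (sym (*-distribˡ-+ (suc Q) (length X') hits)) (cong (suc Q *_) complement) ⟩
          length X + Q * length X
            ≡⟨ +-comm (length X) _ ⟩
          Q * length X + length X
            ≤⟨ +-monoʳ-≤ (Q * length X) (≤-trans (m≤m+n (length X) _) le) ⟩
          Q * length X + suc Q * hits ∎)
        pack : Covering T (y ∷ P₀) X' → Covering (suc T) P₀ X
        pack (P , v , l , cov , use) = y ∷ P , (nb , y∈ , v) , s≤s l , (λ x m → covered x m (R x y) refl≡) , used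
          where
          0<hits : 0 < hits
          0<hits = *-cancelˡ-< (suc Q) 0 hits (≤-trans (≤-reflexive (cong suc (*-zeroʳ Q))) (≤-trans (≤-trans (s≤s z≤n) (m≤m+n (length X) _)) le))
          used : ∀ y' → y' ∈ˡ y ∷ P → Σ 𝒳 λ x → x ∈ˡ X × R x y' ≡ true
          used y' (here refl≡) with ∑-positive (λ x → R x y) X 0<hits
          ... | x , e , zs' , p = x , ∈-resp-↭ (↭-sym p) (here refl≡) , e
          used y' (there m) with use y' m
          ... | x , x∈ , e = x , sub x∈ , e
          covered : ∀ x → x ∈ˡ X → ∀ b → R x y ≡ b → Σ 𝒴 λ y' → y' ∈ˡ y ∷ P × R x y' ≡ true
          covered x m true e = y , here refl≡ , e
          covered x m false e with cov x (in-X' (∈-++⁻ X' (∈-resp-↭ X↭ m)))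
            where
            clash : ∀ {b} → b ≡ false → not b ≢ false
            clash refl≡ ()
            in-X' : x ∈ˡ X' ⊎ x ∈ˡ zs → x ∈ˡ X'
            in-X' (inj₁ i) = i
            in-X' (inj₂ i) = ⊥-elim (clash e (unselected (λ x → not (R x y)) X↭ all-X' |X'| i))
          ... | y' , m' , e' = y' , there m' , e'

bernoulli : ∀ Q t → Q ^ t * (Q + t) ≤ Q * suc Q ^ t
bernoulli Q zero = ≤-reflexive (b0 Q)
  where
  b0 : ∀ q → 1 * (q + 0) ≡ q * 1
  b0 = solve-∀
bernoulli Q (suc t) = begin
    Q * Q ^ t * (Q + suc t) ≡⟨ b1 Q (Q ^ t) t ⟩
    Q ^ t * (Q * (Q + t) + Q) ≤⟨ *-monoʳ-≤ (Q ^ t) (+-monoʳ-≤ (Q * (Q + t)) (m≤m+n Q t)) ⟩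
    Q ^ t * (Q * (Q + t) + (Q + t)) ≡⟨ b2 Q (Q ^ t) t ⟩
    suc Q * (Q ^ t * (Q + t)) ≤⟨ *-monoʳ-≤ (suc Q) (bernoulli Q t) ⟩
    suc Q * (Q * suc Q ^ t) ≡⟨ b3 Q (suc Q ^ t) ⟩
    Q * suc Q ^ suc t ∎
  where
  b1 : ∀ q p t → q * p * (q + (1 + t)) ≡ p * (q * (q + t) + q)
  b1 = solve-∀
  b2 : ∀ q p t → p * (q * (q + t) + (q + t)) ≡ (1 + q) * (p * (q + t))
  b2 = solve-∀
  b3 : ∀ q s → (1 + q) * (q * s) ≡ q * ((1 + q) * s)
  b3 = solve-∀

^-distrib-* : ∀ a b s → (a * b) ^ s ≡ a ^ s * b ^ s
^-distrib-* a b zero = refl≡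
^-distrib-* a b (suc s) = trans≡ (cong (a * b *_) (^-distrib-* a b s)) (medial a b (a ^ s) (b ^ s))
  where
  medial : ∀ a b p q → a * b * (p * q) ≡ a * p * (b * q)
  medial = solve-∀

doubling : ∀ Q .{{_ : NonZero Q}} s → 2 ^ s * Q ^ (Q * s) ≤ suc Q ^ (Q * s)
doubling Q s = begin
    2 ^ s * Q ^ (Q * s) ≡⟨ cong (2 ^ s *_) (sym (^-*-assoc Q Q s)) ⟩
    2 ^ s * (Q ^ Q) ^ s ≡⟨ sym (^-distrib-* 2 (Q ^ Q) s) ⟩
    (2 * Q ^ Q) ^ s ≤⟨ ^-monoˡ-≤ s (*-cancelˡ-≤ Q (≤-trans (≤-reflexive (d1 Q (Q ^ Q))) (bernoulli Q Q))) ⟩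
    (suc Q ^ Q) ^ s ≡⟨ ^-*-assoc (suc Q) Q s ⟩
    suc Q ^ (Q * s) ∎
  where
  d1 : ∀ q p → q * (2 * p) ≡ p * (q + q)
  d1 = solve-∀

n<2^n : ∀ n → n < 2 ^ n
n<2^n zero = s≤s z≤n
n<2^n (suc n) = begin
    2 + n ≤⟨ +-mono-≤ {1} {2 ^ n} (m^n>0 2 n) (n<2^n n) ⟩
    2 ^ n + 2 ^ n ≡⟨ cong (2 ^ n +_) (sym (+-identityʳ _)) ⟩
    2 ^ suc n ∎

linear≤2^ : ∀ G x → 3 * G ≤ x → G * suc x ≤ 2 ^ x
linear≤2^ G x le with m≤n⇒∃[o]m+o≡n le
... | y , refl≡ = go y
  where
  base : G * suc (3 * G) ≤ 2 ^ (3 * G)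
  base = begin
    G * suc (3 * G) ≤⟨ m≤m+n _ (G * G * G + 2 * G + 1) ⟩
    G * suc (3 * G) + (G * G * G + 2 * G + 1) ≡⟨ c1 G ⟩
    suc G * (suc G * suc G) ≤⟨ *-mono-≤ (n<2^n G) (*-mono-≤ (n<2^n G) (n<2^n G)) ⟩
    2 ^ G * (2 ^ G * 2 ^ G) ≡⟨ trans≡ (cong (2 ^ G *_) (sym (^-distribˡ-+-* 2 G G))) (trans≡ (sym (^-distribˡ-+-* 2 G (G + G))) (cong (2 ^_) (c2 G))) ⟩
    2 ^ (3 * G) ∎
    where
    c1 : ∀ g → g * (1 + 3 * g) + (g * g * g + 2 * g + 1) ≡ (1 + g) * ((1 + g) * (1 + g))
    c1 = solve-∀
    c2 : ∀ g → g + (g + g) ≡ 3 * g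
    c2 = solve-∀
  go : ∀ y → G * suc (3 * G + y) ≤ 2 ^ (3 * G + y)
  go zero = subst (λ z → G * suc z ≤ 2 ^ z) (sym (+-identityʳ (3 * G))) base
  go (suc y) = subst (λ z → G * suc z ≤ 2 ^ z) (sym (+-suc (3 * G) y)) (begin
    G * suc (suc (3 * G + y)) ≤⟨ *-monoʳ-≤ G (s≤s (s≤s (m≤m+n (3 * G + y) _))) ⟩
    G * (suc (suc (3 * G + y + (3 * G + y)))) ≡⟨ c3 G (3 * G + y) ⟩
    2 * (G * suc (3 * G + y)) ≤⟨ *-monoʳ-≤ 2 (go y) ⟩
    2 ^ suc (3 * G + y) ∎)
    where
    c3 : ∀ g z → g * (2 + (z + z)) ≡ 2 * (g * (1 + z))
    c3 = solve-∀

-- O(log n) rounds of shrinking by the factor Q / (Q + 1) exhaust n^D elements; the rounds fit into n / γ.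
rounds : ∀ Q D γ → 1 ≤ Q → 1 ≤ γ → Σ ℕ λ n₀ → ∀ n → n₀ ≤ n → Σ ℕ λ T → T * γ ≤ n × n ^ D * Q ^ T < suc Q ^ T
rounds Q@(suc _) D γ@(suc _) _ _ = G * suc (3 * G) , λ n le → rounds′ n le
  where
  G : ℕ
  G = γ * (Q * suc D)
  instance
    nzG : NonZero G
    nzG = _
  rounds′ : ∀ n → G * suc (3 * G) ≤ n → Σ ℕ λ T → T * γ ≤ n × n ^ D * Q ^ T < suc Q ^ T
  rounds′ n le = Q * s , fits , exhausted
    where
    x : ℕ
    x = n / G
    s : ℕ
    s = suc (D * x)
    x-large : suc (3 * G) ≤ x
    x-large = ≤-trans (≤-reflexive (sym (trans≡ (cong (_/ G) (*-comm G (suc (3 * G)))) (m*n/n≡m (suc (3 * G)) G)))) (/-monoˡ-≤ G le)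
    Gx≤n : G * x ≤ n
    Gx≤n = ≤-trans (≤-reflexive (*-comm G x)) (m/n*n≤m n G)
    n≤2^x : n ≤ 2 ^ x
    n≤2^x = ≤-trans (<⇒≤ (begin-strict
      n ≡⟨ m≡m%n+[m/n]*n n G ⟩
      n % G + x * G <⟨ +-monoˡ-< (x * G) (m%n<n n G) ⟩
      G + x * G ≡⟨ *-comm (suc x) G ⟩
      G * suc x ∎)) (linear≤2^ G x (≤-trans (n≤1+n _) x-large))
    fits : Q * s * γ ≤ n
    fits = begin
      Q * s * γ ≤⟨ *-monoˡ-≤ γ (*-monoʳ-≤ Q (+-monoˡ-≤ (D * x) (≤-trans (s≤s z≤n) x-large))) ⟩
      Q * (x + D * x) * γ ≡⟨ f1 Q D x γ ⟩
      G * x ≤⟨ Gx≤n ⟩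
      n ∎
      where
      f1 : ∀ q d x g → q * (x + d * x) * g ≡ g * (q * (1 + d)) * x
      f1 = solve-∀
    exhausted : n ^ D * Q ^ (Q * s) < suc Q ^ (Q * s)
    exhausted = ≤-trans (*-monoˡ-< (Q ^ (Q * s)) {{m^n≢0 Q (Q * s)}} (begin-strict
      n ^ D ≤⟨ ^-monoˡ-≤ D n≤2^x ⟩
      (2 ^ x) ^ D ≡⟨ trans≡ (^-*-assoc 2 x D) (cong (2 ^_) (*-comm x D)) ⟩
      2 ^ (D * x) <⟨ m<m+n (2 ^ (D * x)) {2 ^ (D * x) + 0} (≤-trans (m^n>0 2 (D * x)) (m≤m+n _ 0)) ⟩
      2 ^ s ∎)) (doubling Q s)

∧-⟦⟧ : ∀ a b → ⟦ a ∧ b ⟧ ≡ ⟦ a ⟧ * ⟦ b ⟧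
∧-⟦⟧ true b = sym (+-identityʳ _)
∧-⟦⟧ false b = refl≡

same : Bool → Bool → Bool
same a b = not (a xor b)

same⇒≡ : ∀ a b → same a b ≡ true → a ≡ b
same⇒≡ true true _ = refl≡
same⇒≡ false false _ = refl≡

length-concatMap-≤ : {X Y : Set} (f : X → List Y) (s : ℕ) (xs : List X) → (∀ {x} → x ∈ˡ xs → length (f x) ≤ s) → length (concatMap f xs) ≤ length xs * s
length-concatMap-≤ f s [] le = z≤n
length-concatMap-≤ f s (x ∷ xs) le = ≤-trans (≤-reflexive (length-++ (f x))) (+-mono-≤ (le (here refl≡)) (length-concatMap-≤ f s xs (le ∘ there)))

concatMap-concat : {X Y : Set} (f : X → List Y) (xss : List (List X)) → concatMap f (concat xss) ≡ concatMap (concatMap f) xss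
concatMap-concat f [] = refl≡
concatMap-concat f (xs ∷ xss) = trans≡ (concatMap-++ f xs (concat xss)) (cong (concatMap f xs ++_) (concatMap-concat f xss))

module _ {X : Set} (_≟_ : DecidableEquality X) where
  open Fresh _≟_

  private
    tuple-len : {E : Set} (es : List E) (vs : E → List X) (s t : ℕ) → (∀ {e} → e ∈ˡ es → length (vs e) ≤ s) → ∀ {θ} → θ ∈ˡ tuples es t → length (concatMap vs θ) ≤ t * s
    tuple-len es vs s t len {θ} m = ≤-trans (length-concatMap-≤ vs s θ (λ m' → len (All.lookup (proj₂ (∈-tuples⁻ es t m)) m')))
      (≤-reflexive (cong (_* s) (proj₁ (∈-tuples⁻ es t m))))

    level : {E : Set} (es : List E) (vs : E → List X) (s p q Z t : ℕ) → (∀ {e} → e ∈ˡ es → length (vs e) ≤ s) →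
      (∀ F → length F ≤ Z + t * s → ∑ es (λ e → stale F (vs e)) * q ≤ p * length es) →
      ∀ F → length F ≤ Z → ∑ (tuples es t) (λ θ → stale F (concatMap vs θ)) * q ≤ t * p * length (tuples es t)
    level es vs s p q Z t len bound F le = ≤-trans (stale-tuples es vs s p q (Z + t * s) len bound t F (+-monoˡ-≤ (t * s) le))
      (≤-reflexive (trans≡ (cong (λ z → t * (p * z)) (sym (length-tuples es t))) (sym (*-assoc t p _))))

  nested-stale : {E : Set} (es : List E) (vs : E → List X) (s p q Z a b c : ℕ) → (∀ {e} → e ∈ˡ es → length (vs e) ≤ s) →
    (∀ F → length F ≤ Z + c * (b * (a * s)) + b * (a * s) + a * s → ∑ es (λ e → stale F (vs e)) * q ≤ p * length es) →
    ∀ F → length F ≤ Z → ∑ (tuples (tuples (tuples es a) b) c) (λ y → stale F (concatMap (concatMap (concatMap vs)) y)) * q ≤ c * (b * (a * p)) * length (tuples (tuples (tuples es a) b) c)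
  nested-stale es vs s p q Z a b c len bound =
    level (tuples (tuples es a) b) (concatMap (concatMap vs)) (b * (a * s)) (b * (a * p)) q Z c (tuple-len (tuples es a) (concatMap vs) (a * s) b (tuple-len es vs s a len))
      (level (tuples es a) (concatMap vs) (a * s) (a * p) q (Z + c * (b * (a * s))) b (tuple-len es vs s a len)
        (level es vs s p q (Z + c * (b * (a * s)) + b * (a * s)) a len bound))

-- A gadget is a list of coloured blocks (c , z ∷ w), each an edge; a chain of blocks starting at x is usable when every w
-- also forms an edge of the same colour with the last z before it (with x, for the first block), so that every z can be
-- replaced by its predecessor.  This frees the last z and covers x.
module Gadgets {A C : Set} (k' : ℕ) (h : C → List A → Bool) (τ : A → Bool) (Vs : List A) (Cs : List C) where

  private
    k n : ℕ
    k = suc k'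
    n = length Vs
  Blk : Set
  Blk = C × List A
  𝔹 : List Blk
  𝔹 = pairs Cs (tuples Vs k)
  length-𝔹 : length 𝔹 ≡ length Cs * n ^ k
  length-𝔹 = trans≡ (length-pairs Cs _) (cong (length Cs *_) (length-tuples Vs k))

  run : A → List Blk → Bool
  run x [] = true
  run x ((c , []) ∷ θ) = false
  run x ((c , z ∷ w) ∷ θ) = (h c (z ∷ w) ∧ h c (x ∷ w)) ∧ run z θ

  end : A → List Blk → A
  end x [] = x
  end x ((c , []) ∷ θ) = x
  end x ((c , z ∷ w) ∷ θ) = end z θ

  after : A → List Blk → List Blk
  after x [] = []
  after x ((c , []) ∷ θ) = []
  after x ((c , z ∷ w) ∷ θ) = (c , x ∷ w) ∷ after z θ

  reach : ℕ → A → (A → ℕ) → ℕ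
  reach j x φ = ∑ (tuples 𝔹 j) (λ θ → ⟦ run x θ ⟧ * φ (end x θ))

  common : A → A → ℕ
  common x z = ∑ Cs (λ c → ∑ (tuples Vs k') (λ w → ⟦ h c (z ∷ w) ∧ h c (x ∷ w) ⟧))

  reach-zero : ∀ x φ → reach 0 x φ ≡ φ x
  reach-zero x φ = trans≡ (+-identityʳ _) (+-identityʳ _)

  reach-suc : ∀ j x φ → reach (suc j) x φ ≡ ∑ Vs (λ z → common x z * reach j z φ)
  reach-suc j x φ = begin-equality
    reach (suc j) x φ
      ≡⟨ trans≡ (∑-tuples-suc 𝔹 j _) (trans≡ (∑-pairs Cs _ _) (∑-cong Cs (λ c → ∑-tuples-suc Vs k' _))) ⟩
    ∑ Cs (λ c → ∑ Vs λ z → ∑ W λ w → ∑ (tuples 𝔹 j) λ θ → ⟦ (h c (z ∷ w) ∧ h c (x ∷ w)) ∧ run z θ ⟧ * φ (end z θ))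
      ≡⟨ ∑-cong Cs (λ c → ∑-cong Vs λ z → trans≡ (∑-cong W λ w → trans≡ (∑-cong (tuples 𝔹 j) λ θ →
           trans≡ (cong (_* φ (end z θ)) (∧-⟦⟧ (h c (z ∷ w) ∧ h c (x ∷ w)) (run z θ))) (*-assoc ⟦ h c (z ∷ w) ∧ h c (x ∷ w) ⟧ _ _)) (∑-scale (tuples 𝔹 j) ⟦ h c (z ∷ w) ∧ h c (x ∷ w) ⟧ (λ θ → ⟦ run z θ ⟧ * φ (end z θ)))) (∑-scaleʳ W (λ w → ⟦ h c (z ∷ w) ∧ h c (x ∷ w) ⟧) (reach j z φ))) ⟩
    ∑ Cs (λ c → ∑ Vs λ z → ∑ W (λ w → ⟦ h c (z ∷ w) ∧ h c (x ∷ w) ⟧) * reach j z φ)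
      ≡⟨ trans≡ (∑-swap Cs Vs _) (∑-cong Vs (λ z → ∑-scaleʳ Cs (λ c → ∑ W (λ w → ⟦ h c (z ∷ w) ∧ h c (x ∷ w) ⟧)) (reach j z φ))) ⟩
    ∑ Vs (λ z → common x z * reach j z φ) ∎
    where W = tuples Vs k'

  -- From every vertex, chains of length j end in the vertices of the same type with positive density.
  Close : ℕ → ℕ → Set
  Close j K = ∀ x (φ : A → ℕ) → length 𝔹 ^ j * ∑ Vs (λ y → ⟦ same (τ x) (τ y) ⟧ * φ y) ≤ K * n * reach j x φ

  match : List A → List A → Bool
  match [] _ = true
  match (s ∷ S) [] = false
  match (s ∷ S) (t ∷ ts) = same (τ s) (τ t) ∧ match S ts

  runs : List A → List (List Blk) → Bool
  runs [] _ = true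
  runs (s ∷ S) [] = false
  runs (s ∷ S) (θ ∷ Θ) = run s θ ∧ runs S Θ

  ends : List A → List (List Blk) → List A
  ends [] _ = []
  ends (s ∷ S) [] = []
  ends (s ∷ S) (θ ∷ Θ) = end s θ ∷ ends S Θ

  afters : List A → List (List Blk) → List Blk
  afters [] _ = []
  afters (s ∷ S) [] = []
  afters (s ∷ S) (θ ∷ Θ) = after s θ ++ afters S Θ

  Piece : Set
  Piece = C × List A

  absorb : Piece → List (List Blk) → Bool
  absorb (c , S) Θ = runs S Θ ∧ h c (ends S Θ)

  absorbs : List Piece → List (List (List Blk)) → Bool
  absorbs [] _ = true
  absorbs (p ∷ ps) [] = false
  absorbs (p ∷ ps) (Θ ∷ G) = absorb p Θ ∧ absorbs ps G

  Robust : ℕ → Piece → Set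
  Robust K (c , S) = n ^ k ≤ K * ∑ (tuples Vs k) (λ t → ⟦ match S t ⟧ * ⟦ h c t ⟧)

  module Counting (j K : ℕ) (close : Close j K) where

    runs-many : ∀ S (ψ : List A → ℕ) →
      (length 𝔹 ^ j) ^ length S * ∑ (tuples Vs (length S)) (λ t → ⟦ match S t ⟧ * ψ t) ≤
      (K * n) ^ length S * ∑ (tuples (tuples 𝔹 j) (length S)) (λ Θ → ⟦ runs S Θ ⟧ * ψ (ends S Θ))
    runs-many [] ψ = ≤-refl
    runs-many (s ∷ S) ψ = begin
      B * B ^ s′ * ∑ (tuples Vs (suc s′)) (λ t → ⟦ match (s ∷ S) t ⟧ * ψ t)
        ≡⟨ cong (B * B ^ s′ *_) (trans≡ (∑-tuples-suc Vs s′ _) (∑-cong Vs (λ y → trans≡ (∑-cong (tuples Vs s′) (λ t →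
             trans≡ (cong (_* ψ (y ∷ t)) (∧-⟦⟧ (same (τ s) (τ y)) (match S t))) (*-assoc ⟦ same (τ s) (τ y) ⟧ _ _))) (∑-scale (tuples Vs s′) ⟦ same (τ s) (τ y) ⟧ (λ t → ⟦ match S t ⟧ * ψ (y ∷ t)))))) ⟩
      B * B ^ s′ * ∑ Vs (λ y → ⟦ same (τ s) (τ y) ⟧ * M y)
        ≡⟨ trans≡ (*-assoc B (B ^ s′) _) (cong (B *_) (trans≡ (sym (∑-scale Vs (B ^ s′) _)) (∑-cong Vs (λ y → comm3 (B ^ s′) ⟦ same (τ s) (τ y) ⟧ (M y))))) ⟩
      B * ∑ Vs (λ y → ⟦ same (τ s) (τ y) ⟧ * (B ^ s′ * M y))
        ≤⟨ *-monoʳ-≤ B (∑-mono Vs (λ y → *-monoʳ-≤ ⟦ same (τ s) (τ y) ⟧ (runs-many S (λ es → ψ (y ∷ es))))) ⟩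
      B * ∑ Vs (λ y → ⟦ same (τ s) (τ y) ⟧ * ((K * n) ^ s′ * P y))
        ≤⟨ close s (λ y → (K * n) ^ s′ * P y) ⟩
      K * n * reach j s (λ y → (K * n) ^ s′ * P y)
        ≡⟨ cong (K * n *_) (trans≡ (∑-cong (tuples 𝔹 j) (λ θ → comm3 ⟦ run s θ ⟧ ((K * n) ^ s′) (P (end s θ)))) (∑-scale (tuples 𝔹 j) ((K * n) ^ s′) _)) ⟩
      K * n * ((K * n) ^ s′ * reach j s P)
        ≡⟨ sym (*-assoc (K * n) ((K * n) ^ s′) _) ⟩
      (K * n) ^ suc s′ * reach j s P
        ≡⟨ cong ((K * n) ^ suc s′ *_) (sym (trans≡ (∑-tuples-suc (tuples 𝔹 j) s′ _) (∑-cong (tuples 𝔹 j) (λ θ → trans≡ (∑-cong (tuples (tuples 𝔹 j) s′) (λ Θ →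
             trans≡ (cong (_* ψ (end s θ ∷ ends S Θ)) (∧-⟦⟧ (run s θ) (runs S Θ))) (*-assoc ⟦ run s θ ⟧ _ _))) (∑-scale (tuples (tuples 𝔹 j) s′) ⟦ run s θ ⟧ (λ Θ → ⟦ runs S Θ ⟧ * ψ (end s θ ∷ ends S Θ))))))) ⟩
      (K * n) ^ suc s′ * ∑ (tuples (tuples 𝔹 j) (suc s′)) (λ Θ → ⟦ runs (s ∷ S) Θ ⟧ * ψ (ends (s ∷ S) Θ)) ∎
      where
      B = length 𝔹 ^ j
      s′ = length S
      M P : A → ℕ
      M y = ∑ (tuples Vs s′) (λ t → ⟦ match S t ⟧ * ψ (y ∷ t))
      P y = ∑ (tuples (tuples 𝔹 j) s′) (λ Θ → ⟦ runs S Θ ⟧ * ψ (y ∷ ends S Θ))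
      comm3 : ∀ a b c → a * (b * c) ≡ b * (a * c)
      comm3 = solve-∀

    module _ (K₂ : ℕ) (n>0 : 0 < n) where

      absorb-many : ∀ p → length (proj₂ p) ≡ k → Robust K₂ p → length (tuples (tuples 𝔹 j) k) ≤ K₂ * K ^ k * ∑ (tuples (tuples 𝔹 j) k) (λ Θ → ⟦ absorb p Θ ⟧)
      absorb-many (c , S) len rob = *-cancelʳ-≤ _ _ (n ^ k) {{m^n≢0 n k {{>-nonZero n>0}}}} (begin
        length (tuples (tuples 𝔹 j) k) * n ^ k
          ≡⟨ cong (_* n ^ k) (trans≡ (length-tuples (tuples 𝔹 j) k) (cong (_^ k) (length-tuples 𝔹 j))) ⟩
        (length 𝔹 ^ j) ^ k * n ^ k
          ≤⟨ *-monoʳ-≤ ((length 𝔹 ^ j) ^ k) rob ⟩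
        (length 𝔹 ^ j) ^ k * (K₂ * ∑ (tuples Vs k) (λ t → ⟦ match S t ⟧ * ⟦ h c t ⟧))
          ≡⟨ comm3 ((length 𝔹 ^ j) ^ k) K₂ _ ⟩
        K₂ * ((length 𝔹 ^ j) ^ k * ∑ (tuples Vs k) (λ t → ⟦ match S t ⟧ * ⟦ h c t ⟧))
          ≤⟨ *-monoʳ-≤ K₂ (subst (λ z → (length 𝔹 ^ j) ^ z * ∑ (tuples Vs z) (λ t → ⟦ match S t ⟧ * ⟦ h c t ⟧) ≤ (K * n) ^ z * ∑ (tuples (tuples 𝔹 j) z) (λ Θ → ⟦ runs S Θ ⟧ * ⟦ h c (ends S Θ) ⟧)) len (runs-many S (λ t → ⟦ h c t ⟧))) ⟩
        K₂ * ((K * n) ^ k * ∑ (tuples (tuples 𝔹 j) k) (λ Θ → ⟦ runs S Θ ⟧ * ⟦ h c (ends S Θ) ⟧))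
          ≡⟨ cong₂ (λ a b → K₂ * (a * b)) (^-distrib-* K n k) (∑-cong (tuples (tuples 𝔹 j) k) (λ Θ → sym (∧-⟦⟧ (runs S Θ) (h c (ends S Θ))))) ⟩
        K₂ * (K ^ k * n ^ k * ∑ (tuples (tuples 𝔹 j) k) (λ Θ → ⟦ absorb (c , S) Θ ⟧))
          ≡⟨ rearr K₂ (K ^ k) (n ^ k) _ ⟩
        K₂ * K ^ k * ∑ (tuples (tuples 𝔹 j) k) (λ Θ → ⟦ absorb (c , S) Θ ⟧) * n ^ k ∎)
        where
        comm3 : ∀ a b c → a * (b * c) ≡ b * (a * c)
        comm3 = solve-∀
        rearr : ∀ a b c d → a * (b * c * d) ≡ a * b * d * c
        rearr = solve-∀

      absorbs-many : ∀ ps → (∀ {p} → p ∈ˡ ps → length (proj₂ p) ≡ k × Robust K₂ p) →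
        length (tuples (tuples (tuples 𝔹 j) k) (length ps)) ≤ (K₂ * K ^ k) ^ length ps * ∑ (tuples (tuples (tuples 𝔹 j) k) (length ps)) (λ G → ⟦ absorbs ps G ⟧)
      absorbs-many [] _ = ≤-refl
      absorbs-many (p ∷ ps) rob = begin
        length (tuples Y (suc (length ps)))
          ≡⟨ trans≡ (length-tuples Y (suc (length ps))) (cong (length Y *_) (sym (length-tuples Y (length ps)))) ⟩
        length Y * length (tuples Y (length ps))
          ≤⟨ *-mono-≤ (absorb-many p (proj₁ (rob (here refl≡))) (proj₂ (rob (here refl≡)))) (absorbs-many ps (rob ∘ there)) ⟩
        L * ∑ Y (λ Θ → ⟦ absorb p Θ ⟧) * (L ^ length ps * ∑ (tuples Y (length ps)) (λ G → ⟦ absorbs ps G ⟧))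
          ≡⟨ medial L (∑ Y (λ Θ → ⟦ absorb p Θ ⟧)) (L ^ length ps) _ ⟩
        L ^ suc (length ps) * (∑ Y (λ Θ → ⟦ absorb p Θ ⟧) * ∑ (tuples Y (length ps)) (λ G → ⟦ absorbs ps G ⟧))
          ≡⟨ cong (L ^ suc (length ps) *_) (sym (trans≡ (∑-tuples-suc Y (length ps) _) (trans≡ (∑-cong Y (λ Θ → ∑-cong (tuples Y (length ps)) (λ G → ∧-⟦⟧ (absorb p Θ) (absorbs ps G)))) (∑-prod Y (tuples Y (length ps)) (λ Θ → ⟦ absorb p Θ ⟧) (λ G → ⟦ absorbs ps G ⟧))))) ⟩
        L ^ suc (length ps) * ∑ (tuples Y (suc (length ps))) (λ G → ⟦ absorbs (p ∷ ps) G ⟧) ∎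
        where
        Y = tuples (tuples 𝔹 j) k
        L = K₂ * K ^ k
        medial : ∀ a b c d → a * b * (c * d) ≡ a * c * (b * d)
        medial = solve-∀

  vts : List Blk → List A
  vts = concatMap proj₂

  cls : List Blk → List C
  cls = map proj₁

  Sound : List Blk → Set
  Sound θ = ∀ {b} → b ∈ˡ θ → h (proj₁ b) (proj₂ b) ≡ true × length (proj₂ b) ≡ k

  Sound-++ : ∀ {θ θ'} → Sound θ → Sound θ' → Sound (θ ++ θ')
  Sound-++ {θ} s s' m with ∈-++⁻ θ m
  ... | inj₁ i = s i
  ... | inj₂ i = s' i

  -- Coloured lists before and after the exchange, both sound, differing by the vertices xs and ys and by the colours cs.
  record Exchange (θ θ' : List Blk) (xs ys : List A) (cs : List C) : Set where
    field
      verts : vts θ' ++ ys ↭ xs ++ vts θ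
      colours : cls θ' ↭ cs ++ cls θ
      before : Sound θ
      afterwards : Sound θ'

  Exchange-++ : ∀ {θ₁ θ₁' θ₂ θ₂' xs₁ xs₂ ys₁ ys₂ cs₁ cs₂} → Exchange θ₁ θ₁' xs₁ ys₁ cs₁ → Exchange θ₂ θ₂' xs₂ ys₂ cs₂ →
    Exchange (θ₁ ++ θ₂) (θ₁' ++ θ₂') (xs₁ ++ xs₂) (ys₁ ++ ys₂) (cs₁ ++ cs₂)
  Exchange-++ {θ₁} {θ₁'} {θ₂} {θ₂'} {xs₁} {xs₂} {ys₁} {ys₂} {cs₁} {cs₂} e f = record
    { verts = ↭-trans (++⁺ʳ (ys₁ ++ ys₂) (↭-reflexive (concatMap-++ proj₂ θ₁' θ₂'))) (↭-trans (interchange (vts θ₁') (vts θ₂') ys₁ ys₂)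
        (↭-trans (++⁺ (Exchange.verts e) (Exchange.verts f)) (↭-trans (interchange xs₁ (vts θ₁) xs₂ (vts θ₂)) (++⁺ˡ (xs₁ ++ xs₂) (↭-reflexive (sym (concatMap-++ proj₂ θ₁ θ₂)))))))
    ; colours = ↭-trans (↭-reflexive (map-++ proj₁ θ₁' θ₂')) (↭-trans (++⁺ (Exchange.colours e) (Exchange.colours f))
        (↭-trans (interchange cs₁ (cls θ₁) cs₂ (cls θ₂)) (++⁺ˡ (cs₁ ++ cs₂) (↭-reflexive (sym (map-++ proj₁ θ₁ θ₂))))))
    ; before = Sound-++ (Exchange.before e) (Exchange.before f)
    ; afterwards = Sound-++ (Exchange.afterwards e) (Exchange.afterwards f) }

  run-exchange : ∀ x θ → All (λ b → length (proj₂ b) ≡ k) θ → run x θ ≡ true → Exchange θ (after x θ) (x ∷ []) (end x θ ∷ []) []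
  run-exchange x [] _ _ = record { verts = refl ; colours = refl ; before = λ () ; afterwards = λ () }
  run-exchange x ((c , z ∷ w) ∷ θ) (l ∷ ls) e with ∧-true {h c (z ∷ w) ∧ h c (x ∷ w)} e
  ... | e₁ , e₂ with ∧-true {h c (z ∷ w)} e₁ | run-exchange z θ ls e₂
  ... | hz , hx | ex = record
    { verts = ↭-trans (↭-reflexive (cong (x ∷_) (++-assoc w _ _))) (prep x (↭-trans (++⁺ˡ w (Exchange.verts ex)) (shift z w (vts θ))))
    ; colours = prep c (Exchange.colours ex)
    ; before = λ { (here refl≡) → hz , l ; (there m) → Exchange.before ex m }
    ; afterwards = λ { (here refl≡) → hx , l ; (there m) → Exchange.afterwards ex m } }

  runs-exchange : ∀ S Θ → length Θ ≡ length S → All (All (λ b → length (proj₂ b) ≡ k)) Θ → runs S Θ ≡ true → Exchange (concat Θ) (afters S Θ) S (ends S Θ) []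
  runs-exchange [] [] _ _ _ = record { verts = refl ; colours = refl ; before = λ () ; afterwards = λ () }
  runs-exchange (s ∷ S) (θ ∷ Θ) l (a ∷ al) e with ∧-true {run s θ} e
  ... | e₁ , e₂ = Exchange-++ (run-exchange s θ a e₁) (runs-exchange S Θ (suc-injective l) al e₂)

  private
    ends-length : ∀ S Θ → length Θ ≡ length S → length (ends S Θ) ≡ length S
    ends-length [] Θ _ = refl≡
    ends-length (s ∷ S) (θ ∷ Θ) l = cong suc (ends-length S Θ (suc-injective l))

  absorbed : ∀ ps G → length G ≡ length ps → All (λ p → length (proj₂ p) ≡ k) ps → All (λ Θ → length Θ ≡ k × All (All (λ b → length (proj₂ b) ≡ k)) Θ) G →
    absorbs ps G ≡ true → Σ (List Blk) λ θ' → Exchange (concatMap concat G) θ' (vts ps) [] (cls ps)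
  absorbed [] [] _ _ _ _ = [] , record { verts = refl ; colours = refl ; before = λ () ; afterwards = λ () }
  absorbed ((c , S) ∷ ps) (Θ ∷ G) l (lS ∷ lps) ((lΘ , al) ∷ als) e with ∧-true {absorb (c , S) Θ} e
  ... | e₁ , e₂ with ∧-true {runs S Θ} e₁ | absorbed ps G (suc-injective l) lps als e₂
  ... | er , eh | θ' , ex = ((c , ends S Θ) ∷ afters S Θ) ++ θ' , Exchange-++ one ex
    where
    r : Exchange (concat Θ) (afters S Θ) S (ends S Θ) []
    r = runs-exchange S Θ (trans≡ lΘ (sym lS)) al er
    one : Exchange (concat Θ) ((c , ends S Θ) ∷ afters S Θ) S [] (c ∷ [])
    one = record
      { verts = ↭-trans (↭-reflexive (++-identityʳ _)) (↭-trans (++-comm (ends S Θ) (vts (afters S Θ))) (Exchange.verts r))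
      ; colours = prep c (Exchange.colours r)
      ; before = Exchange.before r
      ; afterwards = λ { (here refl≡) → eh , trans≡ (ends-length S Θ (trans≡ lΘ (sym lS))) lS ; (there m) → Exchange.afterwards r m } }

∨-false : ∀ {a b} → a ∨ b ≡ false → a ≡ false × b ≡ false
∨-false {false} {false} _ = refl≡ , refl≡

not-false : ∀ {a} → not a ≡ false → a ≡ true
not-false {true} _ = refl≡

∨-≤ : ∀ a b → ⟦ a ∨ b ⟧ ≤ ⟦ a ⟧ + ⟦ b ⟧
∨-≤ true b = s≤s z≤n
∨-≤ false b = ≤-refl

-- The numbers of vertices and colours of a gadget, and the total numbers that must be available when Z are forbidden.
gadgetV gadgetC : ℕ → ℕ → ℕ → ℕ
gadgetV k j K₀ = K₀ * (k * (j * k))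
gadgetC k j K₀ = K₀ * (k * (j * 1))

spaceV spaceC : ℕ → ℕ → ℕ → ℕ → ℕ → ℕ
spaceV k j K₀ Q Z = 2 * suc Q * (K₀ * (k * (j * (k * (Z + (gadgetV k j K₀ + k * (j * k) + j * k + k))))))
spaceC k j K₀ Q Z = 2 * suc Q * (K₀ * (k * (j * (Z + (gadgetC k j K₀ + k * (j * 1) + j * 1)))))

spaceV-mono : ∀ k j K₀ Q {Z Z'} → Z ≤ Z' → spaceV k j K₀ Q Z ≤ spaceV k j K₀ Q Z'
spaceV-mono k j K₀ Q le = *-monoʳ-≤ (2 * suc Q) (*-monoʳ-≤ K₀ (*-monoʳ-≤ k (*-monoʳ-≤ j (*-monoʳ-≤ k (+-monoˡ-≤ _ le)))))

spaceC-mono : ∀ k j K₀ Q {Z Z'} → Z ≤ Z' → spaceC k j K₀ Q Z ≤ spaceC k j K₀ Q Z'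
spaceC-mono k j K₀ Q le = *-monoʳ-≤ (2 * suc Q) (*-monoʳ-≤ K₀ (*-monoʳ-≤ k (*-monoʳ-≤ j (+-monoˡ-≤ _ le))))

module Absorbers {A C : Set} (_≟A_ : DecidableEquality A) (_≟C_ : DecidableEquality C) (k' : ℕ) (h : C → List A → Bool) (τ : A → Bool)
  (Vs : List A) (Cs : List C) (Vs-unique : Unique Vs) (Cs-unique : Unique Cs) where

  open Gadgets k' h τ Vs Cs
  module FA = Fresh _≟A_
  module FC = Fresh _≟C_

  private
    k n m : ℕ
    k = suc k'
    n = length Vs
    m = length Cs

    stale-blocks : ∀ Z F → length F + k ≤ Z → ∑ 𝔹 (λ b → FA.stale F (proj₂ b)) * n ≤ k * Z * length 𝔹
    stale-blocks Z F le = begin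
      ∑ 𝔹 (λ b → FA.stale F (proj₂ b)) * n
        ≡⟨ cong (_* n) (trans≡ (∑-pairs Cs _ _) (∑-const Cs _)) ⟩
      m * ∑ (tuples Vs k) (FA.stale F) * n
        ≡⟨ *-assoc m _ n ⟩
      m * (∑ (tuples Vs k) (FA.stale F) * n)
        ≤⟨ *-monoʳ-≤ m (FA.stale-vertex-tuples Vs Vs-unique k F Z le) ⟩
      m * (k * (Z * n ^ k))
        ≡⟨ a1 m k Z (n ^ k) ⟩
      k * Z * (m * n ^ k)
        ≡⟨ cong (k * Z *_) (sym length-𝔹) ⟩
      k * Z * length 𝔹 ∎
      where
      a1 : ∀ m k z p → m * (k * (z * p)) ≡ k * z * (m * p)
      a1 = solve-∀

    stale-colours : ∀ Z F → length F ≤ Z → ∑ 𝔹 (λ b → FC.stale F (proj₁ b ∷ [])) * m ≤ Z * length 𝔹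
    stale-colours Z F le = begin
      ∑ 𝔹 (λ b → FC.stale F (proj₁ b ∷ [])) * m
        ≡⟨ cong (_* m) (trans≡ (∑-pairs Cs _ _) (∑-cong Cs (λ c → trans≡ (∑-const (tuples Vs k) _) (cong (_* FC.stale F (c ∷ [])) (length-tuples Vs k))))) ⟩
      ∑ Cs (λ c → n ^ k * FC.stale F (c ∷ [])) * m
        ≡⟨ cong (_* m) (∑-scale Cs (n ^ k) _) ⟩
      n ^ k * ∑ Cs (λ c → FC.stale F (c ∷ [])) * m
        ≤⟨ *-monoˡ-≤ m (*-monoʳ-≤ (n ^ k) (≤-trans (∑-mono Cs (λ c → single (FC.mem c F))) (≤-trans (FC.∑-mem Cs F Cs-unique) le))) ⟩
      n ^ k * Z * m
        ≡⟨ a1 (n ^ k) Z m ⟩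
      Z * (m * n ^ k)
        ≡⟨ cong (Z *_) (sym length-𝔹) ⟩
      Z * length 𝔹 ∎
      where
      single : ∀ b → ⟦ not (not b ∧ true) ⟧ ≤ ⟦ b ⟧
      single true = ≤-refl
      single false = z≤n
      a1 : ∀ p z m → p * z * m ≡ z * (m * p)
      a1 = solve-∀

  Gadget : Set
  Gadget = List (List (List Blk))

  gverts : Gadget → List A
  gverts = concatMap (concatMap (concatMap proj₂))

  gcols : Gadget → List C
  gcols = concatMap (concatMap (concatMap (λ b → proj₁ b ∷ [])))

  private
    flat : Gadget → List Blk
    flat = concatMap concat

    gverts≡ : ∀ G → vts (flat G) ≡ gverts G
    gverts≡ [] = refl≡
    gverts≡ (Θ ∷ G) = trans≡ (concatMap-++ proj₂ (concat Θ) (flat G)) (cong₂ _++_ (concatMap-concat proj₂ Θ) (gverts≡ G))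

    map≡concatMap : ∀ θ → cls θ ≡ concatMap (λ b → proj₁ b ∷ []) θ
    map≡concatMap [] = refl≡
    map≡concatMap (b ∷ θ) = cong (proj₁ b ∷_) (map≡concatMap θ)

    gcols≡ : ∀ G → cls (flat G) ≡ gcols G
    gcols≡ G = trans≡ (map≡concatMap (flat G)) (go G)
      where
      go : ∀ G → concatMap (λ b → proj₁ b ∷ []) (flat G) ≡ gcols G
      go [] = refl≡
      go (Θ ∷ G) = trans≡ (concatMap-++ _ (concat Θ) (flat G)) (cong₂ _++_ (concatMap-concat _ Θ) (go G))

  module _ (j K K₀ K₂ : ℕ) (close : Close j K) (n>0 : 0 < n) (m>0 : 0 < m) (compat : Piece → Bool)
    (robust : ∀ p → p ∈ˡ 𝔹 → compat p ≡ true → Robust K₂ p) (Q : ℕ) (Q≡ : suc Q ≡ 2 * (K₂ * K ^ k) ^ K₀)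
    (FV : List A) (FC₀ : List C) (T : ℕ) where

    private
      Y : List Gadget
      Y = tuples (tuples (tuples 𝔹 j) k) K₀
      sV sC wV wC : ℕ
      sV = gadgetV k j K₀
      sC = gadgetC k j K₀
      wV = sV + k * (j * k) + j * k + k
      wC = sC + k * (j * 1) + j * 1
      ZV ZC : ℕ
      ZV = length FV + T * sV
      ZC = length FC₀ + T * sC
      badV badC bad : List Gadget → Gadget → Bool
      badV P G = not (FA.fresh (concatMap gverts P ++ FV) (gverts G))
      badC P G = not (FC.fresh (concatMap gcols P ++ FC₀) (gcols G))
      bad P G = badV P G ∨ badC P G
      pieces : List Piece
      pieces = proj₁ (select compat 𝔹)

    module _ (roomV : spaceV k j K₀ Q (length FV + T * gadgetV k j K₀) ≤ n) (roomC : spaceC k j K₀ Q (length FC₀ + T * gadgetC k j K₀) ≤ m)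
      (enough : length 𝔹 ^ K₀ * Q ^ T < suc Q ^ T) where

      private
        instance
          nzn : NonZero n
          nzn = >-nonZero n>0
          nzm : NonZero m
          nzm = >-nonZero m>0
        pieces↭ : 𝔹 ↭ pieces ++ proj₁ (proj₂ (select compat 𝔹))
        pieces↭ = proj₁ (proj₂ (proj₂ (select compat 𝔹)))
        pieces-compat : All (λ p → compat p ≡ true) pieces
        pieces-compat = proj₁ (proj₂ (proj₂ (proj₂ (select compat 𝔹))))
        pieces∈ : ∀ {p} → p ∈ˡ pieces → p ∈ˡ 𝔹
        pieces∈ m = ∈-resp-↭ (↭-sym pieces↭) (∈-++⁺ˡ m)
        pieces-len : length pieces ≤ length 𝔹
        pieces-len = ≤-trans (m≤m+n _ _) (≤-reflexive (trans≡ (sym (length-++ pieces)) (sym (↭-length pieces↭))))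
        block-len : ∀ {b} → b ∈ˡ 𝔹 → length (proj₂ b) ≡ k
        block-len {c , S} m = proj₁ (∈-tuples⁻ Vs k (proj₂ (∈-pairs⁻ Cs (tuples Vs k) m)))
        half : ∀ {S X q} → .{{NonZero q}} → S * q ≤ X * length Y → 2 * suc Q * X ≤ q → 2 * (suc Q * S) ≤ length Y
        half {S} {X} {q} le room = *-cancelʳ-≤ _ _ q (begin
          2 * (suc Q * S) * q ≡⟨ a1 (suc Q) S q ⟩
          2 * suc Q * (S * q) ≤⟨ *-monoʳ-≤ (2 * suc Q) le ⟩
          2 * suc Q * (X * length Y) ≡⟨ sym (*-assoc (2 * suc Q) X _) ⟩
          2 * suc Q * X * length Y ≤⟨ *-monoˡ-≤ (length Y) room ⟩
          q * length Y ≡⟨ *-comm q _ ⟩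
          length Y * q ∎)
          where
          a1 : ∀ a s q → 2 * (a * s) * q ≡ 2 * a * (s * q)
          a1 = solve-∀
        few : ∀ P → length (concatMap gverts P) ≤ T * sV → length (concatMap gcols P) ≤ T * sC → suc Q * ∑ Y (λ G → ⟦ bad P G ⟧) ≤ length Y
        few P lV lC = *-cancelˡ-≤ 2 (begin
          2 * (suc Q * ∑ Y (λ G → ⟦ bad P G ⟧))
            ≤⟨ *-monoʳ-≤ 2 (*-monoʳ-≤ (suc Q) (≤-trans (∑-mono Y (λ G → ∨-≤ (badV P G) (badC P G))) (≤-reflexive (∑-add Y _ _)))) ⟩
          2 * (suc Q * (∑ Y (λ G → ⟦ badV P G ⟧) + ∑ Y (λ G → ⟦ badC P G ⟧)))
            ≡⟨ a1 (suc Q) (∑ Y (λ G → ⟦ badV P G ⟧)) (∑ Y (λ G → ⟦ badC P G ⟧)) ⟩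
          2 * (suc Q * ∑ Y (λ G → ⟦ badV P G ⟧)) + 2 * (suc Q * ∑ Y (λ G → ⟦ badC P G ⟧))
            ≤⟨ +-mono-≤
                 (half {∑ Y (λ G → ⟦ badV P G ⟧)} {K₀ * (k * (j * (k * (ZV + wV))))} {n}
                   (nested-stale _≟A_ 𝔹 proj₂ k (k * (ZV + wV)) n ZV j k K₀ (λ m → ≤-reflexive (block-len m))
                     (λ F l → stale-blocks (ZV + wV) F (≤-trans (+-monoˡ-≤ k l) (≤-reflexive (b1 ZV sV (k * (j * k)) (j * k) k))))
                     (concatMap gverts P ++ FV) (≤-trans (≤-reflexive (length-++ (concatMap gverts P))) (≤-trans (+-monoˡ-≤ (length FV) lV) (≤-reflexive (+-comm (T * sV) _))))) roomV)
                 (half {∑ Y (λ G → ⟦ badC P G ⟧)} {K₀ * (k * (j * (ZC + wC)))} {m}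
                   (nested-stale _≟C_ 𝔹 (λ b → proj₁ b ∷ []) 1 (ZC + wC) m ZC j k K₀ (λ _ → ≤-refl)
                     (λ F l → stale-colours (ZC + wC) F (≤-trans l (≤-reflexive (b2 ZC sC (k * (j * 1)) (j * 1)))))
                     (concatMap gcols P ++ FC₀) (≤-trans (≤-reflexive (length-++ (concatMap gcols P))) (≤-trans (+-monoˡ-≤ (length FC₀) lC) (≤-reflexive (+-comm (T * sC) _))))) roomC) ⟩
          length Y + length Y
            ≡⟨ cong (length Y +_) (sym (+-identityʳ _)) ⟩
          2 * length Y ∎)
          where
          a1 : ∀ q a b → 2 * (q * (a + b)) ≡ 2 * (q * a) + 2 * (q * b)
          a1 = solve-∀
          b1 : ∀ z s a b c → z + s + a + b + c ≡ z + (s + a + b + c)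
          b1 = solve-∀
          b2 : ∀ z s a b → z + s + a + b ≡ z + (s + a + b)
          b2 = solve-∀

        gadget-size : {X : Set} (f : Blk → List X) (s : ℕ) → (∀ {b} → b ∈ˡ 𝔹 → length (f b) ≤ s) → ∀ {G} → G ∈ˡ Y →
          length (concatMap (concatMap (concatMap f)) G) ≤ K₀ * (k * (j * s))
        gadget-size f s le {G} m = at (tuples (tuples 𝔹 j) k) K₀ (concatMap (concatMap f)) (k * (j * s))
          (at (tuples 𝔹 j) k (concatMap f) (j * s) (at 𝔹 j f s le)) m
          where
          at : {E : Set} (es : List E) (t : ℕ) (f : E → List _) (s : ℕ) → (∀ {b} → b ∈ˡ es → length (f b) ≤ s) → ∀ {G} → G ∈ˡ tuples es t → length (concatMap f G) ≤ t * s
          at es t f s le {G} m = ≤-trans (length-concatMap-≤ f s G (λ i → le (All.lookup (proj₂ (∈-tuples⁻ es t m)) i))) (≤-reflexive (cong (_* s) (proj₁ (∈-tuples⁻ es t m))))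
        sizeV : ∀ P → All (_∈ˡ Y) P → length P ≤ T → length (concatMap gverts P) ≤ T * sV
        sizeV P P∈ l = ≤-trans (length-concatMap-≤ gverts sV P (λ i → gadget-size proj₂ k (λ m → ≤-reflexive (block-len m)) (All.lookup P∈ i))) (*-monoˡ-≤ sV l)
        sizeC : ∀ P → All (_∈ˡ Y) P → length P ≤ T → length (concatMap gcols P) ≤ T * sC
        sizeC P P∈ l = ≤-trans (length-concatMap-≤ gcols sC P (λ i → gadget-size (λ b → proj₁ b ∷ []) 1 (λ _ → ≤-refl) (All.lookup P∈ i))) (*-monoˡ-≤ sC l)
        gadget-shape : ∀ {G} → G ∈ˡ Y → All (λ Θ → length Θ ≡ k × All (All (λ b → length (proj₂ b) ≡ k)) Θ) G
        gadget-shape m = All.tabulate λ i → let Θ∈ = ∈-tuples⁻ (tuples 𝔹 j) k (All.lookup (proj₂ (∈-tuples⁻ _ K₀ m)) i) in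
          proj₁ Θ∈ , All.tabulate λ i' → All.tabulate λ i'' → block-len (All.lookup (proj₂ (∈-tuples⁻ 𝔹 j (All.lookup (proj₂ Θ∈) i'))) i'')
        open Cover {List Piece} {Gadget} Y absorbs bad
        valid-facts : ∀ P₀ P → Valid P₀ P → Unique (concatMap gverts P) × (∀ {x} → x ∈ˡ concatMap gverts P → x ∉ˡ concatMap gverts P₀ ++ FV) ×
          Unique (concatMap gcols P) × (∀ {x} → x ∈ˡ concatMap gcols P → x ∉ˡ concatMap gcols P₀ ++ FC₀) × All (_∈ˡ Y) P
        valid-facts P₀ [] _ = [] , (λ ()) , [] , (λ ()) , []
        valid-facts P₀ (G ∷ P) (nb , G∈ , v) with valid-facts (G ∷ P₀) P v | ∨-false {badV P₀ G} nb
        ... | uV , dV , uC , dC , P∈ | fV , fC =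
          Unique-++⁺ (FA.fresh-unique _ (gverts G) (not-false fV)) uV (λ i i' → dV i' (∈-++⁺ˡ (∈-++⁺ˡ i))) ,
          dis dV (FA.fresh-disjoint _ (gverts G) (not-false fV)) ,
          Unique-++⁺ (FC.fresh-unique _ (gcols G) (not-false fC)) uC (λ i i' → dC i' (∈-++⁺ˡ (∈-++⁺ˡ i))) ,
          dis dC (FC.fresh-disjoint _ (gcols G) (not-false fC)) , G∈ ∷ P∈
          where
          dis : {X : Set} {a b c d : List X} → (∀ {x} → x ∈ˡ b → x ∉ˡ (a ++ c) ++ d) → (∀ {x} → x ∈ˡ a → x ∉ˡ c ++ d) → ∀ {x} → x ∈ˡ a ++ b → x ∉ˡ c ++ d
          dis {a = a} {c = c} f g i i' with ∈-++⁻ a i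
          ... | inj₁ p = g p i'
          ... | inj₂ p = f p (subst (_ ∈ˡ_) (sym (++-assoc a c _)) (∈-++⁺ʳ a i'))
      record Family : Set where
        field
          blocks : List Blk
          sound : Sound blocks
          v-unique : Unique (vts blocks)
          v-fresh : ∀ {x} → x ∈ˡ vts blocks → x ∉ˡ FV
          c-unique : Unique (cls blocks)
          c-fresh : ∀ {x} → x ∈ˡ cls blocks → x ∉ˡ FC₀
          size : length (vts blocks) ≤ T * sV
          absorbing : ∀ ps → length ps ≡ K₀ → All (λ p → p ∈ˡ 𝔹 × compat p ≡ true) ps →
            Σ (List Blk) λ blocks' → Sound blocks' × vts blocks' ↭ vts ps ++ vts blocks × cls blocks' ↭ cls ps ++ cls blocks

      private
        piece∈ : ∀ {p} → p ∈ˡ 𝔹 × compat p ≡ true → p ∈ˡ pieces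
        piece∈ {p} (p∈ , e) with ∈-++⁻ pieces (∈-resp-↭ pieces↭ p∈)
        ... | inj₁ i = i
        ... | inj₂ i = ⊥-elim (clash (trans≡ (sym e) (unselected compat pieces↭ pieces-compat (proj₂ (proj₂ (proj₂ (proj₂ (select compat 𝔹))))) i)))
          where
          clash : true ≢ false
          clash ()
        ps∈ : ∀ ps → length ps ≡ K₀ → All (λ p → p ∈ˡ 𝔹 × compat p ≡ true) ps → ps ∈ˡ tuples pieces K₀
        ps∈ ps lps al = subst (λ z → ps ∈ˡ tuples pieces z) lps (∈-tuples⁺ pieces (All.map piece∈ al))
        verts≡ : ∀ P → vts (concatMap flat P) ≡ concatMap gverts P
        verts≡ [] = refl≡
        verts≡ (G ∷ P) = trans≡ (concatMap-++ proj₂ (flat G) _) (cong₂ _++_ (gverts≡ G) (verts≡ P))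
        cols≡ : ∀ P → cls (concatMap flat P) ≡ concatMap gcols P
        cols≡ [] = refl≡
        cols≡ (G ∷ P) = trans≡ (map-++ proj₁ (flat G) _) (cong₂ _++_ (gcols≡ G) (cols≡ P))
        exchange : ∀ {ps} → ps ∈ˡ tuples pieces K₀ → ∀ {G} → G ∈ˡ Y → absorbs ps G ≡ true → Σ (List Blk) λ θ' → Exchange (flat G) θ' (vts ps) [] (cls ps)
        exchange {ps} ps∈ {G} G∈ e = absorbed ps G (trans≡ (proj₁ (∈-tuples⁻ _ K₀ G∈)) (sym (proj₁ (∈-tuples⁻ pieces K₀ ps∈))))
          (All.map (λ i → block-len (pieces∈ i)) (proj₂ (∈-tuples⁻ pieces K₀ ps∈))) (gadget-shape G∈) e
        replaced : ∀ {ps} (P : List Gadget) (G : Gadget) (us ws : List Gadget) (θ' : List Blk) → P ≡ us ++ G ∷ ws → Sound (concatMap flat P) →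
          Exchange (flat G) θ' (vts ps) [] (cls ps) →
          Σ (List Blk) λ blocks' → Sound blocks' × vts blocks' ↭ vts ps ++ vts (concatMap flat P) × cls blocks' ↭ cls ps ++ cls (concatMap flat P)
        replaced {ps} P G us ws θ' P≡ sound ex = θ' ++ others , Sound-++ (Exchange.afterwards ex) (λ i → sound (∈-resp-↭ (↭-sym blocks↭) (∈-++⁺ʳ (flat G) i))) ,
            ↭-trans (↭-reflexive (concatMap-++ proj₂ θ' others)) (↭-trans (++⁺ʳ (vts others) (↭-trans (↭-reflexive (sym (++-identityʳ (vts θ')))) (Exchange.verts ex)))
              (↭-trans (↭-reflexive (++-assoc (vts ps) (vts (flat G)) (vts others))) (++⁺ˡ (vts ps) (↭-trans (↭-reflexive (sym (concatMap-++ proj₂ (flat G) others))) (concatMap⁺ proj₂ (↭-sym blocks↭)))))) ,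
            ↭-trans (↭-reflexive (map-++ proj₁ θ' others)) (↭-trans (++⁺ʳ (cls others) (Exchange.colours ex))
              (↭-trans (↭-reflexive (++-assoc (cls ps) (cls (flat G)) (cls others))) (++⁺ˡ (cls ps) (↭-trans (↭-reflexive (sym (map-++ proj₁ (flat G) others))) (map⁺ proj₁ (↭-sym blocks↭))))))
          where
          others : List Blk
          others = concatMap flat (us ++ ws)
          blocks↭ : concatMap flat P ↭ flat G ++ others
          blocks↭ = ↭-trans (↭-reflexive (cong (concatMap flat) P≡)) (concatMap⁺ flat (shift G us ws))
        all-sound : ∀ P → All (_∈ˡ Y) P → (∀ y → y ∈ˡ P → Σ (List Piece) λ x → x ∈ˡ tuples pieces K₀ × absorbs x y ≡ true) → Sound (concatMap flat P)
        all-sound P P∈ use i = at (∈-concatMap⁻ flat P i)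
          where
          at : (Σ Gadget λ G → G ∈ˡ P × _ ∈ˡ flat G) → _
          at (G , G∈ , i') = Exchange.before (proj₂ (exchange (proj₁ (proj₂ (use G G∈))) (All.lookup P∈ G∈) (proj₂ (proj₂ (use G G∈))))) i'
        build : Covering T [] (tuples pieces K₀) → Family
        build (P , v , l , cov , use) = record
          { blocks = concatMap flat P
          ; sound = sound
          ; v-unique = subst Unique (sym (verts≡ P)) (proj₁ facts)
          ; v-fresh = λ i → proj₁ (proj₂ facts) (subst (_ ∈ˡ_) (verts≡ P) i)
          ; c-unique = subst Unique (sym (cols≡ P)) (proj₁ (proj₂ (proj₂ facts)))
          ; c-fresh = λ i → proj₁ (proj₂ (proj₂ (proj₂ facts))) (subst (_ ∈ˡ_) (cols≡ P) i)
          ; size = ≤-trans (≤-reflexive (cong length (verts≡ P))) (sizeV P P∈ l)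
          ; absorbing = λ ps lps al → at ps (ps∈ ps lps al) (cov ps (ps∈ ps lps al)) }
          where
          facts = valid-facts [] P v
          P∈ : All (_∈ˡ Y) P
          P∈ = proj₂ (proj₂ (proj₂ (proj₂ facts)))
          sound : Sound (concatMap flat P)
          sound = all-sound P P∈ use
          at : ∀ ps → ps ∈ˡ tuples pieces K₀ → (Σ Gadget λ G → G ∈ˡ P × absorbs ps G ≡ true) →
            Σ (List Blk) λ blocks' → Sound blocks' × vts blocks' ↭ vts ps ++ vts (concatMap flat P) × cls blocks' ↭ cls ps ++ cls (concatMap flat P)
          at ps ps∈ (G , G∈ , e) = replaced {ps} P G (proj₁ (∈-∃++ G∈)) (proj₁ (proj₂ (∈-∃++ G∈))) (proj₁ ex) (proj₂ (proj₂ (∈-∃++ G∈))) sound (proj₂ ex)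
            where
            ex = exchange ps∈ (All.lookup P∈ G∈) e

      family : Family
      family = build (cover Q T (tuples pieces K₀) [] [] Y-pos
        (λ ps ps∈ → let lps = proj₁ (∈-tuples⁻ pieces K₀ ps∈) in subst (2 * length Y ≤_) (cong (_* ∑ Y (λ G → ⟦ absorbs ps G ⟧)) (sym Q≡)) (begin
          2 * length Y
            ≤⟨ *-monoʳ-≤ 2 (subst (λ z → length (tuples (tuples (tuples 𝔹 j) k) z) ≤ (K₂ * K ^ k) ^ z * ∑ (tuples (tuples (tuples 𝔹 j) k) z) (λ G → ⟦ absorbs ps G ⟧)) lps
                 (Counting.absorbs-many j K close K₂ n>0 ps (λ i → let p∈ = All.lookup (proj₂ (∈-tuples⁻ pieces K₀ ps∈)) i in
                   block-len (pieces∈ p∈) , robust _ (pieces∈ p∈) (All.lookup pieces-compat p∈)))) ⟩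
          2 * ((K₂ * K ^ k) ^ K₀ * ∑ Y (λ G → ⟦ absorbs ps G ⟧))
            ≡⟨ sym (*-assoc 2 ((K₂ * K ^ k) ^ K₀) _) ⟩
          2 * (K₂ * K ^ k) ^ K₀ * ∑ Y (λ G → ⟦ absorbs ps G ⟧) ∎))
        (λ P P∈ lt → few P (sizeV P P∈ (≤-trans (<⇒≤ lt) (≤-reflexive (+-identityʳ T)))) (sizeC P P∈ (≤-trans (<⇒≤ lt) (≤-reflexive (+-identityʳ T)))))
        (≤-trans (s≤s (*-monoˡ-≤ (Q ^ T) (≤-trans (≤-reflexive (length-tuples pieces K₀)) (^-monoˡ-≤ K₀ pieces-len)))) enough))
        where
        𝔹-pos : NonZero (length 𝔹)
        𝔹-pos = subst NonZero (sym length-𝔹) (m*n≢0 m (n ^ k) {{nzm}} {{m^n≢0 n k {{nzn}}}})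
        Y-pos : 0 < length Y
        Y-pos = subst (0 <_) (sym (trans≡ (length-tuples (tuples (tuples 𝔹 j) k) K₀) (cong (_^ K₀) (trans≡ (length-tuples (tuples 𝔹 j) k) (cong (_^ k) (length-tuples 𝔹 j))))))
          (m^n>0 ((length 𝔹 ^ j) ^ k) {{m^n≢0 (length 𝔹 ^ j) k {{m^n≢0 (length 𝔹) j {{𝔹-pos}}}}}} K₀)

private
  every : (Bool → Bool) → Bool
  every p = p true ∧ p false

  every⇒ : ∀ p → every p ≡ true → ∀ b → p b ≡ true
  every⇒ p e true = proj₁ (∧-true {p true} e)
  every⇒ p e false = proj₂ (∧-true {p true} e)

  ≤-bool₂ : (f g : Bool → Bool → ℕ) → every (λ a → every (λ b → f a b ≤ᵇ g a b)) ≡ true → ∀ a b → f a b ≤ g a b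
  ≤-bool₂ f g e a b = ≤ᵇ⇒≤ _ _ (true-T (every⇒ (λ b → f a b ≤ᵇ g a b) (every⇒ (λ a → every (λ b → f a b ≤ᵇ g a b)) e a) b))

  ≤-bool₃ : (f g : Bool → Bool → Bool → ℕ) → every (λ a → every (λ b → every (λ c → f a b c ≤ᵇ g a b c))) ≡ true → ∀ a b c → f a b c ≤ g a b c
  ≤-bool₃ f g e a = ≤-bool₂ (f a) (g a) (every⇒ (λ a → every (λ b → every (λ c → f a b c ≤ᵇ g a b c))) e a)

  ≤-bool₄ : (f g : Bool → Bool → Bool → Bool → ℕ) → every (λ a → every (λ b → every (λ c → every (λ d → f a b c d ≤ᵇ g a b c d)))) ≡ true → ∀ a b c d → f a b c d ≤ g a b c d
  ≤-bool₄ f g e a = ≤-bool₃ (f a) (g a) (every⇒ (λ a → every (λ b → every (λ c → every (λ d → f a b c d ≤ᵇ g a b c d)))) e a)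

-- Overlaps of the sets f x ⊆ Ω, each of which contains almost half of Ω.
module Overlap {A O : Set} (Ω : List O) (f : A → O → Bool) (e : ℕ) (e≥1 : 1 ≤ e)
  (half : ∀ x → e * length Ω ≤ e * (2 * ∑ Ω (λ o → ⟦ f x o ⟧)) + length Ω) where

  ω : ℕ
  ω = length Ω

  # : (O → Bool) → ℕ
  # p = ∑ Ω (λ o → ⟦ p o ⟧)

  size : A → ℕ
  size x = # (f x)

  meet agree disagree outer outside-both : A → A → ℕ
  meet x z = # (λ o → f z o ∧ f x o)
  agree x y = # (λ o → same (f x o) (f y o))
  disagree x y = # (λ o → f x o xor f y o)
  outer x u = # (λ o → f x o ∧ not (f u o))
  outside-both u v = # (λ o → not (f u o) ∧ not (f v o))

  private
    S₂ : (p q : O → ℕ) → ∑ Ω (λ o → p o + q o) ≡ ∑ Ω p + ∑ Ω q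
    S₂ p q = ∑-add Ω p q
    S₃ : (p q r : O → ℕ) → ∑ Ω (λ o → p o + q o + r o) ≡ ∑ Ω p + ∑ Ω q + ∑ Ω r
    S₃ p q r = trans≡ (∑-add Ω _ r) (cong (_+ ∑ Ω r) (∑-add Ω p q))
    one : ∑ Ω (λ _ → 1) ≡ ω
    one = sym (length≡∑ Ω)

  #≤ω : ∀ p → # p ≤ ω
  #≤ω p = ≤-trans (∑-≤-length Ω 1 (λ o → bool-≤1 (p o))) (≤-reflexive (*-identityʳ ω))

  agree+sizes : ∀ z u → agree z u + size z + size u ≤ 2 * meet u z + ω
  agree+sizes z u = begin
    agree z u + size z + size u ≡⟨ sym (S₃ _ _ _) ⟩
    ∑ Ω (λ o → ⟦ same (f z o) (f u o) ⟧ + ⟦ f z o ⟧ + ⟦ f u o ⟧)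
      ≤⟨ ∑-mono Ω (λ o → ≤-bool₂ (λ a b → ⟦ same a b ⟧ + ⟦ a ⟧ + ⟦ b ⟧) (λ a b → 2 * ⟦ a ∧ b ⟧ + 1) refl≡ (f z o) (f u o)) ⟩
    ∑ Ω (λ o → 2 * ⟦ f z o ∧ f u o ⟧ + 1) ≡⟨ trans≡ (S₂ _ _) (cong₂ _+_ (∑-scale Ω 2 _) one) ⟩
    2 * meet u z + ω ∎

  sizes≤ : ∀ u z → size u + size z ≤ ω + meet u z
  sizes≤ u z = begin
    size u + size z ≡⟨ sym (S₂ _ _) ⟩
    ∑ Ω (λ o → ⟦ f u o ⟧ + ⟦ f z o ⟧)
      ≤⟨ ∑-mono Ω (λ o → ≤-bool₂ (λ a b → ⟦ a ⟧ + ⟦ b ⟧) (λ a b → 1 + ⟦ b ∧ a ⟧) refl≡ (f u o) (f z o)) ⟩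
    ∑ Ω (λ o → 1 + ⟦ f z o ∧ f u o ⟧) ≡⟨ trans≡ (S₂ _ _) (cong (_+ meet u z) one) ⟩
    ω + meet u z ∎

  disagree-via : ∀ x u y → disagree x y ≤ agree x u + agree y u
  disagree-via x u y = ≤-trans (∑-mono Ω (λ o → ≤-bool₃ (λ a b c → ⟦ a xor c ⟧) (λ a b c → ⟦ same a b ⟧ + ⟦ same c b ⟧) refl≡ (f x o) (f u o) (f y o))) (≤-reflexive (S₂ _ _))

  disagree-via₂ : ∀ x y u v → disagree x y ≤ agree x u + agree y v + disagree u v
  disagree-via₂ x y u v = ≤-trans (∑-mono Ω (λ o → ≤-bool₄ (λ a b c d → ⟦ a xor b ⟧) (λ a b c d → ⟦ same a c ⟧ + ⟦ same b d ⟧ + ⟦ c xor d ⟧) refl≡ (f x o) (f y o) (f u o) (f v o))) (≤-reflexive (S₃ _ _ _))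

  agree-via₂ : ∀ x y u v → agree x y ≤ agree x u + agree y v + agree u v
  agree-via₂ x y u v = ≤-trans (∑-mono Ω (λ o → ≤-bool₄ (λ a b c d → ⟦ same a b ⟧) (λ a b c d → ⟦ same a c ⟧ + ⟦ same b d ⟧ + ⟦ same c d ⟧) refl≡ (f x o) (f y o) (f u o) (f v o))) (≤-reflexive (S₃ _ _ _))

  agree+ω : ∀ u v → agree u v + ω ≤ 2 * outside-both u v + (size u + size v)
  agree+ω u v = begin
    agree u v + ω ≡⟨ trans≡ (cong (agree u v +_) (sym one)) (sym (S₂ _ _)) ⟩
    ∑ Ω (λ o → ⟦ same (f u o) (f v o) ⟧ + 1)
      ≤⟨ ∑-mono Ω (λ o → ≤-bool₂ (λ a b → ⟦ same a b ⟧ + 1) (λ a b → 2 * ⟦ not a ∧ not b ⟧ + (⟦ a ⟧ + ⟦ b ⟧)) refl≡ (f u o) (f v o)) ⟩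
    ∑ Ω (λ o → 2 * ⟦ not (f u o) ∧ not (f v o) ⟧ + (⟦ f u o ⟧ + ⟦ f v o ⟧)) ≡⟨ trans≡ (S₂ _ _) (cong₂ _+_ (∑-scale Ω 2 _) (S₂ _ _)) ⟩
    2 * outside-both u v + (size u + size v) ∎

  outer-sum : ∀ x u v → 2 * size x + disagree u v ≤ 2 * (outer x u + outer x v) + (size u + size v)
  outer-sum x u v = begin
    2 * size x + disagree u v ≡⟨ sym (trans≡ (S₂ _ _) (cong (_+ disagree u v) (∑-scale Ω 2 _))) ⟩
    ∑ Ω (λ o → 2 * ⟦ f x o ⟧ + ⟦ f u o xor f v o ⟧)
      ≤⟨ ∑-mono Ω (λ o → ≤-bool₃ (λ a b c → 2 * ⟦ a ⟧ + ⟦ b xor c ⟧) (λ a b c → 2 * (⟦ a ∧ not b ⟧ + ⟦ a ∧ not c ⟧) + (⟦ b ⟧ + ⟦ c ⟧)) refl≡ (f x o) (f u o) (f v o)) ⟩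
    ∑ Ω (λ o → 2 * (⟦ f x o ∧ not (f u o) ⟧ + ⟦ f x o ∧ not (f v o) ⟧) + (⟦ f u o ⟧ + ⟦ f v o ⟧))
      ≡⟨ trans≡ (S₂ _ _) (cong₂ _+_ (trans≡ (∑-scale Ω 2 _) (cong (2 *_) (S₂ _ _))) (S₂ _ _)) ⟩
    2 * (outer x u + outer x v) + (size u + size v) ∎

  outer≤ : ∀ x z u → outer x u ≤ meet x z + agree z u
  outer≤ x z u = ≤-trans (∑-mono Ω (λ o → ≤-bool₃ (λ a b c → ⟦ a ∧ not c ⟧) (λ a b c → ⟦ b ∧ a ⟧ + ⟦ same b c ⟧) refl≡ (f x o) (f z o) (f u o))) (≤-reflexive (S₂ _ _))

  ω≤meet : ∀ z z' u → ω ≤ meet z z' + agree z u + agree z' u + size u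
  ω≤meet z z' u = begin
    ω ≡⟨ sym one ⟩
    ∑ Ω (λ _ → 1)
      ≤⟨ ∑-mono Ω (λ o → ≤-bool₃ (λ a b c → 1) (λ a b c → ⟦ b ∧ a ⟧ + ⟦ same a c ⟧ + ⟦ same b c ⟧ + ⟦ c ⟧) refl≡ (f z o) (f z' o) (f u o)) ⟩
    ∑ Ω (λ o → ⟦ f z' o ∧ f z o ⟧ + ⟦ same (f z o) (f u o) ⟧ + ⟦ same (f z' o) (f u o) ⟧ + ⟦ f u o ⟧) ≡⟨ trans≡ (S₂ _ _) (cong (_+ size u) (S₃ _ _ _)) ⟩
    meet z z' + agree z u + agree z' u + size u ∎

  outside≤meet : ∀ z z' u v → outside-both u v ≤ meet z z' + agree z u + agree z' v
  outside≤meet z z' u v = ≤-trans (∑-mono Ω (λ o → ≤-bool₄ (λ a b c d → ⟦ not c ∧ not d ⟧) (λ a b c d → ⟦ b ∧ a ⟧ + ⟦ same a c ⟧ + ⟦ same b d ⟧) refl≡ (f z o) (f z' o) (f u o) (f v o))) (≤-reflexive (S₃ _ _ _))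

  size≤outer : ∀ z u → size z ≤ outer z u + meet u z
  size≤outer z u = ≤-trans (∑-mono Ω (λ o → ≤-bool₂ (λ a b → ⟦ a ⟧) (λ a b → ⟦ a ∧ not b ⟧ + ⟦ a ∧ b ⟧) refl≡ (f z o) (f u o))) (≤-reflexive (S₂ _ _))

  outer≤outside : ∀ z u v → outer z u ≤ outside-both u v + agree z v
  outer≤outside z u v = ≤-trans (∑-mono Ω (λ o → ≤-bool₃ (λ a b c → ⟦ a ∧ not b ⟧) (λ a b c → ⟦ not b ∧ not c ⟧ + ⟦ same a c ⟧) refl≡ (f z o) (f u o) (f v o))) (≤-reflexive (S₂ _ _))

  meet-comm : ∀ x z → meet x z ≡ meet z x
  meet-comm x z = ∑-cong Ω (λ o → cong ⟦_⟧ (comm (f z o) (f x o)))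
    where
    comm : ∀ a b → a ∧ b ≡ b ∧ a
    comm true true = refl≡
    comm true false = refl≡
    comm false true = refl≡
    comm false false = refl≡

  module Scaled (P : ℕ) (P≤e : P ≤ e) where

    private
      instance
        nze : NonZero e
        nze = >-nonZero e≥1

    size≥ : ∀ x → P * ω ≤ 2 * P * size x + ω
    size≥ x = *-cancelˡ-≤ e (begin
      e * (P * ω) ≡⟨ a1 e P ω ⟩
      P * (e * ω) ≤⟨ *-monoʳ-≤ P (half x) ⟩
      P * (e * (2 * size x) + ω) ≡⟨ a2 P e (size x) ω ⟩
      e * (2 * P * size x) + P * ω ≤⟨ +-monoʳ-≤ (e * (2 * P * size x)) (*-monoˡ-≤ ω P≤e) ⟩
      e * (2 * P * size x) + e * ω ≡⟨ sym (*-distribˡ-+ e (2 * P * size x) ω) ⟩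
      e * (2 * P * size x + ω) ∎)
      where
      a1 : ∀ e p w → e * (p * w) ≡ p * (e * w)
      a1 = solve-∀
      a2 : ∀ p e s w → p * (e * (2 * s) + w) ≡ e * (2 * p * s) + p * w
      a2 = solve-∀

    size≤ : ∀ u z → P * meet u z ≤ ω → 2 * P * size u ≤ P * ω + 3 * ω
    size≤ u z h = +-cancelʳ-≤ (P * ω) _ _ (begin
      2 * P * size u + P * ω ≤⟨ +-monoʳ-≤ (2 * P * size u) (size≥ z) ⟩
      2 * P * size u + (2 * P * size z + ω) ≡⟨ a1 P (size u) (size z) ω ⟩
      2 * P * (size u + size z) + ω ≤⟨ +-monoˡ-≤ ω (*-monoʳ-≤ (2 * P) (sizes≤ u z)) ⟩
      2 * P * (ω + meet u z) + ω ≡⟨ a2 P ω (meet u z) ⟩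
      2 * (P * meet u z) + ω + (P * ω + P * ω) ≤⟨ +-monoˡ-≤ (P * ω + P * ω) (+-monoˡ-≤ ω (*-monoʳ-≤ 2 h)) ⟩
      2 * ω + ω + (P * ω + P * ω) ≡⟨ a3 (P * ω) ω ⟩
      P * ω + 3 * ω + P * ω ∎)
      where
      a1 : ∀ p s t w → 2 * p * s + (2 * p * t + w) ≡ 2 * p * (s + t) + w
      a1 = solve-∀
      a2 : ∀ p w m → 2 * p * (w + m) + w ≡ 2 * (p * m) + w + (p * w + p * w)
      a2 = solve-∀
      a3 : ∀ x w → 2 * w + w + (x + x) ≡ x + 3 * w + x
      a3 = solve-∀

    agree≤ : ∀ u z → P * meet u z ≤ ω → P * agree z u ≤ 3 * ω
    agree≤ u z h = +-cancelʳ-≤ (P * size z + P * size u + P * ω + P * ω) _ _ (begin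
      P * agree z u + (P * size z + P * size u + P * ω + P * ω) ≡⟨ a1 P (agree z u) (size z) (size u) ω ⟩
      P * (agree z u + size z + size u) + P * ω + P * ω ≤⟨ +-monoˡ-≤ (P * ω) (+-monoˡ-≤ (P * ω) (*-monoʳ-≤ P (agree+sizes z u))) ⟩
      P * (2 * meet u z + ω) + P * ω + P * ω ≡⟨ a2 P (meet u z) ω ⟩
      2 * (P * meet u z) + P * ω + (P * ω + P * ω) ≤⟨ +-mono-≤ (+-monoˡ-≤ (P * ω) (*-monoʳ-≤ 2 h)) ≤-refl ⟩
      2 * ω + P * ω + (P * ω + P * ω) ≤⟨ both ⟩
      3 * ω + (P * size z + P * size u + P * ω + P * ω) ∎)
      where
      a1 : ∀ p a s t w → p * a + (p * s + p * t + p * w + p * w) ≡ p * (a + s + t) + p * w + p * w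
      a1 = solve-∀
      a2 : ∀ p m w → p * (2 * m + w) + p * w + p * w ≡ 2 * (p * m) + p * w + (p * w + p * w)
      a2 = solve-∀
      a3 : ∀ p s t w → 4 * w + 3 * (p * w) + ((2 * p * s + w) + (2 * p * t + w)) + (p * w) + (p * w) ≡ 2 * (3 * w + (p * s + p * t + p * w + p * w)) + p * w
      a3 = solve-∀
      both : 2 * ω + P * ω + (P * ω + P * ω) ≤ 3 * ω + (P * size z + P * size u + P * ω + P * ω)
      both = *-cancelˡ-≤ 2 (+-cancelʳ-≤ (P * ω) _ _ (begin
        2 * (2 * ω + P * ω + (P * ω + P * ω)) + P * ω ≡⟨ a4 ω (P * ω) ⟩
        4 * ω + 3 * (P * ω) + (P * ω + P * ω) + P * ω + P * ω ≤⟨ +-monoˡ-≤ (P * ω) (+-monoˡ-≤ (P * ω) (+-monoʳ-≤ (4 * ω + 3 * (P * ω)) (+-mono-≤ (size≥ z) (size≥ u)))) ⟩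
        4 * ω + 3 * (P * ω) + ((2 * P * size z + ω) + (2 * P * size u + ω)) + P * ω + P * ω ≡⟨ a3 P (size z) (size u) ω ⟩
        2 * (3 * ω + (P * size z + P * size u + P * ω + P * ω)) + P * ω ∎))
        where
        a4 : ∀ w x → 2 * (2 * w + x + (x + x)) + x ≡ 4 * w + 3 * x + (x + x) + x + x
        a4 = solve-∀

-- A pair u, v with few paths u - z - v of large overlaps: almost every f z is close to the complement of f u or of f v.
module Classes {A O : Set} (Ω : List O) (f : A → O → Bool) (e : ℕ) (e≥1 : 1 ≤ e)
  (half : ∀ x → e * length Ω ≤ e * (2 * ∑ Ω (λ o → ⟦ f x o ⟧)) + length Ω)
  (P : ℕ) (P≤e : P ≤ e) (Vs : List A) (ω>0 : 0 < length Ω) (P≥30 : 30 ≤ P) (u v : A)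
  (few-paths : P * P * P * ∑ Vs (λ z → Overlap.meet Ω f e e≥1 half u z * Overlap.meet Ω f e e≥1 half z v) < length Vs * (length Ω * length Ω)) where

  open Overlap Ω f e e≥1 half
  open Scaled P P≤e

  n : ℕ
  n = length Vs

  inA inB rest : A → Bool
  inA z = P * meet u z <ᵇ ω
  inB z = not (inA z) ∧ (P * meet z v <ᵇ ω)
  rest z = not (inA z) ∧ not (P * meet z v <ᵇ ω)

  private
    instance
      nzω : NonZero ω
      nzω = >-nonZero ω>0
      nzP : NonZero P
      nzP = >-nonZero (≤-trans (s≤s z≤n) P≥30)

  data Class (z : A) : Set where
    class-A : inA z ≡ true → inB z ≡ false → rest z ≡ false → P * meet u z ≤ ω → Class z
    class-B : inA z ≡ false → inB z ≡ true → rest z ≡ false → P * meet v z ≤ ω → Class z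
    class-E : inA z ≡ false → inB z ≡ false → rest z ≡ true → ω * ω ≤ P * P * (meet u z * meet z v) → Class z

  classify : ∀ z → Class z
  classify z = go (<ᵇ-cases (P * meet u z) ω) (<ᵇ-cases (P * meet z v) ω)
    where
    go : (P * meet u z <ᵇ ω) ≡ true ⊎ ((P * meet u z <ᵇ ω) ≡ false × ω ≤ P * meet u z) →
      (P * meet z v <ᵇ ω) ≡ true ⊎ ((P * meet z v <ᵇ ω) ≡ false × ω ≤ P * meet z v) → Class z
    go (inj₁ a) _ = class-A a (cong (λ x → not x ∧ (P * meet z v <ᵇ ω)) a) (cong (λ x → not x ∧ not (P * meet z v <ᵇ ω)) a) (<⇒≤ (<ᵇ-true {P * meet u z} a))
    go (inj₂ (a , _)) (inj₁ b) = class-B a (cong₂ (λ x y → not x ∧ y) a b) (cong₂ (λ x y → not x ∧ not y) a b)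
      (≤-trans (≤-reflexive (cong (P *_) (meet-comm v z))) (<⇒≤ (<ᵇ-true {P * meet z v} b)))
    go (inj₂ (a , a')) (inj₂ (b , b')) = class-E a (cong₂ (λ x y → not x ∧ y) a b) (cong₂ (λ x y → not x ∧ not y) a b)
      (≤-trans (*-mono-≤ a' b') (≤-reflexive (a1 P (meet u z) (meet z v))))
      where
      a1 : ∀ p a b → p * a * (p * b) ≡ p * p * (a * b)
      a1 = solve-∀

  A-agree : ∀ {z} → inA z ≡ true → P * agree z u ≤ 3 * ω
  A-agree {z} a = agree≤ u z (<⇒≤ (<ᵇ-true {P * meet u z} a))

  B-agree : ∀ {z} → inB z ≡ true → P * agree z v ≤ 3 * ω
  B-agree {z} b = agree≤ v z (≤-trans (≤-reflexive (cong (P *_) (meet-comm v z))) (<⇒≤ (<ᵇ-true {P * meet z v} (proj₂ (∧-true {not (inA z)} b)))))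

  #A #B #E : ℕ
  #A = ∑ Vs (λ z → ⟦ inA z ⟧)
  #B = ∑ Vs (λ z → ⟦ inB z ⟧)
  #E = ∑ Vs (λ z → ⟦ rest z ⟧)

  rest-few : P * #E ≤ n
  rest-few = *-cancelʳ-≤ _ _ (ω * ω) {{m*n≢0 ω ω}} (begin
    P * #E * (ω * ω) ≡⟨ trans≡ (*-assoc P #E _) (cong (P *_) (sym (∑-scaleʳ Vs _ (ω * ω)))) ⟩
    P * ∑ Vs (λ z → ⟦ rest z ⟧ * (ω * ω)) ≤⟨ *-monoʳ-≤ P (∑-mono Vs (λ z → pt z (classify z))) ⟩
    P * ∑ Vs (λ z → P * P * (meet u z * meet z v)) ≡⟨ trans≡ (cong (P *_) (∑-scale Vs (P * P) _)) (a1 P (∑ Vs (λ z → meet u z * meet z v))) ⟩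
    P * P * P * ∑ Vs (λ z → meet u z * meet z v) ≤⟨ <⇒≤ few-paths ⟩
    n * (ω * ω) ∎)
    where
    a1 : ∀ p s → p * (p * p * s) ≡ p * p * p * s
    a1 = solve-∀
    pt : ∀ z → Class z → ⟦ rest z ⟧ * (ω * ω) ≤ P * P * (meet u z * meet z v)
    pt z (class-A _ _ e _) = ≤-trans (≤-reflexive (cong (λ b → ⟦ b ⟧ * (ω * ω)) e)) z≤n
    pt z (class-B _ _ e _) = ≤-trans (≤-reflexive (cong (λ b → ⟦ b ⟧ * (ω * ω)) e)) z≤n
    pt z (class-E _ _ e le) = ≤-trans (≤-reflexive (trans≡ (cong (λ b → ⟦ b ⟧ * (ω * ω)) e) (+-identityʳ (ω * ω)))) le

  sizes-sum : 3 * ∑ Vs size ≤ 2 * (n * ω)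
  sizes-sum = *-cancelˡ-≤ (2 * P) {{m*n≢0 2 P}} (begin
    2 * P * (3 * ∑ Vs size) ≡⟨ trans≡ (a1 P (∑ Vs size)) (cong (3 *_) (sym (∑-scale Vs (2 * P) size))) ⟩
    3 * ∑ Vs (λ z → 2 * P * size z) ≤⟨ *-monoʳ-≤ 3 (∑-mono Vs (λ z → pt z (classify z))) ⟩
    3 * ∑ Vs (λ z → (P * ω + 3 * ω) + 2 * P * ω * ⟦ rest z ⟧) ≡⟨ cong (3 *_) (trans≡ (∑-add Vs _ _) (cong₂ _+_ (∑-const Vs _) (∑-scale Vs (2 * P * ω) _))) ⟩
    3 * (n * (P * ω + 3 * ω) + 2 * P * ω * #E) ≡⟨ a2 n P ω #E ⟩
    3 * (n * (P * ω + 3 * ω)) + 6 * ω * (P * #E) ≤⟨ +-monoʳ-≤ (3 * (n * (P * ω + 3 * ω))) (*-monoʳ-≤ (6 * ω) rest-few) ⟩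
    3 * (n * (P * ω + 3 * ω)) + 6 * ω * n ≤⟨ m≤m+n _ (15 * (n * ω)) ⟩
    3 * (n * (P * ω + 3 * ω)) + 6 * ω * n + 15 * (n * ω) ≡⟨ a3 n P ω ⟩
    3 * P * (n * ω) + 30 * (n * ω) ≤⟨ +-monoʳ-≤ (3 * P * (n * ω)) (*-monoˡ-≤ (n * ω) P≥30) ⟩
    3 * P * (n * ω) + P * (n * ω) ≡⟨ a4 P (n * ω) ⟩
    2 * P * (2 * (n * ω)) ∎)
    where
    a1 : ∀ p s → 2 * p * (3 * s) ≡ 3 * (2 * p * s)
    a1 = solve-∀
    a2 : ∀ n p w e → 3 * (n * (p * w + 3 * w) + 2 * p * w * e) ≡ 3 * (n * (p * w + 3 * w)) + 6 * w * (p * e)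
    a2 = solve-∀
    a3 : ∀ n p w → 3 * (n * (p * w + 3 * w)) + 6 * w * n + 15 * (n * w) ≡ 3 * p * (n * w) + 30 * (n * w)
    a3 = solve-∀
    a4 : ∀ p x → 3 * p * x + p * x ≡ 2 * p * (2 * x)
    a4 = solve-∀
    pt : ∀ z → Class z → 2 * P * size z ≤ (P * ω + 3 * ω) + 2 * P * ω * ⟦ rest z ⟧
    pt z (class-A _ _ _ le) = ≤-trans (size≤ z u (≤-trans (≤-reflexive (cong (P *_) (meet-comm z u))) le)) (m≤m+n _ _)
    pt z (class-B _ _ _ le) = ≤-trans (size≤ z v (≤-trans (≤-reflexive (cong (P *_) (meet-comm z v))) le)) (m≤m+n _ _)
    pt z (class-E _ _ e _) = ≤-trans (*-monoʳ-≤ (2 * P) (#≤ω (f z))) (≤-trans (≤-reflexive (sym (trans≡ (cong (λ b → 2 * P * ω * ⟦ b ⟧) e) (*-identityʳ (2 * P * ω))))) (m≤n+m _ (P * ω + 3 * ω)))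

  Δ D : ℕ
  Δ = ∑ Vs (λ x → ∑ Vs (λ y → disagree x y))
  D = disagree u v

  private
    -- Sums over pairs of vertices of a bound depending on the classes only.
    pair-sum : (G : A → A → ℕ) (α β : ℕ) →
      (∀ x y → P * G x y ≤ α + (P * ω * ⟦ rest x ⟧ + P * ω * ⟦ rest y ⟧) + β * (⟦ inA x ⟧ * ⟦ inB y ⟧ + ⟦ inB x ⟧ * ⟦ inA y ⟧)) →
      P * ∑ Vs (λ x → ∑ Vs (λ y → G x y)) ≤ n * n * α + 2 * (n * n * ω) + 2 * β * (#A * #B)
    pair-sum G α β pt = begin
      P * ∑ Vs (λ x → ∑ Vs (λ y → G x y))
        ≡⟨ trans≡ (sym (∑-scale Vs P _)) (∑-cong Vs (λ x → sym (∑-scale Vs P _))) ⟩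
      ∑ Vs (λ x → ∑ Vs (λ y → P * G x y))
        ≤⟨ ∑-mono Vs (λ x → ∑-mono Vs (pt x)) ⟩
      ∑ Vs (λ x → ∑ Vs (λ y → α + (P * ω * ⟦ rest x ⟧ + P * ω * ⟦ rest y ⟧) + β * (⟦ inA x ⟧ * ⟦ inB y ⟧ + ⟦ inB x ⟧ * ⟦ inA y ⟧)))
        ≡⟨ ∑-cong Vs (λ x → trans≡ (∑-add Vs _ _) (cong₂ _+_
             (trans≡ (∑-add Vs _ _) (cong₂ _+_ (∑-const Vs α) (trans≡ (∑-add Vs _ _) (cong₂ _+_ (∑-const Vs _) (∑-scale Vs (P * ω) _)))))
             (trans≡ (∑-scale Vs β _) (cong (β *_) (trans≡ (∑-add Vs _ _) (cong₂ _+_ (∑-scale Vs ⟦ inA x ⟧ (λ y → ⟦ inB y ⟧)) (∑-scale Vs ⟦ inB x ⟧ (λ y → ⟦ inA y ⟧)))))))) ⟩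
      ∑ Vs (λ x → n * α + (n * (P * ω * ⟦ rest x ⟧) + P * ω * #E) + β * (⟦ inA x ⟧ * #B + ⟦ inB x ⟧ * #A))
        ≡⟨ trans≡ (∑-add Vs _ _) (cong₂ _+_
             (trans≡ (∑-add Vs _ _) (cong₂ _+_ (∑-const Vs _) (trans≡ (∑-add Vs _ _) (cong₂ _+_ (trans≡ (∑-scale Vs n _) (cong (n *_) (∑-scale Vs (P * ω) _))) (∑-const Vs _)))))
             (trans≡ (∑-scale Vs β _) (cong (β *_) (trans≡ (∑-add Vs _ _) (cong₂ _+_ (∑-scaleʳ Vs _ #B) (∑-scaleʳ Vs _ #A)))))) ⟩
      n * (n * α) + (n * (P * ω * #E) + n * (P * ω * #E)) + β * (#A * #B + #B * #A)
        ≡⟨ a1 n α P ω #E β #A #B ⟩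
      n * n * α + 2 * (n * ω) * (P * #E) + 2 * β * (#A * #B)
        ≤⟨ +-monoˡ-≤ (2 * β * (#A * #B)) (+-monoʳ-≤ (n * n * α) (*-monoʳ-≤ (2 * (n * ω)) rest-few)) ⟩
      n * n * α + 2 * (n * ω) * n + 2 * β * (#A * #B)
        ≡⟨ cong (λ z → n * n * α + z + 2 * β * (#A * #B)) (a2 n ω) ⟩
      n * n * α + 2 * (n * n * ω) + 2 * β * (#A * #B) ∎
      where
      a1 : ∀ n α p w e β a b → n * (n * α) + (n * (p * w * e) + n * (p * w * e)) + β * (a * b + b * a) ≡ n * n * α + 2 * (n * w) * (p * e) + 2 * β * (a * b)
      a1 = solve-∀
      a2 : ∀ n w → 2 * (n * w) * n ≡ 2 * (n * n * w)
      a2 = solve-∀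

    two : ∀ {x y z} → P * x ≤ 3 * ω → P * y ≤ 3 * ω → z ≤ x + y → P * z ≤ 6 * ω
    two {x} {y} hx hy hz = ≤-trans (*-monoʳ-≤ P hz) (≤-trans (≤-reflexive (*-distribˡ-+ P x y)) (≤-trans (+-mono-≤ hx hy) (≤-reflexive (a1 ω))))
      where
      a1 : ∀ w → 3 * w + 3 * w ≡ 6 * w
      a1 = solve-∀

    three : ∀ {x y z t} → P * x ≤ 3 * ω → P * y ≤ 3 * ω → z ≤ x + y + t → P * z ≤ 6 * ω + P * t
    three {x} {y} {z} {t} hx hy hz = ≤-trans (*-monoʳ-≤ P hz) (≤-trans (≤-reflexive (*-distribˡ-+ P (x + y) t)) (+-monoˡ-≤ (P * t) (two hx hy ≤-refl)))

  -- A bound from which pair-sum applies: α within a class, α + β across the classes.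
  pair-bound : (G : A → A → ℕ) (α β : ℕ) → (∀ x y → G x y ≤ ω) →
    (∀ {x y} → inA x ≡ true → inA y ≡ true → P * G x y ≤ α) → (∀ {x y} → inB x ≡ true → inB y ≡ true → P * G x y ≤ α) →
    (∀ {x y} → inA x ≡ true → inB y ≡ true → P * G x y ≤ α + β) → (∀ {x y} → inB x ≡ true → inA y ≡ true → P * G x y ≤ α + β) →
    P * ∑ Vs (λ x → ∑ Vs (λ y → G x y)) ≤ n * n * α + 2 * (n * n * ω) + 2 * β * (#A * #B)
  pair-bound G α β G≤ AA BB AB BA = pair-sum G α β (λ x y → pt x y (classify x) (classify y))
    where
    pt : ∀ x y → Class x → Class y → P * G x y ≤ α + (P * ω * ⟦ rest x ⟧ + P * ω * ⟦ rest y ⟧) + β * (⟦ inA x ⟧ * ⟦ inB y ⟧ + ⟦ inB x ⟧ * ⟦ inA y ⟧)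
    big : ∀ x y → P * G x y ≤ P * ω
    big x y = *-monoʳ-≤ P (G≤ x y)
    pt x y (class-E _ _ ex _) _ = ≤-trans (big x y) (≤-trans (≤-reflexive (sym (trans≡ (cong (λ b → P * ω * ⟦ b ⟧) ex) (*-identityʳ (P * ω))))) (≤-trans (m≤m+n _ _) (≤-trans (m≤n+m _ α) (m≤m+n _ _))))
    pt x y _ (class-E _ _ ey _) = ≤-trans (big x y) (≤-trans (≤-reflexive (sym (trans≡ (cong (λ b → P * ω * ⟦ b ⟧) ey) (*-identityʳ (P * ω))))) (≤-trans (m≤n+m _ (P * ω * ⟦ rest x ⟧)) (≤-trans (m≤n+m _ α) (m≤m+n _ _))))
    pt x y (class-A ax _ _ _) (class-A ay _ _ _) = ≤-trans (AA ax ay) (≤-trans (m≤m+n α _) (m≤m+n _ _))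
    pt x y (class-B _ bx _ _) (class-B _ by _ _) = ≤-trans (BB bx by) (≤-trans (m≤m+n α _) (m≤m+n _ _))
    pt x y (class-A ax _ _ _) (class-B _ by _ _) = ≤-trans (AB ax by) (+-mono-≤ (m≤m+n α _) (≤-trans (≤-reflexive (sym (*-identityʳ β))) (*-monoʳ-≤ β (≤-trans (≤-reflexive (sym (cong₂ (λ a b → ⟦ a ⟧ * ⟦ b ⟧) ax by))) (m≤m+n _ _)))))
    pt x y (class-B _ bx _ _) (class-A ay _ _ _) = ≤-trans (BA bx ay) (+-mono-≤ (m≤m+n α _) (≤-trans (≤-reflexive (sym (*-identityʳ β))) (*-monoʳ-≤ β (≤-trans (≤-reflexive (sym (cong₂ (λ a b → ⟦ a ⟧ * ⟦ b ⟧) bx ay))) (m≤n+m _ _)))))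

  Δ≤ : P * Δ ≤ 8 * (n * n * ω) + 2 * (P * D) * (#A * #B)
  Δ≤ = ≤-trans (pair-bound disagree (6 * ω) (P * D) (λ x y → #≤ω _)
      (λ {x} {y} a b → two (A-agree a) (A-agree b) (disagree-via x u y)) (λ {x} {y} a b → two (B-agree a) (B-agree b) (disagree-via x v y))
      (λ {x} {y} a b → three (A-agree a) (B-agree b) (disagree-via₂ x y u v))
      (λ {x} {y} b a → three (B-agree b) (A-agree a) (≤-trans (disagree-via₂ x y v u) (≤-reflexive (cong (agree x v + agree y u +_) (∑-cong Ω (λ o → cong ⟦_⟧ (xor-comm (f v o) (f u o)))))))))
    (≤-reflexive (a1 n ω (P * D) #A #B))
    where
    a1 : ∀ n w x a b → n * n * (6 * w) + 2 * (n * n * w) + 2 * x * (a * b) ≡ 8 * (n * n * w) + 2 * x * (a * b)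
    a1 = solve-∀

  A-size : ∀ {z} → inA z ≡ true → 2 * P * size u ≤ P * ω + 3 * ω
  A-size {z} a = size≤ u z (<⇒≤ (<ᵇ-true {P * meet u z} a))

  B-size : ∀ {z} → inB z ≡ true → 2 * P * size v ≤ P * ω + 3 * ω
  B-size {z} b = size≤ v z (≤-trans (≤-reflexive (cong (P *_) (meet-comm v z))) (<⇒≤ (<ᵇ-true {P * meet z v} (proj₂ (∧-true {not (inA z)} b)))))

module _ (ω P : ℕ) .{{_ : NonZero P}} where

  private
    dbl : ∀ x → x + x ≡ 2 * x
    dbl = solve-∀

  near-bound : ∀ {o m a} H → 6 * H ≤ P → o ≤ m + a → P * a ≤ 3 * ω → ω ≤ H * o → ω ≤ 2 * H * m
  near-bound {o} {m} {a} H big le ha ho = *-cancelˡ-≤ P (+-cancelʳ-≤ (P * ω) _ _ (begin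
    P * ω + P * ω ≡⟨ dbl (P * ω) ⟩
    2 * (P * ω) ≤⟨ *-monoʳ-≤ 2 (*-monoʳ-≤ P (≤-trans ho (*-monoʳ-≤ H le))) ⟩
    2 * (P * (H * (m + a))) ≡⟨ a1 P H m a ⟩
    P * (2 * H * m) + 2 * H * (P * a) ≤⟨ +-monoʳ-≤ (P * (2 * H * m)) (≤-trans (*-monoʳ-≤ (2 * H) ha) (≤-trans (≤-reflexive (a2 H ω)) (*-monoˡ-≤ ω big))) ⟩
    P * (2 * H * m) + P * ω ∎))
    where
    a1 : ∀ p h m a → 2 * (p * (h * (m + a))) ≡ p * (2 * h * m) + 2 * h * (p * a)
    a1 = solve-∀
    a2 : ∀ h w → 2 * h * (3 * w) ≡ 6 * h * w
    a2 = solve-∀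

  within-bound : ∀ {m a a' s} → 30 ≤ P → ω ≤ m + a + a' + s → P * a ≤ 3 * ω → P * a' ≤ 3 * ω → 2 * P * s ≤ P * ω + 3 * ω → ω ≤ 4 * m
  within-bound {m} {a} {a'} {s} big le ha ha' hs = *-cancelˡ-≤ P (+-cancelʳ-≤ (3 * (P * ω)) _ _ (begin
    P * ω + 3 * (P * ω) ≡⟨ a0 P ω ⟩
    4 * (P * ω) ≤⟨ *-monoʳ-≤ 4 (*-monoʳ-≤ P le) ⟩
    4 * (P * (m + a + a' + s)) ≡⟨ a1 P m a a' s ⟩
    P * (4 * m) + 4 * (P * a) + 4 * (P * a') + 2 * (2 * P * s) ≤⟨ +-mono-≤ (+-mono-≤ (+-monoʳ-≤ (P * (4 * m)) (*-monoʳ-≤ 4 ha)) (*-monoʳ-≤ 4 ha')) (*-monoʳ-≤ 2 hs) ⟩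
    P * (4 * m) + 4 * (3 * ω) + 4 * (3 * ω) + 2 * (P * ω + 3 * ω) ≡⟨ a2 P m ω ⟩
    P * (4 * m) + 2 * (P * ω) + 30 * ω ≤⟨ +-monoʳ-≤ (P * (4 * m) + 2 * (P * ω)) (*-monoˡ-≤ ω big) ⟩
    P * (4 * m) + 2 * (P * ω) + P * ω ≡⟨ a3 (P * (4 * m)) (P * ω) ⟩
    P * (4 * m) + 3 * (P * ω) ∎))
    where
    a0 : ∀ p w → p * w + 3 * (p * w) ≡ 4 * (p * w)
    a0 = solve-∀
    a1 : ∀ p m a b s → 4 * (p * (m + a + b + s)) ≡ p * (4 * m) + 4 * (p * a) + 4 * (p * b) + 2 * (2 * p * s)
    a1 = solve-∀
    a2 : ∀ p m w → p * (4 * m) + 4 * (3 * w) + 4 * (3 * w) + 2 * (p * w + 3 * w) ≡ p * (4 * m) + 2 * (p * w) + 30 * w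
    a2 = solve-∀
    a3 : ∀ x y → x + 2 * y + y ≡ x + 3 * y
    a3 = solve-∀

  across-bound : ∀ {o m a a'} Q → 12 * Q ≤ P → o ≤ m + a + a' → P * a ≤ 3 * ω → P * a' ≤ 3 * ω → ω ≤ Q * o → ω ≤ 2 * Q * m
  across-bound {o} {m} {a} {a'} Q big le ha ha' ho = *-cancelˡ-≤ P (+-cancelʳ-≤ (P * ω) _ _ (begin
    P * ω + P * ω ≡⟨ dbl (P * ω) ⟩
    2 * (P * ω) ≤⟨ *-monoʳ-≤ 2 (*-monoʳ-≤ P (≤-trans ho (*-monoʳ-≤ Q le))) ⟩
    2 * (P * (Q * (m + a + a'))) ≡⟨ a1 P Q m a a' ⟩
    P * (2 * Q * m) + 2 * Q * (P * a + P * a') ≤⟨ +-monoʳ-≤ (P * (2 * Q * m)) (≤-trans (*-monoʳ-≤ (2 * Q) (+-mono-≤ ha ha')) (≤-trans (≤-reflexive (a2 Q ω)) (*-monoˡ-≤ ω big))) ⟩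
    P * (2 * Q * m) + P * ω ∎))
    where
    a1 : ∀ p h m a b → 2 * (p * (h * (m + a + b))) ≡ p * (2 * h * m) + 2 * h * (p * a + p * b)
    a1 = solve-∀
    a2 : ∀ h w → 2 * h * (3 * w + 3 * w) ≡ 12 * h * w
    a2 = solve-∀

record DichotomyData (A O : Set) : Set where
  constructor dichotomy-data
  field
    Ω : List O
    f : A → O → Bool
    e : ℕ
    e≥1 : 1 ≤ e
    half : ∀ x → e * length Ω ≤ e * (2 * ∑ Ω (λ o → ⟦ f x o ⟧)) + length Ω
    P : ℕ
    P≤e : P ≤ e
    Vs : List A
    ω>0 : 0 < length Ω
    P≥30 : 30 ≤ P
    u v : A
    few-paths : P * P * P * ∑ Vs (λ z → Overlap.meet Ω f e e≥1 half u z * Overlap.meet Ω f e e≥1 half z v) < length Vs * (length Ω * length Ω)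
    k Q : ℕ
    k≥1 : 1 ≤ k
    n>0 : 0 < length Vs
    P≥k : 6 * (144 * k) ≤ P
    P≥Q : 14 * Q ≤ P
    Q≥k : 2 * (144 * k) ≤ Q
    influence-large : 2 * (length Vs * length Vs * length Ω) ≤ 9 * k * ∑ Vs (λ x → ∑ Vs (λ y → Overlap.disagree Ω f e e≥1 half x y))

module Dichotomy {A O : Set} (data′ : DichotomyData A O) where

  open DichotomyData data′

  open Overlap Ω f e e≥1 half public
  open Scaled P P≤e public
  open Classes Ω f e e≥1 half P P≤e Vs ω>0 P≥30 u v few-paths public

  H : ℕ
  H = 144 * k

  private
    instance
      nzω : NonZero ω
      nzω = >-nonZero ω>0
      nzn : NonZero n
      nzn = >-nonZero n>0
      nzP : NonZero P
      nzP = >-nonZero (≤-trans (s≤s z≤n) P≥30)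
    144k≤P : 144 * k ≤ P
    144k≤P = ≤-trans (m≤n*m (144 * k) 6) P≥k

  product-large : n * n * ω ≤ 18 * k * (#A * #B * D)
  product-large = *-cancelˡ-≤ P (+-cancelʳ-≤ (P * (n * n * ω)) _ _ (begin
    P * (n * n * ω) + P * (n * n * ω) ≡⟨ a1 P (n * n * ω) ⟩
    P * (2 * (n * n * ω)) ≤⟨ *-monoʳ-≤ P influence-large ⟩
    P * (9 * k * Δ) ≡⟨ a2 P k Δ ⟩
    9 * k * (P * Δ) ≤⟨ *-monoʳ-≤ (9 * k) Δ≤ ⟩
    9 * k * (8 * (n * n * ω) + 2 * (P * D) * (#A * #B)) ≡⟨ a3 k (n * n * ω) P D (#A * #B) ⟩
    P * (18 * k * (#A * #B * D)) + 72 * k * (n * n * ω) ≤⟨ +-monoʳ-≤ (P * (18 * k * (#A * #B * D))) (*-monoˡ-≤ (n * n * ω) (≤-trans (*-monoˡ-≤ k (≤ᵇ⇒≤ 72 144 tt)) 144k≤P)) ⟩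
    P * (18 * k * (#A * #B * D)) + P * (n * n * ω) ∎))
    where
    a1 : ∀ p x → p * x + p * x ≡ p * (2 * x)
    a1 = solve-∀
    a2 : ∀ p k d → p * (9 * k * d) ≡ 9 * k * (p * d)
    a2 = solve-∀
    a3 : ∀ k x p d ab → 9 * k * (8 * x + 2 * (p * d) * ab) ≡ p * (18 * k * (ab * d)) + 72 * k * x
    a3 = solve-∀

  private
    #≤n : (p : A → Bool) → ∑ Vs (λ z → ⟦ p z ⟧) ≤ n
    #≤n p = ≤-trans (∑-≤-length Vs 1 (λ z → bool-≤1 (p z))) (≤-reflexive (*-identityʳ n))

  A-large : n ≤ 18 * k * #A
  A-large = *-cancelʳ-≤ _ _ (n * ω) {{m*n≢0 n ω}} (begin
    n * (n * ω) ≡⟨ sym (*-assoc n n ω) ⟩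
    n * n * ω ≤⟨ product-large ⟩
    18 * k * (#A * #B * D) ≤⟨ *-monoʳ-≤ (18 * k) (*-mono-≤ (*-monoʳ-≤ #A (#≤n inB)) (#≤ω _)) ⟩
    18 * k * (#A * n * ω) ≡⟨ a1 (18 * k) #A n ω ⟩
    18 * k * #A * (n * ω) ∎)
    where
    a1 : ∀ k a n w → k * (a * n * w) ≡ k * a * (n * w)
    a1 = solve-∀

  B-large : n ≤ 18 * k * #B
  B-large = *-cancelʳ-≤ _ _ (n * ω) {{m*n≢0 n ω}} (begin
    n * (n * ω) ≡⟨ sym (*-assoc n n ω) ⟩
    n * n * ω ≤⟨ product-large ⟩
    18 * k * (#A * #B * D) ≤⟨ *-monoʳ-≤ (18 * k) (*-mono-≤ (*-monoˡ-≤ #B (#≤n inA)) (#≤ω _)) ⟩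
    18 * k * (n * #B * ω) ≡⟨ a1 (18 * k) #B n ω ⟩
    18 * k * #B * (n * ω) ∎)
    where
    a1 : ∀ k b n w → k * (n * b * w) ≡ k * b * (n * w)
    a1 = solve-∀

  D-large : ω ≤ 18 * k * D
  D-large = *-cancelˡ-≤ (n * n) {{m*n≢0 n n}} (begin
    n * n * ω ≤⟨ product-large ⟩
    18 * k * (#A * #B * D) ≤⟨ *-monoʳ-≤ (18 * k) (*-monoˡ-≤ D (*-mono-≤ (#≤n inA) (#≤n inB))) ⟩
    18 * k * (n * n * D) ≡⟨ a1 (18 * k) (n * n) D ⟩
    n * n * (18 * k * D) ∎)
    where
    a1 : ∀ k x d → k * (x * d) ≡ x * (k * d)
    a1 = solve-∀

  private
    nonempty : (p : A → Bool) → n ≤ 18 * k * ∑ Vs (λ z → ⟦ p z ⟧) → Σ A λ z → p z ≡ true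
    nonempty p le with ∑-positive p Vs (*-cancelˡ-< (18 * k) 0 _ (≤-trans (≤-reflexive (cong suc (*-zeroʳ (18 * k)))) (≤-trans n>0 le)))
    ... | z , e , _ = z , e

  u-size : 2 * P * size u ≤ P * ω + 3 * ω
  u-size = A-size (proj₂ (nonempty inA A-large))

  v-size : 2 * P * size v ≤ P * ω + 3 * ω
  v-size = B-size (proj₂ (nonempty inB B-large))

  outer-large : ∀ x → ω ≤ 72 * k * (outer x u + outer x v)
  outer-large x = *-cancelˡ-≤ (4 * P) {{m*n≢0 4 P}} (+-cancelʳ-≤ (4 * (P * ω)) _ _ (begin
    4 * P * ω + 4 * (P * ω) ≡⟨ a0 P ω ⟩
    8 * P * ω ≤⟨ *-monoʳ-≤ (8 * P) D-large ⟩
    8 * P * (18 * k * D) ≡⟨ a1 P k D ⟩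
    72 * k * (2 * P * D) ≤⟨ *-monoʳ-≤ (72 * k) PD ⟩
    72 * k * (4 * P * (outer x u + outer x v) + 8 * ω) ≡⟨ a2 k P (outer x u + outer x v) ω ⟩
    4 * P * (72 * k * (outer x u + outer x v)) + 4 * (144 * k * ω) ≤⟨ +-monoʳ-≤ (4 * P * (72 * k * (outer x u + outer x v))) (*-monoʳ-≤ 4 (*-monoˡ-≤ ω 144k≤P)) ⟩
    4 * P * (72 * k * (outer x u + outer x v)) + 4 * (P * ω) ∎))
    where
    a0 : ∀ p w → 4 * p * w + 4 * (p * w) ≡ 8 * p * w
    a0 = solve-∀
    a1 : ∀ p k d → 8 * p * (18 * k * d) ≡ 72 * k * (2 * p * d)
    a1 = solve-∀
    a2 : ∀ k p o w → 72 * k * (4 * p * o + 8 * w) ≡ 4 * p * (72 * k * o) + 4 * (144 * k * w)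
    a2 = solve-∀
    a3 : ∀ p d s w → 2 * p * d + (2 * (p * w) + 4 * p * s) ≡ 2 * p * (2 * s + d) + 2 * (p * w)
    a3 = solve-∀
    a4 : ∀ p o s t → 2 * p * (2 * o + (s + t)) ≡ 4 * p * o + (2 * p * s + 2 * p * t)
    a4 = solve-∀
    a5 : ∀ p o w s → 4 * p * o + ((p * w + 3 * w) + (p * w + 3 * w)) + 2 * (2 * p * s + w) ≡ 4 * p * o + 8 * w + (2 * (p * w) + 4 * p * s)
    a5 = solve-∀
    PD : 2 * P * D ≤ 4 * P * (outer x u + outer x v) + 8 * ω
    PD = +-cancelʳ-≤ (2 * (P * ω) + 4 * P * size x) _ _ (begin
      2 * P * D + (2 * (P * ω) + 4 * P * size x) ≡⟨ a3 P D (size x) ω ⟩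
      2 * P * (2 * size x + D) + 2 * (P * ω) ≤⟨ +-mono-≤ (*-monoʳ-≤ (2 * P) (outer-sum x u v)) (*-monoʳ-≤ 2 (size≥ x)) ⟩
      2 * P * (2 * (outer x u + outer x v) + (size u + size v)) + 2 * (2 * P * size x + ω)
        ≡⟨ cong (_+ 2 * (2 * P * size x + ω)) (a4 P (outer x u + outer x v) (size u) (size v)) ⟩
      4 * P * (outer x u + outer x v) + (2 * P * size u + 2 * P * size v) + 2 * (2 * P * size x + ω)
        ≤⟨ +-monoˡ-≤ (2 * (2 * P * size x + ω)) (+-monoʳ-≤ (4 * P * (outer x u + outer x v)) (+-mono-≤ u-size v-size)) ⟩
      4 * P * (outer x u + outer x v) + ((P * ω + 3 * ω) + (P * ω + 3 * ω)) + 2 * (2 * P * size x + ω)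
        ≡⟨ a5 P (outer x u + outer x v) ω (size x) ⟩
      4 * P * (outer x u + outer x v) + 8 * ω + (2 * (P * ω) + 4 * P * size x) ∎)

  τ : A → Bool
  τ x = ω ≤ᵇ H * outer x u

  private
    ≤ᵇ-cases : ∀ a b → (a ≤ᵇ b) ≡ true × a ≤ b ⊎ (a ≤ᵇ b) ≡ false × b < a
    ≤ᵇ-cases a b with a ≤ᵇ b in eq
    ... | true = inj₁ (refl≡ , ≤ᵇ⇒≤ a b (true-T eq))
    ... | false = inj₂ (refl≡ , ≰⇒> λ le → case-absurd (trans≡ (sym eq) (T-true (≤⇒≤ᵇ le))))
      where
      case-absurd : false ≢ true
      case-absurd ()

  -- The class of typical vertices through which chains leave x.
  gate : Bool → A → Bool
  gate true = inA
  gate false = inB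

  gate-large : ∀ b → n ≤ 18 * k * ∑ Vs (λ z → ⟦ gate b z ⟧)
  gate-large true = A-large
  gate-large false = B-large

  near : ∀ x {z} → gate (τ x) z ≡ true → ω ≤ 2 * H * meet x z
  near x {z} = go (≤ᵇ-cases ω (H * outer x u))
    where
    go : (τ x ≡ true × ω ≤ H * outer x u) ⊎ (τ x ≡ false × H * outer x u < ω) → gate (τ x) z ≡ true → ω ≤ 2 * H * meet x z
    go (inj₁ (t , le)) g = near-bound ω P H P≥k (outer≤ x z u) (A-agree (subst (λ b → gate b z ≡ true) t g)) le
    go (inj₂ (t , lt)) g = near-bound ω P H P≥k (outer≤ x z v) (B-agree (subst (λ b → gate b z ≡ true) t g)) (+-cancelˡ-≤ ω _ _ (begin
      ω + ω ≡⟨ cong (ω +_) (sym (+-identityʳ ω)) ⟩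
      2 * ω ≤⟨ *-monoʳ-≤ 2 (outer-large x) ⟩
      2 * (72 * k * (outer x u + outer x v)) ≡⟨ a1 k (outer x u) (outer x v) ⟩
      H * outer x u + H * outer x v ≤⟨ +-monoˡ-≤ (H * outer x v) (<⇒≤ lt) ⟩
      ω + H * outer x v ∎))
      where
      a1 : ∀ k a b → 2 * (72 * k * (a + b)) ≡ 144 * k * a + 144 * k * b
      a1 = solve-∀

  within : ∀ b {z z'} → gate b z ≡ true → gate b z' ≡ true → ω ≤ 4 * meet z z'
  within true {z} {z'} a a' = within-bound ω P P≥30 (ω≤meet z z' u) (A-agree a) (A-agree a') u-size
  within false {z} {z'} b b' = within-bound ω P P≥30 (ω≤meet z z' v) (B-agree b) (B-agree b') v-size

  private
    12Q≤P : 12 * Q ≤ P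
    12Q≤P = ≤-trans (*-monoˡ-≤ Q (≤ᵇ⇒≤ 12 14 tt)) P≥Q

  connected : ω ≤ Q * outside-both u v → ∀ b b' {z z'} → gate b z ≡ true → gate b' z' ≡ true → ω ≤ 4 * Q * meet z z'
  connected big b b' {z} {z'} = go b b'
    where
    Q≥1 : 1 ≤ Q
    Q≥1 = ≤-trans (≤-trans k≥1 (≤-trans (m≤n*m k 144) (m≤n*m (144 * k) 2))) Q≥k
    from-within : ω ≤ 4 * meet z z' → ω ≤ 4 * Q * meet z z'
    from-within le = ≤-trans le (*-monoˡ-≤ (meet z z') (≤-trans (≤-reflexive (sym (*-identityʳ 4))) (*-monoʳ-≤ 4 Q≥1)))
    from-across : ω ≤ 2 * Q * meet z z' → ω ≤ 4 * Q * meet z z'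
    from-across le = ≤-trans le (*-monoˡ-≤ (meet z z') (*-monoˡ-≤ Q (≤ᵇ⇒≤ 2 4 tt)))
    go : ∀ b b' → gate b z ≡ true → gate b' z' ≡ true → ω ≤ 4 * Q * meet z z'
    go true true a a' = from-within (within true a a')
    go false false a a' = from-within (within false a a')
    go true false a b = from-across (across-bound ω P Q 12Q≤P (outside≤meet z z' u v) (A-agree a) (B-agree b) big)
    go false true b a = from-across (≤-trans (across-bound ω P Q 12Q≤P (outside≤meet z' z u v) (A-agree a) (B-agree b) big) (≤-reflexive (cong (2 * Q *_) (meet-comm z' z))))

  module TwoClasses (sparse : Q * outside-both u v < ω) where

    private
      instance
        nzQ : NonZero Q
        nzQ = >-nonZero (≤-trans (≤-trans k≥1 (≤-trans (m≤n*m k 144) (m≤n*m (144 * k) 2))) Q≥k)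

    A-type : ∀ {z} → inA z ≡ true → τ z ≡ true
    A-type {z} a = T-true (≤⇒≤ᵇ (≤-trans ω≤4 (*-monoˡ-≤ (outer z u) (≤-trans (≤-trans (≤ᵇ⇒≤ 4 144 tt) (≤-reflexive (sym (*-identityʳ 144)))) (*-monoʳ-≤ 144 k≥1)))))
      where
      a1 : ∀ p s w → p * w + p * w ≡ 2 * (p * w)
      a1 = solve-∀
      a2 : ∀ p o m w → 2 * (2 * p * (o + m) + w) ≡ p * (4 * o) + 4 * (p * m) + 2 * w
      a2 = solve-∀
      a3 : ∀ x w → x + 4 * w + 2 * w ≡ x + 6 * w
      a3 = solve-∀
      ω≤4 : ω ≤ 4 * outer z u
      ω≤4 = *-cancelˡ-≤ P (+-cancelʳ-≤ (P * ω) _ _ (begin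
        P * ω + P * ω ≡⟨ a1 P (size z) ω ⟩
        2 * (P * ω) ≤⟨ *-monoʳ-≤ 2 (≤-trans (size≥ z) (+-monoˡ-≤ ω (*-monoʳ-≤ (2 * P) (size≤outer z u)))) ⟩
        2 * (2 * P * (outer z u + meet u z) + ω) ≡⟨ a2 P (outer z u) (meet u z) ω ⟩
        P * (4 * outer z u) + 4 * (P * meet u z) + 2 * ω ≤⟨ +-monoˡ-≤ (2 * ω) (+-monoʳ-≤ (P * (4 * outer z u)) (*-monoʳ-≤ 4 (<⇒≤ (<ᵇ-true {P * meet u z} {ω} a)))) ⟩
        P * (4 * outer z u) + 4 * ω + 2 * ω ≡⟨ a3 (P * (4 * outer z u)) ω ⟩
        P * (4 * outer z u) + 6 * ω ≤⟨ +-monoʳ-≤ (P * (4 * outer z u)) (*-monoˡ-≤ ω (≤-trans (≤ᵇ⇒≤ 6 30 tt) P≥30)) ⟩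
        P * (4 * outer z u) + P * ω ∎))

    B-type : ∀ {z} → inB z ≡ true → τ z ≡ false
    B-type {z} b = go (≤ᵇ-cases ω (H * outer z u))
      where
      a1 : ∀ p q h o → 4 * (p * q * (h * o)) ≡ 4 * h * (p * q * o)
      a1 = solve-∀
      a2 : ∀ p q h o a → 4 * h * (p * q * (o + a)) ≡ 2 * (2 * h) * (p * (q * o)) + 4 * h * q * (p * a)
      a2 = solve-∀
      a3 : ∀ p q h w → 2 * (2 * h) * (p * w) + 4 * h * q * (3 * w) ≡ 2 * (2 * h) * p * w + 2 * (6 * h) * q * w
      a3 = solve-∀
      a4 : ∀ p q w → 2 * q * p * w + 2 * p * q * w ≡ 4 * (p * q * w)
      a4 = solve-∀
      lt : H * outer z u < ω
      lt = *-cancelˡ-< (4 * (P * Q)) _ _ (begin-strict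
        4 * (P * Q) * (H * outer z u) ≡⟨ trans≡ (*-assoc 4 (P * Q) _) (a1 P Q H (outer z u)) ⟩
        4 * H * (P * Q * outer z u) ≤⟨ *-monoʳ-≤ (4 * H) (*-monoʳ-≤ (P * Q) (outer≤outside z u v)) ⟩
        4 * H * (P * Q * (outside-both u v + agree z v)) ≡⟨ a2 P Q H (outside-both u v) (agree z v) ⟩
        2 * (2 * H) * (P * (Q * outside-both u v)) + 4 * H * Q * (P * agree z v)
          <⟨ +-mono-<-≤ (*-monoʳ-< (2 * (2 * H)) {{H-nz}} (*-monoʳ-< P sparse)) (*-monoʳ-≤ (4 * H * Q) (B-agree b)) ⟩
        2 * (2 * H) * (P * ω) + 4 * H * Q * (3 * ω) ≡⟨ a3 P Q H ω ⟩
        2 * (2 * H) * P * ω + 2 * (6 * H) * Q * ω ≤⟨ +-mono-≤ (*-monoˡ-≤ ω (*-monoˡ-≤ P (*-monoʳ-≤ 2 Q≥k))) (*-monoˡ-≤ ω (*-monoˡ-≤ Q (*-monoʳ-≤ 2 P≥k))) ⟩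
        2 * Q * P * ω + 2 * P * Q * ω ≡⟨ trans≡ (a4 P Q ω) (sym (*-assoc 4 (P * Q) ω)) ⟩
        4 * (P * Q) * ω ∎)
        where
        H-nz : NonZero (2 * (2 * H))
        H-nz = >-nonZero (≤-trans k≥1 (≤-trans (m≤n*m k 144) (≤-trans (m≤n*m H 2) (m≤n*m (2 * H) 2))))
      go : (τ z ≡ true × ω ≤ H * outer z u) ⊎ (τ z ≡ false × H * outer z u < ω) → τ z ≡ false
      go (inj₁ (_ , le)) = ⊥-elim (<⇒≱ lt le)
      go (inj₂ (e , _)) = e

    err : A → A → ℕ
    err x y = # (λ o → (f x o xor f y o) xor (τ x xor τ y))

    private
      err-same : ∀ {x y} → (τ x xor τ y) ≡ false → err x y ≡ disagree x y
      err-same {x} {y} e = ∑-cong Ω (λ o → cong ⟦_⟧ (trans≡ (cong ((f x o xor f y o) xor_) e) (xor-identityʳ (f x o xor f y o))))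
      err-diff : ∀ {x y} → (τ x xor τ y) ≡ true → err x y ≡ agree x y
      err-diff {x} {y} e = ∑-cong Ω (λ o → cong ⟦_⟧ (trans≡ (cong ((f x o xor f y o) xor_) e) (xor-true (f x o xor f y o))))
        where
        xor-true : ∀ a → a xor true ≡ not a
        xor-true true = refl≡
        xor-true false = refl≡
      β : ℕ
      β = 2 * P * outside-both u v + 3 * ω
      P-agree : P * agree u v ≤ β
      P-agree = *-cancelˡ-≤ 2 (+-cancelʳ-≤ (2 * (P * ω)) _ _ (begin
        2 * (P * agree u v) + 2 * (P * ω) ≡⟨ a1 P (agree u v) ω ⟩
        2 * P * (agree u v + ω) ≤⟨ *-monoʳ-≤ (2 * P) (agree+ω u v) ⟩
        2 * P * (2 * outside-both u v + (size u + size v)) ≡⟨ a2 P (outside-both u v) (size u) (size v) ⟩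
        4 * P * outside-both u v + (2 * P * size u + 2 * P * size v) ≤⟨ +-monoʳ-≤ (4 * P * outside-both u v) (+-mono-≤ u-size v-size) ⟩
        4 * P * outside-both u v + ((P * ω + 3 * ω) + (P * ω + 3 * ω)) ≡⟨ a3 P (outside-both u v) ω ⟩
        2 * β + 2 * (P * ω) ∎))
        where
        a1 : ∀ p a w → 2 * (p * a) + 2 * (p * w) ≡ 2 * p * (a + w)
        a1 = solve-∀
        a2 : ∀ p o s t → 2 * p * (2 * o + (s + t)) ≡ 4 * p * o + (2 * p * s + 2 * p * t)
        a2 = solve-∀
        a3 : ∀ p o w → 4 * p * o + ((p * w + 3 * w) + (p * w + 3 * w)) ≡ 2 * (2 * p * o + 3 * w) + 2 * (p * w)
        a3 = solve-∀
      two : ∀ {x y z} → P * x ≤ 3 * ω → P * y ≤ 3 * ω → z ≤ x + y → P * z ≤ 6 * ω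
      two {x} {y} hx hy hz = ≤-trans (*-monoʳ-≤ P hz) (≤-trans (≤-reflexive (*-distribˡ-+ P x y)) (≤-trans (+-mono-≤ hx hy) (≤-reflexive (a1 ω))))
        where
        a1 : ∀ w → 3 * w + 3 * w ≡ 6 * w
        a1 = solve-∀
      three : ∀ {x y z t} → P * x ≤ 3 * ω → P * y ≤ 3 * ω → P * t ≤ β → z ≤ x + y + t → P * z ≤ 6 * ω + β
      three {x} {y} {z} {t} hx hy ht hz = ≤-trans (*-monoʳ-≤ P hz) (≤-trans (≤-reflexive (*-distribˡ-+ P (x + y) t)) (+-mono-≤ (two hx hy ≤-refl) ht))
      agree-comm : agree v u ≡ agree u v
      agree-comm = ∑-cong Ω (λ o → cong ⟦_⟧ (same-comm (f v o) (f u o)))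
        where
        same-comm : ∀ a b → same a b ≡ same b a
        same-comm true true = refl≡
        same-comm true false = refl≡
        same-comm false true = refl≡
        same-comm false false = refl≡

    err-sum : Q * ∑ Vs (λ x → ∑ Vs (λ y → err x y)) ≤ 5 * (n * n * ω)
    err-sum = *-cancelˡ-≤ P (begin
      P * (Q * ∑ Vs (λ x → ∑ Vs (λ y → err x y)))
        ≡⟨ a1 P Q _ ⟩
      Q * (P * ∑ Vs (λ x → ∑ Vs (λ y → err x y)))
        ≤⟨ *-monoʳ-≤ Q (pair-bound err (6 * ω) β (λ x y → #≤ω _)
             (λ {x} {y} a b → ≤-trans (≤-reflexive (cong (P *_) (err-same (cong₂ _xor_ (A-type a) (A-type b))))) (two (A-agree a) (A-agree b) (disagree-via x u y)))
             (λ {x} {y} a b → ≤-trans (≤-reflexive (cong (P *_) (err-same (cong₂ _xor_ (B-type a) (B-type b))))) (two (B-agree a) (B-agree b) (disagree-via x v y)))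
             (λ {x} {y} a b → ≤-trans (≤-reflexive (cong (P *_) (err-diff (cong₂ _xor_ (A-type a) (B-type b))))) (three (A-agree a) (B-agree b) P-agree (agree-via₂ x y u v)))
             (λ {x} {y} b a → ≤-trans (≤-reflexive (cong (P *_) (err-diff (cong₂ _xor_ (B-type b) (A-type a))))) (three (B-agree b) (A-agree a) (≤-trans (≤-reflexive (cong (P *_) agree-comm)) P-agree) (agree-via₂ x y v u)))) ⟩
      Q * (n * n * (6 * ω) + 2 * (n * n * ω) + 2 * β * (#A * #B))
        ≤⟨ *-monoʳ-≤ Q (+-monoʳ-≤ (n * n * (6 * ω) + 2 * (n * n * ω)) (*-monoʳ-≤ (2 * β) (*-mono-≤ (#≤n inA) (#≤n inB)))) ⟩
      Q * (n * n * (6 * ω) + 2 * (n * n * ω) + 2 * β * (n * n))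
        ≡⟨ a2 Q (n * n) ω P (outside-both u v) ⟩
      14 * Q * (n * n * ω) + 4 * P * (Q * outside-both u v) * (n * n)
        ≤⟨ +-mono-≤ (*-monoˡ-≤ (n * n * ω) P≥Q) (*-monoˡ-≤ (n * n) (*-monoʳ-≤ (4 * P) (<⇒≤ sparse))) ⟩
      P * (n * n * ω) + 4 * P * ω * (n * n)
        ≡⟨ a3 P (n * n) ω ⟩
      P * (5 * (n * n * ω)) ∎)
      where
      a1 : ∀ p q s → p * (q * s) ≡ q * (p * s)
      a1 = solve-∀
      a2 : ∀ q n w p o → q * (n * (6 * w) + 2 * (n * w) + 2 * (2 * p * o + 3 * w) * n) ≡ 14 * q * (n * w) + 4 * p * (q * o) * n
      a2 = solve-∀
      a3 : ∀ p n w → p * (n * w) + 4 * p * w * n ≡ p * (5 * (n * w))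
      a3 = solve-∀

parity : {A : Set} → (A → Bool) → List A → Bool
parity τ [] = false
parity τ (x ∷ xs) = τ x xor parity τ xs

xor-left-comm : ∀ a b c → a xor (b xor c) ≡ b xor (a xor c)
xor-left-comm true true c = refl≡
xor-left-comm true false c = refl≡
xor-left-comm false true c = refl≡
xor-left-comm false false c = refl≡

parity-↭ : {A : Set} (τ : A → Bool) {xs ys : List A} → xs ↭ ys → parity τ xs ≡ parity τ ys
parity-↭ τ refl = refl≡
parity-↭ τ (prep x p) = cong (τ x xor_) (parity-↭ τ p)
parity-↭ τ {_ ∷ _ ∷ xs} (swap x y p) = trans≡ (xor-left-comm (τ x) (τ y) _) (cong (λ z → τ y xor (τ x xor z)) (parity-↭ τ p))
parity-↭ τ (trans p q) = trans≡ (parity-↭ τ p) (parity-↭ τ q)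

search : {X : Set} (p : X → Bool) (xs : List X) → (Σ X λ x → p x ≡ true) ⊎ (∀ x → x ∈ˡ xs → p x ≡ false)
search p [] = inj₂ (λ _ ())
search p (x ∷ xs) = go (p x) refl≡ (search p xs)
  where
  go : ∀ b → p x ≡ b → (Σ _ λ x → p x ≡ true) ⊎ (∀ x → x ∈ˡ xs → p x ≡ false) → (Σ _ λ x → p x ≡ true) ⊎ (∀ y → y ∈ˡ x ∷ xs → p y ≡ false)
  go true e _ = inj₁ (x , e)
  go false e (inj₁ r) = inj₁ r
  go false e (inj₂ r) = inj₂ λ { y (here refl≡) → e ; y (there m) → r y m }

module StructureTheorem {A C : Set} (k' : ℕ) (h : C → List A → Bool) (h-sym : ∀ c → SymFun (h c))
  (Vs : List A) (Cs : List C) (all-Vs : ∀ x → x ∈ˡ Vs) (n>0 : 0 < length Vs) (m>0 : 0 < length Cs) where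

  private
    k n m T : ℕ
    k = suc k'
    n = length Vs
    m = length Cs
    T = n ^ k
    instance
      nzn : NonZero n
      nzn = >-nonZero n>0
      nzm : NonZero m
      nzm = >-nonZero m>0
      nzT : NonZero T
      nzT = m^n≢0 n k
      nzp : NonZero (n ^ k')
      nzp = m^n≢0 n k'

  module G (τ : A → Bool) = Gadgets k' h τ Vs Cs

  -- j, K, K₂, K₃, γ measure, in this order, the length and density of chains, the density of matching edges,
  -- the sizes of the two types, and the number of atypical colours.
  record Structure (j K K₂ K₃ γ : ℕ) : Set where
    field
      τ : A → Bool
      I : C → Bool
      typ : C → Bool
      close : G.Close τ j K
      robust : ∀ c S → typ c ≡ true → length S ≡ k → parity τ S ≡ I c → G.Robust τ K₂ (c , S)
      few : γ * ∑ Cs (λ c → ⟦ not (typ c) ⟧) ≤ m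
      types : ((∀ x → τ x ≡ false) × (∀ c → I c ≡ false)) ⊎ (n ≤ K₃ * ∑ Vs (λ x → ⟦ τ x ⟧) × n ≤ K₃ * ∑ Vs (λ x → ⟦ not (τ x) ⟧))

  module _ (e : ℕ) (half₁ : ∀ c x → e * n ^ k' ≤ e * (2 * ∑ (tuples Vs k') (λ w → ⟦ h c (x ∷ w) ⟧)) + n ^ k') (e≥3 : 3 ≤ e) where

    private
      instance
        nze : NonZero e
        nze = >-nonZero (≤-trans (s≤s z≤n) e≥3)
      Ω : List (C × List A)
      Ω = pairs Cs (tuples Vs k')
      f : A → C × List A → Bool
      f x o = h (proj₁ o) (x ∷ proj₂ o)
      ω : ℕ
      ω = length Ω
      ω≡ : ω ≡ m * n ^ k'
      ω≡ = trans≡ (length-pairs Cs _) (cong (m *_) (length-tuples Vs k'))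
      ω>0 : 0 < ω
      ω>0 = subst (0 <_) (sym ω≡) (>-nonZero⁻¹ (m * n ^ k') {{m*n≢0 m (n ^ k')}})
      half : ∀ x → e * ω ≤ e * (2 * ∑ Ω (λ o → ⟦ f x o ⟧)) + ω
      half x = begin
        e * ω ≡⟨ trans≡ (cong (e *_) ω≡) (a1 e m (n ^ k')) ⟩
        m * (e * n ^ k') ≡⟨ sym (∑-const Cs _) ⟩
        ∑ Cs (λ c → e * n ^ k') ≤⟨ ∑-mono Cs (λ c → half₁ c x) ⟩
        ∑ Cs (λ c → e * (2 * ∑ (tuples Vs k') (λ w → ⟦ h c (x ∷ w) ⟧)) + n ^ k')
          ≡⟨ trans≡ (∑-add Cs _ _) (cong₂ _+_ (trans≡ (∑-scale Cs e _) (cong (e *_) (∑-scale Cs 2 _))) (∑-const Cs _)) ⟩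
        e * (2 * ∑ Cs (λ c → ∑ (tuples Vs k') (λ w → ⟦ h c (x ∷ w) ⟧))) + m * n ^ k'
          ≡⟨ sym (cong₂ (λ a b → e * (2 * a) + b) (∑-pairs Cs (tuples Vs k') _) ω≡) ⟩
        e * (2 * ∑ Ω (λ o → ⟦ f x o ⟧)) + ω ∎
        where
        a1 : ∀ e m p → e * (m * p) ≡ m * (e * p)
        a1 = solve-∀
      e≥1 : 1 ≤ e
      e≥1 = ≤-trans (s≤s z≤n) e≥3

    open Overlap Ω f e e≥1 half using (meet; disagree; meet-comm; outside-both)

    private
      edges-of : C → ℕ
      edges-of c = ∑ (tuples Vs k) (λ t → ⟦ h c t ⟧)

    edges-many : ∀ c → T ≤ 3 * edges-of c
    edges-many c = *-cancelˡ-≤ (2 * e) {{m*n≢0 2 e}} (+-cancelʳ-≤ (e * T) _ _ (begin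
      2 * e * T + e * T ≡⟨ a1 e T ⟩
      3 * (e * T) ≤⟨ *-monoʳ-≤ 3 total ⟩
      3 * (e * (2 * edges-of c) + T) ≡⟨ a2 e (edges-of c) T ⟩
      2 * e * (3 * edges-of c) + 3 * T ≤⟨ +-monoʳ-≤ (2 * e * (3 * edges-of c)) (*-monoˡ-≤ T e≥3) ⟩
      2 * e * (3 * edges-of c) + e * T ∎))
      where
      a1 : ∀ e t → 2 * e * t + e * t ≡ 3 * (e * t)
      a1 = solve-∀
      a2 : ∀ e s t → 3 * (e * (2 * s) + t) ≡ 2 * e * (3 * s) + 3 * t
      a2 = solve-∀
      a3 : ∀ e n p → e * (n * p) ≡ n * (e * p)
      a3 = solve-∀
      total : e * T ≤ e * (2 * edges-of c) + T
      total = begin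
        e * T ≡⟨ a3 e n (n ^ k') ⟩
        n * (e * n ^ k') ≡⟨ sym (∑-const Vs _) ⟩
        ∑ Vs (λ x → e * n ^ k') ≤⟨ ∑-mono Vs (half₁ c) ⟩
        ∑ Vs (λ x → e * (2 * ∑ (tuples Vs k') (λ w → ⟦ h c (x ∷ w) ⟧)) + n ^ k')
          ≡⟨ trans≡ (∑-add Vs _ _) (cong₂ _+_ (trans≡ (∑-scale Vs e _) (cong (e *_) (∑-scale Vs 2 _))) (∑-const Vs _)) ⟩
        e * (2 * ∑ Vs (λ x → ∑ (tuples Vs k') (λ w → ⟦ h c (x ∷ w) ⟧))) + T
          ≡⟨ cong (λ s → e * (2 * s) + T) (sym (∑-tuples-suc Vs k' _)) ⟩
        e * (2 * edges-of c) + T ∎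

    private
      mT : m * T ≡ n * ω
      mT = trans≡ (a1 m n (n ^ k')) (cong (n *_) (sym ω≡))
        where
        a1 : ∀ m n p → m * (n * p) ≡ n * (m * p)
        a1 = solve-∀

      ∑-edges : ∑ Cs edges-of ≡ ∑ Vs (λ x → ∑ Ω (λ o → ⟦ f x o ⟧))
      ∑-edges = trans≡ (∑-cong Cs (λ c → ∑-tuples-suc Vs k' _)) (trans≡ (∑-swap Cs Vs _) (∑-cong Vs (λ x → sym (∑-pairs Cs (tuples Vs k') _))))

      pairs-swap : (F : C → List A → A → A → ℕ) → ∑ Cs (λ c → ∑ Vs λ x → ∑ Vs λ y → ∑ (tuples Vs k') λ w → F c w x y) ≡ ∑ Vs (λ x → ∑ Vs λ y → ∑ Ω (λ o → F (proj₁ o) (proj₂ o) x y))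
      pairs-swap F = trans≡ (∑-swap Cs Vs _) (∑-cong Vs (λ x → trans≡ (∑-swap Cs Vs _) (∑-cong Vs (λ y → sym (∑-pairs Cs (tuples Vs k') _)))))

    influence-large : 3 * ∑ Vs (λ x → ∑ Ω (λ o → ⟦ f x o ⟧)) ≤ 2 * (n * ω) → 2 * (n * n * ω) ≤ 9 * k * ∑ Vs (λ x → ∑ Vs (λ y → disagree x y))
    influence-large sizes = *-cancelˡ-≤ (n ^ k') (+-cancelʳ-≤ (4 * (T * (n * ω))) _ _ (begin
      n ^ k' * (2 * (n * n * ω)) + 4 * (T * (n * ω))
        ≡⟨ a1 (n ^ k') n ω ⟩
      6 * (T * (n * ω))
        ≡⟨ trans≡ (cong (λ z → 6 * (T * z)) (sym mT)) (a2 T m) ⟩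
      3 * (m * (2 * (T * T)))
        ≡⟨ cong (3 *_) (sym (∑-const Cs _)) ⟩
      3 * ∑ Cs (λ c → 2 * (T * T))
        ≤⟨ *-monoʳ-≤ 3 (∑-mono Cs per-colour) ⟩
      3 * ∑ Cs (λ c → 3 * (k * (n ^ k' * influence Vs k' (h c))) + 2 * (T * edges-of c))
        ≡⟨ cong (3 *_) (trans≡ (∑-add Cs _ _) (cong₂ _+_ (trans≡ (∑-scale Cs 3 _) (cong (3 *_) (trans≡ (∑-scale Cs k _) (cong (k *_) (∑-scale Cs (n ^ k') _)))))
             (trans≡ (∑-scale Cs 2 _) (cong (2 *_) (∑-scale Cs T _))))) ⟩
      3 * (3 * (k * (n ^ k' * ∑ Cs (λ c → influence Vs k' (h c)))) + 2 * (T * ∑ Cs edges-of))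
        ≡⟨ cong₂ (λ a b → 3 * (3 * (k * (n ^ k' * a)) + 2 * (T * b))) (pairs-swap (λ c w x y → ne (h c (x ∷ w)) (h c (y ∷ w)))) ∑-edges ⟩
      3 * (3 * (k * (n ^ k' * Δ)) + 2 * (T * Σs))
        ≡⟨ a3 k (n ^ k') Δ T Σs ⟩
      n ^ k' * (9 * k * Δ) + 2 * (T * (3 * Σs))
        ≤⟨ +-monoʳ-≤ (n ^ k' * (9 * k * Δ)) (*-monoʳ-≤ 2 (*-monoʳ-≤ T sizes)) ⟩
      n ^ k' * (9 * k * Δ) + 2 * (T * (2 * (n * ω)))
        ≡⟨ cong (n ^ k' * (9 * k * Δ) +_) (a4 T (n * ω)) ⟩
      n ^ k' * (9 * k * Δ) + 4 * (T * (n * ω)) ∎))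
      where
      Δ = ∑ Vs (λ x → ∑ Vs (λ y → disagree x y))
      Σs = ∑ Vs (λ x → ∑ Ω (λ o → ⟦ f x o ⟧))
      a1 : ∀ p n w → p * (2 * (n * n * w)) + 4 * (n * p * (n * w)) ≡ 6 * (n * p * (n * w))
      a1 = solve-∀
      a2 : ∀ t m → 6 * (t * (m * t)) ≡ 3 * (m * (2 * (t * t)))
      a2 = solve-∀
      a3 : ∀ k p d t s → 3 * (3 * (k * (p * d)) + 2 * (t * s)) ≡ p * (9 * k * d) + 2 * (t * (3 * s))
      a3 = solve-∀
      a4 : ∀ t x → 2 * (t * (2 * x)) ≡ 4 * (t * x)
      a4 = solve-∀
      b1 : ∀ S R → 2 * ((S + R) * (S + R)) ≡ 2 * R * (S + R) + 2 * ((S + R) * S)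
      b1 = solve-∀
      b2 : ∀ D S R → D + 2 * (S * S) ≡ 2 * ((S + R) * S) → D ≡ 2 * (R * S)
      b2 D S R eq = +-cancelʳ-≡ (2 * (S * S)) _ _ (trans≡ eq (b3 S R))
        where
        b3 : ∀ S R → 2 * ((S + R) * S) ≡ 2 * (R * S) + 2 * (S * S)
        b3 = solve-∀
      b4 : ∀ R S → 2 * R * (3 * S) ≡ 3 * (2 * (R * S))
      b4 = solve-∀
      per : ∀ D S T' R → S + R ≡ T' → D + 2 * (S * S) ≡ 2 * (T' * S) → T' ≤ 3 * S → 2 * (T' * T') ≤ 3 * D + 2 * (T' * S)
      per D S _ R refl≡ eq le = begin
        2 * ((S + R) * (S + R)) ≡⟨ b1 S R ⟩
        2 * R * (S + R) + 2 * ((S + R) * S) ≤⟨ +-monoˡ-≤ (2 * ((S + R) * S)) (*-monoʳ-≤ (2 * R) le) ⟩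
        2 * R * (3 * S) + 2 * ((S + R) * S) ≡⟨ cong (_+ 2 * ((S + R) * S)) (trans≡ (b4 R S) (cong (3 *_) (sym (b2 D S R eq)))) ⟩
        3 * D + 2 * ((S + R) * S) ∎
      per-colour : ∀ c → 2 * (T * T) ≤ 3 * (k * (n ^ k' * influence Vs k' (h c))) + 2 * (T * edges-of c)
      per-colour c = ≤-trans (per (differ Vs k (h c)) (edges-of c) T (T ∸ edges-of c) (m+[n∸m]≡n edges≤) (differ-count Vs k (h c)) (edges-many c))
        (+-monoˡ-≤ (2 * (T * edges-of c)) (*-monoʳ-≤ 3 (differ≤influence Vs k' (h c) (h-sym c))))
        where
        edges≤ : edges-of c ≤ T
        edges≤ = ≤-trans (∑-≤-length (tuples Vs k) 1 (λ t → bool-≤1 (h c t))) (≤-reflexive (trans≡ (*-identityʳ _) (length-tuples Vs k)))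

    private
      common≡meet : ∀ τ x z → G.common τ x z ≡ meet x z
      common≡meet τ x z = sym (∑-pairs Cs (tuples Vs k') _)

      𝔹≡ : ∀ τ → length (G.𝔹 τ) ≡ n * ω
      𝔹≡ τ = trans≡ (G.length-𝔹 τ) mT

      reach₁ : ∀ τ x φ → G.reach τ 1 x φ ≡ ∑ Vs (λ y → meet x y * φ y)
      reach₁ τ x φ = trans≡ (G.reach-suc τ 0 x φ) (∑-cong Vs (λ y → cong₂ _*_ (common≡meet τ x y) (G.reach-zero τ y φ)))

      reach₂ : ∀ τ x φ → G.reach τ 2 x φ ≡ ∑ Vs (λ y → ∑ Vs (λ z → meet x z * meet z y) * φ y)
      reach₂ τ x φ = begin-equality
        G.reach τ 2 x φ
          ≡⟨ trans≡ (G.reach-suc τ 1 x φ) (∑-cong Vs (λ z → trans≡ (cong₂ _*_ (common≡meet τ x z) (reach₁ τ z φ)) (sym (∑-scale Vs (meet x z) _)))) ⟩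
        ∑ Vs (λ z → ∑ Vs (λ y → meet x z * (meet z y * φ y)))
          ≡⟨ trans≡ (∑-swap Vs Vs _) (∑-cong Vs (λ y → trans≡ (∑-cong Vs (λ z → sym (*-assoc (meet x z) (meet z y) (φ y)))) (∑-scaleʳ Vs _ (φ y)))) ⟩
        ∑ Vs (λ y → ∑ Vs (λ z → meet x z * meet z y) * φ y) ∎

      reach₃ : ∀ τ x φ → G.reach τ 3 x φ ≡ ∑ Vs (λ y → ∑ Vs (λ z → meet x z * ∑ Vs (λ z' → meet z z' * meet z' y)) * φ y)
      reach₃ τ x φ = begin-equality
        G.reach τ 3 x φ
          ≡⟨ trans≡ (G.reach-suc τ 2 x φ) (∑-cong Vs (λ z → trans≡ (cong₂ _*_ (common≡meet τ x z) (reach₂ τ z φ)) (sym (∑-scale Vs (meet x z) _)))) ⟩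
        ∑ Vs (λ z → ∑ Vs (λ y → meet x z * (∑ Vs (λ z' → meet z z' * meet z' y) * φ y)))
          ≡⟨ trans≡ (∑-swap Vs Vs _) (∑-cong Vs (λ y → trans≡ (∑-cong Vs (λ z → sym (*-assoc (meet x z) _ (φ y)))) (∑-scaleʳ Vs _ (φ y)))) ⟩
        ∑ Vs (λ y → ∑ Vs (λ z → meet x z * ∑ Vs (λ z' → meet z z' * meet z' y)) * φ y) ∎

    -- W x y counts the chains from x to y.
    close-from : ∀ τ j K (W : A → A → ℕ) → (∀ x φ → G.reach τ (suc j) x φ ≡ ∑ Vs (λ y → W x y * φ y)) →
      (∀ x y → same (τ x) (τ y) ≡ true → n ^ j * ω ^ suc j ≤ K * W x y) → G.Close τ (suc j) K
    close-from τ j K W reach≡ dense x φ = begin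
      length (G.𝔹 τ) ^ suc j * ∑ Vs (λ y → ⟦ same (τ x) (τ y) ⟧ * φ y)
        ≡⟨ cong (λ z → z ^ suc j * ∑ Vs (λ y → ⟦ same (τ x) (τ y) ⟧ * φ y)) (𝔹≡ τ) ⟩
      (n * ω) ^ suc j * ∑ Vs (λ y → ⟦ same (τ x) (τ y) ⟧ * φ y)
        ≡⟨ trans≡ (cong (_* ∑ Vs (λ y → ⟦ same (τ x) (τ y) ⟧ * φ y)) (trans≡ (^-distrib-* n ω (suc j)) (*-assoc n (n ^ j) _))) (trans≡ (*-assoc n _ _) (cong (n *_) (sym (∑-scale Vs (n ^ j * ω ^ suc j) (λ y → ⟦ same (τ x) (τ y) ⟧ * φ y))))) ⟩
      n * ∑ Vs (λ y → n ^ j * ω ^ suc j * (⟦ same (τ x) (τ y) ⟧ * φ y))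
        ≤⟨ *-monoʳ-≤ n (∑-mono Vs (λ y → pt y (same (τ x) (τ y)) refl≡)) ⟩
      n * ∑ Vs (λ y → K * (W x y * φ y))
        ≡⟨ trans≡ (cong (n *_) (trans≡ (∑-scale Vs K _) (cong (K *_) (sym (reach≡ x φ))))) (a1 n K _) ⟩
      K * n * G.reach τ (suc j) x φ ∎
      where
      a1 : ∀ n k r → n * (k * r) ≡ k * n * r
      a1 = solve-∀
      pt : ∀ y b → same (τ x) (τ y) ≡ b → n ^ j * ω ^ suc j * (⟦ b ⟧ * φ y) ≤ K * (W x y * φ y)
      pt y true e = ≤-trans (≤-reflexive (cong (n ^ j * ω ^ suc j *_) (+-identityʳ (φ y)))) (≤-trans (*-monoˡ-≤ (φ y) (dense x y e)) (≤-reflexive (*-assoc K _ (φ y))))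
      pt y false e = ≤-trans (≤-reflexive (*-zeroʳ (n ^ j * ω ^ suc j))) z≤n

    chain₃ : ∀ {x y} (g g' : A → Bool) (a b c d : ℕ) → n ≤ d * ∑ Vs (λ z → ⟦ g z ⟧) → n ≤ d * ∑ Vs (λ z → ⟦ g' z ⟧) →
      (∀ {z} → g z ≡ true → ω ≤ a * meet x z) → (∀ {z z'} → g z ≡ true → g' z' ≡ true → ω ≤ b * meet z z') → (∀ {z} → g' z ≡ true → ω ≤ c * meet z y) →
      n ^ 2 * ω ^ 3 ≤ d * d * (a * b * c) * ∑ Vs (λ z → meet x z * ∑ Vs (λ z' → meet z z' * meet z' y))
    chain₃ {x} {y} g g' a b c d lg lg' hx hz hy = begin
      n ^ 2 * ω ^ 3
        ≡⟨ a1 n ω ⟩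
      n * n * (ω * (ω * ω))
        ≤⟨ *-monoˡ-≤ (ω * (ω * ω)) (*-mono-≤ lg lg') ⟩
      d * ∑ Vs (λ z → ⟦ g z ⟧) * (d * ∑ Vs (λ z → ⟦ g' z ⟧)) * (ω * (ω * ω))
        ≡⟨ trans≡ (a2 d (∑ Vs (λ z → ⟦ g z ⟧)) (∑ Vs (λ z → ⟦ g' z ⟧)) (ω * (ω * ω))) (cong (λ s → d * d * (s * (ω * (ω * ω)))) (sym (∑-prod Vs Vs _ _))) ⟩
      d * d * (∑ Vs (λ z → ∑ Vs (λ z' → ⟦ g z ⟧ * ⟦ g' z' ⟧)) * (ω * (ω * ω)))
        ≡⟨ cong (d * d *_) (trans≡ (sym (∑-scaleʳ Vs _ _)) (∑-cong Vs (λ z → sym (∑-scaleʳ Vs _ _)))) ⟩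
      d * d * ∑ Vs (λ z → ∑ Vs (λ z' → ⟦ g z ⟧ * ⟦ g' z' ⟧ * (ω * (ω * ω))))
        ≤⟨ *-monoʳ-≤ (d * d) (∑-mono Vs (λ z → ∑-mono Vs (λ z' → pt z z' (g z) (g' z') refl≡ refl≡))) ⟩
      d * d * ∑ Vs (λ z → ∑ Vs (λ z' → a * b * c * (meet x z * (meet z z' * meet z' y))))
        ≡⟨ trans≡ (cong (d * d *_) (trans≡ (∑-cong Vs (λ z → trans≡ (∑-scale Vs (a * b * c) _) (cong (a * b * c *_) (∑-scale Vs (meet x z) _)))) (∑-scale Vs (a * b * c) _))) (sym (*-assoc (d * d) (a * b * c) _)) ⟩
      d * d * (a * b * c) * ∑ Vs (λ z → meet x z * ∑ Vs (λ z' → meet z z' * meet z' y)) ∎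
      where
      a1 : ∀ n w → n * (n * 1) * (w * (w * (w * 1))) ≡ n * n * (w * (w * w))
      a1 = solve-∀
      a2 : ∀ d s t w → d * s * (d * t) * w ≡ d * d * (s * t * w)
      a2 = solve-∀
      a3 : ∀ a b c p q r → a * p * (b * q * (c * r)) ≡ a * b * c * (p * (q * r))
      a3 = solve-∀
      pt : ∀ z z' s s' → g z ≡ s → g' z' ≡ s' → ⟦ s ⟧ * ⟦ s' ⟧ * (ω * (ω * ω)) ≤ a * b * c * (meet x z * (meet z z' * meet z' y))
      pt z z' false s' _ _ = z≤n
      pt z z' true false _ _ = z≤n
      pt z z' true true e e' = ≤-trans (≤-reflexive (*-identityˡ _)) (≤-trans (*-mono-≤ (hx e) (*-mono-≤ (hz e e') (hy e'))) (≤-reflexive (a3 a b c (meet x z) (meet z z') (meet z' y))))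

    private
      untyped : A → Bool
      untyped _ = false

      match-untyped : ∀ S t → length S ≡ length t → G.match untyped S t ≡ true
      match-untyped [] t _ = refl≡
      match-untyped (s ∷ S) (_ ∷ t) e = match-untyped S t (suc-injective e)

    one-class : ∀ j K → G.Close untyped j K → ∀ γ → Structure j K 3 1 γ
    one-class j K close γ = record
      { τ = untyped ; I = λ _ → false ; typ = λ _ → true ; close = close
      ; robust = λ c S _ l _ → ≤-trans (edges-many c) (*-monoʳ-≤ 3 (≤-reflexive (∑-cong-∈ (tuples Vs k) (λ t m →
          sym (trans≡ (cong (λ b → ⟦ b ⟧ * ⟦ h c t ⟧) (match-untyped S t (trans≡ l (sym (proj₁ (∈-tuples⁻ Vs k m)))))) (+-identityʳ _))))))
      ; few = ≤-trans (≤-reflexive (trans≡ (cong (γ *_) (∑-zero Cs)) (*-zeroʳ γ))) z≤n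
      ; types = inj₁ ((λ _ → refl≡) , (λ _ → refl≡)) }

    module _ (P : ℕ) (P≤e : P ≤ e) (P≥30 : 30 ≤ P) (γ : ℕ) (γ≥1 : 1 ≤ γ) where

      private
        R Q Kc Kt : ℕ
        R = 2 * (k * (18 * k) ^ k)
        Q = 5 * (R * γ)
        Kc = 18 * k * (18 * k) * (2 * (144 * k) * (4 * Q) * (2 * (144 * k)))
        Kt = 18 * k * (18 * k) * (2 * (144 * k) * 4 * (2 * (144 * k)))

      module _ (P≥k : 6 * (144 * k) ≤ P) (P≥Q : 14 * Q ≤ P) (Q≥k : 2 * (144 * k) ≤ Q) where

        paths : A → A → ℕ
        paths u v = ∑ Vs (λ z → meet u z * meet z v)

        Result : Set
        Result = (∀ γ' → Structure 2 (P * P * P) 3 1 γ') ⊎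
          (∀ γ' → Structure 3 Kc 3 1 γ') ⊎
          Structure 3 Kt (2 * (18 * k) ^ k) (18 * k) γ

        private
          module WithPair (u v : A) (few-paths : P * P * P * paths u v < n * (ω * ω)) where

            sizes-sum : 3 * ∑ Vs (λ x → ∑ Ω (λ o → ⟦ f x o ⟧)) ≤ 2 * (n * ω)
            sizes-sum = Classes.sizes-sum Ω f e e≥1 half P P≤e Vs ω>0 P≥30 u v few-paths

            open Dichotomy (dichotomy-data Ω f e e≥1 half P P≤e Vs ω>0 P≥30 u v few-paths k Q (s≤s z≤n) n>0 P≥k P≥Q Q≥k (influence-large sizes-sum))
              hiding (meet; disagree; meet-comm; outside-both; n; ω; sizes-sum)

            connected-case : ω ≤ Q * outside-both u v → ∀ γ' → Structure 3 Kc 3 1 γ'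
            connected-case big = one-class 3 Kc (close-from untyped 2 Kc (λ x y → ∑ Vs (λ z → meet x z * ∑ Vs (λ z' → meet z z' * meet z' y))) (reach₃ untyped)
              (λ x y _ → chain₃ (gate (τ x)) (gate (τ y)) (2 * H) (4 * Q) (2 * H) (18 * k) (gate-large (τ x)) (gate-large (τ y)) (near x) (connected big (τ x) (τ y))
                (λ {z} g → ≤-trans (near y g) (≤-reflexive (cong (2 * H *_) (meet-comm y z))))))

            module Sparse (sparse : Q * outside-both u v < ω) where
              open TwoClasses sparse

              closeness : G.Close τ 3 Kt
              closeness = close-from τ 2 Kt (λ x y → ∑ Vs (λ z → meet x z * ∑ Vs (λ z' → meet z z' * meet z' y))) (reach₃ τ)
                (λ x y e → chain₃ (gate (τ x)) (gate (τ y)) (2 * H) 4 (2 * H) (18 * k) (gate-large (τ x)) (gate-large (τ y)) (near x) (within′ (τ x) (τ y) e)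
                  (λ {z} g → ≤-trans (near y g) (≤-reflexive (cong (2 * H *_) (meet-comm y z)))))
                where
                within′ : ∀ b b' → same b b' ≡ true → ∀ {z z'} → gate b z ≡ true → gate b' z' ≡ true → ω ≤ 4 * meet z z'
                within′ true true _ = within true
                within′ false false _ = within false

              g : C → List A → Bool
              g c t = h c t xor parity τ t

              g-sym : ∀ c → SymFun (g c)
              g-sym c p = cong₂ _xor_ (h-sym c p) (parity-↭ τ p)

              errC : C → ℕ
              errC c = influence Vs k' (g c)

              err-total : ∑ Cs errC ≡ ∑ Vs (λ x → ∑ Vs (λ y → err x y))
              err-total = trans≡ (pairs-swap (λ c w x y → ne (g c (x ∷ w)) (g c (y ∷ w)))) (∑-cong Vs (λ x → ∑-cong Vs (λ y → ∑-cong Ω (λ o →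
                cong ⟦_⟧ (xors (f x o) (f y o) (τ x) (τ y) (parity τ (proj₂ o)))))))
                where
                xors : ∀ a b s t p → (a xor (s xor p)) xor (b xor (t xor p)) ≡ (a xor b) xor (s xor t)
                xors true true true true true = refl≡
                xors true true true true false = refl≡
                xors true true true false true = refl≡
                xors true true true false false = refl≡
                xors true true false true true = refl≡
                xors true true false true false = refl≡
                xors true true false false true = refl≡
                xors true true false false false = refl≡
                xors true false true true true = refl≡
                xors true false true true false = refl≡
                xors true false true false true = refl≡
                xors true false true false false = refl≡
                xors true false false true true = refl≡
                xors true false false true false = refl≡
                xors true false false false true = refl≡
                xors true false false false false = refl≡
                xors false true true true true = refl≡
                xors false true true true false = refl≡
                xors false true true false true = refl≡
                xors false true true false false = refl≡
                xors false true false true true = refl≡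
                xors false true false true false = refl≡
                xors false true false false true = refl≡
                xors false true false false false = refl≡
                xors false false true true true = refl≡
                xors false false true true false = refl≡
                xors false false true false true = refl≡
                xors false false true false false = refl≡
                xors false false false true true = refl≡
                xors false false false true false = refl≡
                xors false false false false true = refl≡
                xors false false false false false = refl≡

              typ : C → Bool
              typ c = not (n * T <ᵇ R * errC c)

              few : γ * ∑ Cs (λ c → ⟦ not (typ c) ⟧) ≤ m
              few = *-cancelˡ-≤ (5 * R) {{m*n≢0 5 R {{_}} {{R-nz}}}} (*-cancelʳ-≤ _ _ (n * T) {{m*n≢0 n T}} (begin
                5 * R * (γ * at) * (n * T)
                  ≡⟨ a1 R γ at (n * T) ⟩
                Q * (at * (n * T))
                  ≡⟨ cong (Q *_) (sym (∑-scaleʳ Cs _ (n * T))) ⟩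
                Q * ∑ Cs (λ c → ⟦ not (typ c) ⟧ * (n * T))
                  ≤⟨ *-monoʳ-≤ Q (∑-mono Cs (λ c → pt c (<ᵇ-cases (n * T) (R * errC c)))) ⟩
                Q * ∑ Cs (λ c → R * errC c)
                  ≡⟨ trans≡ (cong (Q *_) (trans≡ (∑-scale Cs R errC) (cong (R *_) err-total))) (a2 Q R _) ⟩
                R * (Q * ∑ Vs (λ x → ∑ Vs (λ y → err x y)))
                  ≤⟨ *-monoʳ-≤ R err-sum ⟩
                R * (5 * (n * n * ω))
                  ≡⟨ trans≡ (cong (λ z → R * (5 * z)) (trans≡ (*-assoc n n ω) (cong (n *_) (sym mT)))) (a3 R n m T) ⟩
                5 * R * m * (n * T) ∎))
                where
                at = ∑ Cs (λ c → ⟦ not (typ c) ⟧)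
                R-nz : NonZero R
                R-nz = m*n≢0 2 (k * (18 * k) ^ k) {{_}} {{m*n≢0 k ((18 * k) ^ k) {{_}} {{m^n≢0 (18 * k) k {{m*n≢0 18 k}}}}}}
                a1 : ∀ r g a x → 5 * r * (g * a) * x ≡ 5 * (r * g) * (a * x)
                a1 = solve-∀
                a2 : ∀ q r s → q * (r * s) ≡ r * (q * s)
                a2 = solve-∀
                a3 : ∀ r n m t → r * (5 * (n * (m * t))) ≡ 5 * r * m * (n * t)
                a3 = solve-∀
                pt : ∀ c → ((n * T <ᵇ R * errC c) ≡ true ⊎ ((n * T <ᵇ R * errC c) ≡ false × R * errC c ≤ n * T)) → ⟦ not (typ c) ⟧ * (n * T) ≤ R * errC c
                pt c (inj₁ e) = ≤-trans (≤-reflexive (trans≡ (cong (λ b → ⟦ not (not b) ⟧ * (n * T)) e) (+-identityʳ (n * T)))) (<⇒≤ (<ᵇ-true {n * T} e))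
                pt c (inj₂ (e , _)) = ≤-trans (≤-reflexive (cong (λ b → ⟦ not (not b) ⟧ * (n * T)) e)) z≤n

              same-large : ∀ s → n ≤ 18 * k * ∑ Vs (λ y → ⟦ same s (τ y) ⟧)
              same-large true = ≤-trans A-large (*-monoʳ-≤ (18 * k) (∑-mono Vs (λ z → pt z (inA z) refl≡)))
                where
                pt : ∀ z b → inA z ≡ b → ⟦ b ⟧ ≤ ⟦ same true (τ z) ⟧
                pt z true a = ≤-reflexive (cong (λ t → ⟦ same true t ⟧) (sym (A-type a)))
                pt z false a = z≤n
              same-large false = ≤-trans B-large (*-monoʳ-≤ (18 * k) (∑-mono Vs (λ z → pt z (inB z) refl≡)))
                where
                pt : ∀ z b → inB z ≡ b → ⟦ b ⟧ ≤ ⟦ same false (τ z) ⟧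
                pt z true a = ≤-reflexive (cong (λ t → ⟦ same false t ⟧) (sym (B-type a)))
                pt z false a = z≤n

              matches-many : ∀ S → n ^ length S ≤ (18 * k) ^ length S * ∑ (tuples Vs (length S)) (λ t → ⟦ G.match τ S t ⟧)
              matches-many [] = ≤-refl
              matches-many (s ∷ S) = begin
                n * n ^ length S
                  ≤⟨ *-mono-≤ (same-large (τ s)) (matches-many S) ⟩
                18 * k * ∑ Vs (λ y → ⟦ same (τ s) (τ y) ⟧) * ((18 * k) ^ length S * ∑ (tuples Vs (length S)) (λ t → ⟦ G.match τ S t ⟧))
                  ≡⟨ medial (18 * k) (∑ Vs (λ y → ⟦ same (τ s) (τ y) ⟧)) ((18 * k) ^ length S) _ ⟩
                (18 * k) ^ suc (length S) * (∑ Vs (λ y → ⟦ same (τ s) (τ y) ⟧) * ∑ (tuples Vs (length S)) (λ t → ⟦ G.match τ S t ⟧))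
                  ≡⟨ cong ((18 * k) ^ suc (length S) *_) (trans≡ (sym (∑-prod Vs (tuples Vs (length S)) _ _)) (sym (trans≡ (∑-tuples-suc Vs (length S) _)
                       (∑-cong Vs (λ y → ∑-cong (tuples Vs (length S)) (λ t → ∧-⟦⟧ (same (τ s) (τ y)) (G.match τ S t))))))) ⟩
                (18 * k) ^ suc (length S) * ∑ (tuples Vs (suc (length S))) (λ t → ⟦ G.match τ (s ∷ S) t ⟧) ∎
                where
                medial : ∀ a b c d → a * b * (c * d) ≡ a * c * (b * d)
                medial = solve-∀

              match-parity : ∀ S t → length S ≡ length t → G.match τ S t ≡ true → parity τ S ≡ parity τ t
              match-parity [] [] _ _ = refl≡
              match-parity (s ∷ S) (y ∷ t) l e with ∧-true {same (τ s) (τ y)} e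
              ... | e₁ , e₂ = cong₂ _xor_ (same⇒≡ (τ s) (τ y) e₁) (match-parity S t (suc-injective l) e₂)

              Good : C → Bool → Set
              Good c i = ∀ S → length S ≡ k → parity τ S ≡ i → G.Robust τ (2 * (18 * k) ^ k) (c , S)

              good-parity : ∀ c → R * errC c ≤ n * T → Σ Bool λ i → Good c i
              good-parity c le = pack (∑-pick-≤ (tuples Vs k) (λ v → R * ∑ (tuples Vs k) (λ t → ne (g c v) (g c t))) (λ _ → k * T)
                  (subst (0 <_) (sym (length-tuples Vs k)) (>-nonZero⁻¹ T)) (begin
                ∑ (tuples Vs k) (λ v → R * ∑ (tuples Vs k) (λ t → ne (g c v) (g c t)))
                  ≡⟨ ∑-scale (tuples Vs k) R _ ⟩
                R * differ Vs k (g c)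
                  ≤⟨ *-monoʳ-≤ R (differ≤influence Vs k' (g c) (g-sym c)) ⟩
                R * (k * (n ^ k' * errC c))
                  ≡⟨ a1 R k (n ^ k') (errC c) ⟩
                k * n ^ k' * (R * errC c)
                  ≤⟨ *-monoʳ-≤ (k * n ^ k') le ⟩
                k * n ^ k' * (n * T)
                  ≡⟨ a2 k (n ^ k') n T ⟩
                T * (k * T)
                  ≡⟨ sym (trans≡ (∑-const (tuples Vs k) (k * T)) (cong (_* (k * T)) (length-tuples Vs k))) ⟩
                ∑ (tuples Vs k) (λ _ → k * T) ∎))
                where
                a1 : ∀ r k p e → r * (k * (p * e)) ≡ k * p * (r * e)
                a1 = solve-∀
                a2 : ∀ k p n t → k * p * (n * t) ≡ n * p * (k * t)
                a2 = solve-∀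
                a3 : ∀ k l e → k * (2 * (l * e)) ≡ 2 * (k * l) * e
                a3 = solve-∀
                a4 : ∀ t l x e → l * (x + e) + l * (x + e) ≡ 2 * l * x + 2 * (l * e)
                a4 = solve-∀
                pack : (Σ (List A) λ v → v ∈ˡ tuples Vs k × R * ∑ (tuples Vs k) (λ t → ne (g c v) (g c t)) ≤ k * T) → Σ Bool λ i → Good c i
                pack (v , _ , Rv) = not (g c v) , λ S l p → +-cancelʳ-≤ T _ _ (begin
                  T + T
                    ≤⟨ +-mono-≤ (hit S l p) (hit S l p) ⟩
                  L * (X S + E) + L * (X S + E)
                    ≡⟨ a4 T L (X S) E ⟩
                  2 * L * X S + 2 * (L * E)
                    ≤⟨ +-monoʳ-≤ (2 * L * X S) (*-cancelˡ-≤ k (≤-trans (≤-reflexive (a3 k L E)) Rv)) ⟩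
                  2 * L * X S + T ∎)
                  where
                  L E : ℕ
                  L = (18 * k) ^ k
                  E = ∑ (tuples Vs k) (λ t → ne (g c v) (g c t))
                  X : List A → ℕ
                  X S = ∑ (tuples Vs k) (λ t → ⟦ G.match τ S t ⟧ * ⟦ h c t ⟧)
                  bools : ∀ y a → ⟦ true ⟧ ≤ ⟦ true ⟧ * ⟦ a ⟧ + ne y (a xor not y)
                  bools true true = s≤s z≤n
                  bools true false = s≤s z≤n
                  bools false true = s≤s z≤n
                  bools false false = s≤s z≤n
                  pt : ∀ S → length S ≡ k → parity τ S ≡ not (g c v) → ∀ t → length t ≡ k → ∀ b → G.match τ S t ≡ b → ⟦ b ⟧ ≤ ⟦ b ⟧ * ⟦ h c t ⟧ + ne (g c v) (g c t)
                  pt S l p t lt false _ = z≤n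
                  pt S l p t lt true e = ≤-trans (bools (g c v) (h c t)) (≤-reflexive (cong (λ q → ⟦ true ⟧ * ⟦ h c t ⟧ + ne (g c v) (h c t xor q))
                    (trans≡ (sym p) (match-parity S t (trans≡ l (sym lt)) e))))
                  hit : ∀ S → length S ≡ k → parity τ S ≡ not (g c v) → T ≤ L * (X S + E)
                  hit S l p = ≤-trans (subst (λ z → n ^ z ≤ (18 * k) ^ z * ∑ (tuples Vs z) (λ t → ⟦ G.match τ S t ⟧)) l (matches-many S))
                    (*-monoʳ-≤ L (≤-trans (∑-mono-∈ (tuples Vs k) (λ t m → pt S l p t (proj₁ (∈-tuples⁻ Vs k m)) (G.match τ S t) refl≡)) (≤-reflexive (∑-add (tuples Vs k) _ _))))

              choice : ∀ c → Σ Bool λ i → typ c ≡ true → Good c i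
              choice c = go (<ᵇ-cases (n * T) (R * errC c))
                where
                absurd : ∀ {b} → b ≡ true → not b ≢ true
                absurd refl≡ ()
                go : ((n * T <ᵇ R * errC c) ≡ true ⊎ ((n * T <ᵇ R * errC c) ≡ false × R * errC c ≤ n * T)) → Σ Bool λ i → typ c ≡ true → Good c i
                go (inj₁ e) = false , λ t → ⊥-elim (absurd e t)
                go (inj₂ (_ , le)) = proj₁ (good-parity c le) , λ _ → proj₂ (good-parity c le)

              two-class : Structure 3 Kt (2 * (18 * k) ^ k) (18 * k) γ
              two-class = record
                { τ = τ ; I = λ c → proj₁ (choice c) ; typ = typ ; close = closeness
                ; robust = λ c S t l p → proj₂ (choice c) t S l p
                ; few = few
                ; types = inj₂ (≤-trans (same-large true) (*-monoʳ-≤ (18 * k) (∑-mono Vs (λ z → ≤-reflexive (cong ⟦_⟧ (same-true (τ z)))))) , same-large false) }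
                where
                same-true : ∀ b → same true b ≡ b
                same-true true = refl≡
                same-true false = refl≡

            outcome : Result
            outcome = go (Q * outside-both u v <? ω)
              where
              go : Dec (Q * outside-both u v < ω) → Result
              go (yes sparse) = inj₂ (inj₂ (Sparse.two-class sparse))
              go (no dense) = inj₂ (inj₁ (connected-case (≮⇒≥ dense)))

        structure : Result
        structure = go (search (λ p → P * P * P * paths (proj₁ p) (proj₂ p) <ᵇ n * (ω * ω)) (pairs Vs Vs))
          where
          go : (Σ (A × A) λ p → (P * P * P * paths (proj₁ p) (proj₂ p) <ᵇ n * (ω * ω)) ≡ true) ⊎
            (∀ p → p ∈ˡ pairs Vs Vs → (P * P * P * paths (proj₁ p) (proj₂ p) <ᵇ n * (ω * ω)) ≡ false) → Result
          go (inj₁ ((u , v) , e)) = WithPair.outcome u v (<ᵇ-true {P * P * P * paths u v} e)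
          go (inj₂ none) = inj₁ (one-class 2 (P * P * P) (close-from untyped 1 (P * P * P) paths (reach₂ untyped) (λ x y _ → ≤-trans (≤-reflexive (a1 n ω)) (many x y (<ᵇ-cases (P * P * P * paths x y) (n * (ω * ω)))))))
            where
            a1 : ∀ n w → n * 1 * (w * (w * 1)) ≡ n * (w * w)
            a1 = solve-∀
            absurd : ∀ {b} → b ≡ true → b ≢ false
            absurd refl≡ ()
            many : ∀ x y → (P * P * P * paths x y <ᵇ n * (ω * ω)) ≡ true ⊎ ((P * P * P * paths x y <ᵇ n * (ω * ω)) ≡ false × n * (ω * ω) ≤ P * P * P * paths x y) → n * (ω * ω) ≤ P * P * P * paths x y
            many x y (inj₁ e) = ⊥-elim (absurd e (none (x , y) (∈-pairs⁺ (all-Vs x) (all-Vs y))))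
            many x y (inj₂ (_ , le)) = le

module Picking {A : Set} (_≟_ : DecidableEquality A) (Vs : List A) (uniq : Unique Vs) where
  open Fresh _≟_

  Picked : (A → Bool) → ℕ → List A → Set
  Picked p j F = Σ (List A) λ xs → length xs ≡ j × All (λ x → p x ≡ true) xs × Unique xs × (∀ {x} → x ∈ˡ xs → x ∉ˡ F)

  pick-fresh : (p : A → Bool) → ∀ j F → length F + j ≤ ∑ Vs (λ x → ⟦ p x ⟧) → Picked p j F
  pick-fresh p zero F _ = [] , refl≡ , [] , [] , λ ()
  pick-fresh p (suc j) F le = first (∑-pick Vs (λ x → ⟦ mem x F ⟧) (λ x → ⟦ p x ⟧) (begin-strict
      ∑ Vs (λ x → ⟦ mem x F ⟧) ≤⟨ ∑-mem Vs F uniq ⟩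
      length F <⟨ m<m+n (length F) (s≤s z≤n) ⟩
      length F + suc j ≤⟨ le ⟩
      ∑ Vs (λ x → ⟦ p x ⟧) ∎))
    where
    first : (Σ A λ x → x ∈ˡ Vs × ⟦ mem x F ⟧ < ⟦ p x ⟧) → Picked p (suc j) F
    first (x , _ , lt) = rest (pick-fresh p j (x ∷ F) (≤-trans (≤-reflexive (sym (+-suc (length F) j))) le))
      where
      flags : ∀ a b → ⟦ a ⟧ < ⟦ b ⟧ → a ≡ false × b ≡ true
      flags false true _ = refl≡ , refl≡
      flags true true (s≤s ())
      flags true false ()
      flags false false ()
      rest : Picked p j (x ∷ F) → Picked p (suc j) F
      rest (xs , l , al , u , d) = x ∷ xs , cong suc l , proj₂ (flags (mem x F) (p x) lt) ∷ al , ∉⇒All≢ xs (λ m → d m (here refl≡)) ∷ u ,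
        λ { (here refl≡) m → clash (trans≡ (sym (proj₁ (flags (mem x F) (p x) lt))) (∈⇒mem m)) ; (there i) m → d i (there m) }
        where
        clash : false ≢ true
        clash ()

  module _ {C : Set} (k : ℕ) (h : C → List A → Bool) where

    FreshEdge : C → List A → Set
    FreshEdge c F = Σ (List A) λ t → length t ≡ k × h c t ≡ true × Unique t × (∀ {x} → x ∈ˡ t → x ∉ˡ F)

    fresh-edge : ∀ c F → length Vs ^ k ≤ 3 * ∑ (tuples Vs k) (λ t → ⟦ h c t ⟧) → 3 * (k * (length F + k)) < length Vs → FreshEdge c F
    fresh-edge c F many room = found (∑-pick (tuples Vs k) (stale F) (λ t → ⟦ h c t ⟧) (*-cancelˡ-< (3 * n) _ _ (begin-strict
        3 * n * ∑ (tuples Vs k) (stale F) ≡⟨ a1 n (∑ (tuples Vs k) (stale F)) ⟩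
        3 * (∑ (tuples Vs k) (stale F) * n) ≤⟨ *-monoʳ-≤ 3 (stale-vertex-tuples Vs uniq k F (length F + k) ≤-refl) ⟩
        3 * (k * ((length F + k) * n ^ k)) ≡⟨ a2 k (length F + k) (n ^ k) ⟩
        3 * (k * (length F + k)) * n ^ k <⟨ *-monoˡ-< (n ^ k) {{m^n≢0 n k {{nz}}}} room ⟩
        n * n ^ k ≤⟨ *-monoʳ-≤ n many ⟩
        n * (3 * ∑ (tuples Vs k) (λ t → ⟦ h c t ⟧)) ≡⟨ a3 n _ ⟩
        3 * n * ∑ (tuples Vs k) (λ t → ⟦ h c t ⟧) ∎)))
      where
      n = length Vs
      nz : NonZero n
      nz = >-nonZero (≤-trans (s≤s z≤n) room)
      a1 : ∀ n s → 3 * n * s ≡ 3 * (s * n)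
      a1 = solve-∀
      a2 : ∀ k z p → 3 * (k * (z * p)) ≡ 3 * (k * z) * p
      a2 = solve-∀
      a3 : ∀ n s → n * (3 * s) ≡ 3 * n * s
      a3 = solve-∀
      flags : ∀ a b → ⟦ not a ⟧ < ⟦ b ⟧ → a ≡ true × b ≡ true
      flags true true _ = refl≡ , refl≡
      flags false true (s≤s ())
      flags true false ()
      flags false false ()
      found : (Σ (List A) λ t → t ∈ˡ tuples Vs k × stale F t < ⟦ h c t ⟧) → FreshEdge c F
      found (t , m , lt) = t , proj₁ (∈-tuples⁻ Vs k m) , proj₂ fl , fresh-unique F t (proj₁ fl) , fresh-disjoint F t (proj₁ fl)
        where fl = flags (fresh F t) (h c t) lt

    Frozen : List C → List A → Set
    Frozen cs F = Σ (List (C × List A)) λ B → map proj₁ B ≡ cs × (∀ {b} → b ∈ˡ B → h (proj₁ b) (proj₂ b) ≡ true × length (proj₂ b) ≡ k) ×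
      Unique (concatMap proj₂ B) × (∀ {x} → x ∈ˡ concatMap proj₂ B → x ∉ˡ F)

    freeze : (cs : List C) (F : List A) → (∀ c → length Vs ^ k ≤ 3 * ∑ (tuples Vs k) (λ t → ⟦ h c t ⟧)) → 3 * (k * (length F + length cs * k + k)) < length Vs →
      Frozen cs F
    freeze [] F _ _ = [] , refl≡ , (λ ()) , [] , λ ()
    freeze (c ∷ cs) F many room = go (fresh-edge c F (many c) (≤-trans (s≤s (*-monoʳ-≤ 3 (*-monoʳ-≤ k (+-monoˡ-≤ k (m≤m+n (length F) _))))) room))
      where
      go : FreshEdge c F → Frozen (c ∷ cs) F
      go (t , l , e , u , d) = rest (freeze cs (t ++ F) many (≤-trans (s≤s (*-monoʳ-≤ 3 (*-monoʳ-≤ k (+-monoˡ-≤ k (≤-reflexive size))))) room))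
        where
        a1 : ∀ f a b → a + f + b ≡ f + (a + b)
        a1 = solve-∀
        size : length (t ++ F) + length cs * k ≡ length F + length (c ∷ cs) * k
        size = trans≡ (cong (_+ length cs * k) (trans≡ (length-++ t) (cong (_+ length F) l))) (a1 (length F) k (length cs * k))
        rest : Frozen cs (t ++ F) → Frozen (c ∷ cs) F
        rest (B , e' , s , u' , d') = (c , t) ∷ B , cong (c ∷_) e' , (λ { (here refl≡) → e , l ; (there m) → s m }) ,
          Unique-++⁺ u u' (λ i i' → d' i' (∈-++⁺ˡ i)) , dis
          where
          dis : ∀ {x} → x ∈ˡ t ++ concatMap proj₂ B → x ∉ˡ F
          dis i with ∈-++⁻ t i
          ... | inj₁ p = d p
          ... | inj₂ p = λ m → d' p (∈-++⁺ʳ t m)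

xors : {C : Set} → (C → Bool) → List C → Bool
xors I [] = false
xors I (c ∷ cs) = I c xor xors I cs

xors≡parity : {C : Set} (I : C → Bool) (cs : List C) → xors I cs ≡ parity I cs
xors≡parity I [] = refl≡
xors≡parity I (c ∷ cs) = cong (I c xor_) (xors≡parity I cs)

parity-++ : {A : Set} (τ : A → Bool) (xs ys : List A) → parity τ (xs ++ ys) ≡ parity τ xs xor parity τ ys
parity-++ τ [] ys = refl≡
parity-++ τ (x ∷ xs) ys = trans≡ (cong (τ x xor_) (parity-++ τ xs ys)) (sym (xor-assoc (τ x) (parity τ xs) (parity τ ys)))

xor-cancelˡ : ∀ a {b c} → a xor b ≡ a xor c → b ≡ c
xor-cancelˡ true {true} {true} _ = refl≡
xor-cancelˡ true {false} {false} _ = refl≡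
xor-cancelˡ false e = e

parity-const : {A : Set} (τ : A → Bool) → (∀ x → τ x ≡ false) → ∀ xs → parity τ xs ≡ false
parity-const τ e [] = refl≡
parity-const τ e (x ∷ xs) = trans≡ (cong (_xor parity τ xs) (e x)) (parity-const τ e xs)

-- Each piece takes the vertex carried over, k - 2 vertices of W, and one of a pair of vertices of different types, chosen to give
-- the piece the required parity; the other one is carried over.  The last parity is right because the total is.
module Splitting {A C : Set} (τ : A → Bool) (I : C → Bool) (k'' : ℕ) where

  private
    k : ℕ
    k = suc (suc k'')

  Flip : A × A → Set
  Flip (a , b) = (τ a ≢ τ b) ⊎ ((∀ x → τ x ≡ false) × (∀ c → I c ≡ false))

  flat : List (A × A) → List A
  flat [] = []
  flat ((a , b) ∷ P) = a ∷ b ∷ flat P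

  private
    differ-xor : ∀ a b p i → a ≢ b → a xor p ≢ i → b xor p ≡ i
    differ-xor true true p i n _ = ⊥-elim (n refl≡)
    differ-xor false false p i n _ = ⊥-elim (n refl≡)
    differ-xor true false true true _ _ = refl≡
    differ-xor true false true false _ n = ⊥-elim (n refl≡)
    differ-xor true false false true _ n = ⊥-elim (n refl≡)
    differ-xor true false false false _ _ = refl≡
    differ-xor false true true true _ n = ⊥-elim (n refl≡)
    differ-xor false true true false _ _ = refl≡
    differ-xor false true false true _ _ = refl≡
    differ-xor false true false false _ n = ⊥-elim (n refl≡)

    bool-≟ : (a b : Bool) → Dec (a ≡ b)
    bool-≟ true true = yes refl≡
    bool-≟ true false = no λ ()
    bool-≟ false true = no λ ()
    bool-≟ false false = yes refl≡

  Pieces : List C → List A → Set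
  Pieces D X = Σ (List (C × List A)) λ ps → map proj₁ ps ≡ D × concatMap proj₂ ps ↭ X × All (λ p → length (proj₂ p) ≡ k × parity τ (proj₂ p) ≡ I (proj₁ p)) ps

  split : ∀ (D : List C) (P : List (A × A)) (W : List A) → All Flip P → length D ≡ suc (length P) → length W ≡ length P * k'' + k →
    xors I D ≡ parity τ (flat P ++ W) → Pieces D (flat P ++ W)
  split (c ∷ []) [] W _ _ lW e = (c , W) ∷ [] , refl≡ , ↭-reflexive (++-identityʳ W) , (lW , sym (trans≡ (sym (xor-identityʳ (I c))) e)) ∷ []
  split (c ∷ D) ((a , b) ∷ P) W (fl ∷ fls) lD lW e with split-at (suc k'') W (≤-trans (s≤s (m≤m+n k'' _)) (≤-trans (≤-reflexive (a1 k'' (length P * k''))) (≤-reflexive (sym lW))))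
    where
    a1 : ∀ k p → 1 + (k + (1 + p + k)) ≡ (k + p) + (2 + k)
    a1 = solve-∀
  ... | S , W' , refl≡ , lS = choose (bool-≟ (parity τ (a ∷ S)) (I c))
    where
    lW' : suc (length W') ≡ length P * k'' + k
    lW' = +-cancelˡ-≡ (suc k'') _ _ (trans≡ (trans≡ (+-suc (suc k'') (length W')) (cong suc (trans≡ (cong (_+ length W') (sym lS)) (trans≡ (sym (length-++ S)) lW)))) (a2 k'' (length P * k'')))
      where
      a2 : ∀ k p → 1 + ((k + p) + (2 + k)) ≡ 1 + k + (p + (2 + k))
      a2 = solve-∀
    go : ∀ x y → parity τ (x ∷ S) ≡ I c → x ∷ y ∷ flat P ↭ a ∷ b ∷ flat P → Pieces (c ∷ D) (a ∷ b ∷ flat P ++ S ++ W')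
    go x y px perm = pack (split D P (y ∷ W') fls (suc-injective lD) lW' (xor-cancelˡ (I c) (trans≡ e (trans≡ (parity-↭ τ (↭-trans (++⁺ʳ (S ++ W') (↭-sym perm)) regroup))
        (trans≡ (parity-++ τ (x ∷ S) (flat P ++ y ∷ W')) (cong (_xor parity τ (flat P ++ y ∷ W')) px))))))
      where
      regroup : x ∷ y ∷ flat P ++ S ++ W' ↭ (x ∷ S) ++ (flat P ++ y ∷ W')
      regroup = prep x (↭-trans (shuffle (y ∷ []) (flat P) S W') (++⁺ˡ S refl))
        where
        module PA = CMSolver (++-commutativeMonoid {A = A})
        shuffle : ∀ (a b c d : List A) → a ++ (b ++ (c ++ d)) ↭ c ++ (b ++ (a ++ d))
        shuffle = PA.solve 4 (λ a b c d → a PA.⊕ (b PA.⊕ (c PA.⊕ d)) PA.⊜ c PA.⊕ (b PA.⊕ (a PA.⊕ d))) refl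
      pack : Pieces D (flat P ++ y ∷ W') → Pieces (c ∷ D) (a ∷ b ∷ flat P ++ S ++ W')
      pack (ps , eD , vp , al) = (c , x ∷ S) ∷ ps , cong (c ∷_) eD , ↭-trans (++⁺ˡ (x ∷ S) vp) (↭-trans (↭-sym regroup) (++⁺ʳ (S ++ W') perm)) , (cong suc lS , px) ∷ al
    choose : Dec (parity τ (a ∷ S) ≡ I c) → Pieces (c ∷ D) (a ∷ b ∷ flat P ++ S ++ W')
    choose (yes p) = go a b p refl
    choose (no ¬p) = go b a (flipped fl) (swap b a refl)
      where
      flipped : Flip (a , b) → parity τ (b ∷ S) ≡ I c
      flipped (inj₁ ne) = differ-xor (τ a) (τ b) (parity τ S) (I c) ne ¬p
      flipped (inj₂ (t , i)) = ⊥-elim (¬p (trans≡ (parity-const τ t (a ∷ S)) (sym (i c))))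

record FinishData (A C : Set) : Set where
  constructor finish-data
  field
    _≟A_ : DecidableEquality A
    _≟C_ : DecidableEquality C
    k'' : ℕ
    h : C → List A → Bool
    h-sym : ∀ c → SymFun (h c)
    h-unique : ∀ c t → length t ≡ suc (suc k'') → h c t ≡ true → Unique t
    Vs : List A
    Cs : List C
    Vs-unique : Unique Vs
    Cs-unique : Unique Cs
    all-Vs : ∀ x → x ∈ˡ Vs
    all-Cs : ∀ c → c ∈ˡ Cs
    n≡km : length Vs ≡ suc (suc k'') * length Cs
    n>0 : 0 < length Vs
    m>0 : 0 < length Cs
    edges-many : ∀ c → length Vs ^ suc (suc k'') ≤ 3 * ∑ (tuples Vs (suc (suc k''))) (λ t → ⟦ h c t ⟧)
    exact : ∀ (τ : A → Bool) (J : C → Bool) → (∀ c t → length t ≡ suc (suc k'') → h c t ≡ true → parity τ t ≡ J c) → xors J Cs ≡ parity τ Vs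
    j K K₂ K₃ γ : ℕ
    K₃≥1 : 1 ≤ K₃
    st : StructureTheorem.Structure (suc k'') h h-sym Vs Cs all-Vs n>0 m>0 j K K₂ K₃ γ

module Finish {A C : Set} (data′ : FinishData A C) where

  open FinishData data′

  private
    k k' n m : ℕ
    k = suc (suc k'')
    k' = suc k''
    n = length Vs
    m = length Cs
    instance
      nzn : NonZero n
      nzn = >-nonZero n>0

  open StructureTheorem.Structure st
  open Gadgets k' h τ Vs Cs
  module FA = Fresh _≟A_
  module FC = Fresh _≟C_

  at : ℕ
  at = ∑ Cs (λ c → ⟦ not (typ c) ⟧)

  match-parity : ∀ S t → length S ≡ length t → match S t ≡ true → parity τ S ≡ parity τ t
  match-parity [] [] _ _ = refl≡
  match-parity (s ∷ S) (y ∷ t) l e with ∧-true {same (τ s) (τ y)} e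
  ... | e₁ , e₂ = cong₂ _xor_ (same⇒≡ (τ s) (τ y) e₁) (match-parity S t (suc-injective l) e₂)

  private
    some-edge : ∀ c → Σ (List A) λ t → length t ≡ k × h c t ≡ true
    some-edge c = pack (∑-positive (h c) (tuples Vs k) (*-cancelˡ-< 3 0 _ (≤-trans (m^n>0 n k) (edges-many c))))
      where
      pack : (Σ (List A) λ t → h c t ≡ true × (Σ (List (List A)) λ zs → tuples Vs k ↭ t ∷ zs)) → Σ (List A) λ t → length t ≡ k × h c t ≡ true
      pack (t , e , zs , p) = t , proj₁ (∈-tuples⁻ Vs k (∈-resp-↭ (↭-sym p) (here refl≡))) , e

    with-parity : ∀ c → (n ≤ K₃ * ∑ Vs (λ x → ⟦ τ x ⟧)) × (n ≤ K₃ * ∑ Vs (λ x → ⟦ not (τ x) ⟧)) → Σ (List A) λ S → length S ≡ k × parity τ S ≡ I c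
    with-parity c (lt , lf) = go (I c) refl≡ (member τ lt) (member (not ∘ τ) lf)
      where
      member : (p : A → Bool) → n ≤ K₃ * ∑ Vs (λ x → ⟦ p x ⟧) → Σ A λ x → p x ≡ true
      member p le with ∑-positive p Vs (*-cancelˡ-< K₃ 0 _ (≤-trans (≤-reflexive (cong suc (*-zeroʳ K₃))) (≤-trans n>0 le)))
      ... | x , e , _ = x , e
      falses : ∀ y → τ y ≡ false → ∀ j → parity τ (replicate j y) ≡ false
      falses y e zero = refl≡
      falses y e (suc j) = trans≡ (cong (_xor parity τ (replicate j y)) e) (falses y e j)
      len : ∀ (y : A) j → length (replicate j y) ≡ j
      len y zero = refl≡
      len y (suc j) = cong suc (len y j)
      go : ∀ b → I c ≡ b → (Σ A λ x → τ x ≡ true) → (Σ A λ x → not (τ x) ≡ true) → Σ (List A) λ S → length S ≡ k × parity τ S ≡ I c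
      go true e (x , t) (y , f) = x ∷ replicate k' y , cong suc (len y k') , trans≡ (cong₂ _xor_ t (falses y (not-true f) k')) (sym e)
      go false e _ (y , f) = replicate k y , len y k , trans≡ (falses y (not-true f) k) (sym e)

  -- Reserved vertices Z and at most one reserved colour, which in the end correct the parity of the leftover.
  record Switch : Set where
    field
      Z : List A
      Cz Cs' : List C
      Z-unique : Unique Z
      Z-size : length Z ≤ 2 * k
      Cz-size : length Cz ≤ 1
      Cs↭ : Cs ↭ Cz ++ Cs'
      resolve : ∀ (Bs : List Blk) (D : List C) (X : List A) → Sound Bs → vts Bs ++ (X ++ Z) ↭ Vs → cls Bs ++ (D ++ Cz) ↭ Cs → All (λ c → typ c ≡ true) D →
        Σ (List Blk) λ Bz → Σ (List A) λ Z' → Sound Bz × cls Bz ≡ Cz × Z ↭ vts Bz ++ Z' × xors I D ≡ parity τ (X ++ Z')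

  private
    not-mem : ∀ {x F} → not (FA.mem x F) ≡ true → x ∉ˡ F
    not-mem {x} {F} e i = clash (trans≡ (sym (not-true e)) (FA.∈⇒mem i))
      where
      clash : false ≢ true
      clash ()

    switch-from : ∀ c e₁ e₂ → length e₁ ≡ k → length e₂ ≡ k → h c e₁ ≡ true → h c e₂ ≡ true → parity τ e₁ ≢ parity τ e₂ → Switch
    switch-from c e₁ e₂ l₁ l₂ h₁ h₂ ne = build (select (λ x → not (FA.mem x e₁)) e₂) (∈-∃++ (all-Cs c))
      where
      build : (Σ (List A) λ ys → Σ (List A) λ zs → e₂ ↭ ys ++ zs × All (λ x → not (FA.mem x e₁) ≡ true) ys × length ys ≡ ∑ e₂ (λ x → ⟦ not (FA.mem x e₁) ⟧)) →
        (Σ (List C) λ us → Σ (List C) λ ws → Cs ≡ us ++ c ∷ ws) → Switch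
      build (z₁ , zs , e₂↭ , out , |z₁|) (us , ws , Cs≡) = with-rest (extract e₂ Z u₂ (All.tabulate covered))
        where
        Z : List A
        Z = e₁ ++ z₁
        u₂ : Unique e₂
        u₂ = h-unique c e₂ l₂ h₂
        Z-unique : Unique Z
        Z-unique = Unique-++⁺ (h-unique c e₁ l₁ h₁) (proj₁ (Unique-++⁻ z₁ (Unique-resp-↭ e₂↭ u₂))) (λ i i' → not-mem (All.lookup out i') i)
        Z-size : length Z ≤ 2 * k
        Z-size = ≤-trans (≤-reflexive (length-++ e₁)) (+-mono-≤ (≤-reflexive l₁) (≤-trans (≤-trans (m≤m+n (length z₁) (length zs))
          (≤-reflexive (trans≡ (sym (length-++ z₁)) (trans≡ (sym (↭-length e₂↭)) l₂)))) (m≤m+n k 0)))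
        covered : ∀ {x} → x ∈ˡ e₂ → x ∈ˡ Z
        covered {x} i = at-bool (FA.mem x e₁) refl≡
          where
          at-bool : ∀ b → FA.mem x e₁ ≡ b → x ∈ˡ Z
          at-bool true e = ∈-++⁺ˡ (FA.mem⇒∈ e₁ e)
          at-bool false e = ∈-++⁺ʳ e₁ (selected (∈-++⁻ z₁ (∈-resp-↭ e₂↭ i)))
            where
            selected : x ∈ˡ z₁ ⊎ x ∈ˡ zs → x ∈ˡ z₁
            selected (inj₁ i') = i'
            selected (inj₂ i') = ⊥-elim (clash e (unselected (λ y → not (FA.mem y e₁)) e₂↭ out |z₁| i'))
              where
              clash : ∀ {b} → b ≡ false → not b ≢ false
              clash refl≡ ()
        with-rest : (Σ (List A) λ z₂ → Z ↭ e₂ ++ z₂) → Switch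
        with-rest (z₂ , Z↭₂) = record
          { Z = Z ; Cz = c ∷ [] ; Cs' = us ++ ws ; Z-unique = Z-unique ; Z-size = Z-size ; Cz-size = ≤-refl
          ; Cs↭ = ↭-trans (↭-reflexive Cs≡) (shift c us ws)
          ; resolve = λ Bs D X _ _ _ _ → choose D X (bool-≟ (xors I D) (parity τ (X ++ z₁))) }
          where
          bool-≟ : (a b : Bool) → Dec (a ≡ b)
          bool-≟ true true = yes refl≡
          bool-≟ true false = no λ ()
          bool-≟ false true = no λ ()
          bool-≟ false false = yes refl≡
          bools : ∀ x p₁ p₂ q₁ q₂ t → p₁ xor q₁ ≡ p₂ xor q₂ → p₁ ≢ p₂ → t ≢ x xor q₁ → t ≡ x xor q₂
          bools x true true q₁ q₂ t _ n _ = ⊥-elim (n refl≡)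
          bools x false false q₁ q₂ t _ n _ = ⊥-elim (n refl≡)
          bools true true false true false true _ _ _ = refl≡
          bools true true false true false false _ _ n = ⊥-elim (n refl≡)
          bools true true false false true true _ _ n = ⊥-elim (n refl≡)
          bools true true false false true false _ _ _ = refl≡
          bools false true false true false true _ _ n = ⊥-elim (n refl≡)
          bools false true false true false false _ _ _ = refl≡
          bools false true false false true true _ _ _ = refl≡
          bools false true false false true false _ _ n = ⊥-elim (n refl≡)
          bools true false true true false true _ _ _ = refl≡
          bools true false true true false false _ _ n = ⊥-elim (n refl≡)
          bools true false true false true true _ _ n = ⊥-elim (n refl≡)
          bools true false true false true false _ _ _ = refl≡
          bools false false true true false true _ _ n = ⊥-elim (n refl≡)
          bools false false true true false false _ _ _ = refl≡
          bools false false true false true true _ _ _ = refl≡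
          bools false false true false true false _ _ n = ⊥-elim (n refl≡)
          bools x true false true true t () _ _
          bools x true false false false t () _ _
          bools x false true true true t () _ _
          bools x false true false false t () _ _
          one-block : ∀ e → length e ≡ k → h c e ≡ true → Sound ((c , e) ∷ [])
          one-block e l hh (here refl≡) = hh , l
          choose : ∀ D X → Dec (xors I D ≡ parity τ (X ++ z₁)) → Σ (List Blk) λ Bz → Σ (List A) λ Z' → Sound Bz × cls Bz ≡ c ∷ [] × Z ↭ vts Bz ++ Z' × xors I D ≡ parity τ (X ++ Z')
          choose D X (yes e) = (c , e₁) ∷ [] , z₁ , one-block e₁ l₁ h₁ , refl≡ , ↭-reflexive (cong (_++ z₁) (sym (++-identityʳ e₁))) , e
          choose D X (no ¬e) = (c , e₂) ∷ [] , z₂ , one-block e₂ l₂ h₂ , refl≡ , ↭-trans Z↭₂ (↭-reflexive (cong (_++ z₂) (sym (++-identityʳ e₂)))) ,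
            trans≡ (bools (parity τ X) (parity τ e₁) (parity τ e₂) (parity τ z₁) (parity τ z₂) (xors I D)
              (trans≡ (sym (parity-++ τ e₁ z₁)) (trans≡ (parity-↭ τ Z↭₂) (parity-++ τ e₂ z₂))) ne (λ e → ¬e (trans≡ e (sym (parity-++ τ X z₁))))) (sym (parity-++ τ X z₂))

    no-switch : (∀ c t t' → length t ≡ k → length t' ≡ k → h c t ≡ true → h c t' ≡ true → parity τ t ≡ parity τ t') → Switch
    no-switch consistent = record
      { Z = [] ; Cz = [] ; Cs' = Cs ; Z-unique = [] ; Z-size = z≤n ; Cz-size = z≤n ; Cs↭ = refl
      ; resolve = λ Bs D X s v c t → [] , [] , (λ ()) , refl≡ , refl , resolved Bs D X s v c t }
      where
      J : C → Bool
      J c = parity τ (proj₁ (some-edge c))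
      J-right : ∀ c t → length t ≡ k → h c t ≡ true → parity τ t ≡ J c
      J-right c t l e = consistent c t _ l (proj₁ (proj₂ (some-edge c))) e (proj₂ (proj₂ (some-edge c)))
      I≡J : ∀ c → typ c ≡ true → I c ≡ J c
      I≡J c t = go types
        where
        go : ((∀ x → τ x ≡ false) × (∀ c → I c ≡ false)) ⊎ (n ≤ K₃ * ∑ Vs (λ x → ⟦ τ x ⟧) × n ≤ K₃ * ∑ Vs (λ x → ⟦ not (τ x) ⟧)) → I c ≡ J c
        go (inj₁ (τ0 , I0)) = trans≡ (I0 c) (sym (parity-const τ τ0 (proj₁ (some-edge c))))
        go (inj₂ large) = from (with-parity c large)
          where
          from : (Σ (List A) λ S → length S ≡ k × parity τ S ≡ I c) → I c ≡ J c
          from (S , l , p) = found (∑-positive (λ t → match S t ∧ h c t) (tuples Vs k) (*-cancelˡ-< K₂ 0 _ (≤-trans (≤-reflexive (cong suc (*-zeroʳ K₂)))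
              (≤-trans (m^n>0 n k) (≤-trans (robust c S t l p) (*-monoʳ-≤ K₂ (≤-reflexive (∑-cong (tuples Vs k) (λ t → sym (∧-⟦⟧ (match S t) (h c t)))))))))))
            where
            found : (Σ (List A) λ t → (match S t ∧ h c t) ≡ true × (Σ (List (List A)) λ zs → tuples Vs k ↭ t ∷ zs)) → I c ≡ J c
            found (t' , e , zs , perm) = trans≡ (sym p) (trans≡ (match-parity S t' (trans≡ l (sym lt)) (proj₁ (∧-true {match S t'} e))) (J-right c t' lt (proj₂ (∧-true {match S t'} e))))
              where
              lt : length t' ≡ k
              lt = proj₁ (∈-tuples⁻ Vs k (∈-resp-↭ (↭-sym perm) (here refl≡)))
      blocks-parity : ∀ Bs → Sound Bs → parity τ (vts Bs) ≡ xors J (cls Bs)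
      blocks-parity [] _ = refl≡
      blocks-parity ((c , t) ∷ Bs) s = trans≡ (parity-++ τ t (vts Bs)) (cong₂ _xor_ (J-right c t (proj₂ (s (here refl≡))) (proj₁ (s (here refl≡)))) (blocks-parity Bs (s ∘ there)))
      I≡J-list : ∀ D → All (λ c → typ c ≡ true) D → xors I D ≡ xors J D
      I≡J-list [] _ = refl≡
      I≡J-list (c ∷ D) (t ∷ ts) = cong₂ _xor_ (I≡J c t) (I≡J-list D ts)
      resolved : ∀ Bs D X → Sound Bs → vts Bs ++ (X ++ []) ↭ Vs → cls Bs ++ (D ++ []) ↭ Cs → All (λ c → typ c ≡ true) D → xors I D ≡ parity τ (X ++ [])
      resolved Bs D X s v c t = xor-cancelˡ (parity τ (vts Bs)) (trans≡ (cong₂ _xor_ (blocks-parity Bs s) (I≡J-list D t)) (trans≡ bridge (parity-++ τ (vts Bs) (X ++ []))))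
        where
        bridge : (xors J (cls Bs) xor xors J D) ≡ parity τ (vts Bs ++ (X ++ []))
        bridge = trans≡ (cong₂ _xor_ (xors≡parity J (cls Bs)) (trans≡ (cong (xors J) (sym (++-identityʳ D))) (xors≡parity J (D ++ []))))
          (trans≡ (sym (parity-++ J (cls Bs) (D ++ []))) (trans≡ (parity-↭ J c) (trans≡ (sym (xors≡parity J Cs)) (trans≡ (exact τ J J-right) (parity-↭ τ (↭-sym v))))))

  switch : Switch
  switch = go (search bad (pairs Cs (pairs (tuples Vs k) (tuples Vs k))))
    where
    bad : C × List A × List A → Bool
    bad (c , t , t') = (sized t ∧ sized t') ∧ ((h c t ∧ h c t') ∧ (parity τ t xor parity τ t'))
      where
      sized : List A → Bool
      sized t = does (length t ≟ℕ k)
    sized-true : ∀ (t : List A) → does (length t ≟ℕ k) ≡ true → length t ≡ k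
    sized-true t e = ≡ᵇ⇒≡ (length t) k (true-T e)
    true-sized : ∀ (t : List A) → length t ≡ k → does (length t ≟ℕ k) ≡ true
    true-sized t e = T-true (≡⇒≡ᵇ (length t) k e)
    xor-ne : ∀ {a b} → a xor b ≡ true → a ≢ b
    xor-ne {true} () refl≡
    xor-ne {false} () refl≡
    xor-eq : ∀ a b → a xor b ≡ false → a ≡ b
    xor-eq true true _ = refl≡
    xor-eq false false _ = refl≡
    go : (Σ (C × List A × List A) λ p → bad p ≡ true) ⊎ (∀ p → p ∈ˡ pairs Cs (pairs (tuples Vs k) (tuples Vs k)) → bad p ≡ false) → Switch
    go (inj₁ ((c , t , t') , e)) = found (∧-true {does (length t ≟ℕ k) ∧ does (length t' ≟ℕ k)} e)
      where
      found : (does (length t ≟ℕ k) ∧ does (length t' ≟ℕ k)) ≡ true × ((h c t ∧ h c t') ∧ (parity τ t xor parity τ t')) ≡ true → Switch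
      found (s , r) = switch-from c t t' (sized-true t (proj₁ (∧-true s))) (sized-true t' (proj₂ (∧-true {does (length t ≟ℕ k)} s)))
        (proj₁ (∧-true (proj₁ (∧-true {h c t ∧ h c t'} r)))) (proj₂ (∧-true {h c t} (proj₁ (∧-true {h c t ∧ h c t'} r)))) (xor-ne (proj₂ (∧-true {h c t ∧ h c t'} r)))
    go (inj₂ none) = no-switch (λ c t t' l l' e e' → xor-eq (parity τ t) (parity τ t') (trans≡
      (sym (cong₂ _∧_ (cong₂ _∧_ (true-sized t l) (true-sized t' l')) (cong (_∧ (parity τ t xor parity τ t')) (cong₂ _∧_ e e'))))
      (none (c , t , t') (∈-pairs⁺ (all-Cs c) (∈-pairs⁺ (tup t l) (tup t' l'))))))
      where
      tup : ∀ t → length t ≡ k → t ∈ˡ tuples Vs k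
      tup t l = subst (λ z → t ∈ˡ tuples Vs z) l (∈-tuples⁺ Vs (All.tabulate (λ {x} _ → all-Vs x)))

-- The end of the proof: the blocks PB, Fz, M cover everything but the pairs P, the vertices U and Z and the colours D and Cz.
module Closing {A C : Set} (k'' : ℕ) (h : C → List A → Bool) (τ : A → Bool) (I typ : C → Bool) (Vs : List A) (Cs : List C)
  (all-Vs : ∀ x → x ∈ˡ Vs) (all-Cs : ∀ c → c ∈ˡ Cs) (n≡km : length Vs ≡ suc (suc k'') * length Cs) where

  open Gadgets (suc k'') h τ Vs Cs
  open Splitting τ I k''

  private
    k m : ℕ
    k = suc (suc k'')
    m = length Cs

  Perfect : Set
  Perfect = Σ (List Blk) λ B → Sound B × vts B ↭ Vs × cls B ↭ Cs

  compat : Piece → Bool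
  compat (c , S) = typ c ∧ same (parity τ S) (I c)

  length-vts : ∀ θ → Sound θ → length (vts θ) ≡ length θ * k
  length-vts θ s = length-concatMap proj₂ k θ (All.tabulate (λ m → proj₂ (s m)))

  flat-length : ∀ P → length (flat P) ≡ 2 * length P
  flat-length [] = refl≡
  flat-length (_ ∷ P) = trans≡ (cong (2 +_) (flat-length P)) (a1 (length P))
    where
    a1 : ∀ p → 2 + 2 * p ≡ 2 * (1 + p)
    a1 = solve-∀

  private
    module PA = CMSolver (++-commutativeMonoid {A = A})
    module PC = CMSolver (++-commutativeMonoid {A = C})
    v-shuffle : ∀ (p f m u r z : List A) → (p ++ (f ++ m)) ++ ((r ++ u) ++ z) ↭ (m ++ u) ++ (p ++ (f ++ (r ++ z)))
    v-shuffle = PA.solve 6 (λ p f m u r z → (p PA.⊕ (f PA.⊕ m)) PA.⊕ ((r PA.⊕ u) PA.⊕ z) PA.⊜ (m PA.⊕ u) PA.⊕ (p PA.⊕ (f PA.⊕ (r PA.⊕ z)))) refl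
    c-shuffle : ∀ (p f m d z : List C) → (p ++ (f ++ m)) ++ (d ++ z) ↭ (m ++ d) ++ (p ++ (f ++ z))
    c-shuffle = PC.solve 5 (λ p f m d z → (p PC.⊕ (f PC.⊕ m)) PC.⊕ (d PC.⊕ z) PC.⊜ (m PC.⊕ d) PC.⊕ (p PC.⊕ (f PC.⊕ z))) refl
    v-shuffle₂ : ∀ (s p f m z : List A) → (s ++ p) ++ (f ++ (m ++ z)) ↭ (p ++ (f ++ m)) ++ (s ++ z)
    v-shuffle₂ = PA.solve 5 (λ s p f m z → (s PA.⊕ p) PA.⊕ (f PA.⊕ (m PA.⊕ z)) PA.⊜ (p PA.⊕ (f PA.⊕ m)) PA.⊕ (s PA.⊕ z)) refl
    c-shuffle₂ : ∀ (s p f m z : List C) → (s ++ p) ++ (f ++ (m ++ z)) ↭ (p ++ (f ++ m)) ++ (s ++ z)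
    c-shuffle₂ = PC.solve 5 (λ s p f m z → (s PC.⊕ p) PC.⊕ (f PC.⊕ (m PC.⊕ z)) PC.⊜ (p PC.⊕ (f PC.⊕ m)) PC.⊕ (s PC.⊕ z)) refl

    v-shuffle₃ : ∀ (p u z b : List A) → (p ++ (u ++ z)) ++ b ↭ (p ++ u) ++ (b ++ z)
    v-shuffle₃ = PA.solve 4 (λ p u z b → (p PA.⊕ (u PA.⊕ z)) PA.⊕ b PA.⊜ (p PA.⊕ u) PA.⊕ (b PA.⊕ z)) refl

  module _ (P : List (A × A)) (flip : All Flip P) (Z : List A) (Cz At : List C)
    (Fz : List Blk) (Fz-cols : cls Fz ≡ At) (Fz-sound : Sound Fz) (PB : List Blk) (PB-sound : Sound PB)
    (absorbing : ∀ ps → length ps ≡ suc (length P) → All (λ p → p ∈ˡ 𝔹 × compat p ≡ true) ps → Σ (List Blk) λ B' → Sound B' × vts B' ↭ vts ps ++ vts PB × cls B' ↭ cls ps ++ cls PB)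
    (V' : List A) (C' : List C) (V↭ : Vs ↭ V' ++ (vts PB ++ (vts Fz ++ (flat P ++ Z)))) (C↭ : Cs ↭ C' ++ (cls PB ++ (At ++ Cz))) (C'-typ : ∀ {c} → c ∈ˡ C' → typ c ≡ true)
    (M : List Blk) (U : List A) (D : List C) (vert : vts M ++ U ↭ V') (col : cls M ++ D ↭ C') (M-sound : Sound M) (|D| : length D ≡ suc (length P)) where

    private
      FV : List A
      FV = vts Fz ++ (flat P ++ Z)
    Bs : List Blk
    Bs = PB ++ (Fz ++ M)

    Bs-sound : Sound Bs
    Bs-sound = Sound-++ {PB} PB-sound (Sound-++ {Fz} Fz-sound M-sound)

    private
      vts-Bs : vts Bs ≡ vts PB ++ (vts Fz ++ vts M)
      vts-Bs = trans≡ (concatMap-++ proj₂ PB (Fz ++ M)) (cong (vts PB ++_) (concatMap-++ proj₂ Fz M))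
      cls-Bs : cls Bs ≡ cls PB ++ (cls Fz ++ cls M)
      cls-Bs = trans≡ (map-++ proj₁ PB (Fz ++ M)) (cong (cls PB ++_) (map-++ proj₁ Fz M))

    all-vertices : vts Bs ++ ((flat P ++ U) ++ Z) ↭ Vs
    all-vertices = ↭-trans (↭-reflexive (cong (_++ ((flat P ++ U) ++ Z)) vts-Bs)) (↭-trans (v-shuffle (vts PB) (vts Fz) (vts M) U (flat P) Z)
      (↭-trans (++⁺ʳ (vts PB ++ FV) vert) (↭-sym V↭)))

    all-colours : cls Bs ++ (D ++ Cz) ↭ Cs
    all-colours = ↭-trans (↭-reflexive (cong (_++ (D ++ Cz)) cls-Bs)) (↭-trans (c-shuffle (cls PB) (cls Fz) (cls M) D Cz)
      (↭-trans (++⁺ col (↭-reflexive (cong (λ z → cls PB ++ (z ++ Cz)) Fz-cols))) (↭-sym C↭)))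

    D-typ : All (λ c → typ c ≡ true) D
    D-typ = All.tabulate (λ i → C'-typ (∈-resp-↭ col (∈-++⁺ʳ (cls M) i)))

    finish : (Σ (List Blk) λ Bz → Σ (List A) λ Z' → Sound Bz × cls Bz ≡ Cz × Z ↭ vts Bz ++ Z' × xors I D ≡ parity τ ((flat P ++ U) ++ Z')) → Perfect
    finish (Bz , Z' , Bz-sound , Bz-cols , Z↭ , par) = absorb-them (split D P (U ++ Z') flip |D| size
        (trans≡ par (cong (parity τ) (++-assoc (flat P) U Z'))))
      where
      total : vts Bs ++ ((flat P ++ (U ++ Z')) ++ vts Bz) ↭ Vs
      total = ↭-trans (++⁺ˡ (vts Bs) (↭-trans (v-shuffle₃ (flat P) U Z' (vts Bz)) (++⁺ˡ (flat P ++ U) (↭-sym Z↭)))) all-vertices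
      size : length (U ++ Z') ≡ length P * k'' + k
      size = +-cancelˡ-≡ (length Bs * k + length (flat P) + length Bz * k) _ _ (begin-equality
        length Bs * k + length (flat P) + length Bz * k + length (U ++ Z')
          ≡⟨ a1 (length Bs * k) (length (flat P)) (length Bz * k) (length (U ++ Z')) ⟩
        length Bs * k + ((length (flat P) + length (U ++ Z')) + length Bz * k)
          ≡⟨ sym (cong₂ (λ a b → a + ((length (flat P) + length (U ++ Z')) + b)) (length-vts Bs Bs-sound) (length-vts Bz Bz-sound)) ⟩
        length (vts Bs) + ((length (flat P) + length (U ++ Z')) + length (vts Bz))
          ≡⟨ sym (trans≡ (length-++ (vts Bs)) (cong (length (vts Bs) +_) (trans≡ (length-++ (flat P ++ (U ++ Z'))) (cong (_+ length (vts Bz)) (length-++ (flat P)))))) ⟩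
        length (vts Bs ++ ((flat P ++ (U ++ Z')) ++ vts Bz))
          ≡⟨ trans≡ (↭-length total) n≡km ⟩
        k * m
          ≡⟨ cong (k *_) (trans≡ (sym (↭-length all-colours)) (trans≡ (length-++ (cls Bs)) (cong₂ _+_ (length-map proj₁ Bs)
               (trans≡ (length-++ D) (cong₂ _+_ |D| (trans≡ (sym (cong length Bz-cols)) (length-map proj₁ Bz))))))) ⟩
        k * (length Bs + (suc (length P) + length Bz))
          ≡⟨ a2 k'' (length Bs) (length P) (length Bz) ⟩
        length Bs * k + 2 * length P + length Bz * k + (length P * k'' + k)
          ≡⟨ cong (λ z → length Bs * k + z + length Bz * k + (length P * k'' + k)) (sym (flat-length P)) ⟩
        length Bs * k + length (flat P) + length Bz * k + (length P * k'' + k) ∎)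
        where
        a1 : ∀ a b c d → a + b + c + d ≡ a + ((b + d) + c)
        a1 = solve-∀
        a2 : ∀ k b p z → (2 + k) * (b + ((1 + p) + z)) ≡ b * (2 + k) + 2 * p + z * (2 + k) + (p * k + (2 + k))
        a2 = solve-∀
      absorb-them : Pieces D (flat P ++ (U ++ Z')) → Perfect
      absorb-them (ps , ps-cols , ps-verts , ps-par) = done (absorbing ps (trans≡ (sym (length-map proj₁ ps)) (trans≡ (cong length ps-cols) |D|)) (All.tabulate piece))
        where
        same-refl : ∀ {a b} → a ≡ b → same a b ≡ true
        same-refl {true} refl≡ = refl≡
        same-refl {false} refl≡ = refl≡
        piece : ∀ {p} → p ∈ˡ ps → p ∈ˡ 𝔹 × compat p ≡ true
        piece {c , S} i = ∈-pairs⁺ (all-Cs c) (subst (λ z → S ∈ˡ tuples Vs z) (proj₁ (All.lookup ps-par i)) (∈-tuples⁺ Vs (All.tabulate (λ {x} _ → all-Vs x)))) ,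
          cong₂ _∧_ (All.lookup D-typ (subst (c ∈ˡ_) ps-cols (∈-map⁺ proj₁ i))) (same-refl (proj₂ (All.lookup ps-par i)))
        done : (Σ (List Blk) λ B' → Sound B' × vts B' ↭ vts ps ++ vts PB × cls B' ↭ cls ps ++ cls PB) → Perfect
        done (B' , B'-sound , B'-verts , B'-cols) = B' ++ (Fz ++ (M ++ Bz)) ,
          Sound-++ {B'} B'-sound (Sound-++ {Fz} Fz-sound (Sound-++ {M} M-sound Bz-sound)) ,
          ↭-trans (↭-reflexive (trans≡ (concatMap-++ proj₂ B' _) (cong (vts B' ++_) (trans≡ (concatMap-++ proj₂ Fz _) (cong (vts Fz ++_) (concatMap-++ proj₂ M Bz))))))
            (↭-trans (++⁺ʳ (vts Fz ++ (vts M ++ vts Bz)) B'-verts) (↭-trans (v-shuffle₂ (vts ps) (vts PB) (vts Fz) (vts M) (vts Bz))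
              (↭-trans (++⁺ (↭-reflexive (sym vts-Bs)) (++⁺ʳ (vts Bz) ps-verts)) total))) ,
          ↭-trans (↭-reflexive (trans≡ (map-++ proj₁ B' _) (cong (cls B' ++_) (trans≡ (map-++ proj₁ Fz _) (cong (cls Fz ++_) (map-++ proj₁ M Bz))))))
            (↭-trans (++⁺ʳ (cls Fz ++ (cls M ++ cls Bz)) B'-cols) (↭-trans (c-shuffle₂ (cls ps) (cls PB) (cls Fz) (cls M) (cls Bz))
              (↭-trans (++⁺ (↭-reflexive (sym cls-Bs)) (↭-reflexive (cong₂ _++_ ps-cols Bz-cols))) all-colours)))

    perfect : (∀ (Bs : List Blk) (D : List C) (X : List A) → Sound Bs → vts Bs ++ (X ++ Z) ↭ Vs → cls Bs ++ (D ++ Cz) ↭ Cs → All (λ c → typ c ≡ true) D →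
        Σ (List Blk) λ Bz → Σ (List A) λ Z' → Sound Bz × cls Bz ≡ Cz × Z ↭ vts Bz ++ Z' × xors I D ≡ parity τ (X ++ Z')) → Perfect
    perfect resolve = finish (resolve Bs D (flat P ++ U) Bs-sound all-vertices all-colours D-typ)

room-left : ∀ k c' v' pb at cz f ρ n m → n ≡ k * m → n ≡ v' + (k * pb + (k * at + f)) → m ≡ c' + (pb + (at + cz)) → f ≤ ρ → k * c' ≤ v' + ρ
room-left k c' v' pb at cz f ρ n m n≡ n≡' m≡ f≤ = +-cancelʳ-≤ (k * pb + k * at) _ _ (begin
    k * c' + (k * pb + k * at) ≤⟨ m≤m+n _ (k * cz) ⟩
    k * c' + (k * pb + k * at) + k * cz ≡⟨ a1 k c' pb at cz ⟩
    k * (c' + (pb + (at + cz))) ≡⟨ trans≡ (cong (k *_) (sym m≡)) (trans≡ (sym n≡) n≡') ⟩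
    v' + (k * pb + (k * at + f)) ≤⟨ +-monoʳ-≤ v' (+-monoʳ-≤ (k * pb) (+-monoʳ-≤ (k * at) f≤)) ⟩
    v' + (k * pb + (k * at + ρ)) ≡⟨ a2 v' (k * pb) (k * at) ρ ⟩
    v' + ρ + (k * pb + k * at) ∎)
  where
  a1 : ∀ k a b c d → k * a + (k * b + k * c) + k * d ≡ k * (a + (b + (c + d)))
  a1 = solve-∀
  a2 : ∀ v p a f → v + (p + (a + f)) ≡ v + f + (p + a)
  a2 = solve-∀

module _ {A C : Set} (_≟A_ : DecidableEquality A) (τ : A → Bool) (I : C → Bool) (k'' : ℕ) (Vs : List A) (Vs-unique : Unique Vs) (K₃ : ℕ) (K₃≥1 : 1 ≤ K₃) where

  open Splitting {A} {C} τ I k''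
  open Picking _≟A_ Vs Vs-unique

  private
    n : ℕ
    n = length Vs

    record Sides : Set where
      field
        pA pB : A → Bool
        largeA : n ≤ K₃ * ∑ Vs (λ x → ⟦ pA x ⟧)
        largeB : n ≤ K₃ * ∑ Vs (λ x → ⟦ pB x ⟧)
        flips : ∀ {a b} → pA a ≡ true → pB b ≡ true → Flip (a , b)

    Types : Set
    Types = ((∀ x → τ x ≡ false) × (∀ c → I c ≡ false)) ⊎ (n ≤ K₃ * ∑ Vs (λ x → ⟦ τ x ⟧) × n ≤ K₃ * ∑ Vs (λ x → ⟦ not (τ x) ⟧))

    sides : Types → Sides
    sides (inj₁ trivial) = record { pA = λ _ → true ; pB = λ _ → true ; largeA = full ; largeB = full ; flips = λ _ _ → inj₂ trivial }
      where
      full : n ≤ K₃ * ∑ Vs (λ _ → 1)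
      full = ≤-trans (≤-trans (≤-reflexive (sym (*-identityˡ n))) (*-monoˡ-≤ n K₃≥1)) (≤-reflexive (cong (K₃ *_) (length≡∑ Vs)))
    sides (inj₂ (la , lb)) = record { pA = τ ; pB = not ∘ τ ; largeA = la ; largeB = lb ; flips = λ {a} {b} e f → inj₁ (differ₂ (τ a) (τ b) e f) }
      where
      differ₂ : ∀ a b → a ≡ true → not b ≡ true → a ≢ b
      differ₂ true true _ ()
      differ₂ true false _ _ ()

    zipped : ∀ (xs ys : List A) → length xs ≡ length ys → Σ (List (A × A)) λ P → flat P ↭ xs ++ ys × length P ≡ length xs × (∀ {p} → p ∈ˡ P → proj₁ p ∈ˡ xs × proj₂ p ∈ˡ ys)
    zipped [] [] _ = [] , refl , refl≡ , λ ()
    zipped (x ∷ xs) (y ∷ ys) e with zipped xs ys (suc-injective e)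
    ... | P , p , l , f = (x , y) ∷ P , prep x (↭-trans (prep y p) (↭-sym (shift y xs ys))) , cong suc l ,
      λ { (here refl≡) → here refl≡ , here refl≡ ; (there m) → there (proj₁ (f m)) , there (proj₂ (f m)) }

  Pairs : ℕ → List A → Set
  Pairs s Z = Σ (List (A × A)) λ P → All Flip P × length P ≡ s × Unique (flat P ++ Z)

  reserve-pairs : Types → ∀ s Z → Unique Z → K₃ * (2 * s + length Z) ≤ n → Pairs s Z
  reserve-pairs types s Z Z-unique room = from (sides types)
    where
    from : Sides → Pairs s Z
    from S = first (pick-fresh pA s Z (enough largeA (≤-trans (≤-reflexive (+-comm (length Z) s)) (+-monoˡ-≤ (length Z) (m≤m+n s _)))))
      where
      open Sides S
      enough : ∀ {c t} → n ≤ K₃ * c → t ≤ 2 * s + length Z → t ≤ c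
      enough le t≤ = *-cancelˡ-≤ K₃ {{>-nonZero K₃≥1}} (≤-trans (*-monoʳ-≤ K₃ t≤) (≤-trans room le))
      first : Picked pA s Z → Pairs s Z
      first (xs , lx , ax , ux , dx) = second (pick-fresh pB s (xs ++ Z) (enough largeB (≤-reflexive
          (trans≡ (cong (_+ s) (trans≡ (length-++ xs) (cong (_+ length Z) lx))) (a1 s (length Z))))))
        where
        a1 : ∀ s z → s + z + s ≡ 2 * s + z
        a1 = solve-∀
        second : Picked pB s (xs ++ Z) → Pairs s Z
        second (ys , ly , ay , uy , dy) = pair (zipped xs ys (trans≡ lx (sym ly)))
          where
          pair : (Σ (List (A × A)) λ P → flat P ↭ xs ++ ys × length P ≡ length xs × (∀ {p} → p ∈ˡ P → proj₁ p ∈ˡ xs × proj₂ p ∈ˡ ys)) → Pairs s Z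
          pair (P , p , l , f) = P , All.tabulate (λ i → flips (All.lookup ax (proj₁ (f i))) (All.lookup ay (proj₂ (f i)))) , trans≡ l lx ,
            Unique-++⁺ (Unique-resp-↭ (↭-sym p) (Unique-++⁺ ux uy (λ i i' → dy i' (∈-++⁺ˡ i)))) Z-unique (λ i i' → apart (∈-++⁻ xs (∈-resp-↭ p i)) i')
            where
            apart : ∀ {x} → x ∈ˡ xs ⊎ x ∈ˡ ys → x ∉ˡ Z
            apart (inj₁ i) = dx i
            apart (inj₂ i) i' = dy i (∈-++⁺ʳ xs i')

record AssemblyData (A C : Set) : Set where
  constructor assembly-data
  field
    _≟A_ : DecidableEquality A
    _≟C_ : DecidableEquality C
    k'' : ℕ
    h : C → List A → Bool
    h-sym : ∀ c → SymFun (h c)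
    h-unique : ∀ c t → length t ≡ suc (suc k'') → h c t ≡ true → Unique t
    Vs : List A
    Cs : List C
    Vs-unique : Unique Vs
    Cs-unique : Unique Cs
    all-Vs : ∀ x → x ∈ˡ Vs
    all-Cs : ∀ c → c ∈ˡ Cs
    n≡km : length Vs ≡ suc (suc k'') * length Cs
    n>0 : 0 < length Vs
    m>0 : 0 < length Cs
    edges-many : ∀ c → length Vs ^ suc (suc k'') ≤ 3 * ∑ (tuples Vs (suc (suc k''))) (λ t → ⟦ h c t ⟧)
    exact : ∀ (τ : A → Bool) (J : C → Bool) → (∀ c t → length t ≡ suc (suc k'') → h c t ≡ true → parity τ t ≡ J c) → xors J Cs ≡ parity τ Vs
    r' ℓ : ℕ
    ℓ+r : ℓ + suc r' ≡ suc (suc k'')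
    cases : (2 * suc r' < suc (suc k'')) ⊎ (2 * suc r' ≡ suc (suc k'') × 2 ≤ suc r')
    κ E d₀ : ℕ
    κ≡ : 4 * (suc (suc k'') * excessConst (suc r')) ≡ κ
    E≡ : 2 * (excessConst (suc r') * suc (suc k'')) ≡ E
    d₀≡ : suc (8 * suc r' * κ) ≡ d₀
    κ≥1 : 1 ≤ κ
    E≥1 : 1 ≤ E
    degree : ∀ c L → Unique L → length L ≡ ℓ → 2 * E * length Vs ^ suc r' ≤ 2 * E * (2 * ∑ (tuples Vs (suc r')) (λ t → ⟦ h c (L ++ t) ⟧)) + length Vs ^ suc r'
    K₀ K₀' : ℕ
    K₀≡ : K₀ ≡ suc K₀'
    d₀≤K₀ : d₀ ≤ K₀
    room : d₀ * ℓ + (2 * K₀' + 2 * suc (suc k'')) ≤ suc (suc k'') * K₀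

module Assembly {A C : Set} (data′ : AssemblyData A C) where

  open AssemblyData data′

  private
    k n m : ℕ
    k = suc (suc k'')
    n = length Vs
    m = length Cs

  Result : Set
  Result = Σ (List (C × List A)) λ B → (∀ {b} → b ∈ˡ B → h (proj₁ b) (proj₂ b) ≡ true × length (proj₂ b) ≡ k) × concatMap proj₂ B ↭ Vs × map proj₁ B ↭ Cs

  record StructureData : Set where
    constructor structure-data
    field
      j K K₂ K₃ γ : ℕ
      K₃≥1 : 1 ≤ K₃
      st : StructureTheorem.Structure (suc k'') h h-sym Vs Cs all-Vs n>0 m>0 j K K₂ K₃ γ
      Q T w : ℕ
      Q≡ : suc Q ≡ 2 * (K₂ * K ^ k) ^ K₀
      w≡ : T * gadgetV k j K₀ + k * ∑ Cs (λ c → ⟦ not (StructureTheorem.Structure.typ st c) ⟧) + (2 * K₀' + 2 * k) ≡ w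
      small₁ : 4 * suc r' * E * (suc k'' + d₀ * ℓ + w) ≤ n
      small₂ : 16 * (κ * (suc r' * suc r' * (k * k))) + (suc k'' + d₀ * ℓ + w) ≤ n
      roomV : spaceV k j K₀ Q w ≤ n
      roomC : spaceC k j K₀ Q w ≤ m
      enough : (m * n ^ k) ^ K₀ * Q ^ T < suc Q ^ T
      freezing : 3 * (k * (w + k)) < n
      picking : K₃ * w ≤ n
      colours : w + K₀ ≤ m

  module WithStructure (structure : StructureData) where

    open StructureData structure

    open StructureTheorem.Structure st
    open Gadgets (suc k'') h τ Vs Cs using (vts; cls; Sound; Blk; Piece; 𝔹; length-𝔹; Robust)

    private
      sw : Finish.Switch (finish-data _≟A_ _≟C_ k'' h h-sym h-unique Vs Cs Vs-unique Cs-unique all-Vs all-Cs n≡km n>0 m>0 edges-many exact j K K₂ K₃ γ K₃≥1 st)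
      sw = Finish.switch (finish-data _≟A_ _≟C_ k'' h h-sym h-unique Vs Cs Vs-unique Cs-unique all-Vs all-Cs n≡km n>0 m>0 edges-many exact j K K₂ K₃ γ K₃≥1 st)
      open Finish.Switch sw
      open Splitting {A} {C} τ I k'' using (flat)

      at ρ gV : ℕ
      at = ∑ Cs (λ c → ⟦ not (typ c) ⟧)
      ρ = 2 * K₀' + 2 * k
      gV = gadgetV k j K₀

      ρ≤w : k * at + ρ ≤ w
      ρ≤w = ≤-trans (m≤n+m _ (T * gV)) (≤-reflexive (trans≡ (sym (+-assoc (T * gV) (k * at) ρ)) w≡))

      compat : Piece → Bool
      compat = Closing.compat k'' h τ I typ Vs Cs all-Vs all-Cs n≡km

      robust′ : ∀ p → p ∈ˡ 𝔹 → compat p ≡ true → Robust K₂ p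
      robust′ (c , S) i e = robust c S (proj₁ (∧-true {typ c} e)) (proj₁ (∈-tuples⁻ Vs k (proj₂ (∈-pairs⁻ Cs (tuples Vs k) i)))) (same⇒≡ _ _ (proj₂ (∧-true {typ c} e)))

      length-flat : ∀ P → length (flat P) ≡ 2 * length P
      length-flat = Closing.flat-length k'' h τ I typ Vs Cs all-Vs all-Cs n≡km

      length-vts : ∀ θ → Sound θ → length (vts θ) ≡ k * length θ
      length-vts θ s = trans≡ (length-concatMap proj₂ k θ (All.tabulate (λ m → proj₂ (s m)))) (*-comm (length θ) k)

    private
     module WithPairs (P : List (A × A)) (flip : All (Splitting.Flip τ I k'') P) (|P| : length P ≡ K₀') (F₀-unique : Unique (flat P ++ Z))
      (At Ct : List C) (Cs'↭ : Cs' ↭ At ++ Ct) (Ct-typ : ∀ {c} → c ∈ˡ Ct → typ c ≡ true) (|At| : length At ≤ at) where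

      F₀ : List A
      F₀ = flat P ++ Z

      |F₀| : length F₀ ≤ ρ
      |F₀| = ≤-trans (≤-reflexive (length-++ (flat P))) (+-mono-≤ (≤-reflexive (trans≡ (length-flat P) (cong (2 *_) |P|))) Z-size)

      FC₀ : List C
      FC₀ = At ++ Cz

      |FC₀| : length FC₀ ≤ k * at + ρ
      |FC₀| = ≤-trans (≤-reflexive (length-++ At)) (+-mono-≤ (≤-trans |At| (m≤n*m at k)) (≤-trans Cz-size (≤-trans (s≤s z≤n) (m≤n+m (2 * k) (2 * K₀')))))

      Cs↭′ : Cs ↭ FC₀ ++ Ct
      Cs↭′ = ↭-trans Cs↭ (↭-trans (++⁺ˡ Cz Cs'↭) (↭-trans (shifts Cz At) (↭-reflexive (sym (++-assoc At Cz Ct)))))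

      FC₀-unique : Unique FC₀
      FC₀-unique = proj₁ (Unique-++⁻ FC₀ (Unique-resp-↭ Cs↭′ Cs-unique))

      module WithFrozen (Fz : List Blk) (Fz-cols : cls Fz ≡ At) (Fz-sound : Sound Fz) (Fz-unique : Unique (vts Fz)) (Fz-fresh : ∀ {x} → x ∈ˡ vts Fz → x ∉ˡ F₀) where

        FV : List A
        FV = vts Fz ++ F₀

        FV-unique : Unique FV
        FV-unique = Unique-++⁺ Fz-unique F₀-unique Fz-fresh

        |FV| : length FV ≤ k * at + ρ
        |FV| = ≤-trans (≤-reflexive (length-++ (vts Fz))) (+-mono-≤ (≤-trans (≤-reflexive (trans≡ (length-vts Fz Fz-sound) (cong (k *_) (trans≡ (sym (length-map proj₁ Fz)) (cong length Fz-cols))))) (*-monoʳ-≤ k |At|)) |F₀|)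

        ZV≤ : length FV + T * gV ≤ w
        ZV≤ = ≤-trans (+-monoˡ-≤ (T * gV) |FV|) (≤-reflexive (trans≡ (+-comm (k * at + ρ) (T * gV)) (trans≡ (sym (+-assoc (T * gV) (k * at) ρ)) w≡)))

        ZC≤ : length FC₀ + T * gadgetC k j K₀ ≤ w
        ZC≤ = ≤-trans (+-mono-≤ |FC₀| (*-monoʳ-≤ T (*-monoʳ-≤ K₀ (*-monoʳ-≤ k (*-monoʳ-≤ j (s≤s z≤n))))))
          (≤-reflexive (trans≡ (+-comm (k * at + ρ) (T * gV)) (trans≡ (sym (+-assoc (T * gV) (k * at) ρ)) w≡)))

        module WithFamily (PB : List Blk) (PB-sound : Sound PB) (PB-unique : Unique (vts PB)) (PB-fresh : ∀ {x} → x ∈ˡ vts PB → x ∉ˡ FV)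
          (PBc-unique : Unique (cls PB)) (PBc-fresh : ∀ {x} → x ∈ˡ cls PB → x ∉ˡ FC₀) (|PB| : length (vts PB) ≤ T * gV)
          (absorbing : ∀ ps → length ps ≡ K₀ → All (λ p → p ∈ˡ 𝔹 × compat p ≡ true) ps → Σ (List Blk) λ B' → Sound B' × vts B' ↭ vts ps ++ vts PB × cls B' ↭ cls ps ++ cls PB) where

          W : List A
          W = vts PB ++ FV

          |W| : length W ≤ w
          |W| = ≤-trans (≤-reflexive (trans≡ (length-++ (vts PB)) (+-comm (length (vts PB)) _))) (≤-trans (+-monoʳ-≤ (length FV) |PB|) ZV≤)

          module WithRest (V' : List A) (C' : List C) (V↭ : Vs ↭ V' ++ W) (C↭ : Cs ↭ C' ++ (cls PB ++ FC₀)) where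

            m≡ : m ≡ length C' + (length PB + (length At + length Cz))
            m≡ = trans≡ (↭-length C↭) (trans≡ (length-++ C') (cong (length C' +_) (trans≡ (length-++ (cls PB)) (cong₂ _+_ (length-map proj₁ PB) (length-++ At)))))

            n≡ : n ≡ length V' + (k * length PB + (k * length At + length F₀))
            n≡ = trans≡ (↭-length V↭) (trans≡ (length-++ V') (cong (length V' +_) (trans≡ (length-++ (vts PB)) (cong₂ _+_ (length-vts PB PB-sound)
              (trans≡ (length-++ (vts Fz)) (cong (_+ length F₀) (trans≡ (length-vts Fz Fz-sound) (cong (k *_) (trans≡ (sym (length-map proj₁ Fz)) (cong length Fz-cols))))))))))

            C'-large : K₀ ≤ length C'
            C'-large = +-cancelˡ-≤ w _ _ (begin
              w + K₀ ≤⟨ colours ⟩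
              m ≡⟨ m≡ ⟩
              length C' + (length PB + (length At + length Cz))
                ≤⟨ +-monoʳ-≤ (length C') (+-mono-≤ (≤-trans (m≤n*m (length PB) k) (≤-trans (≤-reflexive (sym (length-vts PB PB-sound))) |PB|)) (≤-trans (≤-reflexive (sym (length-++ At))) |FC₀|)) ⟩
              length C' + (T * gV + (k * at + ρ)) ≡⟨ trans≡ (cong (length C' +_) (trans≡ (sym (+-assoc (T * gV) (k * at) ρ)) w≡)) (+-comm (length C') w) ⟩
              w + length C' ∎)

            C'-typ : ∀ {c} → c ∈ˡ C' → typ c ≡ true
            C'-typ {c} i = go (∈-++⁻ FC₀ (∈-resp-↭ Cs↭′ (all-Cs c)))
              where
              go : c ∈ˡ FC₀ ⊎ c ∈ˡ Ct → typ c ≡ true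
              go (inj₁ i') = ⊥-elim (proj₂ (proj₂ (Unique-++⁻ C' (Unique-resp-↭ C↭ Cs-unique))) i (∈-++⁺ʳ (cls PB) i'))
              go (inj₂ i') = Ct-typ i'

            matched : Σ (State k h V' C') λ s → length (State.D s) ≡ K₀
            matched = NearPerfect.near-perfect (near-perfect-data _≟A_ (suc k'') r' ℓ ℓ+r cases h h-sym Vs V' W C' Vs-unique V↭ κ E d₀ κ≡ E≡ d₀≡ κ≥1 E≥1 (λ {c} _ → degree c)
              (≤-trans (*-monoʳ-≤ (4 * suc r' * E) (+-monoʳ-≤ (suc k'' + d₀ * ℓ) |W|)) small₁)
              (≤-trans (+-monoʳ-≤ (16 * (κ * (suc r' * suc r' * (k * k)))) (+-monoʳ-≤ (suc k'' + d₀ * ℓ) |W|)) small₂))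
              K₀ ρ (room-left k (length C') (length V') (length PB) (length At) (length Cz) (length F₀) ρ n m n≡km n≡ m≡ |F₀|) d₀≤K₀ room C'-large

            finished : (Σ (State k h V' C') λ s → length (State.D s) ≡ K₀) → Result
            finished (s , |D|) = Closing.perfect k'' h τ I typ Vs Cs all-Vs all-Cs n≡km P flip Z Cz At Fz Fz-cols Fz-sound PB PB-sound
              (λ ps l → absorbing ps (trans≡ l K₀P)) V' C' V↭ C↭ C'-typ (State.M s) (State.U s) (State.D s) (State.vert s) (State.col s) (State.sound s) (trans≡ |D| (sym K₀P)) resolve
              where
              K₀P : suc (length P) ≡ K₀
              K₀P = trans≡ (cong suc |P|) (sym K₀≡)

            result : Result
            result = finished matched

          result : Result
          result = go (extract W Vs (Unique-++⁺ PB-unique FV-unique PB-fresh) (All.tabulate (λ {x} _ → all-Vs x)))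
            (extract (cls PB ++ FC₀) Cs (Unique-++⁺ PBc-unique FC₀-unique PBc-fresh) (All.tabulate (λ {c} _ → all-Cs c)))
            where
            go : (Σ (List A) λ V' → Vs ↭ W ++ V') → (Σ (List C) λ C' → Cs ↭ (cls PB ++ FC₀) ++ C') → Result
            go (V' , p) (C' , q) = WithRest.result V' C' (↭-trans p (++-comm W V')) (↭-trans q (++-comm (cls PB ++ FC₀) C'))

        family : Absorbers.Family _≟A_ _≟C_ (suc k'') h τ Vs Cs Vs-unique Cs-unique j K K₀ K₂ close n>0 m>0 compat robust′ Q Q≡ FV FC₀ T
          (≤-trans (spaceV-mono k j K₀ Q ZV≤) roomV) (≤-trans (spaceC-mono k j K₀ Q ZC≤) roomC) (subst (λ z → z ^ K₀ * Q ^ T < suc Q ^ T) (sym length-𝔹) enough)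
        family = Absorbers.family _≟A_ _≟C_ (suc k'') h τ Vs Cs Vs-unique Cs-unique j K K₀ K₂ close n>0 m>0 compat robust′ Q Q≡ FV FC₀ T
          (≤-trans (spaceV-mono k j K₀ Q ZV≤) roomV) (≤-trans (spaceC-mono k j K₀ Q ZC≤) roomC) (subst (λ z → z ^ K₀ * Q ^ T < suc Q ^ T) (sym length-𝔹) enough)

        result : Result
        result = WithFamily.result (F.blocks) F.sound F.v-unique F.v-fresh F.c-unique F.c-fresh F.size F.absorbing
          where module F = Absorbers.Family family

      result : Result
      result = go (Picking.freeze _≟A_ Vs Vs-unique k h At F₀ edges-many (≤-trans (s≤s (*-monoʳ-≤ 3 (*-monoʳ-≤ k (+-monoˡ-≤ k small)))) freezing))
        where
        small : length F₀ + length At * k ≤ w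
        small = ≤-trans (+-mono-≤ |F₀| (≤-trans (*-monoˡ-≤ k |At|) (≤-reflexive (*-comm at k)))) (≤-trans (≤-reflexive (+-comm ρ (k * at))) ρ≤w)
        go : Picking.Frozen _≟A_ Vs Vs-unique k h At F₀ → Result
        go (Fz , cols , sound , unique , fresh) = WithFrozen.result Fz cols sound unique fresh

    assembled : Result
    assembled = go (reserve-pairs _≟A_ τ I k'' Vs Vs-unique K₃ K₃≥1 types K₀' Z Z-unique (≤-trans (*-monoʳ-≤ K₃ (≤-trans (+-monoʳ-≤ (2 * K₀') Z-size) (≤-trans (m≤n+m ρ (k * at)) ρ≤w))) picking))
        (select (λ c → not (typ c)) Cs')
      where
      go : Pairs _≟A_ τ I k'' Vs Vs-unique K₃ K₃≥1 K₀' Z →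
        (Σ (List C) λ At → Σ (List C) λ Ct → Cs' ↭ At ++ Ct × All (λ c → not (typ c) ≡ true) At × length At ≡ ∑ Cs' (λ c → ⟦ not (typ c) ⟧)) → Result
      go (P , flip , |P| , u) (At , Ct , Cs'↭ , At-not , |At|) = WithPairs.result P flip |P| u At Ct Cs'↭ (λ i → not-false′ (unselected (λ c → not (typ c)) Cs'↭ At-not |At| i))
        (≤-trans (≤-reflexive |At|) (≤-trans (m≤n+m _ (∑ Cz (λ c → ⟦ not (typ c) ⟧))) (≤-reflexive (trans≡ (sym (∑-++ Cz Cs' _)) (sym (∑-↭ _ Cs↭))))))
        where
        not-false′ : ∀ {b} → not b ≡ false → b ≡ true
        not-false′ {true} _ = refl≡

-- Everything required by the assembly is at most N (w + const), and w + const is a small fraction of n / k.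
module Numbers (k'' r E κ d₀ ℓ K₀ K₀' j Q K₃ : ℕ) (Q≥1 : 1 ≤ Q) where

  private
    k ρ gV cV cC big c₁ N γr : ℕ
    k = suc (suc k'')
    ρ = 2 * K₀' + 2 * k
    gV = gadgetV k j K₀
    cV = 2 * suc Q * (K₀ * (k * (j * k)))
    cC = 2 * suc Q * (K₀ * (k * j))
    big = 16 * (κ * (r * r * (k * k)))
    c₁ = (suc k'' + d₀ * ℓ) + big + (gV + k * (j * k) + j * k + k) + (gadgetC k j K₀ + k * (j * 1) + j * 1) + k + K₀ + 1
    N = 4 * r * E + cV + cC + suc (3 * k) + K₃
    γr = suc (3 * N * k * gV)

  atypical-bound : ℕ
  atypical-bound = 3 * N * k * k

  private
    n₁ : ℕ
    n₁ = proj₁ (rounds Q (suc k * K₀) γr Q≥1 (s≤s z≤n))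

  size-bound : ℕ
  size-bound = n₁ + 3 * N * k * (ρ + c₁)

  record Sizes (n m at : ℕ) : Set where
    field
      T w : ℕ
      w≡ : T * gadgetV k j K₀ + k * at + (2 * K₀' + 2 * k) ≡ w
      small₁ : 4 * r * E * (suc k'' + d₀ * ℓ + w) ≤ n
      small₂ : 16 * (κ * (r * r * (k * k))) + (suc k'' + d₀ * ℓ + w) ≤ n
      roomV : spaceV k j K₀ Q w ≤ n
      roomC : spaceC k j K₀ Q w ≤ m
      enough : (m * n ^ k) ^ K₀ * Q ^ T < suc Q ^ T
      freezing : 3 * (k * (w + k)) < n
      picking : K₃ * w ≤ n
      colours : w + K₀ ≤ m

  sizes : ∀ n m at → n ≡ k * m → size-bound ≤ n → atypical-bound * at ≤ m → Sizes n m at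
  sizes n m at n≡ le few = go (proj₂ (rounds Q (suc k * K₀) γr Q≥1 (s≤s z≤n)) n (≤-trans (m≤m+n n₁ _) le))
    where
    go : (Σ ℕ λ T → T * γr ≤ n × n ^ (suc k * K₀) * Q ^ T < suc Q ^ T) → Sizes n m at
    go (T , Tγ , fin) = record
      { T = T ; w = w ; w≡ = refl≡
      ; small₁ = ≤-trans (*-mono-≤ {4 * r * E} {N} (p₁ (4 * r * E) cV cC (suc (3 * k)) K₃) (q₁ (suc k'' + d₀ * ℓ) big wV wC k K₀ w)) Ns≤n
      ; small₂ = ≤-trans (q₂ (suc k'' + d₀ * ℓ) big wV wC k K₀ w) s≤n
      ; roomV = ≤-trans (≤-reflexive (r₁ Q K₀ k j (w + wV))) (≤-trans (*-mono-≤ {cV} {N} (p₂ (4 * r * E) cV cC (suc (3 * k)) K₃) (q₃ (suc k'' + d₀ * ℓ) big wV wC k K₀ w)) Ns≤n)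
      ; roomC = ≤-trans (≤-reflexive (r₂ Q K₀ k j (w + wC))) (≤-trans (*-mono-≤ {cC} {N} (p₃ (4 * r * E) cV cC (suc (3 * k)) K₃) (q₄ (suc k'' + d₀ * ℓ) big wV wC k K₀ w)) Ns≤m)
      ; enough = ≤-trans (s≤s (*-monoˡ-≤ (Q ^ T) (≤-trans (^-monoˡ-≤ K₀ (*-monoˡ-≤ (n ^ k) m≤n)) (≤-reflexive (^-*-assoc n (suc k) K₀))))) fin
      ; freezing = ≤-trans (≤-trans (r₃ k (w + k)) (*-mono-≤ {suc (3 * k)} {N} (p₄ (4 * r * E) cV cC (suc (3 * k)) K₃) (q₅ (suc k'' + d₀ * ℓ) big wV wC k K₀ w))) Ns≤n
      ; picking = ≤-trans (*-mono-≤ {K₃} {N} (m≤n+m K₃ _) (m≤m+n w c₁)) Ns≤n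
      ; colours = ≤-trans (q₆ (suc k'' + d₀ * ℓ) big wV wC k K₀ w) s≤m }
      where
      w wV wC s : ℕ
      w = T * gV + k * at + ρ
      wV = gV + k * (j * k) + j * k + k
      wC = gadgetC k j K₀ + k * (j * 1) + j * 1
      s = w + c₁
      m≤n : m ≤ n
      m≤n = ≤-trans (m≤n*m m k) (≤-reflexive (sym n≡))
      main : N * (k * s) ≤ n
      main = *-cancelˡ-≤ 3 (begin
        3 * (N * (k * s)) ≡⟨ a1 N k T gV at ρ c₁ ⟩
        T * (3 * N * k * gV) + 3 * N * k * k * at + 3 * N * k * (ρ + c₁)
          ≤⟨ +-mono-≤ (+-mono-≤ (≤-trans (*-monoʳ-≤ T (n≤1+n _)) Tγ) (≤-trans few m≤n)) (≤-trans (m≤n+m _ n₁) le) ⟩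
        n + n + n ≡⟨ a2 n ⟩
        3 * n ∎)
        where
        a1 : ∀ N k T g a ρ c → 3 * (N * (k * (T * g + k * a + ρ + c))) ≡ T * (3 * N * k * g) + 3 * N * k * k * a + 3 * N * k * (ρ + c)
        a1 = solve-∀
        a2 : ∀ n → n + n + n ≡ 3 * n
        a2 = solve-∀
      Ns≤m : N * s ≤ m
      Ns≤m = *-cancelˡ-≤ k (≤-trans (≤-reflexive (a1 k N s)) (≤-trans main (≤-reflexive n≡)))
        where
        a1 : ∀ k N s → k * (N * s) ≡ N * (k * s)
        a1 = solve-∀
      Ns≤n : N * s ≤ n
      Ns≤n = ≤-trans Ns≤m m≤n
      N≥1 : 1 ≤ N
      N≥1 = ≤-trans (s≤s z≤n) (p₄ (4 * r * E) cV cC (suc (3 * k)) K₃)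
        where
        p₄ : ∀ a b c d e → d ≤ a + b + c + d + e
        p₄ a b c d e = ≤-trans (m≤n+m d (a + b + c)) (m≤m+n _ e)
      s≤m : s ≤ m
      s≤m = ≤-trans (≤-trans (≤-reflexive (sym (*-identityˡ s))) (*-monoˡ-≤ s N≥1)) Ns≤m
      s≤n : s ≤ n
      s≤n = ≤-trans s≤m m≤n
      p₁ : ∀ a b c d e → a ≤ a + b + c + d + e
      p₁ a b c d e = ≤-trans (m≤m+n a b) (≤-trans (m≤m+n _ c) (≤-trans (m≤m+n _ d) (m≤m+n _ e)))
      p₂ : ∀ a b c d e → b ≤ a + b + c + d + e
      p₂ a b c d e = ≤-trans (m≤n+m b a) (≤-trans (m≤m+n _ c) (≤-trans (m≤m+n _ d) (m≤m+n _ e)))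
      p₃ : ∀ a b c d e → c ≤ a + b + c + d + e
      p₃ a b c d e = ≤-trans (m≤n+m c (a + b)) (≤-trans (m≤m+n _ d) (m≤m+n _ e))
      p₄ : ∀ a b c d e → d ≤ a + b + c + d + e
      p₄ a b c d e = ≤-trans (m≤n+m d (a + b + c)) (m≤m+n _ e)
      q₁ : ∀ a b v c k K w → a + w ≤ w + (a + b + v + c + k + K + 1)
      q₁ a b v c k K w = ≤-trans (m≤m+n (a + w) (b + v + c + k + K + 1)) (≤-reflexive (eq a b v c k K w))
        where
        eq : ∀ a b v c k K w → a + w + (b + v + c + k + K + 1) ≡ w + (a + b + v + c + k + K + 1)
        eq = solve-∀
      q₂ : ∀ a b v c k K w → b + (a + w) ≤ w + (a + b + v + c + k + K + 1)
      q₂ a b v c k K w = ≤-trans (m≤m+n (b + (a + w)) (v + c + k + K + 1)) (≤-reflexive (eq a b v c k K w))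
        where
        eq : ∀ a b v c k K w → b + (a + w) + (v + c + k + K + 1) ≡ w + (a + b + v + c + k + K + 1)
        eq = solve-∀
      q₃ : ∀ a b v c k K w → w + v ≤ w + (a + b + v + c + k + K + 1)
      q₃ a b v c k K w = ≤-trans (m≤m+n (w + v) (a + b + c + k + K + 1)) (≤-reflexive (eq a b v c k K w))
        where
        eq : ∀ a b v c k K w → w + v + (a + b + c + k + K + 1) ≡ w + (a + b + v + c + k + K + 1)
        eq = solve-∀
      q₄ : ∀ a b v c k K w → w + c ≤ w + (a + b + v + c + k + K + 1)
      q₄ a b v c k K w = ≤-trans (m≤m+n (w + c) (a + b + v + k + K + 1)) (≤-reflexive (eq a b v c k K w))
        where
        eq : ∀ a b v c k K w → w + c + (a + b + v + k + K + 1) ≡ w + (a + b + v + c + k + K + 1)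
        eq = solve-∀
      q₅ : ∀ a b v c k K w → suc (w + k) ≤ w + (a + b + v + c + k + K + 1)
      q₅ a b v c k K w = ≤-trans (m≤m+n (1 + (w + k)) (a + b + v + c + K)) (≤-reflexive (eq a b v c k K w))
        where
        eq : ∀ a b v c k K w → 1 + (w + k) + (a + b + v + c + K) ≡ w + (a + b + v + c + k + K + 1)
        eq = solve-∀
      q₆ : ∀ a b v c k K w → w + K ≤ w + (a + b + v + c + k + K + 1)
      q₆ a b v c k K w = ≤-trans (m≤m+n (w + K) (a + b + v + c + k + 1)) (≤-reflexive (eq a b v c k K w))
        where
        eq : ∀ a b v c k K w → w + K + (a + b + v + c + k + 1) ≡ w + (a + b + v + c + k + K + 1)
        eq = solve-∀
      r₁ : ∀ Q K k j x → 2 * (1 + Q) * (K * (k * (j * (k * x)))) ≡ 2 * (1 + Q) * (K * (k * (j * k))) * x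
      r₁ = solve-∀
      r₂ : ∀ Q K k j x → 2 * (1 + Q) * (K * (k * (j * x))) ≡ 2 * (1 + Q) * (K * (k * j)) * x
      r₂ = solve-∀
      r₃ : ∀ k x → suc (3 * (k * x)) ≤ suc (3 * k) * suc x
      r₃ k x = ≤-trans (m≤m+n _ (x + 3 * k)) (≤-reflexive (eq k x))
        where
        eq : ∀ k x → 1 + 3 * (k * x) + (x + 3 * k) ≡ (1 + 3 * k) * (1 + x)
        eq = solve-∀

half-weaken : ∀ e' e T S → 1 ≤ e → e' ≤ e → e * T ≤ e * (2 * S) + T → e' * T ≤ e' * (2 * S) + T
half-weaken e' e@(suc _) T S _ le h = *-cancelˡ-≤ e (begin
    e * (e' * T) ≡⟨ a1 e e' T ⟩
    e' * (e * T) ≤⟨ *-monoʳ-≤ e' h ⟩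
    e' * (e * (2 * S) + T) ≡⟨ a2 e e' S T ⟩
    e * (e' * (2 * S)) + e' * T ≤⟨ +-monoʳ-≤ (e * (e' * (2 * S))) (*-monoˡ-≤ T le) ⟩
    e * (e' * (2 * S)) + e * T ≡⟨ sym (*-distribˡ-+ e (e' * (2 * S)) T) ⟩
    e * (e' * (2 * S) + T) ∎)
  where
  a1 : ∀ a b c → a * (b * c) ≡ b * (a * c)
  a1 = solve-∀
  a2 : ∀ e f s t → f * (e * (2 * s) + t) ≡ e * (f * (2 * s)) + f * t
  a2 = solve-∀

module _ {A C : Set} (k' : ℕ) (h : C → List A → Bool) (h-sym : ∀ c → SymFun (h c))
  (Vs : List A) (Cs : List C) (all-Vs : ∀ x → x ∈ˡ Vs) (n>0 : 0 < length Vs) (m>0 : 0 < length Cs) where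

  private
    k n : ℕ
    k = suc k'
    n = length Vs
    St : ℕ → ℕ → ℕ → ℕ → ℕ → Set
    St = StructureTheorem.Structure k' h h-sym Vs Cs all-Vs n>0 m>0

  structure-cases : ∀ e → (∀ c x → e * n ^ k' ≤ e * (2 * ∑ (tuples Vs k') (λ w → ⟦ h c (x ∷ w) ⟧)) + n ^ k') → 3 ≤ e →
    ∀ P → P ≤ e → 30 ≤ P → ∀ γ Q Kc Kt K₂ K₃ → 1 ≤ γ → 5 * (2 * (k * (18 * k) ^ k) * γ) ≡ Q →
    18 * k * (18 * k) * (2 * (144 * k) * (4 * Q) * (2 * (144 * k))) ≡ Kc → 18 * k * (18 * k) * (2 * (144 * k) * 4 * (2 * (144 * k))) ≡ Kt →
    2 * (18 * k) ^ k ≡ K₂ → 18 * k ≡ K₃ → 6 * (144 * k) ≤ P → 14 * Q ≤ P → 2 * (144 * k) ≤ Q →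
    (∀ γ' → St 2 (P * P * P) 3 1 γ') ⊎ (∀ γ' → St 3 Kc 3 1 γ') ⊎ St 3 Kt K₂ K₃ γ
  structure-cases e half₁ e≥3 P P≤e P≥30 γ Q Kc Kt K₂ K₃ γ≥1 refl≡ refl≡ refl≡ refl≡ refl≡ = StructureTheorem.structure k' h h-sym Vs Cs all-Vs n>0 m>0 e half₁ e≥3 P P≤e P≥30 γ γ≥1

Matching : ∀ n m → ℕ → (Fin m → List (Fin n) → Bool) → Set
Matching n m k h = Σ (List (Fin m × List (Fin n))) λ B → (∀ {b} → b ∈ˡ B → h (proj₁ b) (proj₂ b) ≡ true × length (proj₂ b) ≡ k) × concatMap proj₂ B ↭ allFin n × map proj₁ B ↭ allFin m

CoreProperty : ℕ → ℕ → ℕ → ℕ → Set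
CoreProperty k ℓ e bound = ∀ n m (h : Fin m → List (Fin n) → Bool) → (∀ c → SymFun (h c)) → (∀ c t → length t ≡ k → h c t ≡ true → Unique t) →
  n ≡ k * m → bound ≤ n →
  (∀ c L s → Unique L → length L ≤ ℓ → length L + s ≡ k → e * n ^ s ≤ e * (2 * ∑ (tuples (allFin n) s) (λ t → ⟦ h c (L ++ t) ⟧)) + n ^ s) →
  (∀ (τ : Fin n → Bool) (J : Fin m → Bool) → (∀ c t → length t ≡ k → h c t ≡ true → parity τ t ≡ J c) → xors J (allFin m) ≡ parity τ (allFin n)) →
  Matching n m k h

CoreStatement : ℕ → ℕ → Set
CoreStatement k ℓ = Σ ℕ λ e → Σ ℕ λ bound → CoreProperty k ℓ e bound

record Constants (k'' r' ℓ : ℕ) : Set where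
  constructor constants
  field
    κ E d₀ K₀ K₀' γ Q P Kc Kt K₂ K₃ e Q₁ Q₂ Q₃ : ℕ
    κ≡ : 4 * (suc (suc k'') * excessConst (suc r')) ≡ κ
    E≡ : 2 * (excessConst (suc r') * suc (suc k'')) ≡ E
    d₀≡ : suc (8 * suc r' * κ) ≡ d₀
    κ≥1 : 1 ≤ κ
    E≥1 : 1 ≤ E
    K₀≡ : K₀ ≡ suc K₀'
    d₀≤K₀ : d₀ ≤ K₀
    room : d₀ * ℓ + (2 * K₀' + 2 * suc (suc k'')) ≤ suc (suc k'') * K₀
    P≥30 : 30 ≤ P
    γ≥1 : 1 ≤ γ
    Q≡ : 5 * (2 * (suc (suc k'') * (18 * suc (suc k'')) ^ suc (suc k'')) * γ) ≡ Q
    Kc≡ : 18 * suc (suc k'') * (18 * suc (suc k'')) * (2 * (144 * suc (suc k'')) * (4 * Q) * (2 * (144 * suc (suc k'')))) ≡ Kc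
    Kt≡ : 18 * suc (suc k'') * (18 * suc (suc k'')) * (2 * (144 * suc (suc k'')) * 4 * (2 * (144 * suc (suc k'')))) ≡ Kt
    K₂≡ : 2 * (18 * suc (suc k'')) ^ suc (suc k'') ≡ K₂
    K₃≡ : 18 * suc (suc k'') ≡ K₃
    P≥k : 6 * (144 * suc (suc k'')) ≤ P
    P≥Q : 14 * Q ≤ P
    Q≥k : 2 * (144 * suc (suc k'')) ≤ Q
    K₃≥1 : 1 ≤ K₃
    P≤e : P ≤ e
    2E≤e : 2 * E ≤ e
    Q₁≡ : suc Q₁ ≡ 2 * (3 * (P * P * P) ^ suc (suc k'')) ^ K₀
    Q₂≡ : suc Q₂ ≡ 2 * (3 * Kc ^ suc (suc k'')) ^ K₀
    Q₃≡ : suc Q₃ ≡ 2 * (K₂ * Kt ^ suc (suc k'')) ^ K₀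
    Q₁≥1 : 1 ≤ Q₁
    Q₂≥1 : 1 ≤ Q₂
    Q₃≥1 : 1 ≤ Q₃
    γ-large : Numbers.atypical-bound k'' (suc r') E κ d₀ ℓ K₀ K₀' 3 Q₃ K₃ Q₃≥1 ≤ γ

module CoreProof (k'' r' ℓ : ℕ) (k≥3 : 1 ≤ k'') (ℓ≥1 : 1 ≤ ℓ) (ℓ+r : ℓ + suc r' ≡ suc (suc k''))
  (cases : (2 * suc r' < suc (suc k'')) ⊎ (2 * suc r' ≡ suc (suc k'') × 2 ≤ suc r')) (data′ : Constants k'' r' ℓ) where

  open Constants data′

  private
    k r s₁ s₂ s₃ : ℕ
    k = suc (suc k'')
    r = suc r'
    s₁ = Numbers.size-bound k'' r E κ d₀ ℓ K₀ K₀' 2 Q₁ 1 Q₁≥1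
    s₂ = Numbers.size-bound k'' r E κ d₀ ℓ K₀ K₀' 3 Q₂ 1 Q₂≥1
    s₃ = Numbers.size-bound k'' r E κ d₀ ℓ K₀ K₀' 3 Q₃ K₃ Q₃≥1

  core : CoreStatement k ℓ
  core = e , suc (s₁ + (s₂ + s₃)) , theorem
    where
    theorem : CoreProperty k ℓ e (suc (s₁ + (s₂ + s₃)))
    theorem n m h h-sym h-unique n≡km large deg exact = go (structure-cases (suc k'') h h-sym Vs Cs ∈-allFin n>0 m>0 e half₁ e≥3 P P≤e P≥30 γ Q Kc Kt K₂ K₃ γ≥1 Q≡ Kc≡ Kt≡ K₂≡ K₃≡ P≥k P≥Q Q≥k)
      where
      Vs = allFin n
      Cs = allFin m
      |Vs| : length Vs ≡ n
      |Vs| = length-tabulate id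
      |Cs| : length Cs ≡ m
      |Cs| = length-tabulate id
      n≡ : length Vs ≡ k * length Cs
      n≡ = trans≡ |Vs| (trans≡ n≡km (cong (k *_) (sym |Cs|)))
      large′ : suc (s₁ + (s₂ + s₃)) ≤ length Vs
      large′ = ≤-trans large (≤-reflexive (sym |Vs|))
      n>0 : 0 < length Vs
      n>0 = ≤-trans (s≤s z≤n) large′
      m>0 : 0 < length Cs
      m>0 = *-cancelˡ-< k 0 (length Cs) (≤-trans (≤-reflexive (cong suc (*-zeroʳ k))) (≤-trans n>0 (≤-reflexive n≡)))
      bounds : ∀ {x} → x ≤ s₁ + (s₂ + s₃) → x ≤ length Vs
      bounds le = ≤-trans le (≤-trans (n≤1+n _) large′)
      e≥3 : 3 ≤ e
      e≥3 = ≤-trans (≤-trans (≤ᵇ⇒≤ 3 30 tt) P≥30) P≤e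
      deg₀ : ∀ c L s → Unique L → length L ≤ ℓ → length L + s ≡ k → e * length Vs ^ s ≤ e * (2 * ∑ (tuples Vs s) (λ t → ⟦ h c (L ++ t) ⟧)) + length Vs ^ s
      deg₀ c L s u l l' = subst (λ z → e * z ^ s ≤ e * (2 * ∑ (tuples Vs s) (λ t → ⟦ h c (L ++ t) ⟧)) + z ^ s) (sym |Vs|) (deg c L s u l l')
      half₁ : ∀ c x → e * length Vs ^ suc k'' ≤ e * (2 * ∑ (tuples Vs (suc k'')) (λ w → ⟦ h c (x ∷ w) ⟧)) + length Vs ^ suc k''
      half₁ c x = deg₀ c (x ∷ []) (suc k'') ([] ∷ []) ℓ≥1 refl≡
      edges-many : ∀ c → length Vs ^ k ≤ 3 * ∑ (tuples Vs k) (λ t → ⟦ h c t ⟧)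
      edges-many = StructureTheorem.edges-many (suc k'') h h-sym Vs Cs ∈-allFin n>0 m>0 e half₁ e≥3
      St : ℕ → ℕ → ℕ → ℕ → ℕ → Set
      St = StructureTheorem.Structure (suc k'') h h-sym Vs Cs ∈-allFin n>0 m>0
      deg′ : ∀ c L → Unique L → length L ≡ ℓ → 2 * E * length Vs ^ r ≤ 2 * E * (2 * ∑ (tuples Vs r) (λ t → ⟦ h c (L ++ t) ⟧)) + length Vs ^ r
      deg′ c L u l = half-weaken (2 * E) e (length Vs ^ r) (∑ (tuples Vs r) (λ t → ⟦ h c (L ++ t) ⟧)) (≤-trans (s≤s z≤n) e≥3) 2E≤e (deg₀ c L r u (≤-reflexive l) (trans≡ (cong (_+ r) l) ℓ+r))
      exact′ : ∀ (τ : Fin n → Bool) (J : Fin m → Bool) → (∀ c t → length t ≡ k → h c t ≡ true → parity τ t ≡ J c) → xors J Cs ≡ parity τ Vs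
      exact′ = exact
      assemble : ∀ j K K₂ K₃ γ' Q₀ (Q≥1 : 1 ≤ Q₀) (K₃≥1 : 1 ≤ K₃) → suc Q₀ ≡ 2 * (K₂ * K ^ k) ^ K₀ →
        (S : St j K K₂ K₃ γ') → Numbers.Sizes k'' r E κ d₀ ℓ K₀ K₀' j Q₀ K₃ Q≥1 (length Vs) (length Cs) (∑ Cs (λ c → ⟦ not (StructureTheorem.Structure.typ S c) ⟧)) → Matching n m k h
      assemble j K K₂ K₃ γ' Q₀ Q≥1 K₃≥1 Q≡ S z = Assembly.WithStructure.assembled (assembly-data Data.Fin._≟_ Data.Fin._≟_ k'' h h-sym h-unique Vs Cs (allFin⁺ n) (allFin⁺ m) ∈-allFin ∈-allFin n≡ n>0 m>0 edges-many exact′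
        r' ℓ ℓ+r cases κ E d₀ κ≡ E≡ d₀≡ κ≥1 E≥1 deg′ K₀ K₀' K₀≡ d₀≤K₀ room)
        (Assembly.structure-data j K K₂ K₃ γ' K₃≥1 S Q₀ Z.T Z.w Q≡ Z.w≡ Z.small₁ Z.small₂ Z.roomV Z.roomC Z.enough Z.freezing Z.picking Z.colours)
        where module Z = Numbers.Sizes z
      go : (∀ γ' → St 2 (P * P * P) 3 1 γ') ⊎ (∀ γ' → St 3 Kc 3 1 γ') ⊎ St 3 Kt K₂ K₃ γ → Matching n m k h
      go (inj₁ S) = assemble 2 (P * P * P) 3 1 ab Q₁ Q₁≥1 (s≤s z≤n) Q₁≡ (S ab)
          (Numbers.sizes k'' r E κ d₀ ℓ K₀ K₀' 2 Q₁ 1 Q₁≥1 (length Vs) (length Cs) _ n≡ (bounds (m≤m+n s₁ _)) (StructureTheorem.Structure.few (S ab)))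
        where ab = Numbers.atypical-bound k'' r E κ d₀ ℓ K₀ K₀' 2 Q₁ 1 Q₁≥1
      go (inj₂ (inj₁ S)) = assemble 3 Kc 3 1 ab Q₂ Q₂≥1 (s≤s z≤n) Q₂≡ (S ab)
          (Numbers.sizes k'' r E κ d₀ ℓ K₀ K₀' 3 Q₂ 1 Q₂≥1 (length Vs) (length Cs) _ n≡ (bounds (≤-trans (m≤m+n s₂ s₃) (m≤n+m _ s₁))) (StructureTheorem.Structure.few (S ab)))
        where ab = Numbers.atypical-bound k'' r E κ d₀ ℓ K₀ K₀' 3 Q₂ 1 Q₂≥1
      go (inj₂ (inj₂ S)) = assemble 3 Kt K₂ K₃ γ Q₃ Q₃≥1 K₃≥1 Q₃≡ S
          (Numbers.sizes k'' r E κ d₀ ℓ K₀ K₀' 3 Q₃ K₃ Q₃≥1 (length Vs) (length Cs) _ n≡ (bounds (≤-trans (m≤n+m s₃ s₂) (m≤n+m _ s₁)))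
            (≤-trans (*-monoˡ-≤ _ γ-large) (StructureTheorem.Structure.few S)))

-- The value of a constant is forgotten, which keeps it from being unfolded.
naming : {B : Set} (x : ℕ) → (∀ y → x ≡ y → B) → B
naming x f = f x refl≡

core-theorem : ∀ k'' r' ℓ → 1 ≤ k'' → 1 ≤ ℓ → ℓ + suc r' ≡ suc (suc k'') → (2 * suc r' < suc (suc k'')) ⊎ (2 * suc r' ≡ suc (suc k'') × 2 ≤ suc r') → CoreStatement (suc (suc k'')) ℓ
core-theorem k'' r' ℓ k≥3 ℓ≥1 ℓ+r cases =
  naming (4 * (k * excessConst r)) λ κ κ≡ →
  naming (2 * (excessConst r * k)) λ E E≡ →
  naming (suc (8 * r * κ)) λ d₀ d₀≡ →
  naming (d₀ * ℓ + 2 * k + 8 * r * κ) λ K₀' K₀'≡ →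
  naming (suc K₀') λ K₀ K₀≡ →
  naming (18 * k) λ K₃ K₃≡ →
  naming (2 * (18 * k) ^ k) λ K₂ K₂≡ →
  naming (18 * k * (18 * k) * (2 * (144 * k) * 4 * (2 * (144 * k)))) λ Kt Kt≡ →
  naming (pred (2 * (K₂ * Kt ^ k) ^ K₀)) λ Q₃ Q₃≡ →
  withQ₃ κ E d₀ K₀ K₀' K₃ K₂ Kt Q₃ κ≡ E≡ d₀≡ K₀'≡ K₀≡ K₃≡ K₂≡ Kt≡
    (Q-facts Kt K₂ K₀ Q₃ Q₃≡ (subst (1 ≤_) Kt≡ (s≤s z≤n)) (subst (1 ≤_) K₂≡ (>-nonZero⁻¹ _ {{m*n≢0 2 ((18 * k) ^ k) {{_}} {{m^n≢0 (18 * k) k}}}})))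
  where
  k r : ℕ
  k = suc (suc k'')
  r = suc r'
  Q-facts : ∀ K K₂ K₀ Q → pred (2 * (K₂ * K ^ k) ^ K₀) ≡ Q → 1 ≤ K → 1 ≤ K₂ → suc Q ≡ 2 * (K₂ * K ^ k) ^ K₀ × 1 ≤ Q
  Q-facts K K₂ K₀ Q refl≡ K≥1 K₂≥1 = go (2 * L) (*-monoʳ-≤ 2 L≥1)
    where
    L : ℕ
    L = (K₂ * K ^ k) ^ K₀
    L≥1 : 1 ≤ L
    L≥1 = >-nonZero⁻¹ L {{m^n≢0 (K₂ * K ^ k) K₀ {{m*n≢0 K₂ (K ^ k) {{>-nonZero K₂≥1}} {{m^n≢0 K k {{>-nonZero K≥1}}}}}}}}
    go : ∀ x → 2 ≤ x → suc (pred x) ≡ x × 1 ≤ pred x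
    go (suc zero) (s≤s ())
    go (suc (suc x)) _ = refl≡ , s≤s z≤n
  withQ₃ : ∀ κ E d₀ K₀ K₀' K₃ K₂ Kt Q₃ → 4 * (k * excessConst r) ≡ κ → 2 * (excessConst r * k) ≡ E → suc (8 * r * κ) ≡ d₀ → d₀ * ℓ + 2 * k + 8 * r * κ ≡ K₀' → suc K₀' ≡ K₀ →
    18 * k ≡ K₃ → 2 * (18 * k) ^ k ≡ K₂ → 18 * k * (18 * k) * (2 * (144 * k) * 4 * (2 * (144 * k))) ≡ Kt → suc Q₃ ≡ 2 * (K₂ * Kt ^ k) ^ K₀ × 1 ≤ Q₃ → CoreStatement k ℓ
  withQ₃ κ E d₀ K₀ K₀' K₃ K₂ Kt Q₃ κ≡ E≡ d₀≡ K₀'≡ K₀≡ K₃≡ K₂≡ Kt≡ (Q₃≡ , Q₃≥1) =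
    naming (29 + Numbers.atypical-bound k'' r E κ d₀ ℓ K₀ K₀' 3 Q₃ K₃ Q₃≥1) λ γ γ≡ →
    naming (5 * (2 * (k * (18 * k) ^ k) * γ)) λ Q Q≡ →
    naming (30 + 6 * (144 * k) + 14 * Q) λ P P≡ →
    naming (18 * k * (18 * k) * (2 * (144 * k) * (4 * Q) * (2 * (144 * k)))) λ Kc Kc≡ →
    naming (2 * E + P) λ e e≡ →
    naming (pred (2 * (3 * (P * P * P) ^ k) ^ K₀)) λ Q₁ Q₁≡ →
    naming (pred (2 * (3 * Kc ^ k) ^ K₀)) λ Q₂ Q₂≡ →
    withAll γ Q P Kc e Q₁ Q₂ γ≡ Q≡ P≡ Kc≡ e≡ Q₁≡ Q₂≡
    where
    withAll : ∀ γ Q P Kc e Q₁ Q₂ → 29 + Numbers.atypical-bound k'' r E κ d₀ ℓ K₀ K₀' 3 Q₃ K₃ Q₃≥1 ≡ γ → 5 * (2 * (k * (18 * k) ^ k) * γ) ≡ Q → 30 + 6 * (144 * k) + 14 * Q ≡ P →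
      18 * k * (18 * k) * (2 * (144 * k) * (4 * Q) * (2 * (144 * k))) ≡ Kc → 2 * E + P ≡ e → pred (2 * (3 * (P * P * P) ^ k) ^ K₀) ≡ Q₁ → pred (2 * (3 * Kc ^ k) ^ K₀) ≡ Q₂ → CoreStatement k ℓ
    withAll γ Q P Kc e Q₁ Q₂ γ≡ Q≡ P≡ Kc≡ e≡ Q₁≡ Q₂≡ = CoreProof.core k'' r' ℓ k≥3 ℓ≥1 ℓ+r cases (constants κ E d₀ K₀ K₀' γ Q P Kc Kt K₂ K₃ e Q₁ Q₂ Q₃
      κ≡ E≡ d₀≡ (subst (1 ≤_) κ≡ (s≤s z≤n)) (subst (1 ≤_) E≡ (s≤s z≤n)) (sym K₀≡) d₀≤K₀ K₀-room P≥30 (≤-trans (≤ᵇ⇒≤ 1 29 tt) γ≥29) Q≡ Kc≡ Kt≡ K₂≡ K₃≡ P≥k P≥Q Q≥k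
      (subst (1 ≤_) K₃≡ (s≤s z≤n)) (≤-trans (m≤n+m P (2 * E)) (≤-reflexive e≡)) (≤-trans (m≤m+n (2 * E) P) (≤-reflexive e≡))
      (proj₁ F₁) (proj₁ F₂) Q₃≡ (proj₂ F₁) (proj₂ F₂) Q₃≥1 (≤-trans (m≤n+m _ 29) (≤-reflexive γ≡)))
      where
      γ≥29 : 29 ≤ γ
      γ≥29 = ≤-trans (m≤m+n 29 _) (≤-reflexive γ≡)
      P≥30 : 30 ≤ P
      P≥30 = ≤-trans (≤-trans (m≤m+n 30 (6 * (144 * k))) (m≤m+n _ (14 * Q))) (≤-reflexive P≡)
      P≥k : 6 * (144 * k) ≤ P
      P≥k = ≤-trans (≤-trans (m≤n+m (6 * (144 * k)) 30) (m≤m+n _ (14 * Q))) (≤-reflexive P≡)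
      P≥Q : 14 * Q ≤ P
      P≥Q = ≤-trans (m≤n+m (14 * Q) (30 + 6 * (144 * k))) (≤-reflexive P≡)
      Q≥k : 2 * (144 * k) ≤ Q
      Q≥k = begin
        2 * (144 * k) ≤⟨ m≤m+n (2 * (144 * k)) (2 * k) ⟩
        2 * (144 * k) + 2 * k ≡⟨ a1 k ⟩
        5 * (2 * (k * 1) * 29) ≤⟨ *-monoʳ-≤ 5 (*-mono-≤ (*-monoʳ-≤ 2 (*-monoʳ-≤ k (>-nonZero⁻¹ ((18 * k) ^ k) {{m^n≢0 (18 * k) k}}))) γ≥29) ⟩
        5 * (2 * (k * (18 * k) ^ k) * γ) ≡⟨ Q≡ ⟩
        Q ∎
        where
        a1 : ∀ k → 2 * (144 * k) + 2 * k ≡ 5 * (2 * (k * 1) * 29)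
        a1 = solve-∀
      Kc≥1 : 1 ≤ Kc
      Kc≥1 = subst (1 ≤_) Kc≡ (*-mono-≤ {1} {18 * k * (18 * k)} (s≤s z≤n) (*-mono-≤ {1} {2 * (144 * k) * (4 * Q)} (*-mono-≤ {1} {2 * (144 * k)} (s≤s z≤n) (*-mono-≤ {1} {4} (s≤s z≤n) (≤-trans (s≤s z≤n) Q≥k))) (s≤s z≤n)))
      F₁ = Q-facts (P * P * P) 3 K₀ Q₁ Q₁≡ (*-mono-≤ {1} {P * P} (*-mono-≤ {1} {P} (≤-trans (s≤s z≤n) P≥30) (≤-trans (s≤s z≤n) P≥30)) (≤-trans (s≤s z≤n) P≥30)) (s≤s z≤n)
      F₂ = Q-facts Kc 3 K₀ Q₂ Q₂≡ Kc≥1 (s≤s z≤n)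
      d₀≤K₀ : d₀ ≤ K₀
      d₀≤K₀ = ≤-trans (≤-reflexive (sym d₀≡)) (≤-trans (s≤s (≤-trans (m≤n+m (8 * r * κ) (d₀ * ℓ + 2 * k)) (≤-reflexive K₀'≡))) (≤-reflexive K₀≡))
      K₀-room : d₀ * ℓ + (2 * K₀' + 2 * k) ≤ k * K₀
      K₀-room = begin
        d₀ * ℓ + (2 * K₀' + 2 * k) ≤⟨ m≤m+n _ (8 * r * κ + 3) ⟩
        d₀ * ℓ + (2 * K₀' + 2 * k) + (8 * r * κ + 3) ≡⟨ a1 (d₀ * ℓ) (2 * K₀') (2 * k) (8 * r * κ) ⟩
        (d₀ * ℓ + 2 * k + 8 * r * κ) + 2 * K₀' + 3 ≡⟨ cong (λ z → z + 2 * K₀' + 3) K₀'≡ ⟩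
        K₀' + 2 * K₀' + 3 ≡⟨ a2 K₀' ⟩
        3 * suc K₀' ≡⟨ cong (3 *_) K₀≡ ⟩
        3 * K₀ ≤⟨ *-monoˡ-≤ K₀ (s≤s (s≤s k≥3)) ⟩
        k * K₀ ∎
        where
        a1 : ∀ d K k x → d + (K + k) + (x + 3) ≡ (d + k + x) + K + 3
        a1 = solve-∀
        a2 : ∀ K → K + 2 * K + 3 ≡ 3 * (1 + K)
        a2 = solve-∀

-- Finite sets

fromList : ∀ {n} → List (Fin n) → Subset n
fromList [] = ∅
fromList (x ∷ xs) = ⁅ x ⁆ ∪ fromList xs

insert-fresh : ∀ {n} (v : Fin n) (S : Subset n) → lookup S v ≡ false → ∣ ⁅ v ⁆ ∪ S ∣ ≡ suc ∣ S ∣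
insert-fresh zero (false ∷ S) _ = cong (λ z → suc ∣ z ∣) (∪-identityˡ S)
insert-fresh (suc v) (true ∷ S) e = cong (1 +_) (insert-fresh v S e)
insert-fresh (suc v) (false ∷ S) e = insert-fresh v S e

insert-old : ∀ {n} (v : Fin n) (S : Subset n) → lookup S v ≡ true → ⁅ v ⁆ ∪ S ≡ S
insert-old zero (true ∷ S) _ = cong (true ∷_) (∪-identityˡ S)
insert-old (suc v) (b ∷ S) e = cong (b ∷_) (insert-old v S e)

insert-≤ : ∀ {n} (v : Fin n) (S : Subset n) → ∣ ⁅ v ⁆ ∪ S ∣ ≤ suc ∣ S ∣
insert-≤ v S = go (lookup S v) refl≡
  where
  go : ∀ b → lookup S v ≡ b → ∣ ⁅ v ⁆ ∪ S ∣ ≤ suc ∣ S ∣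
  go true e = ≤-trans (≤-reflexive (cong ∣_∣ (insert-old v S e))) (n≤1+n _)
  go false e = ≤-reflexive (insert-fresh v S e)

∩-insert : ∀ {n} (v : Fin n) (A S : Subset n) → lookup S v ≡ false → ∣ A ∩ (⁅ v ⁆ ∪ S) ∣ ≡ ⟦ lookup A v ⟧ + ∣ A ∩ S ∣
∩-insert zero (true ∷ A) (false ∷ S) _ = cong (λ z → suc ∣ A ∩ z ∣) (∪-identityˡ S)
∩-insert zero (false ∷ A) (false ∷ S) _ = cong (λ z → ∣ A ∩ z ∣) (∪-identityˡ S)
∩-insert (suc v) (true ∷ A) (true ∷ S) e = trans≡ (cong (1 +_) (∩-insert v A S e)) (sym (+-suc _ _))
∩-insert (suc v) (true ∷ A) (false ∷ S) e = ∩-insert v A S e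
∩-insert (suc v) (false ∷ A) (true ∷ S) e = ∩-insert v A S e
∩-insert (suc v) (false ∷ A) (false ∷ S) e = ∩-insert v A S e

∩-∁-insert : ∀ {n} (v : Fin n) (A S : Subset n) → lookup S v ≡ false → ∣ A ∩ ∁ S ∣ ≡ ⟦ lookup A v ⟧ + ∣ A ∩ ∁ (⁅ v ⁆ ∪ S) ∣
∩-∁-insert zero (true ∷ A) (false ∷ S) _ = cong (λ z → suc ∣ A ∩ ∁ z ∣) (sym (∪-identityˡ S))
∩-∁-insert zero (false ∷ A) (false ∷ S) _ = cong (λ z → ∣ A ∩ ∁ z ∣) (sym (∪-identityˡ S))
∩-∁-insert (suc v) (true ∷ A) (true ∷ S) e = ∩-∁-insert v A S e
∩-∁-insert (suc v) (true ∷ A) (false ∷ S) e = trans≡ (cong (1 +_) (∩-∁-insert v A S e)) (sym (+-suc _ _))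
∩-∁-insert (suc v) (false ∷ A) (true ∷ S) e = ∩-∁-insert v A S e
∩-∁-insert (suc v) (false ∷ A) (false ∷ S) e = ∩-∁-insert v A S e

card-split : ∀ {n} (A S : Subset n) → ∣ A ∩ S ∣ + ∣ A ∩ ∁ S ∣ ≡ ∣ A ∣
card-split [] [] = refl≡
card-split (true ∷ A) (true ∷ S) = cong (1 +_) (card-split A S)
card-split (true ∷ A) (false ∷ S) = trans≡ (+-suc _ _) (cong (1 +_) (card-split A S))
card-split (false ∷ A) (true ∷ S) = card-split A S
card-split (false ∷ A) (false ∷ S) = card-split A S

card-split′ : ∀ {n} (A S : Subset n) → ∣ A ∩ S ∣ + ∣ ∁ A ∩ S ∣ ≡ ∣ S ∣
card-split′ [] [] = refl≡
card-split′ (true ∷ A) (true ∷ S) = cong (1 +_) (card-split′ A S)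
card-split′ (false ∷ A) (true ∷ S) = trans≡ (+-suc _ _) (cong (1 +_) (card-split′ A S))
card-split′ (true ∷ A) (false ∷ S) = card-split′ A S
card-split′ (false ∷ A) (false ∷ S) = card-split′ A S

card-∁ : ∀ {n} (A : Subset n) → ∣ A ∣ + ∣ ∁ A ∣ ≡ n
card-∁ [] = refl≡
card-∁ (true ∷ A) = cong (1 +_) (card-∁ A)
card-∁ (false ∷ A) = trans≡ (+-suc _ _) (cong (1 +_) (card-∁ A))

subset-meeting : ∀ {n} (A : Subset n) p q → p ≤ ∣ A ∣ → q ≤ ∣ ∁ A ∣ → Σ (Subset n) λ S → ∣ A ∩ S ∣ ≡ p × ∣ ∁ A ∩ S ∣ ≡ q
subset-meeting [] .0 .0 z≤n z≤n = [] , refl≡ , refl≡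
subset-meeting (true ∷ A) zero q _ q≤ = let S , a , b = subset-meeting A 0 q z≤n q≤ in false ∷ S , a , b
subset-meeting (true ∷ A) (suc p) q (s≤s p≤) q≤ = let S , a , b = subset-meeting A p q p≤ q≤ in true ∷ S , cong (1 +_) a , b
subset-meeting (false ∷ A) p zero p≤ _ = let S , a , b = subset-meeting A p 0 p≤ z≤n in false ∷ S , a , b
subset-meeting (false ∷ A) p (suc q) p≤ (s≤s q≤) = let S , a , b = subset-meeting A p q p≤ q≤ in true ∷ S , a , cong (1 +_) b

subset-of-size : ∀ n a → a ≤ n → Σ (Subset n) λ A → ∣ A ∣ ≡ a
subset-of-size n zero _ = ∅ , empty n
  where
  empty : ∀ n → ∣ ∅ {n} ∣ ≡ 0
  empty zero = refl≡
  empty (suc n) = empty n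
subset-of-size (suc n) (suc a) (s≤s le) = let A , e = subset-of-size n a le in true ∷ A , cong (1 +_) e

∑-allFin-suc : ∀ n (f : Fin (suc n) → ℕ) → ∑ (allFin (suc n)) f ≡ f zero + ∑ (allFin n) (f ∘ Fin.suc)
∑-allFin-suc n f = cong (f zero +_) (trans≡ (cong (λ z → ∑ z f) (sym (map-tabulate id Fin.suc))) (∑-map Fin.suc (allFin n) f))

card-∑ : ∀ {n} (S : Subset n) → ∑ (allFin n) (λ v → ⟦ lookup S v ⟧) ≡ ∣ S ∣
card-∑ [] = refl≡
card-∑ {suc n} (true ∷ S) = trans≡ (∑-allFin-suc n (λ v → ⟦ lookup (true ∷ S) v ⟧)) (cong (1 +_) (card-∑ S))
card-∑ {suc n} (false ∷ S) = trans≡ (∑-allFin-suc n (λ v → ⟦ lookup (false ∷ S) v ⟧)) (card-∑ S)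

⊆-card : ∀ {n} {S E : Subset n} → S ⊆ E → ∣ E ∩ S ∣ ≡ ∣ S ∣
⊆-card {S = []} {[]} _ = refl≡
⊆-card {S = true ∷ S} {true ∷ E} s = cong (1 +_) (⊆-card (drop-∷-⊆ s))
⊆-card {S = true ∷ S} {false ∷ E} s = ⊥-elim (absurd (s (here)))
  where
  absurd : zero ∈ (false ∷ E) → ⊥
  absurd ()
⊆-card {S = false ∷ S} {true ∷ E} s = ⊆-card (drop-∷-⊆ s)
⊆-card {S = false ∷ S} {false ∷ E} s = ⊆-card (drop-∷-⊆ s)

⊆-equal : ∀ {n} {S E : Subset n} → S ⊆ E → ∣ S ∣ ≡ ∣ E ∣ → S ≡ E
⊆-equal {S = []} {[]} _ _ = refl≡
⊆-equal {S = true ∷ S} {true ∷ E} s e = cong (true ∷_) (⊆-equal (drop-∷-⊆ s) (cong pred e))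
⊆-equal {S = true ∷ S} {false ∷ E} s e = ⊥-elim (absurd (s (here)))
  where
  absurd : zero ∈ (false ∷ E) → ⊥
  absurd ()
⊆-equal {S = false ∷ S} {true ∷ E} s e = ⊥-elim (1+n≰n (≤-trans (≤-reflexive (sym e)) (p⊆q⇒∣p∣≤∣q∣ (drop-∷-⊆ s))))
⊆-equal {S = false ∷ S} {false ∷ E} s e = cong (false ∷_) (⊆-equal (drop-∷-⊆ s) e)

does-⇔ : {P R : Set} → (P → R) → (R → P) → (p : Dec P) (r : Dec R) → does p ≡ does r
does-⇔ f g (yes p) (yes r) = refl≡
does-⇔ f g (yes p) (no ¬r) = ⊥-elim (¬r (f p))
does-⇔ f g (no ¬p) (yes r) = ⊥-elim (¬p (g r))
does-⇔ f g (no ¬p) (no ¬r) = refl≡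

-- Degrees counted by tuples

_≟ˢ_ : ∀ {n} → DecidableEquality (Subset n)
_≟ˢ_ = ≡-dec _≟ᵇ_

union-insert : ∀ {n} (v : Fin n) (S T : Subset n) → S ∪ (⁅ v ⁆ ∪ T) ≡ (⁅ v ⁆ ∪ S) ∪ T
union-insert v S T = trans≡ (sym (∪-assoc S ⁅ v ⁆ T)) (cong (_∪ T) (∪-comm S ⁅ v ⁆))

hits : ∀ {n} → Subset n → Subset n → ℕ → ℕ
hits {n} S E s = ∑ (tuples (allFin n) s) (λ t → ⟦ does ((S ∪ fromList t) ≟ˢ E) ⟧)

∑-union-suc : ∀ {n} (f : Subset n → ℕ) S s →
  ∑ (tuples (allFin n) (suc s)) (λ t → f (S ∪ fromList t)) ≡ ∑ (allFin n) (λ v → ∑ (tuples (allFin n) s) (λ t → f ((⁅ v ⁆ ∪ S) ∪ fromList t)))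
∑-union-suc {n} f S s = trans≡ (∑-tuples-suc (allFin n) s (λ t → f (S ∪ fromList t)))
  (∑-cong (allFin n) (λ v → ∑-cong (tuples (allFin n) s) (λ t → cong f (union-insert v S (fromList t)))))

∪-identityʳ′ : ∀ {n} (S : Subset n) → S ∪ ∅ ≡ S
∪-identityʳ′ S = trans≡ (∪-comm S ∅) (∪-identityˡ S)

hits-none : ∀ {n} s (S E : Subset n) → ∣ S ∣ + s < ∣ E ∣ → hits S E s ≡ 0
hits-none zero S E lt = cong (_+ 0) (cong ⟦_⟧ (does-⇔ (λ e → <⇒≢ lt (trans≡ (+-identityʳ ∣ S ∣) (cong ∣_∣ (trans≡ (sym (∪-identityʳ′ S)) e)))) ⊥-elim ((S ∪ ∅) ≟ˢ E) (no id)))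
hits-none {n} (suc s) S E lt = trans≡ (∑-union-suc (λ X → ⟦ does (X ≟ˢ E) ⟧) S s)
  (trans≡ (∑-cong (allFin n) (λ v → hits-none s (⁅ v ⁆ ∪ S) E (≤-trans (s≤s (+-monoˡ-≤ s (insert-≤ v S))) (≤-trans (≤-reflexive (cong (1 +_) (sym (+-suc ∣ S ∣ s)))) lt)))) (∑-zero (allFin n)))

lookup-∩∁ : ∀ {n} (A S : Subset n) v → lookup (A ∩ ∁ S) v ≡ lookup A v ∧ not (lookup S v)
lookup-∩∁ A S v = trans≡ (lookup-zipWith _∧_ v A (∁ S)) (cong (lookup A v ∧_) (lookup-map v not S))

⊆?-insert : ∀ {n} (v : Fin n) (S E : Subset n) → ⟦ does ((⁅ v ⁆ ∪ S) ⊆? E) ⟧ ≡ ⟦ lookup E v ⟧ * ⟦ does (S ⊆? E) ⟧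
⊆?-insert v S E = go (lookup E v) refl≡
  where
  go : ∀ b → lookup E v ≡ b → ⟦ does ((⁅ v ⁆ ∪ S) ⊆? E) ⟧ ≡ ⟦ b ⟧ * ⟦ does (S ⊆? E) ⟧
  go true e = trans≡ (cong ⟦_⟧ (does-⇔ {(⁅ v ⁆ ∪ S) ⊆ E} {S ⊆ E} (λ sub x → sub (x∈p∪q⁺ (inj₂ x))) (λ sub x → [ (λ p → subst (_∈ E) (sym (x∈⁅y⁆⇒x≡y v p)) (lookup⇒[]= v E e)) , sub ]′ (x∈p∪q⁻ ⁅ v ⁆ S x)) ((⁅ v ⁆ ∪ S) ⊆? E) (S ⊆? E)))
    (sym (+-identityʳ _))
  go false e = cong ⟦_⟧ (does-⇔ {(⁅ v ⁆ ∪ S) ⊆ E} {⊥} (λ sub → bad (trans≡ (sym e) ([]=⇒lookup (sub (x∈p∪q⁺ (inj₁ (x∈⁅x⁆ v))))))) ⊥-elim ((⁅ v ⁆ ∪ S) ⊆? E) (no id))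
    where
    bad : false ≡ true → ⊥
    bad ()

hits-all : ∀ {n} s (S E : Subset n) → ∣ S ∣ + s ≡ ∣ E ∣ → hits S E s ≡ s ! * ⟦ does (S ⊆? E) ⟧
hits-all zero S E eq = cong (λ b → ⟦ b ⟧ + 0) (does-⇔ {S ∪ ∅ ≡ E} {S ⊆ E} (λ e {x} → subst (x ∈_) (trans≡ (sym (∪-identityʳ′ S)) e)) (λ sub → trans≡ (∪-identityʳ′ S) (⊆-equal sub (trans≡ (sym (+-identityʳ ∣ S ∣)) eq))) ((S ∪ ∅) ≟ˢ E) (S ⊆? E))
hits-all {n} (suc s) S E eq = trans≡ (∑-union-suc (λ X → ⟦ does (X ≟ˢ E) ⟧) S s) (trans≡ (∑-cong (allFin n) (λ v → each v (lookup S v) refl≡)) (trans≡ total (final (S ⊆? E))))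
  where
  σ : ℕ
  σ = ⟦ does (S ⊆? E) ⟧
  each : ∀ v b → lookup S v ≡ b → hits (⁅ v ⁆ ∪ S) E s ≡ (s ! * σ) * ⟦ lookup (E ∩ ∁ S) v ⟧
  each v true e = trans≡ (hits-none s (⁅ v ⁆ ∪ S) E (≤-reflexive (trans≡ (cong (λ z → suc (∣ z ∣ + s)) (insert-old v S e)) (trans≡ (sym (+-suc _ s)) eq))))
    (sym (trans≡ (cong (λ z → (s ! * σ) * ⟦ z ⟧) (trans≡ (lookup-∩∁ E S v) (trans≡ (cong (λ b → lookup E v ∧ not b) e) (∧-zeroʳ (lookup E v))))) (*-zeroʳ (s ! * σ))))
  each v false e = trans≡ (hits-all s (⁅ v ⁆ ∪ S) E (trans≡ (cong (_+ s) (insert-fresh v S e)) (trans≡ (sym (+-suc _ s)) eq)))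
    (trans≡ (cong (s ! *_) (⊆?-insert v S E)) (trans≡ (a1 (s !) ⟦ lookup E v ⟧ σ) (cong (λ z → (s ! * σ) * ⟦ z ⟧) (sym (trans≡ (lookup-∩∁ E S v) (trans≡ (cong (λ b → lookup E v ∧ not b) e) (∧-identityʳ (lookup E v))))))))
    where
    a1 : ∀ a b c → a * (b * c) ≡ (a * c) * b
    a1 = solve-∀
  total : ∑ (allFin n) (λ v → (s ! * σ) * ⟦ lookup (E ∩ ∁ S) v ⟧) ≡ (s ! * σ) * ∣ E ∩ ∁ S ∣
  total = trans≡ (∑-scale (allFin n) (s ! * σ) (λ v → ⟦ lookup (E ∩ ∁ S) v ⟧)) (cong ((s ! * σ) *_) (card-∑ (E ∩ ∁ S)))
  final : (d : Dec (S ⊆ E)) → (s ! * ⟦ does d ⟧) * ∣ E ∩ ∁ S ∣ ≡ suc s ! * ⟦ does d ⟧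
  final (no _) = trans≡ (cong (_* ∣ E ∩ ∁ S ∣) (*-zeroʳ (s !))) (sym (*-zeroʳ (suc s !)))
  final (yes sub) = trans≡ (cong ((s ! * 1) *_) rest) (a1 (s !) s)
    where
    a1 : ∀ a s → (a * 1) * (1 + s) ≡ ((1 + s) * a) * 1
    a1 = solve-∀
    rest : ∣ E ∩ ∁ S ∣ ≡ suc s
    rest = +-cancelˡ-≡ ∣ S ∣ _ _ (trans≡ (cong (_+ ∣ E ∩ ∁ S ∣) (sym (⊆-card sub))) (trans≡ (card-split E S) (sym eq)))

∑-allSubsets : ∀ n (f : Subset n → ℕ) (X : Subset n) → ∑ (allSubsets n) (λ E → f E * ⟦ does (X ≟ˢ E) ⟧) ≡ f X
∑-allSubsets zero f [] = trans≡ (+-identityʳ _) (*-identityʳ _)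
∑-allSubsets (suc n) f (b ∷ X) = trans≡ (∑-++ (map (false ∷_) (allSubsets n)) (map (true ∷_) (allSubsets n)) F)
  (trans≡ (cong₂ _+_ (∑-map (false ∷_) (allSubsets n) F) (∑-map (true ∷_) (allSubsets n) F)) (go b))
  where
  F : Subset (suc n) → ℕ
  F E = f E * ⟦ does ((b ∷ X) ≟ˢ E) ⟧
  other : ∀ (g : Subset n → ℕ) → ∑ (allSubsets n) (λ E → g E * 0) ≡ 0
  other g = trans≡ (∑-cong (allSubsets n) (λ E → *-zeroʳ (g E))) (∑-zero (allSubsets n))
  go : ∀ b → ∑ (allSubsets n) (λ E → f (false ∷ E) * ⟦ does ((b ∷ X) ≟ˢ (false ∷ E)) ⟧) + ∑ (allSubsets n) (λ E → f (true ∷ E) * ⟦ does ((b ∷ X) ≟ˢ (true ∷ E)) ⟧) ≡ f (b ∷ X)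
  go false = trans≡ (cong₂ _+_ (∑-allSubsets n (λ E → f (false ∷ E)) X) (other (λ E → f (true ∷ E)))) (+-identityʳ _)
  go true = cong₂ _+_ (other (λ E → f (false ∷ E))) (∑-allSubsets n (λ E → f (true ∷ E)) X)

∑-filter : {A : Set} {P : A → Set} (P? : ∀ x → Dec (P x)) (xs : List A) (f : A → ℕ) → ∑ (filter P? xs) f ≡ ∑ xs (λ x → ⟦ does (P? x) ⟧ * f x)
∑-filter P? [] f = refl≡
∑-filter P? (x ∷ xs) f with does (P? x)
... | true = cong₂ _+_ (sym (+-identityʳ (f x))) (∑-filter P? xs f)
... | false = ∑-filter P? xs f

tupleDeg : ∀ {n k} → KGraph n k → Subset n → ℕ → ℕ
tupleDeg {n} H S s = ∑ (tuples (allFin n) s) (λ t → ⟦ edge H (S ∪ fromList t) ⟧)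

tupleDeg-suc : ∀ {n k} (H : KGraph n k) S s → tupleDeg H S (suc s) ≡ ∑ (allFin n) (λ v → tupleDeg H (⁅ v ⁆ ∪ S) s)
tupleDeg-suc H S s = ∑-union-suc (λ X → ⟦ edge H X ⟧) S s

deg-∑ : ∀ {n k} (H : KGraph n k) S → deg H S ≡ ∑ (allSubsets n) (λ E → ⟦ edge H E ⟧ * ⟦ does (S ⊆? E) ⟧)
deg-∑ {n} {k} H S = trans≡ (length≡∑ (filter (S ⊆?_) (edges H)))
  (trans≡ (∑-filter (S ⊆?_) (edges H) (λ _ → 1)) (trans≡ (∑-filter (λ E → edge H E ≟ᵇ true) (subsetsOfSize n k) (λ E → ⟦ does (S ⊆? E) ⟧ * 1))
    (trans≡ (∑-filter (λ E → ∣ E ∣ ≟ℕ k) (allSubsets n) (λ E → ⟦ does (edge H E ≟ᵇ true) ⟧ * (⟦ does (S ⊆? E) ⟧ * 1)))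
      (∑-cong (allSubsets n) (λ E → go E (edge H E) refl≡ (∣ E ∣ ≟ℕ k))))))
  where
  go : ∀ E b → edge H E ≡ b → (d : Dec (∣ E ∣ ≡ k)) → ⟦ does d ⟧ * (⟦ does (edge H E ≟ᵇ true) ⟧ * (⟦ does (S ⊆? E) ⟧ * 1)) ≡ ⟦ edge H E ⟧ * ⟦ does (S ⊆? E) ⟧
  go E b e d = subst (λ z → ⟦ does d ⟧ * (⟦ does (z ≟ᵇ true) ⟧ * (⟦ does (S ⊆? E) ⟧ * 1)) ≡ ⟦ z ⟧ * ⟦ does (S ⊆? E) ⟧) (sym e) (at b e d)
    where
    a1 : ∀ x → 1 * (1 * (x * 1)) ≡ 1 * x
    a1 = solve-∀
    at : ∀ b → edge H E ≡ b → (d : Dec (∣ E ∣ ≡ k)) → ⟦ does d ⟧ * (⟦ does (b ≟ᵇ true) ⟧ * (⟦ does (S ⊆? E) ⟧ * 1)) ≡ ⟦ b ⟧ * ⟦ does (S ⊆? E) ⟧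
    at false _ d = *-zeroʳ ⟦ does d ⟧
    at true e (no ¬p) = ⊥-elim (¬p (uniform H E e))
    at true e (yes _) = a1 ⟦ does (S ⊆? E) ⟧

tupleDeg≡deg : ∀ {n k} (H : KGraph n k) S s → ∣ S ∣ + s ≡ k → tupleDeg H S s ≡ s ! * deg H S
tupleDeg≡deg {n} {k} H S s |S| = ≡R.begin
    tupleDeg H S s
      ≡R.≡⟨ ∑-cong (tuples (allFin n) s) (λ t → sym (∑-allSubsets n (λ E → ⟦ edge H E ⟧) (S ∪ fromList t))) ⟩
    ∑ (tuples (allFin n) s) (λ t → ∑ (allSubsets n) (λ E → ⟦ edge H E ⟧ * ⟦ does ((S ∪ fromList t) ≟ˢ E) ⟧))
      ≡R.≡⟨ ∑-swap (tuples (allFin n) s) (allSubsets n) (λ t E → ⟦ edge H E ⟧ * ⟦ does ((S ∪ fromList t) ≟ˢ E) ⟧) ⟩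
    ∑ (allSubsets n) (λ E → ∑ (tuples (allFin n) s) (λ t → ⟦ edge H E ⟧ * ⟦ does ((S ∪ fromList t) ≟ˢ E) ⟧))
      ≡R.≡⟨ ∑-cong (allSubsets n) (λ E → trans≡ (∑-scale (tuples (allFin n) s) ⟦ edge H E ⟧ (λ t → ⟦ does ((S ∪ fromList t) ≟ˢ E) ⟧)) (go E (edge H E) refl≡)) ⟩
    ∑ (allSubsets n) (λ E → s ! * (⟦ edge H E ⟧ * ⟦ does (S ⊆? E) ⟧))
      ≡R.≡⟨ ∑-scale (allSubsets n) (s !) (λ E → ⟦ edge H E ⟧ * ⟦ does (S ⊆? E) ⟧) ⟩
    s ! * ∑ (allSubsets n) (λ E → ⟦ edge H E ⟧ * ⟦ does (S ⊆? E) ⟧)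
      ≡R.≡⟨ cong (s ! *_) (sym (deg-∑ H S)) ⟩
    s ! * deg H S ≡R.∎
  where
  module ≡R = ≡-Reasoning
  a1 : ∀ a x → a * x ≡ a * (1 * x)
  a1 = solve-∀
  go : ∀ E b → edge H E ≡ b → ⟦ edge H E ⟧ * hits S E s ≡ s ! * (⟦ edge H E ⟧ * ⟦ does (S ⊆? E) ⟧)
  go E false e = subst (λ z → ⟦ z ⟧ * hits S E s ≡ s ! * (⟦ z ⟧ * ⟦ does (S ⊆? E) ⟧)) (sym e) (sym (*-zeroʳ (s !)))
  go E true e = subst (λ z → ⟦ z ⟧ * hits S E s ≡ s ! * (⟦ z ⟧ * ⟦ does (S ⊆? E) ⟧)) (sym e)
    (trans≡ (*-identityˡ _) (trans≡ (hits-all s S E (trans≡ |S| (sym (uniform H E e)))) (a1 (s !) ⟦ does (S ⊆? E) ⟧)))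

minList-member : ∀ x xs → minList (x ∷ xs) ∈ˡ (x ∷ xs)
minList-member x [] = here refl≡
minList-member x (y ∷ xs) = go (⊓-sel y (minList (x ∷ xs)))
  where
  later : ∀ {z} → z ∈ˡ (x ∷ xs) → z ∈ˡ (x ∷ y ∷ xs)
  later (here e) = here e
  later (there p) = there (there p)
  go : (y ⊓ minList (x ∷ xs) ≡ y) ⊎ (y ⊓ minList (x ∷ xs) ≡ minList (x ∷ xs)) → y ⊓ minList (x ∷ xs) ∈ˡ (x ∷ y ∷ xs)
  go (inj₁ e) = there (here e)
  go (inj₂ e) = subst (_∈ˡ (x ∷ y ∷ xs)) (sym e) (later (minList-member x xs))

minList-≤ : ∀ {y} xs → y ∈ˡ xs → minList xs ≤ y
minList-≤ (x ∷ []) (here refl≡) = ≤-refl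
minList-≤ (x ∷ z ∷ xs) (here refl≡) = ≤-trans (m⊓n≤n z _) (minList-≤ (x ∷ xs) (here refl≡))
minList-≤ (x ∷ z ∷ xs) (there (here refl≡)) = m⊓n≤m z _
minList-≤ (x ∷ z ∷ xs) (there (there p)) = ≤-trans (m⊓n≤n z _) (minList-≤ (x ∷ xs) (there p))

maxList-≥ : ∀ {y} xs → y ∈ˡ xs → y ≤ maxList xs
maxList-≥ (x ∷ xs) (here refl≡) = m≤m⊔n x _
maxList-≥ (x ∷ xs) (there p) = ≤-trans (maxList-≥ xs p) (m≤n⊔m x _)

∈-allSubsets : ∀ {n} (S : Subset n) → S ∈ˡ allSubsets n
∈-allSubsets [] = here refl≡
∈-allSubsets {suc n} (false ∷ S) = ∈-++⁺ˡ (∈-map⁺ (false ∷_) (∈-allSubsets S))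
∈-allSubsets {suc n} (true ∷ S) = ∈-++⁺ʳ (map (false ∷_) (allSubsets n)) (∈-map⁺ (true ∷_) (∈-allSubsets S))

minDeg-≤ : ∀ {n k} ℓ (H : KGraph n k) S → ∣ S ∣ ≡ ℓ → minDeg ℓ H ≤ deg H S
minDeg-≤ {n} ℓ H S |S| = minList-≤ (map (deg H) (subsetsOfSize n ℓ)) (∈-map⁺ (deg H) (∈-filter⁺ (λ S → ∣ S ∣ ≟ℕ ℓ) (∈-allSubsets S) |S|))

-- The degree of H only serves to exclude that there is no set of size ℓ, where the minimum is 0 by convention.
minDeg-attained : ∀ {n k} ℓ (G H : KGraph n k) → 0 < minDeg ℓ H → Σ (Subset n) λ S → ∣ S ∣ ≡ ℓ × minDeg ℓ G ≡ deg G S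
minDeg-attained {n} ℓ G H pos = go (subsetsOfSize n ℓ) (λ m → proj₂ (∈-filter⁻ (λ S → ∣ S ∣ ≟ℕ ℓ) {xs = allSubsets n} m)) pos
  where
  go : ∀ L → (∀ {S} → S ∈ˡ L → ∣ S ∣ ≡ ℓ) → 0 < minList (map (deg H) L) → Σ (Subset n) λ S → ∣ S ∣ ≡ ℓ × minList (map (deg G) L) ≡ deg G S
  go (X ∷ L) sizes _ = let S , m , e = ∈-map⁻ (deg G) {xs = X ∷ L} (minList-member (deg G X) (map (deg G) L)) in S , sizes m , e

-- Parities

odd : ℕ → Bool
odd zero = false
odd (suc n) = not (odd n)

odd-+ : ∀ a b → odd (a + b) ≡ odd a xor odd b
odd-+ zero b = refl≡
odd-+ (suc a) b = trans≡ (cong not (odd-+ a b)) (not-distribˡ-xor (odd a) (odd b))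

odd-⟦⟧* : ∀ i m → odd (⟦ i ⟧ * m) ≡ i ∧ odd m
odd-⟦⟧* true m = cong odd (+-identityʳ m)
odd-⟦⟧* false m = refl≡

%2≡odd : ∀ x → x % 2 ≡ ⟦ odd x ⟧
%2≡odd 0 = refl≡
%2≡odd 1 = refl≡
%2≡odd (suc (suc x)) = trans≡ (%2≡odd x) (cong ⟦_⟧ (sym (not-involutive (odd x))))

minDeg≤δ : ∀ k ℓ m i (A : Subset (m * k)) → (i ∧ odd m) xor odd ∣ A ∣ ≡ true → minDeg ℓ (parityGraph (m * k) k ⟦ i ⟧ A) ≤ δ k ℓ m
minDeg≤δ k ℓ m i A e = maxList-≥ _ (∈-map⁺ _ (∈-filter⁺ _ (∈-concatMap⁺ (λ i → map (i ,_) (allSubsets (m * k))) (member i) (∈-map⁺ (⟦ i ⟧ ,_) (∈-allSubsets A)))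
    (trans≡ (%2≡odd (⟦ i ⟧ * m + ∣ A ∣)) (cong ⟦_⟧ (trans≡ (odd-+ (⟦ i ⟧ * m) ∣ A ∣) (trans≡ (cong (_xor odd ∣ A ∣) (odd-⟦⟧* i m)) e))))))
  where
  member : ∀ i → ⟦ i ⟧ ∈ˡ (0 ∷ 1 ∷ [])
  member false = here refl≡
  member true = there (here refl≡)

parityGraph-edge : ∀ n k i (A X : Subset n) → ∣ X ∣ ≡ k → edge (parityGraph n k ⟦ i ⟧ A) X ≡ not (i xor odd ∣ A ∩ X ∣)
parityGraph-edge n k i A X |X| with ∣ X ∣ ≟ℕ k
... | no ¬p = ⊥-elim (¬p |X|)
... | yes _ = trans≡ (cong (Data.Nat._≡ᵇ ⟦ i ⟧) (%2≡odd ∣ A ∩ X ∣)) (go i (odd ∣ A ∩ X ∣))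
  where
  go : ∀ i o → (⟦ o ⟧ Data.Nat.≡ᵇ ⟦ i ⟧) ≡ not (i xor o)
  go true true = refl≡
  go true false = refl≡
  go false true = refl≡
  go false false = refl≡

-- The number of s-tuples of distinct elements from x elements of A and y others, where c says whether an odd number has to lie in A.
choices : Bool → ℕ → ℕ → ℕ → ℕ
choices c zero x y = ⟦ not c ⟧
choices c (suc s) x y = x * choices (not c) s (pred x) y + y * choices c s x (pred y)

falling : ℕ → ℕ → ℕ
falling zero z = 1
falling (suc s) z = z * falling s (pred z)

choices-total : ∀ c s x y → choices c s x y + choices (not c) s x y ≡ falling s (x + y)
choices-total true zero x y = refl≡
choices-total false zero x y = refl≡
choices-total c (suc s) x y = ≡R.begin
    x * choices (not c) s (pred x) y + y * choices c s x (pred y) + (x * choices (not (not c)) s (pred x) y + y * choices (not c) s x (pred y))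
      ≡R.≡⟨ cong (λ b → x * choices (not c) s (pred x) y + y * choices c s x (pred y) + (x * choices b s (pred x) y + y * choices (not c) s x (pred y))) (not-involutive c) ⟩
    x * choices (not c) s (pred x) y + y * choices c s x (pred y) + (x * choices c s (pred x) y + y * choices (not c) s x (pred y))
      ≡R.≡⟨ a1 x y (choices (not c) s (pred x) y) (choices c s x (pred y)) (choices c s (pred x) y) (choices (not c) s x (pred y)) ⟩
    x * (choices c s (pred x) y + choices (not c) s (pred x) y) + y * (choices c s x (pred y) + choices (not c) s x (pred y))
      ≡R.≡⟨ cong₂ _+_ (cong (x *_) (choices-total c s (pred x) y)) (cong (y *_) (choices-total c s x (pred y))) ⟩
    x * falling s (pred x + y) + y * falling s (x + pred y)
      ≡R.≡⟨ cong₂ _+_ (left x) (right y) ⟩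
    x * falling s (pred (x + y)) + y * falling s (pred (x + y))
      ≡R.≡⟨ sym (*-distribʳ-+ (falling s (pred (x + y))) x y) ⟩
    (x + y) * falling s (pred (x + y)) ≡R.∎
  where
  module ≡R = ≡-Reasoning
  a1 : ∀ x y p q r t → x * p + y * q + (x * r + y * t) ≡ x * (r + p) + y * (q + t)
  a1 = solve-∀
  left : ∀ x → x * falling s (pred x + y) ≡ x * falling s (pred (x + y))
  left zero = refl≡
  left (suc x) = refl≡
  right : ∀ y → y * falling s (x + pred y) ≡ y * falling s (pred (x + y))
  right zero = refl≡
  right (suc y) = cong (λ z → suc y * falling s (pred z)) (sym (+-suc x y))

choices-one : ∀ c x y z → z ≤ x → z ≤ y → z ≤ choices c 1 x y
choices-one true x y z zx _ = ≤-trans zx (≤-trans (≤-reflexive (sym (*-identityʳ x))) (m≤m+n (x * 1) (y * 0)))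
choices-one false x y z _ zy = ≤-trans zy (≤-trans (≤-reflexive (sym (*-identityʳ y))) (m≤n+m (y * 1) (x * 0)))

tupleDeg-none : ∀ {n k} (H : KGraph n k) s S → ∣ S ∣ + s < k → tupleDeg H S s ≡ 0
tupleDeg-none H zero S lt = go (edge H (S ∪ ∅)) refl≡
  where
  go : ∀ b → edge H (S ∪ ∅) ≡ b → ⟦ b ⟧ + 0 ≡ 0
  go false _ = refl≡
  go true e = ⊥-elim (<⇒≢ lt (trans≡ (+-identityʳ ∣ S ∣) (trans≡ (cong ∣_∣ (sym (∪-identityʳ′ S))) (uniform H _ e))))
tupleDeg-none {n} H (suc s) S lt = trans≡ (tupleDeg-suc H S s)
  (trans≡ (∑-cong (allFin n) (λ v → tupleDeg-none H s (⁅ v ⁆ ∪ S) (≤-trans (s≤s (+-monoˡ-≤ s (insert-≤ v S))) (≤-trans (≤-reflexive (cong (1 +_) (sym (+-suc ∣ S ∣ s)))) lt)))) (∑-zero (allFin n)))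

module _ {n : ℕ} (k : ℕ) (i : Bool) (A : Subset n) where

  private
    PG : KGraph n k
    PG = parityGraph n k ⟦ i ⟧ A

  parityGraph-degree : ∀ s S → ∣ S ∣ + s ≡ k → tupleDeg PG S s ≡ choices (i xor odd ∣ A ∩ S ∣) s ∣ A ∩ ∁ S ∣ ∣ ∁ A ∩ ∁ S ∣
  parityGraph-degree zero S |S| = trans≡ (+-identityʳ _) (cong ⟦_⟧ (trans≡ (cong (edge PG) (∪-identityʳ′ S))
    (parityGraph-edge n k i A S (trans≡ (sym (+-identityʳ ∣ S ∣)) |S|))))
  parityGraph-degree (suc s) S |S| = ≡R.begin
      tupleDeg PG S (suc s)
        ≡R.≡⟨ tupleDeg-suc PG S s ⟩
      ∑ (allFin n) (λ v → tupleDeg PG (⁅ v ⁆ ∪ S) s)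
        ≡R.≡⟨ ∑-cong (allFin n) (λ v → each v (lookup S v) (lookup A v) refl≡ refl≡) ⟩
      ∑ (allFin n) (λ v → ⟦ lookup (A ∩ ∁ S) v ⟧ * X + ⟦ lookup (∁ A ∩ ∁ S) v ⟧ * Y)
        ≡R.≡⟨ ∑-add (allFin n) (λ v → ⟦ lookup (A ∩ ∁ S) v ⟧ * X) (λ v → ⟦ lookup (∁ A ∩ ∁ S) v ⟧ * Y) ⟩
      ∑ (allFin n) (λ v → ⟦ lookup (A ∩ ∁ S) v ⟧ * X) + ∑ (allFin n) (λ v → ⟦ lookup (∁ A ∩ ∁ S) v ⟧ * Y)
        ≡R.≡⟨ cong₂ _+_ (trans≡ (∑-scaleʳ (allFin n) (λ v → ⟦ lookup (A ∩ ∁ S) v ⟧) X) (cong (_* X) (card-∑ (A ∩ ∁ S))))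
                        (trans≡ (∑-scaleʳ (allFin n) (λ v → ⟦ lookup (∁ A ∩ ∁ S) v ⟧) Y) (cong (_* Y) (card-∑ (∁ A ∩ ∁ S)))) ⟩
      x * X + y * Y ≡R.∎
    where
    module ≡R = ≡-Reasoning
    c : Bool
    c = i xor odd ∣ A ∩ S ∣
    x y X Y : ℕ
    x = ∣ A ∩ ∁ S ∣
    y = ∣ ∁ A ∩ ∁ S ∣
    X = choices (not c) s (pred x) y
    Y = choices c s x (pred y)
    choices-cong : ∀ {c c' x x' y y'} → c ≡ c' → x ≡ x' → y ≡ y' → choices c s x y ≡ choices c' s x' y'
    choices-cong refl≡ refl≡ refl≡ = refl≡
    weight : ∀ v b a → lookup S v ≡ b → lookup A v ≡ a → ⟦ a ∧ not b ⟧ * X + ⟦ not a ∧ not b ⟧ * Y ≡ ⟦ lookup (A ∩ ∁ S) v ⟧ * X + ⟦ lookup (∁ A ∩ ∁ S) v ⟧ * Y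
    weight v b a refl≡ refl≡ = sym (cong₂ (λ p q → ⟦ p ⟧ * X + ⟦ q ⟧ * Y) (lookup-∩∁ A S v) (trans≡ (lookup-∩∁ (∁ A) S v) (cong (_∧ not b) (lookup-map v not A))))
    fresh : ∀ v a → lookup S v ≡ false → lookup A v ≡ a → x ≡ ⟦ a ⟧ + ∣ A ∩ ∁ (⁅ v ⁆ ∪ S) ∣ × y ≡ ⟦ not a ⟧ + ∣ ∁ A ∩ ∁ (⁅ v ⁆ ∪ S) ∣ × ∣ A ∩ (⁅ v ⁆ ∪ S) ∣ ≡ ⟦ a ⟧ + ∣ A ∩ S ∣
    fresh v a e refl≡ = ∩-∁-insert v A S e , trans≡ (∩-∁-insert v (∁ A) S e) (cong (λ z → ⟦ z ⟧ + ∣ ∁ A ∩ ∁ (⁅ v ⁆ ∪ S) ∣) (lookup-map v not A)) , ∩-insert v A S e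
    each : ∀ v b a → lookup S v ≡ b → lookup A v ≡ a → tupleDeg PG (⁅ v ⁆ ∪ S) s ≡ ⟦ lookup (A ∩ ∁ S) v ⟧ * X + ⟦ lookup (∁ A ∩ ∁ S) v ⟧ * Y
    each v true a e e' = trans≡ (tupleDeg-none PG s (⁅ v ⁆ ∪ S) (≤-reflexive (trans≡ (cong (λ z → suc (∣ z ∣ + s)) (insert-old v S e)) (trans≡ (sym (+-suc _ s)) |S|))))
      (trans≡ (zeros a) (weight v true a e e'))
      where
      zeros : ∀ a → 0 ≡ ⟦ a ∧ false ⟧ * X + ⟦ not a ∧ false ⟧ * Y
      zeros true = refl≡
      zeros false = refl≡
    each v false a e e' = trans≡ (parityGraph-degree s (⁅ v ⁆ ∪ S) (trans≡ (cong (_+ s) (insert-fresh v S e)) (trans≡ (sym (+-suc _ s)) |S|)))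
      (trans≡ (go a e') (weight v false a e e'))
      where
      go : ∀ a → lookup A v ≡ a → choices (i xor odd ∣ A ∩ (⁅ v ⁆ ∪ S) ∣) s ∣ A ∩ ∁ (⁅ v ⁆ ∪ S) ∣ ∣ ∁ A ∩ ∁ (⁅ v ⁆ ∪ S) ∣ ≡ ⟦ a ∧ true ⟧ * X + ⟦ not a ∧ true ⟧ * Y
      go true e' = let ex , ey , ep = fresh v true e e' in
        trans≡ (choices-cong (trans≡ (cong (λ z → i xor odd z) ep) (sym (not-distribʳ-xor i (odd ∣ A ∩ S ∣)))) (cong pred (sym ex)) (sym ey)) (sym (trans≡ (+-identityʳ _) (*-identityˡ X)))
      go false e' = let ex , ey , ep = fresh v false e e' in
        trans≡ (choices-cong (cong (λ z → i xor odd z) ep) (sym ex) (cong pred (sym ey))) (sym (*-identityˡ Y))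

-- Degrees lift to smaller sets: all but |X| ≤ k vertices v give a larger set X ∪ {v}.
lift-degree : ∀ {n k} (H : KGraph n k) C s → (∀ X → ∣ X ∣ + s ≡ k → n * n ^ s ≤ n * (2 * tupleDeg H X s) + C * n ^ s) →
  ∀ d X → ∣ X ∣ + (d + s) ≡ k → n * n ^ (d + s) ≤ n * (2 * tupleDeg H X (d + s)) + (C + d * k) * n ^ (d + s)
lift-degree {n} {k} H C s base zero X |X| = ≤-trans (base X |X|) (≤-reflexive (cong (λ z → n * (2 * tupleDeg H X s) + z * n ^ s) (sym (+-identityʳ C))))
lift-degree {n} {k} H C s base (suc d) X |X| = begin
    n * (n * N) ≡⟨ cong (_* (n * N)) (sym |V|) ⟩
    length V * (n * N) ≡⟨ sym (∑-const V (n * N)) ⟩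
    ∑ V (λ _ → n * N) ≤⟨ ∑-mono V (λ v → each v (lookup X v) refl≡) ⟩
    ∑ V (λ v → (n * 2) * T v + (C' * N + ⟦ lookup X v ⟧ * (n * N)))
      ≡⟨ ∑-add V (λ v → (n * 2) * T v) (λ v → C' * N + ⟦ lookup X v ⟧ * (n * N)) ⟩
    ∑ V (λ v → (n * 2) * T v) + ∑ V (λ v → C' * N + ⟦ lookup X v ⟧ * (n * N))
      ≡⟨ cong₂ _+_ (trans≡ (∑-scale V (n * 2) T) (cong ((n * 2) *_) (sym (tupleDeg-suc H X (d + s)))))
           (trans≡ (∑-add V (λ _ → C' * N) (λ v → ⟦ lookup X v ⟧ * (n * N))) (cong₂ _+_ (trans≡ (∑-const V (C' * N)) (cong (_* (C' * N)) |V|))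
             (trans≡ (∑-scaleʳ V (λ v → ⟦ lookup X v ⟧) (n * N)) (cong (_* (n * N)) (card-∑ X))))) ⟩
    (n * 2) * tupleDeg H X (suc (d + s)) + (n * (C' * N) + ∣ X ∣ * (n * N))
      ≤⟨ +-monoʳ-≤ ((n * 2) * tupleDeg H X (suc (d + s))) (+-monoʳ-≤ (n * (C' * N)) (*-monoˡ-≤ (n * N) (≤-trans (m≤m+n ∣ X ∣ _) (≤-reflexive |X|)))) ⟩
    (n * 2) * tupleDeg H X (suc (d + s)) + (n * (C' * N) + k * (n * N))
      ≡⟨ a1 n (tupleDeg H X (suc (d + s))) C d k N ⟩
    n * (2 * tupleDeg H X (suc (d + s))) + (C + (k + d * k)) * (n * N) ∎
  where
  V = allFin n
  N C' : ℕ
  N = n ^ (d + s)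
  C' = C + d * k
  |V| : length V ≡ n
  |V| = length-tabulate id
  T : Fin n → ℕ
  T v = tupleDeg H (⁅ v ⁆ ∪ X) (d + s)
  a1 : ∀ n t C d k N → (n * 2) * t + (n * ((C + d * k) * N) + k * (n * N)) ≡ n * (2 * t) + (C + (k + d * k)) * (n * N)
  a1 = solve-∀
  each : ∀ v b → lookup X v ≡ b → n * N ≤ (n * 2) * T v + (C' * N + ⟦ b ⟧ * (n * N))
  each v true _ = ≤-trans (≤-reflexive (sym (+-identityʳ (n * N)))) (≤-trans (m≤n+m (1 * (n * N)) (C' * N)) (m≤n+m _ ((n * 2) * T v)))
  each v false e = ≤-trans (lift-degree H C s base d (⁅ v ⁆ ∪ X) (trans≡ (cong (_+ (d + s)) (insert-fresh v X e)) (trans≡ (sym (+-suc _ (d + s))) |X|)))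
    (≤-reflexive (a2 n (T v) (C' * N)))
    where
    a2 : ∀ n t c → n * (2 * t) + c ≡ (n * 2) * t + (c + 0)
    a2 = solve-∀

half-odd : ∀ n → 1 ≤ n → Σ ℕ λ a → odd a ≡ true × a ≤ n × n ≤ 2 * a + 4 × 2 * a ≤ n + 4
half-odd 1 _ = 1 , refl≡ , ≤ᵇ⇒≤ _ _ tt , ≤ᵇ⇒≤ _ _ tt , ≤ᵇ⇒≤ _ _ tt
half-odd 2 _ = 1 , refl≡ , ≤ᵇ⇒≤ _ _ tt , ≤ᵇ⇒≤ _ _ tt , ≤ᵇ⇒≤ _ _ tt
half-odd 3 _ = 1 , refl≡ , ≤ᵇ⇒≤ _ _ tt , ≤ᵇ⇒≤ _ _ tt , ≤ᵇ⇒≤ _ _ tt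
half-odd 4 _ = 1 , refl≡ , ≤ᵇ⇒≤ _ _ tt , ≤ᵇ⇒≤ _ _ tt , ≤ᵇ⇒≤ _ _ tt
half-odd (suc (suc (suc (suc n@(suc _))))) _ = let a , o , a≤ , lo , hi = half-odd n (s≤s z≤n) in
  2 + a , trans≡ (not-involutive (odd a)) o , +-mono-≤ {2} {4} (s≤s (s≤s z≤n)) a≤ ,
  ≤-trans (+-monoʳ-≤ 4 lo) (≤-reflexive (a1 a)) , ≤-trans (≤-reflexive (a2 a)) (+-monoʳ-≤ 4 hi)
  where
  a1 : ∀ a → 4 + (2 * a + 4) ≡ 2 * (2 + a) + 4
  a1 = solve-∀
  a2 : ∀ a → 2 * (2 + a) ≡ 4 + 2 * a
  a2 = solve-∀

balanced-degree : ∀ {n} k i (A : Subset n) → n ≤ 2 * ∣ A ∣ + 4 → n ≤ 2 * ∣ ∁ A ∣ + 4 → ∀ X → ∣ X ∣ + 1 ≡ k →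
  n * n ^ 1 ≤ n * (2 * tupleDeg (parityGraph n k ⟦ i ⟧ A) X 1) + (2 * k + 4) * n ^ 1
balanced-degree {n} k i A big₁ big₂ X |X| = begin
    n * n ^ 1 ≤⟨ *-monoʳ-≤ n (≤-trans (≤-reflexive (*-identityʳ n)) (≤-trans (bound (≤-total x y)) (≤-reflexive (cong (λ z → 2 * z + (2 * k + 4)) (sym (parityGraph-degree k i A 1 X |X|)))))) ⟩
    n * (2 * tupleDeg (parityGraph n k ⟦ i ⟧ A) X 1 + (2 * k + 4)) ≡⟨ a1 n (tupleDeg (parityGraph n k ⟦ i ⟧ A) X 1) (2 * k + 4) ⟩
    n * (2 * tupleDeg (parityGraph n k ⟦ i ⟧ A) X 1) + (2 * k + 4) * n ^ 1 ∎
  where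
  a1 : ∀ n t c → n * (2 * t + c) ≡ n * (2 * t) + c * (n * 1)
  a1 = solve-∀
  x y D : ℕ
  x = ∣ A ∩ ∁ X ∣
  y = ∣ ∁ A ∩ ∁ X ∣
  D = choices (i xor odd ∣ A ∩ X ∣) 1 x y
  |X|≤k : ∣ X ∣ ≤ k
  |X|≤k = ≤-trans (m≤m+n ∣ X ∣ 1) (≤-reflexive |X|)
  p≤k : ∣ A ∩ X ∣ ≤ k
  p≤k = ≤-trans (≤-trans (m≤m+n ∣ A ∩ X ∣ ∣ ∁ A ∩ X ∣) (≤-reflexive (card-split′ A X))) |X|≤k
  q≤k : ∣ ∁ A ∩ X ∣ ≤ k
  q≤k = ≤-trans (≤-trans (m≤n+m ∣ ∁ A ∩ X ∣ ∣ A ∩ X ∣) (≤-reflexive (card-split′ A X))) |X|≤k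
  by : ∀ z p a → p + z ≡ a → p ≤ k → n ≤ 2 * a + 4 → z ≤ D → n ≤ 2 * D + (2 * k + 4)
  by z p a refl≡ p≤ n≤ z≤ = begin
    n ≤⟨ n≤ ⟩
    2 * (p + z) + 4 ≤⟨ +-monoˡ-≤ 4 (*-monoʳ-≤ 2 (+-mono-≤ p≤ z≤)) ⟩
    2 * (k + D) + 4 ≡⟨ a2 k D ⟩
    2 * D + (2 * k + 4) ∎
    where
    a2 : ∀ k D → 2 * (k + D) + 4 ≡ 2 * D + (2 * k + 4)
    a2 = solve-∀
  bound : (x ≤ y) ⊎ (y ≤ x) → n ≤ 2 * D + (2 * k + 4)
  bound (inj₁ le) = by x ∣ A ∩ X ∣ ∣ A ∣ (card-split A X) p≤k big₁ (choices-one (i xor odd ∣ A ∩ X ∣) x y x ≤-refl le)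
  bound (inj₂ le) = by y ∣ ∁ A ∩ X ∣ ∣ ∁ A ∣ (card-split (∁ A) X) q≤k big₂ (choices-one (i xor odd ∣ A ∩ X ∣) x y y le ≤-refl)

-- Classes of sizes a', b' and a set with p and q elements in them, such that the degree of this set (into the parity i)
-- is below every degree for classes of sizes a, b.
Low : ℕ → ℕ → ℕ → ℕ → ℕ → ℕ → Bool → Set
Low ℓ r a' b' a b i = Σ ℕ λ p → Σ ℕ λ q → Σ ℕ λ x → Σ ℕ λ y → p + q ≡ ℓ × p + x ≡ a' × q + y ≡ b' ×
  (∀ c p' q' x' y' → p' + q' ≡ ℓ → p' + x' ≡ a → q' + y' ≡ b → choices (i xor odd p) r x y < choices c r x' y')

conflict-up : ∀ ℓ r a b → (∀ i → Low ℓ r (suc a) b a (suc b) i) → ⊥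
conflict-up ℓ r a b low = go (low false) (low true)
  where
  go : Low ℓ r (suc a) b a (suc b) false → Low ℓ r (suc a) b a (suc b) true → ⊥
  go (suc p , q , x , y , pq , px , qy , f) _ = <-irrefl refl≡ (f (odd (suc p)) p (suc q) x y (trans≡ (+-suc p q) pq) (cong pred px) (cong (1 +_) qy))
  go _ (suc p , q , x , y , pq , px , qy , f) = <-irrefl refl≡ (f (not (odd (suc p))) p (suc q) x y (trans≡ (+-suc p q) pq) (cong pred px) (cong (1 +_) qy))
  go (zero , .ℓ , .(suc a) , y , refl≡ , refl≡ , qy , f) (zero , .ℓ , .(suc a) , y' , refl≡ , refl≡ , qy' , f') =
    <-irrefl (trans≡ (choices-total false r (suc a) y) (trans≡ (cong (falling r) (sym (+-suc a y))) (sym (choices-total false r a (suc y)))))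
      (+-mono-< (f false 0 ℓ a (suc y) refl≡ refl≡ (trans≡ (+-suc ℓ y) (cong (1 +_) qy)))
        (subst (λ z → choices true r (suc a) z < choices true r a (suc y)) (+-cancelˡ-≡ ℓ _ _ (trans≡ qy' (sym qy))) (f' true 0 ℓ a (suc y) refl≡ refl≡ (trans≡ (+-suc ℓ y) (cong (1 +_) qy)))))

conflict-down : ∀ ℓ r a b → (∀ i → Low ℓ r a (suc b) (suc a) b i) → ⊥
conflict-down ℓ r a b low = go (low false) (low true)
  where
  go : Low ℓ r a (suc b) (suc a) b false → Low ℓ r a (suc b) (suc a) b true → ⊥
  go (p , suc q , x , y , pq , px , qy , f) _ = <-irrefl refl≡ (f (odd p) (suc p) q x y (trans≡ (sym (+-suc p q)) pq) (cong (1 +_) px) (cong pred qy))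
  go _ (p , suc q , x , y , pq , px , qy , f) = <-irrefl refl≡ (f (not (odd p)) (suc p) q x y (trans≡ (sym (+-suc p q)) pq) (cong (1 +_) px) (cong pred qy))
  go (p , zero , x , .(suc b) , refl≡ , px , refl≡ , f) (p' , zero , x' , .(suc b) , p≡ , px' , refl≡ , f') =
    <-irrefl (trans≡ (choices-total (odd p) r x (suc b)) (trans≡ (cong (falling r) (+-suc x b)) (sym (choices-total (odd p) r (suc x) b))))
      (+-mono-< (f (odd p) (p + 0) 0 (suc x) b (+-identityʳ _) (grow p+0≡) refl≡)
        (subst₂ (λ z w → choices (not (odd z)) r w (suc b) < choices (not (odd p)) r (suc x) b) p'≡p (+-cancelˡ-≡ p _ _ (trans≡ (cong (_+ x') (sym p'≡p)) (trans≡ px' (sym px))))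
          (f' (not (odd p)) (p + 0) 0 (suc x) b (+-identityʳ _) (grow p+0≡) refl≡)))
    where
    p+0≡ : p + 0 ≡ p
    p+0≡ = +-identityʳ p
    p'≡p : p' ≡ p
    p'≡p = +-cancelʳ-≡ 0 p' p p≡
    grow : ∀ {z} → z ≡ p → z + suc x ≡ suc a
    grow refl≡ = trans≡ (+-suc p x) (cong (1 +_) px)

elements : ∀ {n} → Subset n → List (Fin n)
elements [] = []
elements (true ∷ S) = zero ∷ map Fin.suc (elements S)
elements (false ∷ S) = map Fin.suc (elements S)

fromList-suc : ∀ {n} (xs : List (Fin n)) → fromList (map Fin.suc xs) ≡ false ∷ fromList xs
fromList-suc [] = refl≡
fromList-suc (x ∷ xs) = cong (⁅ Fin.suc x ⁆ ∪_) (fromList-suc xs)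

fromList-elements : ∀ {n} (S : Subset n) → fromList (elements S) ≡ S
fromList-elements [] = refl≡
fromList-elements (true ∷ S) = trans≡ (cong (⁅ zero ⁆ ∪_) (fromList-suc (elements S))) (cong (true ∷_) (trans≡ (∪-identityˡ _) (fromList-elements S)))
fromList-elements (false ∷ S) = trans≡ (fromList-suc (elements S)) (cong (false ∷_) (fromList-elements S))

length-elements : ∀ {n} (S : Subset n) → length (elements S) ≡ ∣ S ∣
length-elements [] = refl≡
length-elements (true ∷ S) = cong (1 +_) (trans≡ (length-map Fin.suc (elements S)) (length-elements S))
length-elements (false ∷ S) = trans≡ (length-map Fin.suc (elements S)) (length-elements S)

parity-map : {X Y : Set} (τ : Y → Bool) (f : X → Y) (xs : List X) → parity τ (map f xs) ≡ parity (τ ∘ f) xs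
parity-map τ f [] = refl≡
parity-map τ f (x ∷ xs) = cong (τ (f x) xor_) (parity-map τ f xs)

parity-elements : ∀ {n} (τ : Fin n → Bool) (S : Subset n) → parity τ (elements S) ≡ odd ∣ tabulate τ ∩ S ∣
parity-elements τ [] = refl≡
parity-elements τ (false ∷ S) = trans≡ (parity-map τ Fin.suc (elements S)) (trans≡ (parity-elements (τ ∘ Fin.suc) S) (go (τ zero)))
  where
  go : ∀ b → odd ∣ tabulate (τ ∘ Fin.suc) ∩ S ∣ ≡ odd ∣ (b ∧ false) ∷ (tabulate (τ ∘ Fin.suc) ∩ S) ∣
  go true = refl≡
  go false = refl≡
parity-elements τ (true ∷ S) = trans≡ (cong (τ zero xor_) (trans≡ (parity-map τ Fin.suc (elements S)) (parity-elements (τ ∘ Fin.suc) S))) (go (τ zero))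
  where
  go : ∀ b → b xor odd ∣ tabulate (τ ∘ Fin.suc) ∩ S ∣ ≡ odd ∣ (b ∧ true) ∷ (tabulate (τ ∘ Fin.suc) ∩ S) ∣
  go true = refl≡
  go false = refl≡

parity-allFin : ∀ n (τ : Fin n → Bool) → parity τ (allFin n) ≡ odd ∣ tabulate τ ∣
parity-allFin zero τ = refl≡
parity-allFin (suc n) τ = trans≡ (cong (τ zero xor_) (trans≡ (cong (parity τ) (sym (map-tabulate id Fin.suc))) (trans≡ (parity-map τ Fin.suc (allFin n)) (parity-allFin n (τ ∘ Fin.suc))))) (go (τ zero))
  where
  go : ∀ b → b xor odd ∣ tabulate (τ ∘ Fin.suc) ∣ ≡ odd ∣ b ∷ tabulate (τ ∘ Fin.suc) ∣
  go true = refl≡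
  go false = refl≡

xors-const : {X : Set} (J : X → Bool) (b : Bool) → (∀ c → J c ≡ b) → ∀ cs → xors J cs ≡ b ∧ odd (length cs)
xors-const J true e [] = refl≡
xors-const J false e [] = refl≡
xors-const J b e (c ∷ cs) = trans≡ (cong₂ _xor_ (e c) (xors-const J b e cs)) (go b)
  where
  go : ∀ b → b xor (b ∧ odd (length cs)) ≡ b ∧ not (odd (length cs))
  go true = refl≡
  go false = refl≡

module Degrees (k ℓ m r : ℕ) (k≥1 : 1 ≤ k) (ℓ+r : ℓ + r ≡ k) (H : Fin m → KGraph (m * k) k) (large : (c : Fin m) → δ k ℓ m < minDeg ℓ (H c)) (c₀ : Fin m) where

  private
    n : ℕ
    n = m * k
    PG : Bool → Subset n → KGraph n k
    PG i A = parityGraph n k ⟦ i ⟧ A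

  degrees-exceed : ∀ i A → (i ∧ odd m) xor odd ∣ A ∣ ≡ true → Σ (Subset n) λ S → ∣ S ∣ ≡ ℓ × (∀ c S' → ∣ S' ∣ ≡ ℓ → tupleDeg (PG i A) S r < tupleDeg (H c) S' r)
  degrees-exceed i A ext = go (minDeg-attained ℓ (PG i A) (H c₀) (≤-trans (s≤s z≤n) (large c₀)))
    where
    go : (Σ (Subset n) λ S → ∣ S ∣ ≡ ℓ × minDeg ℓ (PG i A) ≡ deg (PG i A) S) → Σ (Subset n) λ S → ∣ S ∣ ≡ ℓ × (∀ c S' → ∣ S' ∣ ≡ ℓ → tupleDeg (PG i A) S r < tupleDeg (H c) S' r)
    go (S , |S| , e) = S , |S| , λ c S' |S'| → subst₂ _<_ (sym (tupleDeg≡deg (PG i A) S r (trans≡ (cong (_+ r) |S|) ℓ+r))) (sym (tupleDeg≡deg (H c) S' r (trans≡ (cong (_+ r) |S'|) ℓ+r)))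
      (*-monoʳ-< (r !) {{r !≢0}} (≤-trans (s≤s (≤-trans (≤-reflexive (sym e)) (minDeg≤δ k ℓ m i A ext))) (≤-trans (large c) (minDeg-≤ ℓ (H c) S' |S'|))))

  exactness : ∀ (τ : Fin n → Bool) (J : Fin m → Bool) → (∀ c t → length t ≡ k → edge (H c) (fromList t) ≡ true → parity τ t ≡ J c) → xors J (allFin m) ≡ parity τ (allFin n)
  exactness τ J par = trans≡ (go (odd m) refl≡) (sym (parity-allFin n τ))
    where
    A : Subset n
    A = tabulate τ
    inside-parity : ∀ c X → edge (H c) X ≡ true → edge (PG (J c) A) X ≡ true
    inside-parity c X e = trans≡ (parityGraph-edge n k (J c) A X (uniform (H c) X e))
      (trans≡ (cong (λ z → not (J c xor z)) (trans≡ (sym (parity-elements τ X)) (par c (elements X) (trans≡ (length-elements X) (uniform (H c) X e)) (trans≡ (cong (edge (H c)) (fromList-elements X)) e)))) (self (J c)))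
      where
      self : ∀ b → not (b xor b) ≡ true
      self true = refl≡
      self false = refl≡
    tupleDeg-≤ : ∀ c S → tupleDeg (H c) S r ≤ tupleDeg (PG (J c) A) S r
    tupleDeg-≤ c S = ∑-mono (tuples (allFin n) r) (λ t → implies (edge (H c) (S ∪ fromList t)) (edge (PG (J c) A) (S ∪ fromList t)) (inside-parity c (S ∪ fromList t)))
      where
      implies : ∀ a b → (a ≡ true → b ≡ true) → ⟦ a ⟧ ≤ ⟦ b ⟧
      implies false b _ = z≤n
      implies true b f = ≤-reflexive (cong ⟦_⟧ (sym (f refl≡)))
    same-parity : ∀ c → (J c ∧ odd m) xor odd ∣ A ∣ ≡ false
    same-parity c = decide ((J c ∧ odd m) xor odd ∣ A ∣) refl≡
      where
      decide : ∀ b → (J c ∧ odd m) xor odd ∣ A ∣ ≡ b → b ≡ false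
      decide false _ = refl≡
      decide true e = let S , |S| , f = degrees-exceed (J c) A e in ⊥-elim (<-irrefl refl≡ (≤-trans (f c S |S|) (tupleDeg-≤ c S)))
    xor-false : ∀ a b → a xor b ≡ false → a ≡ b
    xor-false true true _ = refl≡
    xor-false false false _ = refl≡
    constant : ∀ b → (∀ c → J c ≡ b) → b ∧ odd m ≡ odd ∣ A ∣ → xors J (allFin m) ≡ odd ∣ A ∣
    constant b e e' = trans≡ (xors-const J b e (allFin m)) (trans≡ (cong (λ z → b ∧ odd z) (length-tabulate {n = m} id)) e')
    module Even (m-even : odd m ≡ false) (c₁ : Bool → Fin m) (J-c₁ : ∀ j → J (c₁ j) ≡ j) where
      A-even : odd ∣ A ∣ ≡ false
      A-even = sym (xor-false _ _ (trans≡ (cong (_xor odd ∣ A ∣) (sym (trans≡ (cong (J c₀ ∧_) m-even) (∧-zeroʳ (J c₀))))) (same-parity c₀)))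
      low : ∀ A' → odd ∣ A' ∣ ≡ true → ∀ i → Low ℓ r (∣ A' ∣) (∣ ∁ A' ∣) (∣ A ∣) (∣ ∁ A ∣) i
      low A' o i = found (degrees-exceed i A' (trans≡ (cong (_xor odd ∣ A' ∣) (trans≡ (cong (i ∧_) m-even) (∧-zeroʳ i))) o))
        where
        found : (Σ (Subset n) λ S → ∣ S ∣ ≡ ℓ × (∀ c S' → ∣ S' ∣ ≡ ℓ → tupleDeg (PG i A') S r < tupleDeg (H c) S' r)) → Low ℓ r (∣ A' ∣) (∣ ∁ A' ∣) (∣ A ∣) (∣ ∁ A ∣) i
        found (S , |S| , f) = ∣ A' ∩ S ∣ , ∣ ∁ A' ∩ S ∣ , ∣ A' ∩ ∁ S ∣ , ∣ ∁ A' ∩ ∁ S ∣ , trans≡ (card-split′ A' S) |S| , card-split A' S , card-split (∁ A') S , above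
          where
          above : ∀ c p' q' x' y' → p' + q' ≡ ℓ → p' + x' ≡ ∣ A ∣ → q' + y' ≡ ∣ ∁ A ∣ → choices (i xor odd ∣ A' ∩ S ∣) r ∣ A' ∩ ∁ S ∣ ∣ ∁ A' ∩ ∁ S ∣ < choices c r x' y'
          above c p' q' x' y' pq px qy = compare (subset-meeting A p' q' (≤-trans (m≤m+n p' x') (≤-reflexive px)) (≤-trans (m≤m+n q' y') (≤-reflexive qy)))
            where
            j : Bool
            j = c xor odd p'
            cancel : ∀ a b → (a xor b) xor b ≡ a
            cancel true true = refl≡
            cancel true false = refl≡
            cancel false true = refl≡
            cancel false false = refl≡
            rewriting : ∀ S' → ∣ A ∩ S' ∣ ≡ p' → ∣ ∁ A ∩ S' ∣ ≡ q' → choices (j xor odd ∣ A ∩ S' ∣) r ∣ A ∩ ∁ S' ∣ ∣ ∁ A ∩ ∁ S' ∣ ≡ choices c r x' y'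
            rewriting S' e e' = trans≡ (cong (λ z → choices (j xor odd z) r ∣ A ∩ ∁ S' ∣ ∣ ∁ A ∩ ∁ S' ∣) e)
              (trans≡ (cong (λ z → choices z r ∣ A ∩ ∁ S' ∣ ∣ ∁ A ∩ ∁ S' ∣) (cancel c (odd p')))
                (cong₂ (choices c r) (+-cancelˡ-≡ p' _ _ (trans≡ (trans≡ (cong (_+ ∣ A ∩ ∁ S' ∣) (sym e)) (card-split A S')) (sym px)))
                  (+-cancelˡ-≡ q' _ _ (trans≡ (trans≡ (cong (_+ ∣ ∁ A ∩ ∁ S' ∣) (sym e')) (card-split (∁ A) S')) (sym qy)))))
            compare : (Σ (Subset n) λ S' → ∣ A ∩ S' ∣ ≡ p' × ∣ ∁ A ∩ S' ∣ ≡ q') → choices (i xor odd ∣ A' ∩ S ∣) r ∣ A' ∩ ∁ S ∣ ∣ ∁ A' ∩ ∁ S ∣ < choices c r x' y'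
            compare (S' , e , e') = subst₂ _<_ (parityGraph-degree k i A' r S (trans≡ (cong (_+ r) |S|) ℓ+r))
                (trans≡ (cong (λ z → tupleDeg (PG z A) S' r) (J-c₁ j)) (trans≡ (parityGraph-degree k j A r S' (trans≡ (cong (_+ r) |S'|) ℓ+r)) (rewriting S' e e')))
                (≤-trans (f (c₁ j) S' |S'|) (tupleDeg-≤ (c₁ j) S'))
              where
              |S'| : ∣ S' ∣ ≡ ℓ
              |S'| = trans≡ (sym (card-split′ A S')) (trans≡ (cong₂ _+_ e e') pq)
      -- A set whose size differs by one from that of A has odd size, hence is admissible with either parity.
      low′ : ∀ a' b' → odd a' ≡ true → a' + b' ≡ n → ∀ i → Low ℓ r a' b' (∣ A ∣) (∣ ∁ A ∣) i
      low′ a' b' o a+b = pick (subset-of-size n a' (≤-trans (m≤m+n a' b') (≤-reflexive a+b)))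
        where
        pick : (Σ (Subset n) λ A' → ∣ A' ∣ ≡ a') → ∀ i → Low ℓ r a' b' (∣ A ∣) (∣ ∁ A ∣) i
        pick (A' , refl≡) i = subst (λ z → Low ℓ r (∣ A' ∣) z (∣ A ∣) (∣ ∁ A ∣) i) (+-cancelˡ-≡ ∣ A' ∣ _ _ (trans≡ (card-∁ A') (sym a+b))) (low A' o i)
      impossible : 0 < n → ⊥
      impossible n>0 = split ∣ A ∣ ∣ ∁ A ∣ refl≡ refl≡
        where
        split : ∀ a b → ∣ A ∣ ≡ a → ∣ ∁ A ∣ ≡ b → ⊥
        split a (suc b) ea eb = conflict-up ℓ r a b (λ i → subst₂ (λ u v → Low ℓ r (suc a) b u v i) ea eb (low′ (suc a) b (cong not (trans≡ (cong odd (sym ea)) A-even)) (trans≡ (sym (+-suc a b)) (trans≡ (cong₂ _+_ (sym ea) (sym eb)) (card-∁ A))) i))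
        split (suc a) zero ea eb = conflict-down ℓ r a 0 (λ i → subst₂ (λ u v → Low ℓ r a 1 u v i) ea eb (low′ a 1 (trans≡ (sym (not-involutive (odd a))) (cong not (trans≡ (cong odd (sym ea)) A-even))) (trans≡ (+-comm a 1) (trans≡ (sym (+-identityʳ (suc a))) (trans≡ (cong₂ _+_ (sym ea) (sym eb)) (card-∁ A)))) i))
        split zero zero ea eb = <⇒≢ n>0 (trans≡ (cong₂ _+_ (sym ea) (sym eb)) (card-∁ A))
    n>0 : 0 < n
    n>0 = *-mono-≤ {1} {m} (≤-trans (s≤s z≤n) (toℕ<n c₀)) k≥1
    go : ∀ b → odd m ≡ b → xors J (allFin m) ≡ odd ∣ A ∣
    go true e = constant (odd ∣ A ∣) (λ c → trans≡ (sym (∧-identityʳ (J c))) (trans≡ (cong (J c ∧_) (sym e)) (xor-false _ _ (same-parity c)))) (trans≡ (cong (odd ∣ A ∣ ∧_) e) (∧-identityʳ (odd ∣ A ∣)))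
    go false e = vary (search (λ c → J c xor J c₀) (allFin m))
      where
      vary : (Σ (Fin m) λ c → J c xor J c₀ ≡ true) ⊎ (∀ c → c ∈ˡ allFin m → J c xor J c₀ ≡ false) → xors J (allFin m) ≡ odd ∣ A ∣
      vary (inj₂ eq) = constant (J c₀) (λ c → xor-false _ _ (eq c (∈-allFin c))) (xor-false _ _ (same-parity c₀))
      vary (inj₁ (c , ne)) = ⊥-elim (Even.impossible e (proj₁ ∘ choose) (proj₂ ∘ choose) n>0)
        where
        choose : ∀ j → Σ (Fin m) λ c₁ → J c₁ ≡ j
        choose j = at (J c₀) (J c) refl≡ refl≡ ne j
          where
          at : ∀ a b → J c₀ ≡ a → J c ≡ b → b xor a ≡ true → ∀ j → Σ (Fin m) λ c₁ → J c₁ ≡ j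
          at true false e e' _ true = c₀ , e
          at true false e e' _ false = c , e'
          at false true e e' _ true = c , e'
          at false true e e' _ false = c₀ , e

module _ (k ℓ m r' : ℕ) (k≥1 : 1 ≤ k) (ℓ+r : ℓ + (r' + 1) ≡ k) (H : Fin m → KGraph (m * k) k) (large : (c : Fin m) → δ k ℓ m < minDeg ℓ (H c)) where

  private
    n r : ℕ
    n = m * k
    r = r' + 1

  fromList-++ : ∀ (L t : List (Fin n)) → fromList (L ++ t) ≡ fromList L ∪ fromList t
  fromList-++ [] t = sym (∪-identityˡ _)
  fromList-++ (x ∷ L) t = trans≡ (cong (⁅ x ⁆ ∪_) (fromList-++ L t)) (sym (∪-assoc ⁅ x ⁆ (fromList L) (fromList t)))

  half-degree : 1 ≤ n → ∀ e → e * (2 * k + 4 + 2 * k * k) ≤ n → ∀ c (L : List (Fin n)) s → ∣ fromList L ∣ ≡ length L → length L ≤ ℓ → length L + s ≡ k →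
    e * n ^ s ≤ e * (2 * ∑ (tuples (allFin n) s) (λ t → ⟦ edge (H c) (fromList (L ++ t)) ⟧)) + n ^ s
  half-degree n≥1 e e-small c L s |L| L≤ℓ L+s = go (half-odd n n≥1)
    where
    d : ℕ
    d = ℓ ∸ length L
    d+r≡s : d + r ≡ s
    d+r≡s = +-cancelˡ-≡ (length L) _ _ (trans≡ (sym (+-assoc (length L) d r)) (trans≡ (cong (_+ r) (m+[n∸m]≡n L≤ℓ)) (trans≡ ℓ+r (sym L+s))))
    go : (Σ ℕ λ a → odd a ≡ true × a ≤ n × n ≤ 2 * a + 4 × 2 * a ≤ n + 4) → e * n ^ s ≤ e * (2 * ∑ (tuples (allFin n) s) (λ t → ⟦ edge (H c) (fromList (L ++ t)) ⟧)) + n ^ s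
    go (a , a-odd , a≤n , big₁ , a-small) = with-A (subset-of-size n a a≤n)
      where
      with-A : (Σ (Subset n) λ A → ∣ A ∣ ≡ a) → e * n ^ s ≤ e * (2 * ∑ (tuples (allFin n) s) (λ t → ⟦ edge (H c) (fromList (L ++ t)) ⟧)) + n ^ s
      with-A (A , refl≡) = with-S (Degrees.degrees-exceed k ℓ m r k≥1 ℓ+r H large c false A a-odd)
        where
        big₂ : n ≤ 2 * ∣ ∁ A ∣ + 4
        big₂ = +-cancelˡ-≤ (∣ A ∣ + ∣ A ∣) n (2 * ∣ ∁ A ∣ + 4) (begin
          ∣ A ∣ + ∣ A ∣ + n ≡⟨ cong (_+ n) (a1 ∣ A ∣) ⟩
          2 * ∣ A ∣ + n ≤⟨ +-monoˡ-≤ n a-small ⟩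
          n + 4 + n ≡⟨ cong (λ z → z + 4 + z) (sym (card-∁ A)) ⟩
          ∣ A ∣ + ∣ ∁ A ∣ + 4 + (∣ A ∣ + ∣ ∁ A ∣) ≡⟨ a2 ∣ A ∣ ∣ ∁ A ∣ ⟩
          ∣ A ∣ + ∣ A ∣ + (2 * ∣ ∁ A ∣ + 4) ∎)
          where
          a1 : ∀ a → a + a ≡ 2 * a
          a1 = solve-∀
          a2 : ∀ a b → a + b + 4 + (a + b) ≡ a + a + (2 * b + 4)
          a2 = solve-∀
        PG : KGraph n k
        PG = parityGraph n k 0 A
        C : ℕ
        C = 2 * k + 4 + r' * k
        with-S : (Σ (Subset n) λ S → ∣ S ∣ ≡ ℓ × (∀ c S' → ∣ S' ∣ ≡ ℓ → tupleDeg PG S r < tupleDeg (H c) S' r)) →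
          e * n ^ s ≤ e * (2 * ∑ (tuples (allFin n) s) (λ t → ⟦ edge (H c) (fromList (L ++ t)) ⟧)) + n ^ s
        with-S (S , |S| , f) = *-cancelˡ-≤ n {{>-nonZero n≥1}} (begin
            n * (e * n ^ s) ≡⟨ a1 n e (n ^ s) ⟩
            e * (n * n ^ s) ≤⟨ *-monoʳ-≤ e (subst (λ s → n * n ^ s ≤ n * (2 * tupleDeg (H c) (fromList L) s) + (C + d * k) * n ^ s) d+r≡s
                (lift-degree (H c) C r base d (fromList L) (trans≡ (cong₂ _+_ |L| d+r≡s) L+s))) ⟩
            e * (n * (2 * tupleDeg (H c) (fromList L) s) + (C + d * k) * n ^ s) ≡⟨ a2 e n (tupleDeg (H c) (fromList L) s) (C + d * k) (n ^ s) ⟩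
            n * (e * (2 * tupleDeg (H c) (fromList L) s)) + (e * (C + d * k)) * n ^ s ≤⟨ +-monoʳ-≤ (n * (e * (2 * tupleDeg (H c) (fromList L) s))) (*-monoˡ-≤ (n ^ s) (≤-trans (*-monoʳ-≤ e C-small) e-small)) ⟩
            n * (e * (2 * tupleDeg (H c) (fromList L) s)) + n * n ^ s ≡⟨ sym (*-distribˡ-+ n (e * (2 * tupleDeg (H c) (fromList L) s)) (n ^ s)) ⟩
            n * (e * (2 * tupleDeg (H c) (fromList L) s) + n ^ s)
              ≡⟨ cong (λ z → n * (e * (2 * z) + n ^ s)) (∑-cong (tuples (allFin n) s) (λ t → cong (λ X → ⟦ edge (H c) X ⟧) (sym (fromList-++ L t)))) ⟩
            n * (e * (2 * ∑ (tuples (allFin n) s) (λ t → ⟦ edge (H c) (fromList (L ++ t)) ⟧)) + n ^ s) ∎)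
          where
          a1 : ∀ n e x → n * (e * x) ≡ e * (n * x)
          a1 = solve-∀
          a2 : ∀ e n t c x → e * (n * (2 * t) + c * x) ≡ n * (e * (2 * t)) + (e * c) * x
          a2 = solve-∀
          base : ∀ X → ∣ X ∣ + r ≡ k → n * n ^ r ≤ n * (2 * tupleDeg (H c) X r) + C * n ^ r
          base X |X| = ≤-trans (lift-degree PG (2 * k + 4) 1 (balanced-degree k false A big₁ big₂) r' S (trans≡ (cong (_+ r) |S|) ℓ+r))
            (+-monoˡ-≤ (C * n ^ r) (*-monoʳ-≤ n (*-monoʳ-≤ 2 (<⇒≤ (f c X (+-cancelʳ-≡ r ∣ X ∣ ℓ (trans≡ |X| (sym ℓ+r))))))))
          C-small : C + d * k ≤ 2 * k + 4 + 2 * k * k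
          C-small = begin
            2 * k + 4 + r' * k + d * k ≤⟨ +-mono-≤ (+-monoʳ-≤ (2 * k + 4) (*-monoˡ-≤ k r'≤k)) (*-monoˡ-≤ k d≤k) ⟩
            2 * k + 4 + k * k + k * k ≡⟨ a3 k ⟩
            2 * k + 4 + 2 * k * k ∎
            where
            a3 : ∀ k → 2 * k + 4 + k * k + k * k ≡ 2 * k + 4 + 2 * k * k
            a3 = solve-∀
            r'≤k : r' ≤ k
            r'≤k = ≤-trans (≤-trans (m≤m+n r' 1) (m≤n+m r ℓ)) (≤-reflexive ℓ+r)
            d≤k : d ≤ k
            d≤k = ≤-trans (m∸n≤m ℓ (length L)) (≤-trans (m≤m+n ℓ r) (≤-reflexive ℓ+r))

fromList-↭ : ∀ {n} {xs ys : List (Fin n)} → xs ↭ ys → fromList xs ≡ fromList ys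
fromList-↭ refl = refl≡
fromList-↭ (prep x p) = cong (⁅ x ⁆ ∪_) (fromList-↭ p)
fromList-↭ {ys = _ ∷ _ ∷ ys} (swap x y p) = trans≡ (cong (λ z → ⁅ x ⁆ ∪ (⁅ y ⁆ ∪ z)) (fromList-↭ p))
  (trans≡ (sym (∪-assoc ⁅ x ⁆ ⁅ y ⁆ (fromList ys))) (trans≡ (cong (_∪ fromList ys) (∪-comm ⁅ x ⁆ ⁅ y ⁆)) (∪-assoc ⁅ y ⁆ ⁅ x ⁆ (fromList ys))))
fromList-↭ (trans p q) = trans≡ (fromList-↭ p) (fromList-↭ q)

∈-fromList⁻ : ∀ {n} {v : Fin n} xs → v ∈ fromList xs → v ∈ˡ xs
∈-fromList⁻ [] v∈ = ⊥-elim (∉⊥ v∈)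
∈-fromList⁻ (x ∷ xs) v∈ = [ (λ p → here (x∈⁅y⁆⇒x≡y x p)) , (λ p → there (∈-fromList⁻ xs p)) ]′ (x∈p∪q⁻ ⁅ x ⁆ (fromList xs) v∈)

∈-fromList⁺ : ∀ {n} {v : Fin n} {xs} → v ∈ˡ xs → v ∈ fromList xs
∈-fromList⁺ (here refl≡) = x∈p∪q⁺ (inj₁ (x∈⁅x⁆ _))
∈-fromList⁺ (there p) = x∈p∪q⁺ (inj₂ (∈-fromList⁺ p))

∣fromList∣≤ : ∀ {n} (xs : List (Fin n)) → ∣ fromList xs ∣ ≤ length xs
∣fromList∣≤ {n} [] = ≤-reflexive (proj₂ (subset-of-size n 0 z≤n))
∣fromList∣≤ (x ∷ xs) = ≤-trans (insert-≤ x (fromList xs)) (s≤s (∣fromList∣≤ xs))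

lookup-false : ∀ {n} {x : Fin n} xs → All (x ≢_) xs → lookup (fromList xs) x ≡ false
lookup-false {x = x} xs fresh = go (lookup (fromList xs) x) refl≡
  where
  go : ∀ b → lookup (fromList xs) x ≡ b → b ≡ false
  go false _ = refl≡
  go true e = ⊥-elim (All.lookup fresh (∈-fromList⁻ xs (lookup⇒[]= x (fromList xs) e)) refl≡)

Unique⇒card : ∀ {n} (xs : List (Fin n)) → Unique xs → ∣ fromList xs ∣ ≡ length xs
Unique⇒card {n} [] _ = proj₂ (subset-of-size n 0 z≤n)
Unique⇒card (x ∷ xs) (f ∷ u) = trans≡ (insert-fresh x (fromList xs) (lookup-false xs f)) (cong (1 +_) (Unique⇒card xs u))

card⇒Unique : ∀ {n} (xs : List (Fin n)) → ∣ fromList xs ∣ ≡ length xs → Unique xs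
card⇒Unique [] _ = []
card⇒Unique (x ∷ xs) e = go (lookup (fromList xs) x) refl≡
  where
  go : ∀ b → lookup (fromList xs) x ≡ b → Unique (x ∷ xs)
  go true e' = ⊥-elim (1+n≰n (≤-trans (≤-reflexive (trans≡ (sym e) (cong ∣_∣ (insert-old x (fromList xs) e')))) (∣fromList∣≤ xs)))
  go false e' = All.tabulate (λ {y} y∈ x≡y → absurd (trans≡ (sym e') ([]=⇒lookup (subst (_∈ fromList xs) (sym x≡y) (∈-fromList⁺ y∈))))) ∷
      card⇒Unique xs (cong pred (trans≡ (sym (insert-fresh x (fromList xs) e')) e))
    where
    absurd : false ≡ true → ⊥
    absurd ()

same-image : {X Y : Set} (f : X → Y) (xs : List X) → Unique (map f xs) → ∀ {a b} → a ∈ˡ xs → b ∈ˡ xs → f a ≡ f b → a ≡ b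
same-image f (x ∷ xs) _ (here refl≡) (here refl≡) _ = refl≡
same-image f (x ∷ xs) (g ∷ _) (here refl≡) (there q) e = ⊥-elim (All.lookup g (∈-map⁺ f q) e)
same-image f (x ∷ xs) (g ∷ _) (there p) (here refl≡) e = ⊥-elim (All.lookup g (∈-map⁺ f p) (sym e))
same-image f (x ∷ xs) (_ ∷ u) (there p) (there q) e = same-image f xs u p q e

same-piece : {X Y : Set} (f : X → List Y) (xs : List X) → Unique (concatMap f xs) → ∀ {a b v} → a ∈ˡ xs → b ∈ˡ xs → v ∈ˡ f a → v ∈ˡ f b → a ≡ b
same-piece f (x ∷ xs) u (here refl≡) (here refl≡) _ _ = refl≡
same-piece f (x ∷ xs) u (here refl≡) (there q) va vb = ⊥-elim (proj₂ (proj₂ (Unique-++⁻ (f x) u)) va (∈-concatMap⁺ f q vb))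
same-piece f (x ∷ xs) u (there p) (here refl≡) va vb = ⊥-elim (proj₂ (proj₂ (Unique-++⁻ (f x) u)) vb (∈-concatMap⁺ f p va))
same-piece f (x ∷ xs) u (there p) (there q) va vb = same-piece f xs (proj₁ (proj₂ (Unique-++⁻ (f x) u))) p q va vb

RainbowMatching : ∀ {k} m → (Fin m → KGraph (m * k) k) → Set
RainbowMatching {k} m H = Σ (Fin m → Subset (m * k)) λ E →
  ((i : Fin m) → edge (H i) (E i) ≡ true) ×
  ((i j : Fin m) → i ≢ j → (v : Fin (m * k)) → v ∈ E i → v ∈ E j → ⊥) ×
  ((v : Fin (m * k)) → ∃ λ i → v ∈ E i)

rainbow-matching : ∀ {k} m (H : Fin m → KGraph (m * k) k) (B : List (Fin m × List (Fin (m * k)))) →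
  (∀ {b} → b ∈ˡ B → edge (H (proj₁ b)) (fromList (proj₂ b)) ≡ true) → concatMap proj₂ B ↭ allFin (m * k) → map proj₁ B ↭ allFin m → RainbowMatching m H
rainbow-matching {k} m H B B-edges covers colours = (λ i → fromList (proj₂ (piece i))) ,
    (λ i → subst (λ c → edge (H c) (fromList (proj₂ (piece i))) ≡ true) (sym (piece-colour i)) (B-edges (piece-∈ i))) ,
    (λ i j i≢j v vi vj → i≢j (trans≡ (piece-colour i) (trans≡ (cong proj₁ (same-piece proj₂ B (Unique-resp-↭ (↭-sym covers) (allFin⁺ (m * k))) (piece-∈ i) (piece-∈ j) (∈-fromList⁻ _ vi) (∈-fromList⁻ _ vj))) (sym (piece-colour j))))) ,
    λ v → cover v (∈-concatMap⁻ proj₂ B (∈-resp-↭ (↭-sym covers) (∈-allFin v)))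
  where
  find : ∀ i → Σ (Fin m × List (Fin (m * k))) λ b → b ∈ˡ B × i ≡ proj₁ b
  find i = ∈-map⁻ proj₁ (∈-resp-↭ (↭-sym colours) (∈-allFin i))
  piece : Fin m → Fin m × List (Fin (m * k))
  piece i = proj₁ (find i)
  piece-∈ : ∀ i → piece i ∈ˡ B
  piece-∈ i = proj₁ (proj₂ (find i))
  piece-colour : ∀ i → i ≡ proj₁ (piece i)
  piece-colour i = proj₂ (proj₂ (find i))
  cover : ∀ v → (Σ (Fin m × List (Fin (m * k))) λ b → b ∈ˡ B × v ∈ˡ proj₂ b) → ∃ λ i → v ∈ fromList (proj₂ (piece i))
  cover v (b , b∈ , v∈) = proj₁ b , subst (λ b → v ∈ fromList (proj₂ b))
    (same-image proj₁ B (Unique-resp-↭ (↭-sym colours) (allFin⁺ m)) b∈ (piece-∈ (proj₁ b)) (piece-colour (proj₁ b))) (∈-fromList⁺ v∈)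

from-core : ∀ k ℓ r' → 1 ≤ k → ℓ + (r' + 1) ≡ k → CoreStatement k ℓ →
  Σ ℕ λ n₀ → (m : ℕ) → n₀ ≤ m * k → (H : Fin m → KGraph (m * k) k) → ((i : Fin m) → δ k ℓ m < minDeg ℓ (H i)) → RainbowMatching m H
from-core k ℓ r' k≥1 ℓ+r (e , bound , core) = suc (bound + e * (2 * k + 4 + 2 * k * k)) , go
  where
  go : (m : ℕ) → suc (bound + e * (2 * k + 4 + 2 * k * k)) ≤ m * k → (H : Fin m → KGraph (m * k) k) → ((i : Fin m) → δ k ℓ m < minDeg ℓ (H i)) → RainbowMatching m H
  go (suc m') big H large = finish (core n m h (λ c p → cong (edge (H c)) (fromList-↭ p)) h-unique (*-comm m k) (≤-trans (m≤m+n bound _) (≤-trans (n≤1+n _) big))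
      (λ c L s u → half-degree k ℓ m r' k≥1 ℓ+r H large (≤-trans (s≤s z≤n) big) e (≤-trans (m≤n+m _ bound) (≤-trans (n≤1+n _) big)) c L s (Unique⇒card L u))
      (Degrees.exactness k ℓ m (r' + 1) k≥1 ℓ+r H large zero))
    where
    m n : ℕ
    m = suc m'
    n = m * k
    h : Fin m → List (Fin n) → Bool
    h c t = edge (H c) (fromList t)
    h-unique : ∀ c t → length t ≡ k → h c t ≡ true → Unique t
    h-unique c t l e = card⇒Unique t (trans≡ (uniform (H c) (fromList t) e) (sym l))
    finish : Matching n m k h → RainbowMatching m H
    finish (B , B-edges , covers , colours) = rainbow-matching m H B (λ b∈ → proj₁ (B-edges b∈)) covers colours

mainTheorem1 : (k ℓ : ℕ) → 3 ≤ k → k ≤ 2 * ℓ → ℓ ≤ k ∸ 1 →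
  Σ ℕ λ n₀ → (m : ℕ) → n₀ ≤ m * k →
    (H : Fin m → KGraph (m * k) k) →
    ((i : Fin m) → δ k ℓ m < minDeg ℓ (H i)) →
    Σ (Fin m → Subset (m * k)) λ E →
      ((i : Fin m) → edge (H i) (E i) ≡ true) ×
      ((i j : Fin m) → i ≢ j → (v : Fin (m * k)) → v ∈ E i → v ∈ E j → ⊥) ×
      ((v : Fin (m * k)) → ∃ λ i → v ∈ E i)
mainTheorem1 k@(suc (suc k''@(suc _))) ℓ _ k≤2ℓ ℓ≤k-1 = from-core k ℓ r' (s≤s z≤n) (trans≡ (cong (ℓ +_) (+-comm r' 1)) ℓ+r)
    (core-theorem k'' r' ℓ (s≤s z≤n) ℓ≥1 ℓ+r (cases (m≤n⇒m<n∨m≡n 2r≤k)))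
  where
  r' : ℕ
  r' = suc k'' ∸ ℓ
  ℓ+r : ℓ + suc r' ≡ k
  ℓ+r = trans≡ (+-suc ℓ r') (cong (1 +_) (m+[n∸m]≡n ℓ≤k-1))
  ℓ≥1 : 1 ≤ ℓ
  ℓ≥1 = *-cancelˡ-< 2 0 ℓ (≤-trans (s≤s z≤n) k≤2ℓ)
  2r≤k : 2 * suc r' ≤ k
  2r≤k = +-cancelˡ-≤ k (2 * suc r') k (begin
    k + 2 * suc r' ≤⟨ +-monoˡ-≤ (2 * suc r') k≤2ℓ ⟩
    2 * ℓ + 2 * suc r' ≡⟨ sym (*-distribˡ-+ 2 ℓ (suc r')) ⟩
    2 * (ℓ + suc r') ≡⟨ cong (2 *_) ℓ+r ⟩
    2 * k ≡⟨ cong (k +_) (+-identityʳ k) ⟩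
    k + k ∎)
  cases : (2 * suc r' < k) ⊎ (2 * suc r' ≡ k) → (2 * suc r' < k) ⊎ (2 * suc r' ≡ k × 2 ≤ suc r')
  cases (inj₁ lt) = inj₁ lt
  cases (inj₂ e) = inj₂ (e , *-cancelˡ-< 2 1 (suc r') (≤-trans (s≤s (s≤s (s≤s z≤n))) (≤-reflexive (sym e))))
mainTheorem1 zero _ ()
mainTheorem1 (suc zero) _ (s≤s ())
mainTheorem1 (suc (suc zero)) _ (s≤s (s≤s ()))
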